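{- Let $G$ be a weighted graph (the communication network) and $T\subseteq G$ a rooted spanning tree of $G$ consisting of exactly a root $r$ and $k$ vertex-disjoint trees $T_1,\dots,T_k$ (a subtree instance). There exists a deterministic $\tilde O(1)$-round Minor-Aggregation algorithm on $G$ that computes the minimum of the 1-respecting cut values $\min_{e\in E(T)}\mathrm{Cut}_{T,G}(e)$ and the 2-respecting cut values $\min_{i<j}\min_{e\in E(T_i),f\in E(T_j)}\mathrm{Cut}_{T,G}(e,f)$.
   Context: Minor-Aggregation model. The communication network is a connected undirected graph $G=(V,E)$ with $n=|V|$ nodes; both nodes and edges are computational units with private memory. Initially nodes know only their unique $\tilde O(1)$-bit ID (and inputs) and edges know the IDs of their endpoints. Computation proceeds in synchronous rounds, each of three steps: (i) Contraction: each edge $e$ chooses $c_e\in\{\bot,\top\}$, defining the minor $G'=G/\{e:c_e=\top\}$ (self-loops removed), whose vertices (supernodes) are identified with the sets of nodes they contain. (ii) Consensus: each node $v$ chooses an $\tilde O(1)$-bit value $x_v$; for each supernode $s$ all nodes of $s$ learn $y_s=\bigoplus_{v\in s}x_v$ for a predefined aggregation operator $\bigoplus$. (iii) Aggregation: each edge $e$ of $G'$ joining supernodes $a,b$ learns $y_a,y_b$ and chooses $\tilde O(1)$-bit values $z_{e,a},z_{e,b}$; all nodes of each supernode $s$ learn the same aggregate $\bigotimes_{e \text{ incident to } s} z_{e,s}$ for a predefined aggregation operator $\bigotimes$. An aggregation operator maps two $B$-bit messages ($B=\tilde O(1)$) to one $B$-bit message, applied pairwise in arbitrary order to aggregate several messages.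 $\tilde O(\cdot)$ hides $\mathrm{poly}(\log n)$ factors. Inputs are distributedly stored: each edge knows its weight (positive integers bounded by $\mathrm{poly}(n)$) and whether it is in $T$, each tree edge knows which endpoint is closer to the root. For tree edges $e,f$: $\mathrm{Cut}_{T,G}(e)$ is the total weight of edges $\{u,v\}\in E(G)$ whose unique $u$–$v$ path in $T$ contains $e$; $\mathrm{Cut}_{T,G}(e,f)$ is the total weight of edges $\{u,v\}\in E(G)$ whose unique $u$–$v$ path in $T$ contains exactly one of $e,f$. -}

module Defs where

open import Data.Nat using (ℕ; zero; suc; _+_; _*_; _^_; _≤_; _<_)
open import Data.Nat.Logarithm using (⌊log₂_⌋)
open import Data.Bool using (Bool; true; false; _∧_; _∨_; not; if_then_else_)
open import Data.Fin using (Fin) renaming (_<_ to _<F_)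
open import Data.Fin.Properties using () renaming (_≟_ to _≟F_)
open import Data.List using (List; []; _∷_; map; filter; foldr; allFin; length; concatMap)
open import Data.Nat.ListAction using (sum)
open import Data.Bool.ListAction using (or)
open import Data.Bool.Properties using (T?)
open import Data.List.Membership.Propositional using (_∈_)
open import Data.List.Relation.Unary.Unique.Propositional using (Unique)
open import Data.Maybe using (Maybe; just; nothing; fromMaybe; maybe′)
open import Data.Vec using (Vec)
open import Data.Product using (Σ; _×_; _,_; proj₁; proj₂)
open import Data.Sum using (_⊎_)
open import Function.Bundles using (_⇔_)
open import Relation.Binary.PropositionalEquality using (_≡_; _≢_)
open import Relation.Nullary using (¬_)
open import Relation.Nullary.Decidable using (⌊_⌋)

polylog : ℕ → ℕ → ℕ
polylog c n = c * (suc ⌊log₂ n ⌋) ^ c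

module _ {n m : ℕ} (ends : Fin m → Fin n × Fin n) where

  Joins : Fin m → Fin n → Fin n → Set
  Joins e u x = (ends e ≡ (u , x)) ⊎ (ends e ≡ (x , u))

  data Walk (ok : Fin m → Set) : Fin n → Fin n → List (Fin m) → List (Fin n) → Set where
    nil  : ∀ {u} → Walk ok u u [] (u ∷ [])
    cons : ∀ {u x v e es vs} → ok e → Joins e u x → Walk ok x v es vs →
           Walk ok u v (e ∷ es) (u ∷ vs)

  SimplePath : (Fin m → Set) → Fin n → Fin n → List (Fin m) → Set
  SimplePath ok u v es = Σ (List (Fin n)) λ vs → Walk ok u v es vs × Unique vs

  SimpleGraph : Set
  SimpleGraph = (∀ e → proj₁ (ends e) ≢ proj₂ (ends e))
              × (∀ e f u v → Joins e u v → Joins f u v → e ≡ f)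

  module _ (inT : Fin m → Bool) where

    TreeEdge : Fin m → Set
    TreeEdge e = inT e ≡ true

    SpanningTree : Set
    SpanningTree = (∀ u v → Σ (List (Fin m)) λ es → SimplePath TreeEdge u v es)
                 × (∀ u v es es' → SimplePath TreeEdge u v es →
                      SimplePath TreeEdge u v es' → es ≡ es')

    CloserToRoot : Fin n → Fin n → Fin n → Set
    CloserToRoot r a b = Σ (List (Fin m)) λ es → Σ (List (Fin m)) λ es' →
      SimplePath TreeEdge r a es × SimplePath TreeEdge r b es' × length es < length es'

    RootOrientation : Fin n → (Fin m → Bool) → Set
    RootOrientation r par = ∀ e → TreeEdge e →
      (par e ≡ true) ⇔ CloserToRoot r (proj₁ (ends e)) (proj₂ (ends e))

    OnTreePath : Fin m → Fin m → Set
    OnTreePath e f = Σ (List (Fin m)) λ es →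
      SimplePath TreeEdge (proj₁ (ends f)) (proj₂ (ends f)) es × e ∈ es

    module _ (w : Fin m → ℕ) where

      weightOf : (Fin m → Bool) → ℕ
      weightOf ind = sum (map (λ f → if ind f then w f else 0) (allFin m))

      Cut1 : Fin m → ℕ → Set
      Cut1 e x = Σ (Fin m → Bool) λ ind →
        (∀ f → (ind f ≡ true) ⇔ OnTreePath e f) × (x ≡ weightOf ind)

      Cut2 : Fin m → Fin m → ℕ → Set
      Cut2 e f x = Σ (Fin m → Bool) λ ind →
        (∀ g → (ind g ≡ true) ⇔ ((OnTreePath e g × ¬ OnTreePath f g)
                                  ⊎ (¬ OnTreePath e g × OnTreePath f g)))
        × (x ≡ weightOf ind)

    -- Subtree instance: T consists of the root r and k vertex-disjoint
    -- trees T_1..T_k.  lab v = just i  means v ∈ V(T_i); lab r = nothing.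

    module _ (r : Fin n) (k : ℕ) (lab : Fin n → Maybe (Fin k)) where

      InSubtree : Fin k → Fin m → Set
      InSubtree i e = TreeEdge e × (lab (proj₁ (ends e)) ≡ just i)
                                  × (lab (proj₂ (ends e)) ≡ just i)

      SubtreeInstance : Set
      SubtreeInstance =
          -- vertex set is {r} ⊎ V(T_1) ⊎ … ⊎ V(T_k) (disjoint)
          (∀ v → (lab v ≡ nothing) ⇔ (v ≡ r))
        × (∀ i → Σ (Fin n) λ v → lab v ≡ just i)
          -- each T_i is a tree (connected subgraph of T)
        × (∀ i u v → lab u ≡ just i → lab v ≡ just i →
             Σ (List (Fin m)) λ es → SimplePath (InSubtree i) u v es)
        × (∀ e → TreeEdge e →
             (proj₁ (ends e) ≡ r) ⊎ (proj₂ (ends e) ≡ r)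
             ⊎ (lab (proj₁ (ends e)) ≡ lab (proj₂ (ends e))))

      Candidate : (Fin m → ℕ) → ℕ → Set
      Candidate w x =
          (Σ (Fin m) λ e → TreeEdge e × Cut1 w e x)
        ⊎ (Σ (Fin k) λ i → Σ (Fin k) λ j → Σ (Fin m) λ e → Σ (Fin m) λ f →
             i <F j × InSubtree i e × InSubtree j f × Cut2 w e f x)

      IsMinCandidate : (Fin m → ℕ) → Maybe ℕ → Set
      IsMinCandidate w out =
          ((out ≡ nothing) × (∀ x → ¬ Candidate w x))
        ⊎ (Σ ℕ λ x → (out ≡ just x) × Candidate w x × (∀ y → Candidate w y → x ≤ y))

WeightsBounded : ∀ {m} → ℕ → ℕ → (Fin m → ℕ) → Set
WeightsBounded d n w = ∀ e → (1 ≤ w e) × (w e ≤ n ^ d)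

IDsValid : ℕ → (n : ℕ) → (Fin n → ℕ) → Set
IDsValid d n ID = (∀ u v → ID u ≡ ID v → u ≡ v) × (∀ v → ID v < 2 ^ polylog d n)

Msg : ℕ → Set
Msg B = Vec Bool B

-- A deterministic Minor-Aggregation algorithm (for networks with n nodes)
-- with B-bit messages running R rounds.  All functions receive the round
-- number t.  Local memory (NS for nodes, ES for edges) is unrestricted.
record Algorithm (n : ℕ) : Set₁ where
  field
    B R : ℕ
    NS ES : Set
    -- initial knowledge: node knows its ID; edge knows the IDs of its
    -- endpoints (in the order of ends), its weight, whether it is in T,
    -- and (par) whether its first endpoint is closer to the root.
    nodeInit : ℕ → NS
    edgeInit : ℕ → ℕ → ℕ → Bool → Bool → ES
    -- aggregation operators for consensus (⊕) and aggregation (⊗)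
    ⊕ ⊗ : ℕ → Msg B → Msg B → Msg B
    ⊕-comm  : ∀ t x y → ⊕ t x y ≡ ⊕ t y x
    ⊕-assoc : ∀ t x y z → ⊕ t (⊕ t x y) z ≡ ⊕ t x (⊕ t y z)
    ⊗-comm  : ∀ t x y → ⊗ t x y ≡ ⊗ t y x
    ⊗-assoc : ∀ t x y z → ⊗ t (⊗ t x y) z ≡ ⊗ t x (⊗ t y z)
    contract : ℕ → ES → Bool
    consensus : ℕ → NS → Msg B
    -- (iii) an edge of the minor learns (y_a , y_b) for its endpoints a,b
    -- (in the order of ends), updates its memory and chooses (z_{e,a}, z_{e,b})
    edgeStep : ℕ → ES → Msg B → Msg B → ES × Msg B × Msg B
    -- a node learns y_s and the aggregate (nothing if its supernode has
    -- no incident edges in the minor) and updates its memory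
    nodeStep : ℕ → NS → Msg B → Maybe (Msg B) → NS
    output : NS → Maybe ℕ

aggregate : {A : Set} → (A → A → A) → List A → Maybe A
aggregate op = foldr (λ a acc → just (maybe′ (op a) a acc)) nothing

iter : {A : Set} → ℕ → (A → A) → A → A
iter zero    f a = a
iter (suc k) f a = f (iter k f a)

module Semantics {n m : ℕ} (ends : Fin m → Fin n × Fin n) where

  _==_ : Fin n → Fin n → Bool
  u == v = ⌊ u ≟F v ⌋

  grow : (Fin m → Bool) → (Fin n → Bool) → (Fin n → Bool)
  grow c S v = S v ∨ or (map (λ e → c e ∧
                    ((S (proj₁ (ends e)) ∧ (v == proj₂ (ends e)))
                   ∨ (S (proj₂ (ends e)) ∧ (v == proj₁ (ends e)))))
                 (allFin m))

  -- sameSN c v u : u belongs to the supernode of v in G / {e | c e}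
  sameSN : (Fin m → Bool) → Fin n → Fin n → Bool
  sameSN c v = iter n (grow c) (λ u → u == v)

  module _ (A : Algorithm n) where
    open Algorithm A

    Config : Set
    Config = (Fin n → NS) × (Fin m → ES)

    round : ℕ → Config → Config
    round t (ns , es) = ns' , es'
      where
      c : Fin m → Bool
      c e = contract t (es e)
      x : Fin n → Msg B
      x v = consensus t (ns v)
      -- y_s for the supernode s of v (the list is never empty)
      y : Fin n → Msg B
      y v = fromMaybe (x v) (aggregate (⊕ t) (map x (filter (λ u → T? (sameSN c v u)) (allFin n))))
      inMinor : Fin m → Bool
      inMinor e = not (sameSN c (proj₁ (ends e)) (proj₂ (ends e)))
      act : Fin m → ES × Msg B × Msg B
      act e = edgeStep t (es e) (y (proj₁ (ends e))) (y (proj₂ (ends e)))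
      es' : Fin m → ES
      es' e = if inMinor e then proj₁ (act e) else es e
      zs : Fin n → List (Msg B)
      zs v = concatMap (λ e →
               if inMinor e
               then (if sameSN c v (proj₁ (ends e)) then proj₁ (proj₂ (act e)) ∷ []
                     else if sameSN c v (proj₂ (ends e)) then proj₂ (proj₂ (act e)) ∷ []
                     else [])
               else [])
             (allFin m)
      ns' : Fin n → NS
      ns' v = nodeStep t (ns v) (y v) (aggregate (⊗ t) (zs v))

    runFrom : ℕ → ℕ → Config → Config
    runFrom t zero    cfg = cfg
    runFrom t (suc k) cfg = runFrom (suc t) k (round t cfg)

    outputs : (Fin m → ℕ) → (Fin m → Bool) → (Fin m → Bool) → (Fin n → ℕ) → Fin n → Maybe ℕ
    outputs w inT par ID v = output (proj₁ (runFrom 0 R (ns₀ , es₀)) v)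
      where
      ns₀ : Fin n → NS
      ns₀ u = nodeInit (ID u)
      es₀ : Fin m → ES
      es₀ e = edgeInit (ID (proj₁ (ends e))) (ID (proj₂ (ends e))) (w e) (inT e) (par e)

{-# OPTIONS --safe #-}
module Submission where

-- With Cut(e), Cut(f) the 1-respecting values and w(e,f) the weight of the edges joining the
-- subtrees of e and f, the 2-respecting value is M(e,f) = Cut(e) + Cut(f) − 2 w(e,f).  A pair with
-- 2 w(e,f) ≤ Cut(e) or ≤ Cut(f) is never better than a single edge.  For the other pairs, more than
-- half of the weight leaving each subtree goes to the other one.
--
-- Depths are computed by merging clusters of the tree according to the bits of their labels, and
-- Strahler numbers decompose the tree into vertical paths so that every root path meets O(log n)
-- of them.  For a bit of the subtree label and two levels, contracting all other tree edges leaves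
-- a star of red and blue paths.  On it the majority property singles out, for every path and every
-- scale of its cut weight, at most one partner per quartile, so polylogarithmically many matchings
-- of paths cover all relevant pairs.  On a matched pair of paths the minimum of M is found by divide
-- and conquer: for the middle row take a best column f*; for a row e on one side, M(e,f) < M(e,f*)
-- forces an edge inside the quadrant of (e,f), and so only two of the four quadrants are recursed on
-- and every edge of the graph stays active in at most one of them.
--
-- All of this consists of sums and maxima over supernodes whose values grow by a factor poly(n)
-- per step, hence polylogarithmically many bits suffice throughout.

open import Defs
open import Data.Nat using (ℕ; zero; suc; _+_; _*_; _∸_; _^_; _⊔_; _⊓_; _≤_; _<_; _≥_; z≤n; s≤s; ⌊_/2⌋; _≡ᵇ_; _≤ᵇ_; _<ᵇ_; _≟_; _≤?_; _<?_; NonZero; >-nonZero)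
open import Data.Nat.Properties
open import Data.Nat.Logarithm using (⌊log₂_⌋; ⌊log₂⌋-mono-≤; ⌊log₂[2^n]⌋≡n)
open import Data.Nat.ListAction using (sum)
open import Data.Nat.Solver using (module +-*-Solver)
open import Data.Bool using (Bool; true; false; _∧_; _∨_; _xor_; not; if_then_else_; T)
open import Data.Bool.Properties using (T?; ∨-identityʳ; ∧-comm) renaming (_≟_ to _≟B_)
open import Data.Bool.ListAction using (or)
open import Data.Fin using (Fin; zero; suc; toℕ; #_; combine; remQuot)
open import Data.Fin.Properties using (toℕ<n; remQuot-combine; injective⇒≤; combine-injective; toℕ-injective) renaming (_≟_ to _≟F_; <-cmp to <F-cmp)
open import Data.List using (List; []; _∷_; _++_; map; filter; foldr; allFin; length; concatMap; tabulate; reverse; _∷ʳ_)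
open import Data.List.Properties using (length-++; length-reverse; unfold-reverse; map-tabulate)
open import Data.List.Membership.Propositional using (_∈_)
open import Data.List.Relation.Unary.Any using (here; there)
open import Data.List.Relation.Unary.All using (All; []; _∷_) renaming (lookup to All-lookup)
open import Data.List.Relation.Unary.AllPairs using ([]; _∷_)
open import Data.List.Relation.Unary.Unique.Propositional using (Unique)
open import Data.Maybe using (Maybe; just; nothing; fromMaybe; maybe′)
open import Data.Maybe.Properties using (just-injective)
open import Data.Product using (Σ; ∃; _×_; _,_; proj₁; proj₂)
open import Data.Sum using (_⊎_; inj₁; inj₂)
open import Data.Vec using (Vec; []; _∷_; lookup) renaming (tabulate to tabulateᵛ; replicate to replicateᵛ)
open import Data.Vec.Properties using (lookup∘tabulate; tabulate∘lookup; tabulate-cong; lookup-replicate)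
open import Data.Empty using (⊥; ⊥-elim)
open import Data.Unit using (⊤; tt)
open import Function using (_∘_; id; case_of_)
open import Function.Bundles using (_⇔_; mk⇔; Equivalence)
open import Relation.Binary using (tri<; tri≈; tri>)
open import Relation.Binary.PropositionalEquality hiding ([_])
open import Relation.Nullary using (¬_; Dec; yes; no)
open import Relation.Nullary.Decidable using (⌊_⌋)

-- Booleans

-- Three constraints shape the construction. The operators of the model must be commutative and
-- associative on all bit vectors, and the word length is fixed in advance: hence a small register
-- language whose values grow only linearly per step, with a syntactic size bound, so that
-- correctness is proved for unbounded numbers and overflow is excluded separately. An edge decides
-- about its contraction from the registers of its two ends alone: hence most contractions join
-- nodes with equal keys, and the recurring obligation is that classes of equal keys are connected
-- in the tree. Paths are encoded by a name and a position because then every key that is monotone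
-- in the position qualifies. Finally, no node knows the right level, scale or quartile: all
-- combinations are tried, which is harmless because only scores of genuine pairs are recorded and
-- scores never decrease. A score is the total weight plus one minus a cut value, so that
-- minimisation becomes a maximum with neutral element 0, where 0 also says that no cut has been
-- seen.

infix 4 _≐_
_≐_ : ∀ {n} → Fin n → Fin n → Bool
u ≐ v = ⌊ u ≟F v ⌋

≐-refl : ∀ {n} (u : Fin n) → (u ≐ u) ≡ true
≐-refl u with u ≟F u
... | yes _ = refl
... | no q = ⊥-elim (q refl)

≐-sound : ∀ {n} {u v : Fin n} → (u ≐ v) ≡ true → u ≡ v
≐-sound {u = u} {v} h with u ≟F v
... | yes e = e

≐-true : ∀ {n} {u v : Fin n} → u ≡ v → (u ≐ v) ≡ true
≐-true refl = ≐-refl _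

≐-false : ∀ {n} {u v : Fin n} → u ≢ v → (u ≐ v) ≡ false
≐-false {u = u} {v} h with u ≟F v
... | yes e = ⊥-elim (h e)
... | no _ = refl

true≢false : ∀ {b} → b ≡ true → b ≡ false → ⊥
true≢false refl ()

bool-ext : ∀ {b c : Bool} → (b ≡ true → c ≡ true) → (c ≡ true → b ≡ true) → b ≡ c
bool-ext {true}  {true}  f g = refl
bool-ext {true}  {false} f g = sym (f refl)
bool-ext {false} {true}  f g = g refl
bool-ext {false} {false} f g = refl

bool-false : ∀ {b} → (b ≡ true → ⊥) → b ≡ false
bool-false {true}  f = ⊥-elim (f refl)
bool-false {false} f = refl

bool-case : (b : Bool) → (b ≡ true) ⊎ (b ≡ false)
bool-case true = inj₁ refl
bool-case false = inj₂ refl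

∧-i : ∀ {a b} → a ≡ true → b ≡ true → (a ∧ b) ≡ true
∧-i refl refl = refl

∧-l : ∀ {a b} → (a ∧ b) ≡ true → a ≡ true
∧-l {true} h = refl

∧-r : ∀ {a b} → (a ∧ b) ≡ true → b ≡ true
∧-r {true} h = h

∨-l : ∀ {a b} → a ≡ true → (a ∨ b) ≡ true
∨-l refl = refl

∨-r : ∀ {a b} → b ≡ true → (a ∨ b) ≡ true
∨-r {true} h = refl
∨-r {false} h = h

∨-e : ∀ {a b} → (a ∨ b) ≡ true → (a ≡ true) ⊎ (b ≡ true)
∨-e {true} h = inj₁ refl
∨-e {false} h = inj₂ h

not-t : ∀ {a} → a ≡ false → not a ≡ true
not-t refl = refl

not-f : ∀ {a} → not a ≡ true → a ≡ false
not-f {false} _ = refl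

T-true : ∀ {b} → T b → b ≡ true
T-true {true} _ = refl

true-T : ∀ {b} → b ≡ true → T b
true-T refl = tt

==-sound : ∀ {a b : ℕ} → (a ≡ᵇ b) ≡ true → a ≡ b
==-sound {a} {b} h = ≡ᵇ⇒≡ a b (true-T h)

==-true : ∀ {a b : ℕ} → a ≡ b → (a ≡ᵇ b) ≡ true
==-true {a} {b} h = T-true (≡⇒≡ᵇ a b h)

==-false : ∀ {a b : ℕ} → a ≢ b → (a ≡ᵇ b) ≡ false
==-false h = bool-false (λ e → h (==-sound e))

<ᵇ-sound : ∀ {a b} → (a <ᵇ b) ≡ true → a < b
<ᵇ-sound {a} {b} h = <ᵇ⇒< a b (true-T h)

<ᵇ-true : ∀ {a b} → a < b → (a <ᵇ b) ≡ true
<ᵇ-true h = T-true (<⇒<ᵇ h)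

<ᵇ-false : ∀ {a b} → b ≤ a → (a <ᵇ b) ≡ false
<ᵇ-false h = bool-false (λ e → <⇒≱ (<ᵇ-sound e) h)

<ᵇ-no : ∀ {a b} → (a <ᵇ b) ≡ false → b ≤ a
<ᵇ-no {a} {b} h = ≮⇒≥ (λ l → true≢false (<ᵇ-true l) h)

≤ᵇ-sound : ∀ {a b} → (a ≤ᵇ b) ≡ true → a ≤ b
≤ᵇ-sound {a} {b} h = ≤ᵇ⇒≤ a b (true-T h)

≤ᵇ-true : ∀ {a b} → a ≤ b → (a ≤ᵇ b) ≡ true
≤ᵇ-true h = T-true (≤⇒≤ᵇ h)

≤ᵇ-no : ∀ {a b} → (a ≤ᵇ b) ≡ false → b < a
≤ᵇ-no {a} {b} h = ≰⇒> (λ l → true≢false (≤ᵇ-true l) h)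

infixr 5 _▸_
_▸_ : Bool → ℕ → ℕ
b ▸ x = if b then x else 0

-- Sums and maxima over finite types

data Op : Set where
  add mx : Op

app : Op → ℕ → ℕ → ℕ
app add = _+_
app mx  = _⊔_

-- The empty fold is 0 for both operators. As 0 is neutral for sums and maxima of naturals, masking
-- an entry by 0 removes it from the fold.
fold : Op → ∀ {n} → (Fin n → ℕ) → ℕ
fold o {zero}  f = 0
fold o {suc n} f = app o (f zero) (fold o (f ∘ suc))

∑ ⨆ : ∀ {n} → (Fin n → ℕ) → ℕ
∑ = fold add
⨆ = fold mx

app-0ʳ : ∀ o x → app o x 0 ≡ x
app-0ʳ add x = +-identityʳ x
app-0ʳ mx  x = ⊔-identityʳ x

app-0ˡ : ∀ o x → app o 0 x ≡ x
app-0ˡ add x = refl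
app-0ˡ mx  x = refl

app-≤+ : ∀ o x y → app o x y ≤ x + y
app-≤+ add x y = ≤-refl
app-≤+ mx  x y = m⊔n≤m+n x y

app-≥ˡ : ∀ o x y → x ≤ app o x y
app-≥ˡ add x y = m≤m+n x y
app-≥ˡ mx  x y = m≤m⊔n x y

app-≥ʳ : ∀ o x y → y ≤ app o x y
app-≥ʳ add x y = m≤n+m y x
app-≥ʳ mx  x y = m≤n⊔m x y

fold-cong : ∀ o {n} {f g : Fin n → ℕ} → (∀ i → f i ≡ g i) → fold o f ≡ fold o g
fold-cong o {zero}  h = refl
fold-cong o {suc n} h = cong₂ (app o) (h zero) (fold-cong o (h ∘ suc))

fold-zero : ∀ o {n} {f : Fin n → ℕ} → (∀ i → f i ≡ 0) → fold o f ≡ 0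
fold-zero o {zero}  h = refl
fold-zero o {suc n} h rewrite h zero | fold-zero o (h ∘ suc) = app-0ˡ o 0

fold-single : ∀ o {n} {f : Fin n → ℕ} j → (∀ i → i ≢ j → f i ≡ 0) → fold o f ≡ f j
fold-single o {suc n} {f} zero h =
  trans (cong (app o (f zero)) (fold-zero o (λ i → h (suc i) (λ ())))) (app-0ʳ o _)
fold-single o {suc n} {f} (suc j) h rewrite h zero (λ ()) =
  trans (app-0ˡ o _) (fold-single o j (λ i q → h (suc i) (λ { refl → q refl })))

fold-bound : ∀ o {n} {f : Fin n → ℕ} {B} → (∀ i → f i ≤ B) → fold o f ≤ n * B
fold-bound o {zero}  h = z≤n
fold-bound o {suc n} {f} h =
  ≤-trans (app-≤+ o (f zero) _) (+-mono-≤ (h zero) (fold-bound o (h ∘ suc)))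

fold-≥ : ∀ o {n} (f : Fin n → ℕ) i → f i ≤ fold o f
fold-≥ o f zero    = app-≥ˡ o _ _
fold-≥ o f (suc i) = ≤-trans (fold-≥ o (f ∘ suc) i) (app-≥ʳ o (f zero) _)

fold-≢0 : ∀ o {n} (f : Fin n → ℕ) → fold o f ≢ 0 → ∃ λ i → f i ≢ 0
fold-≢0 o {zero}  f h = ⊥-elim (h refl)
fold-≢0 o {suc n} f h with f zero ≟ 0
... | no q = zero , q
... | yes q with fold-≢0 o (f ∘ suc) (λ z → h (trans (cong₂ (app o) q z) (app-0ˡ o 0)))
...   | i , p = suc i , p

∑-mono : ∀ {n} {f g : Fin n → ℕ} → (∀ i → f i ≤ g i) → ∑ f ≤ ∑ g
∑-mono {zero}  h = z≤n
∑-mono {suc n} h = +-mono-≤ (h zero) (∑-mono (h ∘ suc))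

∑-+ : ∀ {n} (f g : Fin n → ℕ) → ∑ (λ i → f i + g i) ≡ ∑ f + ∑ g
∑-+ {zero}  f g = refl
∑-+ {suc n} f g rewrite ∑-+ (f ∘ suc) (g ∘ suc) =
  solve 4 (λ a b c d → (a :+ b) :+ (c :+ d) := (a :+ c) :+ (b :+ d)) refl (f zero) (g zero) _ _
  where open +-*-Solver

∑-swap : ∀ {n m} (f : Fin n → Fin m → ℕ) → ∑ (λ i → ∑ (f i)) ≡ ∑ (λ j → ∑ (λ i → f i j))
∑-swap {zero}  {m} f = sym (fold-zero add {m} {λ j → 0} (λ j → refl))
∑-swap {suc n} {m} f =
  trans (cong (∑ (f zero) +_) (∑-swap (f ∘ suc)))
        (sym (∑-+ (f zero) (λ j → ∑ (λ i → f (suc i) j))))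

▸-∑ : ∀ b {n} (f : Fin n → ℕ) → b ▸ ∑ f ≡ ∑ (λ i → b ▸ f i)
▸-∑ true  f = refl
▸-∑ false {n} f = sym (fold-zero add {n} {λ _ → 0} (λ _ → refl))

⨆-attained : ∀ {n} (f : Fin n → ℕ) → ⨆ f ≢ 0 → ∃ λ i → ⨆ f ≡ f i
⨆-attained {zero}  f h = ⊥-elim (h refl)
⨆-attained {suc n} f h with ≤-total (⨆ (f ∘ suc)) (f zero)
... | inj₁ q = zero , m≥n⇒m⊔n≡m q
... | inj₂ q with ⨆ (f ∘ suc) ≟ 0
...   | yes z = zero , trans (cong (f zero ⊔_) z) (⊔-identityʳ _)
...   | no nz with ⨆-attained (f ∘ suc) nz
...     | i , e = suc i , trans (m≤n⇒m⊔n≡n q) e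

foldr-fold : ∀ o {n} {A : Set} (g : Fin n → A) (f : A → ℕ) →
  foldr (λ a s → app o (f a) s) 0 (tabulate g) ≡ fold o (f ∘ g)
foldr-fold o {zero}  g f = refl
foldr-fold o {suc n} g f = cong (app o (f (g zero))) (foldr-fold o (g ∘ suc) f)

sum-∑ : ∀ {m} (f : Fin m → ℕ) → sum (map f (allFin m)) ≡ ∑ f
sum-∑ f = trans (cong sum (map-tabulate id f)) (go f)
  where
  go : ∀ {m} (f : Fin m → ℕ) → sum (tabulate f) ≡ ∑ f
  go {zero}  f = refl
  go {suc m} f = cong (f zero +_) (go (f ∘ suc))

-- Binary digits

odd : ℕ → Bool
odd zero = false
odd (suc zero) = true
odd (suc (suc n)) = odd n

𝟙 : Bool → ℕ
𝟙 b = b ▸ 1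

half-odd : ∀ x → x ≡ 𝟙 (odd x) + (⌊ x /2⌋ + ⌊ x /2⌋)
half-odd zero = refl
half-odd (suc zero) = refl
half-odd (suc (suc x)) = begin
    suc (suc x)                                       ≡⟨ cong (2 +_) (half-odd x) ⟩
    suc (suc (𝟙 (odd x) + (⌊ x /2⌋ + ⌊ x /2⌋)))     ≡⟨ solve 2 (λ a h → con 2 :+ (a :+ (h :+ h)) := a :+ ((con 1 :+ h) :+ (con 1 :+ h))) refl (𝟙 (odd x)) ⌊ x /2⌋ ⟩
    𝟙 (odd x) + (suc ⌊ x /2⌋ + suc ⌊ x /2⌋)         ∎
  where
  open ≡-Reasoning
  open +-*-Solver

bit : ℕ → ℕ → Bool
bit zero    x = odd x
bit (suc i) x = bit i ⌊ x /2⌋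

shr : ℕ → ℕ → ℕ
shr zero    x = x
shr (suc i) x = shr i ⌊ x /2⌋

shr-suc : ∀ i x → shr (suc i) x ≡ ⌊ shr i x /2⌋
shr-suc zero x = refl
shr-suc (suc i) x = shr-suc i ⌊ x /2⌋

bit-shr : ∀ i x → bit i x ≡ odd (shr i x)
bit-shr zero x = refl
bit-shr (suc i) x = bit-shr i ⌊ x /2⌋

shr-split : ∀ i x → shr i x ≡ 𝟙 (bit i x) + (shr (suc i) x + shr (suc i) x)
shr-split i x rewrite shr-suc i x | bit-shr i x = half-odd (shr i x)

shr-mono : ∀ i {x y} → x ≤ y → shr i x ≤ shr i y
shr-mono zero    h = h
shr-mono (suc i) h = shr-mono i (⌊n/2⌋-mono h)

half-< : ∀ {x y} → x < y + y → ⌊ x /2⌋ < y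
half-< {x} {y} h = ≰⇒> λ q →
  <⇒≱ h (≤-trans (+-mono-≤ q q) (≤-trans (m≤n+m _ (𝟙 (odd x))) (≤-reflexive (sym (half-odd x)))))

2^suc : ∀ k → 2 ^ suc k ≡ 2 ^ k + 2 ^ k
2^suc k = cong (2 ^ k +_) (+-identityʳ _)

shr-0 : ∀ i {x} → x < 2 ^ i → shr i x ≡ 0
shr-0 zero    {zero} h = refl
shr-0 zero    {suc x} (s≤s ())
shr-0 (suc i) {x} h = shr-0 i (half-< (subst (x <_) (2^suc i) h))

-- After `L` shifts both numbers are 0. The digits are then restored from the top, each shifted
-- number being determined by the next one and a single digit.
bits-ext : ∀ L x y → x < 2 ^ L → y < 2 ^ L → (∀ i → i < L → bit i x ≡ bit i y) → x ≡ y
bits-ext L x y hx hy h = go L ≤-refl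
  where
  eq : ∀ k → k ≤ L → shr (L ∸ k) x ≡ shr (L ∸ k) y
  eq zero _ = trans (shr-0 L hx) (sym (shr-0 L hy))
  eq (suc k) l = begin
      shr j x                                                   ≡⟨ shr-split j x ⟩
      𝟙 (bit j x) + (shr (suc j) x + shr (suc j) x)            ≡⟨ cong₂ (λ a b → 𝟙 a + (b + b)) (h j j<L) step ⟩
      𝟙 (bit j y) + (shr (suc j) y + shr (suc j) y)            ≡⟨ sym (shr-split j y) ⟩
      shr j y ∎
    where
    open ≡-Reasoning
    j = L ∸ suc k
    sj : suc j ≡ L ∸ k
    sj = sym (+-∸-assoc 1 l)
    j<L : j < L
    j<L = ≤-trans (≤-reflexive sj) (m∸n≤m L k)
    step : shr (suc j) x ≡ shr (suc j) y
    step = subst (λ q → shr q x ≡ shr q y) (sym sj) (eq k (<⇒≤ l))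
  go : ∀ k → k ≤ L → x ≡ y
  go k _ = subst (λ q → shr q x ≡ shr q y) (n∸n≡0 L) (eq L ≤-refl)

-- Chosen instead of `k + k` because parity and halving compute on it: the two rounds of step `k`
-- are numbered `double k` and `suc (double k)`.
double : ℕ → ℕ
double zero = zero
double (suc k) = suc (suc (double k))

double-+ : ∀ k → double k ≡ k + k
double-+ zero = refl
double-+ (suc k) = cong suc (trans (cong suc (double-+ k)) (sym (+-suc k k)))

num : ∀ {b} → (Fin b → Bool) → ℕ
num {zero}  f = 0
num {suc b} f = 𝟙 (f zero) + double (num (f ∘ suc))

digit : ∀ {b} → ℕ → Fin b → Bool
digit x zero    = odd x
digit x (suc i) = digit ⌊ x /2⌋ i

num-digit : ∀ b x → x < 2 ^ b → num {b} (digit x) ≡ x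
num-digit zero    zero h = refl
num-digit zero    (suc x) (s≤s ())
num-digit (suc b) x h =
  trans (cong (λ y → 𝟙 (odd x) + double y) (num-digit b ⌊ x /2⌋ (half-< (subst (x <_) (2^suc b) h))))
        (trans (cong (𝟙 (odd x) +_) (double-+ ⌊ x /2⌋)) (sym (half-odd x)))

num-cong : ∀ {b} {f g : Fin b → Bool} → (∀ i → f i ≡ g i) → num f ≡ num g
num-cong {zero}  h = refl
num-cong {suc b} h = cong₂ (λ a c → 𝟙 a + double c) (h zero) (num-cong (h ∘ suc))

-- Programs: every node has 24 registers, an edge only sees those of its ends

Reg : Set
Reg = Fin 24

Mem : Set
Mem = Vec ℕ 24

record Env : Set where
  constructor env
  field
    own oth : Mem
    wt zz yy : ℕ

-- There is no product, so a value is bounded linearly by the entries of the environment. The test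
-- of `ite` is an arbitrary Boolean function: tests may use any arithmetic, since only values are
-- stored or sent.
data Ex : Set where
  own# oth# : Reg → Ex
  wt# zz# yy# : Ex
  con : ℕ → Ex
  _⊞_ _⊟_ _⊔#_ : Ex → Ex → Ex
  ite : (Env → Bool) → Ex → Ex → Ex

infixl 6 _⊞_ _⊟_ _⊔#_

eval : Ex → Env → ℕ
eval (own# r) ε = lookup (Env.own ε) r
eval (oth# r) ε = lookup (Env.oth ε) r
eval wt# ε = Env.wt ε
eval zz# ε = Env.zz ε
eval yy# ε = Env.yy ε
eval (con c) ε = c
eval (a ⊞ b) ε = eval a ε + eval b ε
eval (a ⊟ b) ε = eval a ε ∸ eval b ε
eval (a ⊔# b) ε = eval a ε ⊔ eval b ε
eval (ite c a b) ε = if c ε then eval a ε else eval b ε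

-- Every value is at most this factor times the largest entry of the environment.
size : Ex → ℕ
size (con c) = c
size (a ⊞ b) = size a + size b
size (a ⊟ b) = size a
size (a ⊔# b) = size a + size b
size (ite c a b) = size a + size b
size _ = 1

EnvBound : Env → ℕ → Set
EnvBound ε B = (∀ r → lookup (Env.own ε) r ≤ B) × (∀ r → lookup (Env.oth ε) r ≤ B)
             × Env.wt ε ≤ B × Env.zz ε ≤ B × Env.yy ε ≤ B

-- Constants are the reason for `1 ≤ B`: each one is charged as a multiple of `B`.
eval-bound : ∀ e ε {B} → 1 ≤ B → EnvBound ε B → eval e ε ≤ size e * B
eval-bound (own# r) ε h (p , _) = ≤-trans (p r) (≤-reflexive (sym (*-identityˡ _)))
eval-bound (oth# r) ε h (_ , p , _) = ≤-trans (p r) (≤-reflexive (sym (*-identityˡ _)))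
eval-bound wt# ε h (_ , _ , p , _) = ≤-trans p (≤-reflexive (sym (*-identityˡ _)))
eval-bound zz# ε h (_ , _ , _ , p , _) = ≤-trans p (≤-reflexive (sym (*-identityˡ _)))
eval-bound yy# ε h (_ , _ , _ , _ , p) = ≤-trans p (≤-reflexive (sym (*-identityˡ _)))
eval-bound (con c) ε h _ = ≤-trans (≤-reflexive (sym (*-identityʳ c))) (*-monoʳ-≤ c h)
eval-bound (a ⊞ b) ε {B} h p =
  ≤-trans (+-mono-≤ (eval-bound a ε h p) (eval-bound b ε h p)) (≤-reflexive (sym (*-distribʳ-+ B (size a) (size b))))
eval-bound (a ⊟ b) ε h p = ≤-trans (m∸n≤m _ (eval b ε)) (eval-bound a ε h p)
eval-bound (a ⊔# b) ε {B} h p =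
  ≤-trans (m⊔n≤m+n (eval a ε) (eval b ε)) (≤-trans (+-mono-≤ (eval-bound a ε h p) (eval-bound b ε h p)) (≤-reflexive (sym (*-distribʳ-+ B (size a) (size b)))))
eval-bound (ite c a b) ε {B} h p with c ε
... | true  = ≤-trans (eval-bound a ε h p) (*-monoˡ-≤ B (m≤m+n (size a) (size b)))
... | false = ≤-trans (eval-bound b ε h p) (*-monoˡ-≤ B (m≤n+m (size b) (size a)))

-- The position of the emitting edge as seen from a node: to its parent, to a child, or outside the tree.
data Role : Set where
  up dn flat : Role

updSize : List (Reg × Ex) → ℕ
updSize [] = 0
updSize ((_ , e) ∷ us) = size e + updSize us

-- A node first folds what `emit` yields at its incident edges (`zz#`); then the supernodes formed
-- by `contr`, which receives the memory of the child before that of the parent, fold `val` (`yy#`);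
-- finally `upd` is applied. `small` is a Boolean check that evaluates for every concrete step, and
-- its common bound makes the growth per step uniform.
record Step : Set where
  constructor mkStep
  field
    opz opy : Op
    emit : Role → Ex
    contr : Mem → Mem → Bool
    val : Ex
    upd : List (Reg × Ex)
  stepSize : ℕ
  stepSize = suc (size (emit up) + (size (emit dn) + (size (emit flat) + (size val + updSize upd))))
  field
    small : T (stepSize ≤ᵇ 64)

-- All right-hand sides are evaluated in the old environment, so the assignments of a step are
-- simultaneous; the first entry for a register counts.
assignAt : List (Reg × Ex) → Env → Mem → Reg → ℕ
assignAt [] ε ρ r = lookup ρ r
assignAt ((q , e) ∷ us) ε ρ r = if toℕ q ≡ᵇ toℕ r then eval e ε else assignAt us ε ρ r

assign : List (Reg × Ex) → Env → Mem → Mem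
assign us ε ρ = tabulateᵛ (assignAt us ε ρ)

zeros : Mem
zeros = replicateᵛ 24 0

data Prog : Set where
  step : Step → Prog
  _⨾_ : Prog → Prog → Prog
  loop down : ℕ → (ℕ → Prog) → Prog

infixr 4 _⨾_

loopSteps downSteps : ℕ → (ℕ → List Step) → List Step
loopSteps zero    f = []
loopSteps (suc k) f = loopSteps k f ++ f k
downSteps zero    f = []
downSteps (suc k) f = f k ++ downSteps k f

steps : Prog → List Step
steps (step S) = S ∷ []
steps (p ⨾ q) = steps p ++ steps q
steps (loop k f) = loopSteps k (λ i → steps (f i))
steps (down k f) = downSteps k (λ i → steps (f i))

-- Ideal execution of programs on unbounded numbers

module Ideal {n m : ℕ} (ends : Fin m → Fin n × Fin n) (inT par : Fin m → Bool) (w : Fin m → ℕ) where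

  open Semantics ends using (sameSN)

  State : Set
  State = Fin n → Mem

  fst snd : Fin m → Fin n
  fst e = proj₁ (ends e)
  snd e = proj₂ (ends e)

  role₁ role₂ : Bool → Bool → Role
  role₁ t p = if t then (if p then dn else up) else flat
  role₂ t p = if t then (if p then up else dn) else flat

  emitEnv : Mem → Mem → ℕ → Env
  emitEnv ρ ρ' x = env ρ ρ' x 0 0

  contrib : Step → State → Fin n → Fin m → ℕ
  contrib S σ v e =
    if v ≐ fst e then eval (Step.emit S (role₁ (inT e) (par e))) (emitEnv (σ (fst e)) (σ (snd e)) (w e))
    else if v ≐ snd e then eval (Step.emit S (role₂ (inT e) (par e))) (emitEnv (σ (snd e)) (σ (fst e)) (w e))
    else 0

  Zv : Step → State → Fin n → ℕ
  Zv S σ v = fold (Step.opz S) (contrib S σ v)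

  contracted : Step → State → Fin m → Bool
  contracted S σ e = inT e ∧ (if par e then Step.contr S (σ (snd e)) (σ (fst e)) else Step.contr S (σ (fst e)) (σ (snd e)))

  Xv : Step → State → Fin n → ℕ
  Xv S σ v = eval (Step.val S) (env (σ v) zeros 0 (Zv S σ v) 0)

  Yv : Step → State → Fin n → ℕ
  Yv S σ v = fold (Step.opy S) (λ u → sameSN (contracted S σ) v u ▸ Xv S σ u)

  exec₁ : Step → State → State
  exec₁ S σ v = assign (Step.upd S) (env (σ v) zeros 0 (Zv S σ v) (Yv S σ v)) (σ v)

  runL : List Step → State → State
  runL [] σ = σ
  runL (S ∷ p) σ = runL p (exec₁ S σ)

  loopExec downExec : ℕ → (ℕ → State → State) → State → State
  loopExec zero    f σ = σ
  loopExec (suc k) f σ = f k (loopExec k f σ)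
  downExec zero    f σ = σ
  downExec (suc k) f σ = downExec k f (f k σ)

  exec : Prog → State → State
  exec (step S) σ = exec₁ S σ
  exec (p ⨾ q) σ = exec q (exec p σ)
  exec (loop k f) σ = loopExec k (λ i → exec (f i)) σ
  exec (down k f) σ = downExec k (λ i → exec (f i)) σ

  runL-++ : ∀ p q σ → runL (p ++ q) σ ≡ runL q (runL p σ)
  runL-++ [] q σ = refl
  runL-++ (S ∷ p) q σ = runL-++ p q (exec₁ S σ)

  runL-steps : ∀ p σ → runL (steps p) σ ≡ exec p σ
  runL-loop : ∀ k f σ → runL (loopSteps k (λ i → steps (f i))) σ ≡ loopExec k (λ i → exec (f i)) σ
  runL-down : ∀ k f σ → runL (downSteps k (λ i → steps (f i))) σ ≡ downExec k (λ i → exec (f i)) σ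
  runL-steps (step S) σ = refl
  runL-steps (p ⨾ q) σ = trans (runL-++ (steps p) (steps q) σ)
    (trans (runL-steps q _) (cong (exec q) (runL-steps p σ)))
  runL-steps (loop k f) σ = runL-loop k f σ
  runL-steps (down k f) σ = runL-down k f σ
  runL-loop zero f σ = refl
  runL-loop (suc k) f σ = trans (runL-++ (loopSteps k (λ i → steps (f i))) (steps (f k)) σ)
    (trans (runL-steps (f k) _) (cong (exec (f k)) (runL-loop k f σ)))
  runL-down zero f σ = refl
  runL-down (suc k) f σ = trans (runL-++ (steps (f k)) (downSteps k (λ i → steps (f i))) σ)
    (trans (cong (runL (downSteps k (λ i → steps (f i)))) (runL-steps (f k) σ)) (runL-down k f _))

  loop-inv : ∀ (I : ℕ → State → Set) k f → (∀ i σ → i < k → I i σ → I (suc i) (exec (f i) σ)) →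
    ∀ {σ} → I 0 σ → I k (exec (loop k f) σ)
  loop-inv I zero f h z = z
  loop-inv I (suc k) f h z = h k _ ≤-refl (loop-inv I k f (λ i σ q → h i σ (m<n⇒m<1+n q)) z)

  down-inv : ∀ (I : ℕ → State → Set) k f → (∀ i σ → i < k → I (suc i) σ → I i (exec (f i) σ)) →
    ∀ {σ} → I k σ → I 0 (exec (down k f) σ)
  down-inv I zero f h z = z
  down-inv I (suc k) f h z = down-inv I k f (λ i σ q → h i σ (m<n⇒m<1+n q)) (h k _ ≤-refl z)

  avoids : (Reg → Bool) → List (Reg × Ex) → Bool
  avoids P [] = true
  avoids P ((q , _) ∷ us) = not (P q) ∧ avoids P us

  -- For a step the condition is a Boolean that evaluates, so most frame proofs are tuples of `tt`.
  -- In a loop it is demanded of the body for every index, reached or not.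
  Frame : (Reg → Bool) → Prog → Set
  Frame P (step S) = T (avoids P (Step.upd S))
  Frame P (p ⨾ q) = Frame P p × Frame P q
  Frame P (loop k f) = ∀ i → Frame P (f i)
  Frame P (down k f) = ∀ i → Frame P (f i)

  frame : ∀ P p → Frame P p → ∀ σ v r → P r ≡ true → lookup (exec p σ v) r ≡ lookup (σ v) r
  frame P (step S) h σ v r pr = trans (lookup∘tabulate (assignAt (Step.upd S) ε (σ v)) r) (go (Step.upd S) h)
    where
    ε = env (σ v) zeros 0 (Zv S σ v) (Yv S σ v)
    go : ∀ us → T (avoids P us) → assignAt us ε (σ v) r ≡ lookup (σ v) r
    go [] _ = refl
    go ((q , e) ∷ us) h with P q in eq | toℕ q ≡ᵇ toℕ r in eq'
    ... | false | false = go us h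
    ... | false | true = ⊥-elim (true≢false (trans (cong P (toℕ-injective (==-sound {toℕ q} {toℕ r} eq'))) pr) eq)
    ... | true | _ = ⊥-elim h
  frame P (p ⨾ q) (h , k) σ v r pr = trans (frame P q k _ v r pr) (frame P p h σ v r pr)
  frame P (loop k f) h σ v r pr = go k
    where
    go : ∀ k → lookup (loopExec k (λ i → exec (f i)) σ v) r ≡ lookup (σ v) r
    go zero = refl
    go (suc k) = trans (frame P (f k) (h k) _ v r pr) (go k)
  frame P (down k f) h σ v r pr = go k σ
    where
    go : ∀ k σ → lookup (downExec k (λ i → exec (f i)) σ v) r ≡ lookup (σ v) r
    go zero σ = refl
    go (suc k) σ = trans (go k _) (frame P (f k) (h k) σ v r pr)

  -- An opaque copy of exec: reasoning about long programs must not unfold intermediate states.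
  opaque
    Run : Prog → State → State
    Run = exec

    toRun : ∀ (Q : State → Set) p σ → Q (exec p σ) → Q (Run p σ)
    toRun Q p σ h = h

    fromRun : ∀ (Q : State → Set) p σ → Q (Run p σ) → Q (exec p σ)
    fromRun Q p σ h = h

    seq : ∀ (S Q : State → Set) p q σ → S (Run p σ) → (∀ τ → S τ → Q (Run q τ)) → Q (Run (p ⨾ q) σ)
    seq S Q p q σ s h = h _ s

    loop-run : ∀ (I : ℕ → State → Set) k f → (∀ i σ → i < k → I i σ → I (suc i) (Run (f i) σ)) →
      ∀ σ → I 0 σ → I k (Run (loop k f) σ)
    loop-run I k f h σ z = loop-inv I k f h {σ} z

    down-run : ∀ (I : ℕ → State → Set) k f → (∀ i σ → i < k → I (suc i) σ → I i (Run (f i) σ)) →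
      ∀ σ → I k σ → I 0 (Run (down k f) σ)
    down-run I k f h σ z = down-inv I k f h {σ} z

    frame-run : ∀ P p → Frame P p → ∀ σ v r → P r ≡ true → lookup (Run p σ v) r ≡ lookup (σ v) r
    frame-run = frame

-- Compilation to Minor-Aggregation rounds.  Numbers are encoded with saturation,
-- which makes the encoding a homomorphism for sums and maxima alike.

app-comm : ∀ o a b → app o a b ≡ app o b a
app-comm add = +-comm
app-comm mx  = ⊔-comm

app-assoc : ∀ o a b c → app o (app o a b) c ≡ app o a (app o b c)
app-assoc add = +-assoc
app-assoc mx  = ⊔-assoc

-- Sums and maxima are inflationary: once an argument reaches the cap, so does the result, and both
-- sides equal `M`.
app-saturate : ∀ o M a b → app o (a ⊓ M) b ⊓ M ≡ app o a b ⊓ M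
app-saturate o M a b with ≤-total a M
... | inj₁ q = cong (λ z → app o z b ⊓ M) (m≤n⇒m⊓n≡m q)
... | inj₂ q = trans (cong (λ z → app o z b ⊓ M) (m≥n⇒m⊓n≡n q))
  (trans (m≥n⇒m⊓n≡n (app-≥ˡ o M b)) (sym (m≥n⇒m⊓n≡n (≤-trans q (app-≥ˡ o a b)))))

enc : ∀ B → ℕ → Msg B
enc B x = tabulateᵛ (digit (x ⊓ (2 ^ B ∸ 1)))

dec : ∀ {B} → Msg B → ℕ
dec v = num (lookup v)

dec-enc : ∀ B x → dec (enc B x) ≡ x ⊓ (2 ^ B ∸ 1)
dec-enc B x = trans (num-cong {B} {lookup (enc B x)} {digit (x ⊓ (2 ^ B ∸ 1))} (lookup∘tabulate (digit (x ⊓ (2 ^ B ∸ 1))))) (num-digit B _ bound)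
  where
  bound : x ⊓ (2 ^ B ∸ 1) < 2 ^ B
  bound = ≤-<-trans (m⊓n≤n x _) (≤-reflexive (m+[n∸m]≡n {1} (m^n>0 2 B)))

dec-enc-< : ∀ B {x} → x < 2 ^ B → dec (enc B x) ≡ x
dec-enc-< B {x} h = trans (dec-enc B x) (m≤n⇒m⊓n≡m (below h))
  where
  below : ∀ {a b} → a < b → a ≤ b ∸ 1
  below (s≤s q) = q

opv : Op → ∀ {B} → Msg B → Msg B → Msg B
opv o {B} x y = enc B (app o (dec x) (dec y))

opv-enc : ∀ o B a b → opv o (enc B a) (enc B b) ≡ enc B (app o a b)
opv-enc o B a b = cong (λ z → tabulateᵛ (digit z)) (begin
    app o (dec (enc B a)) (dec (enc B b)) ⊓ M   ≡⟨ cong₂ (λ x y → app o x y ⊓ M) (dec-enc B a) (dec-enc B b) ⟩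
    app o (a ⊓ M) (b ⊓ M) ⊓ M                   ≡⟨ app-saturate o M a (b ⊓ M) ⟩
    app o a (b ⊓ M) ⊓ M                          ≡⟨ cong (_⊓ M) (app-comm o a (b ⊓ M)) ⟩
    app o (b ⊓ M) a ⊓ M                          ≡⟨ app-saturate o M b a ⟩
    app o b a ⊓ M                                ≡⟨ cong (_⊓ M) (app-comm o b a) ⟩
    app o a b ⊓ M ∎)
  where
  open ≡-Reasoning
  M = 2 ^ B ∸ 1

opv-comm : ∀ o {B} (x y : Msg B) → opv o x y ≡ opv o y x
opv-comm o {B} x y = cong (enc B) (app-comm o (dec x) (dec y))

-- The model asks for this on all messages, not only on encodings of numbers. Both bracketings
-- reduce to the encoding of the unsaturated ternary value, because saturating an intermediate
-- result does not change the saturated outcome.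
opv-assoc : ∀ o {B} (x y z : Msg B) → opv o (opv o x y) z ≡ opv o x (opv o y z)
opv-assoc o {B} x y z = begin
    enc B (app o (dec (enc B (app o a b))) c)   ≡⟨ left a b c ⟩
    enc B (app o (app o a b) c)                 ≡⟨ cong (enc B) (trans (app-assoc o a b c) (app-comm o a _)) ⟩
    enc B (app o (app o b c) a)                 ≡⟨ sym (left b c a) ⟩
    enc B (app o (dec (enc B (app o b c))) a)   ≡⟨ cong (enc B) (app-comm o _ a) ⟩
    enc B (app o a (dec (enc B (app o b c)))) ∎
  where
  open ≡-Reasoning
  a = dec x
  b = dec y
  c = dec z
  left : ∀ a b c → enc B (app o (dec (enc B (app o a b))) c) ≡ enc B (app o (app o a b) c)
  left a b c = cong (λ z → tabulateᵛ (digit z))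
    (trans (cong (λ z → app o z c ⊓ (2 ^ B ∸ 1)) (dec-enc B (app o a b))) (app-saturate o _ (app o a b) c))

module _ {K : ℕ} (b : ℕ) where

  encVec : Vec ℕ K → Msg (K * b)
  encVec ρ = tabulateᵛ (λ k → digit (lookup ρ (proj₁ (remQuot b k))) (proj₂ (remQuot {K} b k)))

  decVec : Msg (K * b) → Vec ℕ K
  decVec v = tabulateᵛ (λ r → num (λ i → lookup v (combine r i)))

  dec-encVec : ∀ ρ → (∀ r → lookup ρ r < 2 ^ b) → decVec (encVec ρ) ≡ ρ
  dec-encVec ρ h = trans (tabulate-cong {f = λ r → num (λ i → lookup (encVec ρ) (combine r i))} {g = lookup ρ} reg) (tabulate∘lookup ρ)
    where
    reg : ∀ r → num (λ (i : Fin b) → lookup (encVec ρ) (combine r i)) ≡ lookup ρ r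
    reg r = trans (num-cong {b} {λ i → lookup (encVec ρ) (combine r i)} {digit (lookup ρ r)} λ i →
                     trans (lookup∘tabulate (λ k → digit (lookup ρ (proj₁ (remQuot b k))) (proj₂ (remQuot {K} b k))) (combine r i))
                     (cong (λ q → digit (lookup ρ (proj₁ q)) (proj₂ q)) (remQuot-combine {K} {b} r i)))
                  (num-digit b _ (h r))

abstract
  -- A message must hold all 24 registers, since a node shows its whole memory to its edges. Such a
  -- message is never combined with another one: it is sent only in rounds in which every supernode
  -- is a single node.
  width : ℕ → ℕ
  width b = 24 * b

  width-≡ : ∀ b → width b ≡ 24 * b
  width-≡ b = refl

  width-≥ : ∀ b → b ≤ width b
  width-≥ b = m≤m+n b (23 * b)

  encMem : ∀ b → Mem → Msg (width b)
  encMem b = encVec b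

  decMem : ∀ b → Msg (width b) → Mem
  decMem b = decVec b

  dec-encMem : ∀ b ρ → (∀ r → lookup ρ r < 2 ^ b) → decMem b (encMem b ρ) ≡ ρ
  dec-encMem b = dec-encVec b

-- A supernode without incident edges aggregates nothing, which is read as 0.
Reads : ∀ {B} → Maybe (Msg B) → ℕ → Set
Reads nothing s = s ≡ 0
Reads {B} (just x) s = x ≡ enc B s

reads-dec : ∀ {B} (a : Maybe (Msg B)) {s} → Reads a s → s < 2 ^ B → maybe′ dec 0 a ≡ s
reads-dec nothing h _ = sym h
reads-dec {B} (just x) refl q = dec-enc-< B q

reads-∷ : ∀ o {B} (a : Maybe (Msg B)) {s} x → Reads a s → Reads (just (maybe′ (opv o (enc B x)) (enc B x) a)) (app o x s)
reads-∷ o {B} nothing x refl = cong (enc B) (sym (app-0ʳ o x))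
reads-∷ o {B} (just _) {s} x refl = opv-enc o B x s

aggregate-filter : ∀ o B {A : Set} (x : A → ℕ) (P : A → Bool) l →
  Reads (aggregate (opv o) (map (λ u → enc B (x u)) (filter (λ u → T? (P u)) l)))
        (foldr (λ u s → app o (P u ▸ x u) s) 0 l)
aggregate-filter o B x P [] = refl
aggregate-filter o B x P (u ∷ l) with P u
... | true  = reads-∷ o _ (x u) (aggregate-filter o B x P l)
... | false = subst (Reads (aggregate (opv o) (map (λ u → enc B (x u)) (filter (λ u → T? (P u)) l)))) (sym (app-0ˡ o _)) (aggregate-filter o B x P l)

aggregate-nothing : ∀ {A : Set} (op : A → A → A) l → aggregate op l ≡ nothing → l ≡ []
aggregate-nothing op [] _ = refl

map-local : ∀ {A B : Set} {f g : A → B} l → (∀ a → f a ≡ g a) → map f l ≡ map g l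
map-local [] h = refl
map-local (a ∷ l) h = cong₂ _∷_ (h a) (map-local l h)

filter-cong : ∀ {A : Set} (P Q : A → Bool) l → (∀ a → P a ≡ Q a) → filter (λ u → T? (P u)) l ≡ filter (λ u → T? (Q u)) l
filter-cong P Q [] h = refl
filter-cong P Q (a ∷ l) h with P a | Q a | h a
... | true  | _ | refl = cong (a ∷_) (filter-cong P Q l h)
... | false | _ | refl = filter-cong P Q l h

filter-≐-none : ∀ {n k} (g : Fin k → Fin n) v → (∀ i → g i ≢ v) → filter (λ u → T? (u ≐ v)) (tabulate g) ≡ []
filter-≐-none {k = zero} g v h = refl
filter-≐-none {k = suc k} g v h rewrite ≐-false (h zero) = filter-≐-none (g ∘ suc) v (h ∘ suc)

filter-≐ : ∀ {n k} (g : Fin k → Fin n) → (∀ {i j} → g i ≡ g j → i ≡ j) → ∀ j →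
  filter (λ u → T? (u ≐ g j)) (tabulate g) ≡ g j ∷ []
filter-≐ {k = suc k} g inj zero rewrite ≐-refl (g zero) =
  cong (g zero ∷_) (filter-≐-none (g ∘ suc) (g zero) (λ i q → case inj q of λ ()))
filter-≐ {k = suc k} g inj (suc j) rewrite ≐-false {u = g zero} {g (suc j)} (λ q → case inj q of λ ()) =
  filter-≐ (g ∘ suc) (λ q → suc-inj (inj q)) j
  where
  suc-inj : ∀ {k} {a b : Fin k} → Fin.suc a ≡ suc b → a ≡ b
  suc-inj refl = refl

-- Elementary facts about supernodes

module SupernodeBasics {n m : ℕ} (ends : Fin m → Fin n × Fin n) where
  open Semantics ends

  or-cong : ∀ {f g : Fin m → Bool} l → (∀ e → f e ≡ g e) → or (map f l) ≡ or (map g l)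
  or-cong l h = cong or (map-local l h)

  grow-cong : ∀ {c c' S S'} → (∀ e → c e ≡ c' e) → (∀ v → S v ≡ S' v) → ∀ v → grow c S v ≡ grow c' S' v
  grow-cong {c} {c'} {S} {S'} hc hS v = cong₂ _∨_ (hS v) (or-cong (allFin m) λ e →
    cong₂ _∧_ (hc e) (cong₂ (λ a b → (a ∧ (v == proj₂ (ends e))) ∨ (b ∧ (v == proj₁ (ends e)))) (hS (proj₁ (ends e))) (hS (proj₂ (ends e)))))

  iter-cong : ∀ {c c'} → (∀ e → c e ≡ c' e) → ∀ k S v → iter k (grow c) S v ≡ iter k (grow c') S v
  iter-cong h zero S v = refl
  iter-cong h (suc k) S v = grow-cong h (iter-cong h k S) v

  sameSN-cong : ∀ {c c'} → (∀ e → c e ≡ c' e) → ∀ v u → sameSN c v u ≡ sameSN c' v u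
  sameSN-cong h v u = iter-cong h n (λ u → u == v) u

  or-false : ∀ {A : Set} {f : A → Bool} l → (∀ a → f a ≡ false) → or (map f l) ≡ false
  or-false [] h = refl
  or-false (a ∷ l) h rewrite h a = or-false l h

  iter-trivial : ∀ k S v → iter k (grow (λ _ → false)) S v ≡ S v
  iter-trivial zero S v = refl
  iter-trivial (suc k) S v =
    trans (cong₂ _∨_ (iter-trivial k S v) (or-false {f = λ (e : Fin m) → false} (allFin m) (λ _ → refl))) (∨-identityʳ (S v))

  sameSN-trivial : ∀ {c} → (∀ e → c e ≡ false) → ∀ v u → sameSN c v u ≡ (u ≐ v)
  sameSN-trivial h v u = trans (sameSN-cong h v u) (iter-trivial n (λ u → u == v) u)

  iter-⊇ : ∀ c k S v → S v ≡ true → iter k (grow c) S v ≡ true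
  iter-⊇ c zero S v h = h
  iter-⊇ c (suc k) S v h = ∨-l (iter-⊇ c k S v h)

  sameSN-refl : ∀ c v → sameSN c v v ≡ true
  sameSN-refl c v = iter-⊇ c n (λ u → u == v) v (≐-refl v)

stepAt : List Step → ℕ → Step
stepAt [] _ = mkStep add add (λ _ → con 0) (λ _ _ → false) (con 0) [] tt
stepAt (S ∷ p) zero = S
stepAt (S ∷ p) (suc i) = stepAt p i

odd-double : ∀ k → odd (double k) ≡ false
odd-double zero = refl
odd-double (suc k) = odd-double k

odd-suc-double : ∀ k → odd (suc (double k)) ≡ true
odd-suc-double zero = refl
odd-suc-double (suc k) = odd-suc-double k

half-double : ∀ k → ⌊ double k /2⌋ ≡ k
half-double zero = refl
half-double (suc k) = cong suc (half-double k)

half-suc-double : ∀ k → ⌊ suc (double k) /2⌋ ≡ k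
half-suc-double zero = refl
half-suc-double (suc k) = cong suc (half-suc-double k)

-- Each step takes two rounds.  In an even round nothing is contracted: the ends of an
-- edge show it their registers and collect the emitted values.  The odd round contracts.
module Compile (n : ℕ) (P : List Step) (b : ℕ) (out : Mem → Maybe ℕ) where

  B : ℕ
  B = width b

  Node Info Edge : Set
  Node = Mem × ℕ
  Info = ℕ × Bool × Bool
  Edge = Info × Mem × Mem

  r₁ r₂ : Bool → Bool → Role
  r₁ t p = if t then (if p then dn else up) else flat
  r₂ t p = if t then (if p then up else dn) else flat

  opH⊕ opH⊗ : Bool → Step → Op
  opH⊕ o S = if o then Step.opy S else add
  opH⊗ o S = Step.opz S

  contractH : Bool → Step → Edge → Bool
  contractH false S _ = false
  contractH true  S ((w , t , p) , ρ₁ , ρ₂) = t ∧ (if p then Step.contr S ρ₂ ρ₁ else Step.contr S ρ₁ ρ₂)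

  consensusH : Bool → Step → Node → Msg B
  consensusH false S (ρ , z) = encMem b ρ
  consensusH true  S (ρ , z) = enc B (eval (Step.val S) (env ρ zeros 0 z 0))

  edgeH : Bool → Step → Edge → Msg B → Msg B → Edge × Msg B × Msg B
  edgeH true  S s y₁ y₂ = s , y₁ , y₂
  edgeH false S ((w , t , p) , _) y₁ y₂ = ((w , t , p) , ρ₁ , ρ₂)
      , enc B (eval (Step.emit S (r₁ t p)) (env ρ₁ ρ₂ w 0 0))
      , enc B (eval (Step.emit S (r₂ t p)) (env ρ₂ ρ₁ w 0 0))
    where
    ρ₁ = decMem b y₁
    ρ₂ = decMem b y₂

  nodeH : Bool → Step → Node → Msg B → Maybe (Msg B) → Node
  nodeH false S (ρ , _) y a = ρ , maybe′ dec 0 a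
  nodeH true  S (ρ , z) y a = assign (Step.upd S) (env ρ zeros 0 z (dec y)) ρ , 0

  alg : Algorithm n
  alg = record
    { B = B ; R = double (length P) ; NS = Node ; ES = Edge
    ; nodeInit = λ i → i ∷ replicateᵛ 23 0 , 0
    ; edgeInit = λ _ _ w t p → (w , t , p) , zeros , zeros
    ; ⊕ = λ t → opv (opH⊕ (odd t) (stepAt P ⌊ t /2⌋))
    ; ⊗ = λ t → opv (opH⊗ (odd t) (stepAt P ⌊ t /2⌋))
    ; ⊕-comm = λ t → opv-comm (opH⊕ (odd t) (stepAt P ⌊ t /2⌋))
    ; ⊕-assoc = λ t → opv-assoc (opH⊕ (odd t) (stepAt P ⌊ t /2⌋))
    ; ⊗-comm = λ t → opv-comm (opH⊗ (odd t) (stepAt P ⌊ t /2⌋))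
    ; ⊗-assoc = λ t → opv-assoc (opH⊗ (odd t) (stepAt P ⌊ t /2⌋))
    ; contract = λ t → contractH (odd t) (stepAt P ⌊ t /2⌋)
    ; consensus = λ t → consensusH (odd t) (stepAt P ⌊ t /2⌋)
    ; edgeStep = λ t → edgeH (odd t) (stepAt P ⌊ t /2⌋)
    ; nodeStep = λ t → nodeH (odd t) (stepAt P ⌊ t /2⌋)
    ; output = λ s → out (proj₁ s)
    }

  module _ {m : ℕ} (ends : Fin m → Fin n × Fin n) (inT par : Fin m → Bool) (w : Fin m → ℕ)
           (loopless : ∀ e → proj₁ (ends e) ≢ proj₂ (ends e)) where

    open Semantics ends
    open SupernodeBasics ends
    open Ideal ends inT par w

    Cfg : Set
    Cfg = (Fin n → Node) × (Fin m → Edge)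

    module RoundH (o : Bool) (S : Step) (ns : Fin n → Node) (es : Fin m → Edge) where
      c : Fin m → Bool
      c e = contractH o S (es e)
      x : Fin n → Msg B
      x v = consensusH o S (ns v)
      y : Fin n → Msg B
      y v = fromMaybe (x v) (aggregate (opv (opH⊕ o S)) (map x (filter (λ u → T? (sameSN c v u)) (allFin n))))
      inMinor : Fin m → Bool
      inMinor e = not (sameSN c (fst e) (snd e))
      act : Fin m → Edge × Msg B × Msg B
      act e = edgeH o S (es e) (y (fst e)) (y (snd e))
      es' : Fin m → Edge
      es' e = if inMinor e then proj₁ (act e) else es e
      zs : Fin n → List (Msg B)
      zs v = concatMap (λ e →
               if inMinor e
               then (if sameSN c v (fst e) then proj₁ (proj₂ (act e)) ∷ []
                     else if sameSN c v (snd e) then proj₂ (proj₂ (act e)) ∷ []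
                     else [])
               else [])
             (allFin m)
      ns' : Fin n → Node
      ns' v = nodeH o S (ns v) (y v) (aggregate (opv (opH⊗ o S)) (zs v))

    roundH : Bool → Step → Cfg → Cfg
    roundH o S (ns , es) = RoundH.ns' o S ns es , RoundH.es' o S ns es

    -- `roundH` repeats the round of the model with parity and step as explicit arguments. The
    -- equality is definitional, and afterwards both arguments can be rewritten to their values.
    round-roundH : ∀ t cfg → round alg t cfg ≡ roundH (odd t) (stepAt P ⌊ t /2⌋) cfg
    round-roundH t cfg = refl

    info : Fin m → Info
    info e = w e , inT e , par e

    aggregate-edges : ∀ o {v} (g : Fin m → List (Msg B)) (h : Fin m → ℕ) →
      (∀ e → g e ≡ (if v ≐ fst e then enc B (h e) ∷ [] else if v ≐ snd e then enc B (h e) ∷ [] else [])) →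
      ∀ l → Reads (aggregate (opv o) (concatMap g l))
              (foldr (λ e s → app o (if v ≐ fst e then h e else if v ≐ snd e then h e else 0) s) 0 l)
    aggregate-edges o g h eq [] = refl
    aggregate-edges o {v} g h eq (e ∷ l) rewrite eq e with v ≐ fst e
    ... | true = reads-∷ o _ (h e) (aggregate-edges o {v} g h eq l)
    ... | false with v ≐ snd e
    ...   | true = reads-∷ o _ (h e) (aggregate-edges o {v} g h eq l)
    ...   | false = subst (Reads (aggregate (opv o) (concatMap g l))) (sym (app-0ˡ o _)) (aggregate-edges o {v} g h eq l)

    module Even (S : Step) (ns : Fin n → Node) (es : Fin m → Edge) (σ : State)
                (hn : ∀ v → proj₁ (ns v) ≡ σ v) (he : ∀ e → proj₁ (es e) ≡ info e)
                (bnd : ∀ v r → lookup (σ v) r < 2 ^ b) (zbnd : ∀ v → Zv S σ v < 2 ^ b) where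
      open RoundH false S ns es

      sn : ∀ v u → sameSN c v u ≡ (u ≐ v)
      sn = sameSN-trivial (λ e → refl)

      y-eq : ∀ v → y v ≡ encMem b (σ v)
      y-eq v rewrite filter-cong (sameSN c v) (_≐ v) (allFin n) (sn v)
                   | filter-≐ {k = n} id id v = cong (encMem b) (hn v)

      dec-y : ∀ v → decMem b (y v) ≡ σ v
      dec-y v = trans (cong (decMem b) (y-eq v)) (dec-encMem b (σ v) (bnd v))

      inMinor-true : ∀ e → inMinor e ≡ true
      inMinor-true e = not-t (trans (sn (fst e) (snd e)) (≐-false (λ q → loopless e (sym q))))

      act-eq : ∀ e → act e ≡ ((info e , σ (fst e) , σ (snd e))
           , enc B (eval (Step.emit S (role₁ (inT e) (par e))) (emitEnv (σ (fst e)) (σ (snd e)) (w e)))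
           , enc B (eval (Step.emit S (role₂ (inT e) (par e))) (emitEnv (σ (snd e)) (σ (fst e)) (w e))))
      act-eq e with es e | he e
      ... | _ , _ | refl rewrite dec-y (fst e) | dec-y (snd e) = refl

      edges : ∀ e → es' e ≡ (info e , σ (fst e) , σ (snd e))
      edges e rewrite inMinor-true e = cong proj₁ (act-eq e)

      sym-≐ : ∀ (u v : Fin n) → (u ≐ v) ≡ (v ≐ u)
      sym-≐ u v = bool-ext (λ q → ≐-true (sym (≐-sound q))) (λ q → ≐-true (sym (≐-sound q)))

      nodes : ∀ v → ns' v ≡ (σ v , Zv S σ v)
      nodes v with ns v in eq
      ... | ρ , z = cong₂ _,_ (trans (sym (cong proj₁ eq)) (hn v))
              (reads-dec (aggregate (opv (Step.opz S)) (zs v)) reads (<-≤-trans (zbnd v) (^-monoʳ-≤ 2 (width-≥ b))))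
        where
        val₁ : Fin m → ℕ
        val₁ e = if v ≐ fst e then eval (Step.emit S (role₁ (inT e) (par e))) (emitEnv (σ (fst e)) (σ (snd e)) (w e))
                else eval (Step.emit S (role₂ (inT e) (par e))) (emitEnv (σ (snd e)) (σ (fst e)) (w e))
        shape : ∀ e → (if inMinor e
               then (if sameSN c v (fst e) then proj₁ (proj₂ (act e)) ∷ []
                     else if sameSN c v (snd e) then proj₂ (proj₂ (act e)) ∷ []
                     else [])
               else []) ≡ (if v ≐ fst e then enc B (val₁ e) ∷ [] else if v ≐ snd e then enc B (val₁ e) ∷ [] else [])
        shape e =
          trans (cong (λ i → choose i (sameSN c v (fst e)) (sameSN c v (snd e)) (act e)) (inMinor-true e))
          (trans (cong₂ (λ p q → choose true p q (act e)) (trans (sn v (fst e)) (sym-≐ (fst e) v)) (trans (sn v (snd e)) (sym-≐ (snd e) v)))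
          (trans (cong (choose true (v ≐ fst e) (v ≐ snd e)) (act-eq e)) last))
          where
          choose : Bool → Bool → Bool → Edge × Msg B × Msg B → List (Msg B)
          choose i p q a = if i then (if p then proj₁ (proj₂ a) ∷ [] else if q then proj₂ (proj₂ a) ∷ [] else []) else []
          last : choose true (v ≐ fst e) (v ≐ snd e) ((info e , σ (fst e) , σ (snd e))
               , enc B (eval (Step.emit S (role₁ (inT e) (par e))) (emitEnv (σ (fst e)) (σ (snd e)) (w e)))
               , enc B (eval (Step.emit S (role₂ (inT e) (par e))) (emitEnv (σ (snd e)) (σ (fst e)) (w e))))
               ≡ (if v ≐ fst e then enc B (val₁ e) ∷ [] else if v ≐ snd e then enc B (val₁ e) ∷ [] else [])
          last with v ≐ fst e
          ... | true = refl
          ... | false = refl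
        fold-eq : foldr (λ e s → app (Step.opz S) (if v ≐ fst e then val₁ e else if v ≐ snd e then val₁ e else 0) s) 0 (allFin m) ≡ Zv S σ v
        fold-eq = trans (foldr-fold (Step.opz S) id (λ e → if v ≐ fst e then val₁ e else if v ≐ snd e then val₁ e else 0))
                        (fold-cong (Step.opz S) same)
          where
          same : ∀ e → (if v ≐ fst e then val₁ e else if v ≐ snd e then val₁ e else 0) ≡ contrib S σ v e
          same e with v ≐ fst e
          ... | true = refl
          ... | false = refl
        reads : Reads (aggregate (opv (Step.opz S)) (zs v)) (Zv S σ v)
        reads = subst (Reads (aggregate (opv (Step.opz S)) (zs v))) fold-eq (aggregate-edges (Step.opz S) {v} _ val₁ shape (allFin m))

    module Odd (S : Step) (ns : Fin n → Node) (es : Fin m → Edge) (σ : State)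
               (hn : ∀ v → ns v ≡ (σ v , Zv S σ v)) (he : ∀ e → es e ≡ (info e , σ (fst e) , σ (snd e)))
               (ybnd : ∀ v → Yv S σ v < 2 ^ b) where
      open RoundH true S ns es

      c-eq : ∀ e → c e ≡ contracted S σ e
      c-eq e rewrite he e = refl

      x-eq : ∀ v → x v ≡ enc B (Xv S σ v)
      x-eq v rewrite hn v = refl

      agg : Fin n → Maybe (Msg B)
      agg v = aggregate (opv (Step.opy S)) (map x (filter (λ u → T? (sameSN c v u)) (allFin n)))

      reads : ∀ v → Reads (agg v) (Yv S σ v)
      reads v rewrite map-local {g = λ u → enc B (Xv S σ u)} (filter (λ u → T? (sameSN c v u)) (allFin n)) x-eq
                    | filter-cong (sameSN c v) (sameSN (contracted S σ) v) (allFin n) (sameSN-cong c-eq v) =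
        subst (Reads (aggregate (opv (Step.opy S)) (map (λ u → enc B (Xv S σ u)) (filter (λ u → T? (sameSN (contracted S σ) v u)) (allFin n)))))
          (foldr-fold (Step.opy S) id (λ u → sameSN (contracted S σ) v u ▸ Xv S σ u))
          (aggregate-filter (Step.opy S) B (Xv S σ) (sameSN (contracted S σ) v) (allFin n))

      -- A node lies in its own supernode, so the list of aggregated values has at least one entry.
      nonempty : ∀ v → agg v ≢ nothing
      nonempty v q = empty (allFin n) (∈-all v) (map-[] (aggregate-nothing (opv (Step.opy S)) _ q))
        where
        map-[] : ∀ {l} → map x l ≡ [] → l ≡ []
        map-[] {[]} _ = refl
        ∈-all : ∀ {k} (v : Fin k) → v ∈ allFin k
        ∈-all v = go id v
          where
          go : ∀ {k j} (g : Fin k → Fin j) v → g v ∈ tabulate g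
          go g zero = here refl
          go g (suc v) = there (go (g ∘ suc) v)
        empty : ∀ l → v ∈ l → filter (λ u → T? (sameSN c v u)) l ≡ [] → ⊥
        empty (u ∷ l) (here refl) q rewrite sameSN-refl c v = case q of λ ()
        empty (u ∷ l) (there i) q with sameSN c v u
        ... | true = case q of λ ()
        ... | false = empty l i q

      dec-y : ∀ v → dec (y v) ≡ Yv S σ v
      dec-y v with agg v in eq | reads v
      ... | nothing | _ = ⊥-elim (nonempty v eq)
      ... | just a | refl = dec-enc-< B (<-≤-trans (ybnd v) (^-monoʳ-≤ 2 (width-≥ b)))

      nodes : ∀ v → proj₁ (ns' v) ≡ exec₁ S σ v
      nodes v with ns v | hn v | dec-y v
      ... | _ | refl | q rewrite q = refl

      edges : ∀ e → proj₁ (es' e) ≡ info e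
      edges e with inMinor e
      ... | true rewrite he e = refl
      ... | false rewrite he e = refl

    -- Absence of overflow is a property of the ideal run alone: the registers before each step and
    -- both folds of the step fit into `b` bits.
    SafeRun : List Step → State → Set
    SafeRun [] σ = ⊤
    SafeRun (S ∷ p) σ = (∀ v r → lookup (σ v) r < 2 ^ b) × (∀ v → Zv S σ v < 2 ^ b) × (∀ v → Yv S σ v < 2 ^ b)
                      × SafeRun p (exec₁ S σ)

    -- Invariant before the even round of a step: the node memories are the ideal state, while of an
    -- edge only the static data matter, because the even round refreshes its copies of the memories
    -- of its ends. The two rounds `Even` and `Odd` re-establish it.
    run-correct : ∀ p i σ cfg → (∀ j → stepAt P (i + j) ≡ stepAt p j) → SafeRun p σ →
      (∀ v → proj₁ (proj₁ cfg v) ≡ σ v) → (∀ e → proj₁ (proj₂ cfg e) ≡ info e) →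
      ∀ v → proj₁ (proj₁ (runFrom alg (double i) (double (length p)) cfg) v) ≡ runL p σ v
    run-correct [] i σ cfg at _ hn he v = hn v
    run-correct (S ∷ p) i σ cfg at (s₁ , s₂ , s₃ , s₄) hn he v =
      trans (cong (λ q → proj₁ (proj₁ (runFrom alg (double (suc i)) (double (length p)) q) v)) two)
            (run-correct p (suc i) (exec₁ S σ) cfg₂ (λ j → trans (cong (stepAt P) (sym (+-suc i j))) (at (suc j))) s₄
              O.nodes O.edges v)
      where
      at0 : stepAt P i ≡ S
      at0 = trans (cong (stepAt P) (sym (+-identityʳ i))) (at 0)
      cfg₁ cfg₂ : Cfg
      cfg₁ = roundH false S cfg
      cfg₂ = roundH true S cfg₁
      module E = Even S (proj₁ cfg) (proj₂ cfg) σ hn he s₁ s₂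
      module O = Odd S (proj₁ cfg₁) (proj₂ cfg₁) σ E.nodes E.edges s₃
      one : round alg (double i) cfg ≡ cfg₁
      one = trans (round-roundH (double i) cfg) (cong₂ (λ o T → roundH o T cfg) (odd-double i) (trans (cong (stepAt P) (half-double i)) at0))
      two : round alg (suc (double i)) (round alg (double i) cfg) ≡ cfg₂
      two = trans (cong (round alg (suc (double i))) one)
              (trans (round-roundH (suc (double i)) cfg₁) (cong₂ (λ o T → roundH o T cfg₁) (odd-suc-double i) (trans (cong (stepAt P) (half-suc-double i)) at0)))

    initial : (Fin n → ℕ) → State
    initial ID v = ID v ∷ replicateᵛ 23 0

    outputs-correct : ∀ ID → SafeRun P (initial ID) → ∀ v →
      outputs alg w inT par ID v ≡ out (runL P (initial ID) v)
    outputs-correct ID safe v = cong out (run-correct P 0 (initial ID) _ (λ _ → refl) safe (λ _ → refl) (λ _ → refl) v)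

-- Kept abstract so that products with it do not unfold.
abstract
  lim : ℕ
  lim = 64

  lim-≡ : lim ≡ 64
  lim-≡ = refl

≤lim* : ∀ x → x ≤ lim * x
≤lim* x = subst (λ c → x ≤ c * x) (sym lim-≡) (m≤n*m x 64)

-- Growth of the register contents

module Growth {n m : ℕ} (ends : Fin m → Fin n × Fin n) (inT par : Fin m → Bool) (w : Fin m → ℕ)
              (loopless : ∀ e → proj₁ (ends e) ≢ proj₂ (ends e))
              (P : List Step) (b : ℕ) (out : Mem → Maybe ℕ)
              (n≥1 : 1 ≤ n) (m≤n² : m ≤ n * n) (q : ℕ) (hq : lim * (n * (lim * (n * n * lim))) ≤ 2 ^ q) where

  open Ideal ends inT par w
  open Compile n P b out

  sizes : ∀ (S : Step) → Step.stepSize S ≤ lim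
  sizes S = ≤-trans (≤ᵇ⇒≤ (Step.stepSize S) 64 (Step.small S)) (≤-reflexive (sym lim-≡))

  emit-size : ∀ S ro → size (Step.emit S ro) ≤ lim
  emit-size S up   = ≤-trans (≤-trans (m≤m+n _ _) (n≤1+n _)) (sizes S)
  emit-size S dn   = ≤-trans (≤-trans (≤-trans (m≤m+n _ _) (m≤n+m _ (size (Step.emit S up)))) (n≤1+n _)) (sizes S)
  emit-size S flat = ≤-trans (≤-trans (≤-trans (≤-trans (m≤m+n _ _) (m≤n+m _ (size (Step.emit S dn)))) (m≤n+m _ (size (Step.emit S up)))) (n≤1+n _)) (sizes S)

  rest-size : ∀ S → size (Step.val S) + updSize (Step.upd S) ≤ lim
  rest-size S = ≤-trans (≤-trans (≤-trans (≤-trans (m≤n+m _ (size (Step.emit S flat))) (m≤n+m _ (size (Step.emit S dn)))) (m≤n+m _ (size (Step.emit S up)))) (n≤1+n _)) (sizes S)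

  zeros-0 : ∀ r → lookup zeros r ≡ 0
  zeros-0 r = lookup-replicate r 0

  module _ (S : Step) (σ : State) (A : ℕ) (hσ : ∀ v r → lookup (σ v) r ≤ 2 ^ A) (hw : ∀ e → w e ≤ 2 ^ A) where

    Z₀ Y₀ : ℕ
    Z₀ = n * n * (lim * 2 ^ A)
    Y₀ = n * (lim * Z₀)

    1≤2^A : 1 ≤ 2 ^ A
    1≤2^A = m^n>0 2 A

    emit-bound : ∀ ro ρ ρ' x → (∀ r → lookup ρ r ≤ 2 ^ A) → (∀ r → lookup ρ' r ≤ 2 ^ A) → x ≤ 2 ^ A →
      eval (Step.emit S ro) (emitEnv ρ ρ' x) ≤ lim * 2 ^ A
    emit-bound ro ρ ρ' x h h' hx = ≤-trans (eval-bound (Step.emit S ro) _ 1≤2^A (h , h' , hx , z≤n , z≤n)) (*-monoˡ-≤ (2 ^ A) (emit-size S ro))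

    contrib-bound : ∀ v e → contrib S σ v e ≤ lim * 2 ^ A
    contrib-bound v e with v ≐ fst e
    ... | true = emit-bound (role₁ (inT e) (par e)) (σ (fst e)) (σ (snd e)) (w e) (hσ (fst e)) (hσ (snd e)) (hw e)
    ... | false with v ≐ snd e
    ...   | true = emit-bound (role₂ (inT e) (par e)) (σ (snd e)) (σ (fst e)) (w e) (hσ (snd e)) (hσ (fst e)) (hw e)
    ...   | false = z≤n

    Z-bound : ∀ v → Zv S σ v ≤ Z₀
    Z-bound v = ≤-trans (fold-bound (Step.opz S) (contrib-bound v)) (*-monoˡ-≤ (lim * 2 ^ A) m≤n²)

    1≤n² : 1 ≤ n * n
    1≤n² = *-mono-≤ n≥1 n≥1

    A≤Z : 2 ^ A ≤ Z₀
    A≤Z = ≤-trans (≤-trans (≤lim* (2 ^ A)) (≤-reflexive (sym (*-identityˡ _)))) (*-monoˡ-≤ (lim * 2 ^ A) 1≤n²)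

    X-bound : ∀ v → Xv S σ v ≤ lim * Z₀
    X-bound v = ≤-trans (eval-bound (Step.val S) _ (≤-trans 1≤2^A A≤Z)
        ((λ r → ≤-trans (hσ v r) A≤Z) , (λ r → ≤-trans (≤-reflexive (zeros-0 r)) z≤n) , z≤n , Z-bound v , z≤n))
      (*-monoˡ-≤ Z₀ (≤-trans (m≤m+n (size (Step.val S)) _) (rest-size S)))

    Y-bound : ∀ v → Yv S σ v ≤ Y₀
    Y-bound v = fold-bound (Step.opy S) λ u → ▸-bound (Semantics.sameSN ends (contracted S σ) v u) (X-bound u)
      where
      ▸-bound : ∀ c {x y} → x ≤ y → c ▸ x ≤ y
      ▸-bound true h = h
      ▸-bound false h = z≤n

    Z≤Y : Z₀ ≤ Y₀
    Z≤Y = ≤-trans (≤-trans (≤lim* Z₀) (≤-reflexive (sym (*-identityˡ _)))) (*-monoˡ-≤ (lim * Z₀) n≥1)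

    -- The factors of one step: the size of the emitted expression, the number of edges, the size of
    -- `val`, the number of nodes in a supernode, the size of an update. Their product is the left
    -- side of `hq`, so a step costs `q` bits.
    Y≤next : lim * Y₀ ≤ 2 ^ (A + q)
    Y≤next = begin
        lim * (n * (lim * (n * n * (lim * 2 ^ A))))   ≡⟨ solve 4 (λ c nn k a → c :* (nn :* (c :* (k :* (c :* a)))) := a :* (c :* (nn :* (c :* (k :* c))))) refl lim n (n * n) (2 ^ A) ⟩
        2 ^ A * (lim * (n * (lim * (n * n * lim))))   ≤⟨ *-monoʳ-≤ (2 ^ A) hq ⟩
        2 ^ A * 2 ^ q                              ≡⟨ sym (^-distribˡ-+-* 2 A q) ⟩
        2 ^ (A + q) ∎
      where
      open ≤-Reasoning
      open +-*-Solver

    next-bound : ∀ v r → lookup (exec₁ S σ v) r ≤ 2 ^ (A + q)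
    next-bound v r = ≤-trans (≤-reflexive (lookup∘tabulate (assignAt (Step.upd S) ε (σ v)) r))
        (≤-trans (go (Step.upd S) (≤-trans (m≤n+m _ (size (Step.val S))) (rest-size S))) Y≤next)
      where
      ε = env (σ v) zeros 0 (Zv S σ v) (Yv S σ v)
      A≤Y = ≤-trans A≤Z Z≤Y
      go : ∀ us → updSize us ≤ lim → assignAt us ε (σ v) r ≤ lim * Y₀
      go [] h = ≤-trans (≤-trans (hσ v r) A≤Y) (≤lim* Y₀)
      go ((t , e) ∷ us) h with toℕ t ≡ᵇ toℕ r
      ... | true = ≤-trans (eval-bound e ε (≤-trans 1≤2^A A≤Y)
              ((λ r → ≤-trans (hσ v r) A≤Y) , (λ r → ≤-trans (≤-reflexive (zeros-0 r)) z≤n) , z≤n , ≤-trans (Z-bound v) Z≤Y , Y-bound v))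
              (*-monoˡ-≤ Y₀ (≤-trans (m≤m+n (size e) _) h))
      ... | false = go us (≤-trans (m≤n+m _ (size e)) h)

  safe : ∀ p σ A → (∀ v r → lookup (σ v) r ≤ 2 ^ A) → (∀ e → w e ≤ 2 ^ A) → A + q * length p < b →
    SafeRun ends inT par w loopless p σ
  safe [] σ A hσ hw hb = tt
  safe (S ∷ p) σ A hσ hw hb =
      (λ v r → ≤-<-trans (hσ v r) (≤-<-trans (^-monoʳ-≤ 2 (m≤m+n A q)) <b))
    , (λ v → ≤-<-trans (≤-trans (Z-bound S σ A hσ hw v) (≤-trans (Z≤Y S σ A hσ hw) Y≤)) <b)
    , (λ v → ≤-<-trans (≤-trans (Y-bound S σ A hσ hw v) Y≤) <b)
    , safe p (exec₁ S σ) (A + q) (next-bound S σ A hσ hw) (λ e → ≤-trans (hw e) (^-monoʳ-≤ 2 (m≤m+n A q)))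
        (≤-trans (s≤s (≤-reflexive (trans (+-assoc A q _) (cong (A +_) (sym (*-suc q (length p))))))) hb)
    where
    Y≤ : Y₀ S σ A hσ hw ≤ 2 ^ (A + q)
    Y≤ = ≤-trans (≤lim* _) (Y≤next S σ A hσ hw)
    <b : 2 ^ (A + q) < 2 ^ b
    <b = ^-monoʳ-< 2 (s≤s (s≤s z≤n)) (≤-trans (s≤s (+-monoʳ-≤ A (≤-trans (m≤m+n q _) (≤-reflexive (sym (*-suc q (length p))))))) hb)

-- Rooted spanning trees

module _ {n m : ℕ} (ends : Fin m → Fin n × Fin n) (par : Fin m → Bool) where

  chd prt : Fin m → Fin n
  chd e = if par e then proj₂ (ends e) else proj₁ (ends e)
  prt e = if par e then proj₁ (ends e) else proj₂ (ends e)

-- What the algorithm needs of the spanning tree, free of paths: parent and depth functions and the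
-- correspondence between non-root nodes and the tree edges above them. The value `p r` is
-- arbitrary, hence the many conditions `v ≢ r`.
record Rooted {n m : ℕ} (ends : Fin m → Fin n × Fin n) (inT par : Fin m → Bool) (r : Fin n) : Set where
  field
    p : Fin n → Fin n
    d : Fin n → ℕ
    d-r : d r ≡ 0
    d-p : ∀ v → v ≢ r → d v ≡ suc (d (p v))
    pe : ∀ v → v ≢ r → Σ (Fin m) λ e → (inT e ≡ true) × (chd ends par e ≡ v)
    chd≢r : ∀ e → inT e ≡ true → chd ends par e ≢ r
    prt-p : ∀ e → inT e ≡ true → prt ends par e ≡ p (chd ends par e)
    chd-inj : ∀ e f → inT e ≡ true → inT f ≡ true → chd ends par e ≡ chd ends par f → e ≡ f

module Walks {n m : ℕ} (ends : Fin m → Fin n × Fin n) (ok : Fin m → Set) where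

  joins-det : ∀ {e u x y} → Joins ends e u x → Joins ends e u y → x ≡ y
  joins-det (inj₁ a) (inj₁ b) = cong proj₂ (trans (sym a) b)
  joins-det (inj₁ a) (inj₂ b) = trans (cong proj₂ (trans (sym a) b)) (cong proj₁ (trans (sym a) b))
  joins-det (inj₂ a) (inj₁ b) = trans (cong proj₁ (trans (sym a) b)) (cong proj₂ (trans (sym a) b))
  joins-det (inj₂ a) (inj₂ b) = cong proj₁ (trans (sym a) b)

  joins-sym : ∀ {e u x} → Joins ends e u x → Joins ends e x u
  joins-sym (inj₁ a) = inj₂ a
  joins-sym (inj₂ a) = inj₁ a

  walk-start : ∀ {u v es vs} → Walk ends ok u v es vs → u ∈ vs
  walk-start nil = here refl
  walk-start (cons _ _ _) = here refl

  snoc : ∀ {u v x e es vs} → Walk ends ok u v es vs → ok e → Joins ends e v x → Walk ends ok u x (es ∷ʳ e) (vs ∷ʳ x)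
  snoc nil o j = cons o j nil
  snoc (cons o' j' w) o j = cons o' j' (snoc w o j)

  reverseʷ : ∀ {u v es vs} → Walk ends ok u v es vs → Walk ends ok v u (reverse es) (reverse vs)
  reverseʷ nil = nil
  reverseʷ (cons {u = u} {e = e} {es = es} {vs = vs} o j w)
    rewrite unfold-reverse e es | unfold-reverse u vs = snoc (reverseʷ w) o (joins-sym j)

  ∈-snoc : ∀ {A : Set} {y x : A} l → y ∈ l ∷ʳ x → (y ∈ l) ⊎ (y ≡ x)
  ∈-snoc [] (here q) = inj₂ q
  ∈-snoc (a ∷ l) (here q) = inj₁ (here q)
  ∈-snoc (a ∷ l) (there q) with ∈-snoc l q
  ... | inj₁ z = inj₁ (there z)
  ... | inj₂ z = inj₂ z

  all-≢ : ∀ {A : Set} {x : A} l → (∀ y → y ∈ l → x ≢ y) → All (x ≢_) l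
  all-≢ [] h = []
  all-≢ (a ∷ l) h = h a (here refl) ∷ all-≢ l (λ y q → h y (there q))

  unique-snoc : ∀ {A : Set} {x : A} {l} → Unique l → (∀ y → y ∈ l → y ≢ x) → Unique (l ∷ʳ x)
  unique-snoc [] h = [] ∷ []
  unique-snoc {x = x} {l = a ∷ l} (q ∷ u) h =
    all-≢ (l ∷ʳ x) (λ y i → case ∈-snoc l i of λ { (inj₁ z) → All-lookup q z ; (inj₂ refl) → h a (here refl) })
    ∷ unique-snoc u (λ y i → h y (there i))

  ∈-reverse : ∀ {A : Set} {y : A} l → y ∈ reverse l → y ∈ l
  ∈-reverse (a ∷ l) i rewrite unfold-reverse a l with ∈-snoc (reverse l) i
  ... | inj₁ z = there (∈-reverse l z)
  ... | inj₂ refl = here refl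

  unique-reverse : ∀ {A : Set} {l : List A} → Unique l → Unique (reverse l)
  unique-reverse [] = []
  unique-reverse {l = a ∷ l} (q ∷ u) rewrite unfold-reverse a l =
    unique-snoc (unique-reverse u) (λ y i e → All-lookup q (∈-reverse l i) (sym e))

  reverse-path : ∀ {u v es} → SimplePath ends ok u v es → SimplePath ends ok v u (reverse es)
  reverse-path (vs , w , u) = reverse vs , reverseʷ w , unique-reverse u

  -- The vertices of the prefix are known to come from the original walk; this keeps the prefix
  -- simple when the induction prepends a vertex.
  split : ∀ {u v es vs} b → Walk ends ok u v es vs → Unique vs → b ∈ vs →
    Σ (List (Fin m)) λ es₁ → Σ (List (Fin m)) λ es₂ → Σ (List (Fin n)) λ vs₁ →
      Walk ends ok u b es₁ vs₁ × Unique vs₁ × (∀ y → y ∈ vs₁ → y ∈ vs) × SimplePath ends ok b v es₂ × es ≡ es₁ ++ es₂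
  split b nil u (here refl) = [] , [] , _ , nil , u , (λ y i → i) , (_ , nil , u) , refl
  split b (cons {vs = vs} o j w) u (here refl) = [] , _ , b ∷ [] , nil , [] ∷ [] , (λ { y (here q) → here q }) , (_ , cons o j w , u) , refl
  split b (cons {u = a} {e = e} o j w) (q ∷ u) (there i) with split b w u i
  ... | es₁ , es₂ , vs₁ , w₁ , u₁ , sub , sp , eq =
    e ∷ es₁ , es₂ , a ∷ vs₁ , cons o j w₁ , all-≢ vs₁ (λ y i → All-lookup q (sub y i)) ∷ u₁
    , (λ { y (here z) → here z ; y (there z) → there (sub y z) }) , sp , cong (e ∷_) eq

  ends-on-walk : ∀ {u v es vs e a b} → Walk ends ok u v es vs → e ∈ es → Joins ends e a b → a ∈ vs
  ends-on-walk (cons o (inj₁ j) w) (here refl) (inj₁ k) = here (cong proj₁ (trans (sym k) j))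
  ends-on-walk (cons o (inj₁ j) w) (here refl) (inj₂ k) = there (subst (_∈ _) (cong proj₂ (trans (sym j) k)) (walk-start w))
  ends-on-walk (cons o (inj₂ j) w) (here refl) (inj₁ k) = there (subst (_∈ _) (cong proj₁ (trans (sym j) k)) (walk-start w))
  ends-on-walk (cons o (inj₂ j) w) (here refl) (inj₂ k) = here (cong proj₂ (trans (sym k) j))
  ends-on-walk (cons o j w) (there i) k = there (ends-on-walk w i k)

member? : ∀ {n} (x : Fin n) l → (x ∈ l) ⊎ (¬ (x ∈ l))
member? x [] = inj₂ λ ()
member? x (y ∷ l) with x ≟F y | member? x l
... | yes q | _ = inj₁ (here q)
... | no q | inj₁ i = inj₁ (there i)
... | no q | inj₂ i = inj₂ λ { (here z) → q z ; (there z) → i z }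

module SpanningTreeFacts {n m : ℕ} (ends : Fin m → Fin n × Fin n) (inT par : Fin m → Bool) (r : Fin n)
  (simple : SimpleGraph ends) (span : SpanningTree ends inT) (orient : RootOrientation ends inT r par) where

  private
    Tr : Fin m → Set
    Tr = TreeEdge ends inT
  open Walks ends Tr

  toRoot : Fin n → List (Fin m)
  toRoot v = proj₁ (proj₁ span v r)

  path : ∀ v → SimplePath ends Tr v r (toRoot v)
  path v = proj₂ (proj₁ span v r)

  path-unique : ∀ {v es} → SimplePath ends Tr v r es → toRoot v ≡ es
  path-unique {v} q = proj₂ span v r _ _ (path v) q

  δ : Fin n → ℕ
  δ v = length (toRoot v)

  next : ∀ {v es vs} → Walk ends Tr v r es vs → Fin n
  next {v} nil = v
  next (cons {x = x} _ _ _) = x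

  parent : Fin n → Fin n
  parent v = next (proj₁ (proj₂ (path v)))

  first-edge : ∀ {v x e es} → toRoot v ≡ e ∷ es → Joins ends e v x → parent v ≡ x × δ v ≡ suc (δ x)
  first-edge {v} {x} {e} {es} eq j = go (proj₁ (proj₂ (path v))) (proj₂ (proj₂ (path v))) eq
    where
    go : ∀ {es₀ vs} (w : Walk ends Tr v r es₀ vs) → Unique vs → es₀ ≡ e ∷ es → next w ≡ x × length es₀ ≡ suc (δ x)
    go (cons o j' w) (_ ∷ u) refl with joins-det j' j
    ... | refl = refl , cong suc (cong length (sym (path-unique (_ , w , u))))

  root-or-step : ∀ v → v ≢ r → Σ (Fin m) λ e → Σ (Fin n) λ x → Σ (List (Fin m)) λ es → Tr e × Joins ends e v x × toRoot v ≡ e ∷ es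
  root-or-step v v≢r = go (proj₁ (proj₂ (path v)))
    where
    go : ∀ {es vs} → Walk ends Tr v r es vs → Σ (Fin m) λ e → Σ (Fin n) λ x → Σ (List (Fin m)) λ es' → Tr e × Joins ends e v x × es ≡ e ∷ es'
    go nil = ⊥-elim (v≢r refl)
    go (cons o j w) = _ , _ , _ , o , j , refl

  -- If `b` is missing from the root path of `a`, prepending `e` gives the root path of `b`. If it
  -- occurs, the part from `a` to `b` is a simple path and by uniqueness consists of `e` alone.
  edge-case : ∀ e a b → Tr e → Joins ends e a b → (Σ (List (Fin m)) λ es → toRoot a ≡ e ∷ es) ⊎ (Σ (List (Fin m)) λ es → toRoot b ≡ e ∷ es)
  edge-case e a b t j with path a
  ... | vs , w , u with member? b vs
  ...   | inj₂ b∉ = inj₂ (_ , path-unique (b ∷ vs , cons t (joins-sym j) w , all-≢ vs (λ { y i refl → b∉ i }) ∷ u))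
  ...   | inj₁ b∈ with split b w u b∈
  ...     | es₁ , es₂ , vs₁ , w₁ , u₁ , _ , _ , eq = inj₁ (es₂ , trans eq (cong (_++ es₂) es₁≡))
    where
    a≢b : a ≢ b
    a≢b refl = case j of λ { (inj₁ q) → proj₁ simple e (trans (cong proj₁ q) (sym (cong proj₂ q)))
                           ; (inj₂ q) → proj₁ simple e (trans (cong proj₁ q) (sym (cong proj₂ q))) }
    es₁≡ : es₁ ≡ e ∷ []
    es₁≡ = proj₂ span a b _ _ (vs₁ , w₁ , u₁) (a ∷ b ∷ [] , cons t j nil , (a≢b ∷ []) ∷ [] ∷ [])

  depth-from-root : ∀ {v es} → SimplePath ends Tr r v es → length es ≡ δ v
  depth-from-root {v} {es} q = trans (sym (length-reverse es)) (cong length (sym (path-unique (reverse-path q))))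

  closer : ∀ {a b} → CloserToRoot ends inT r a b → δ a < δ b
  closer (es , es' , q , q' , l) = subst₂ _<_ (depth-from-root q) (depth-from-root q') l

  closer⁻ : ∀ {a b} → δ a < δ b → CloserToRoot ends inT r a b
  closer⁻ {a} {b} l with proj₁ span r a | proj₁ span r b
  ... | es , q | es' , q' = es , es' , q , q' , subst₂ _<_ (sym (depth-from-root q)) (sym (depth-from-root q')) l

  -- `edge-case` leaves two candidates for the lower end; the one that contradicts `par` would make
  -- the depths of the ends differ in the wrong direction.
  child-first : ∀ e → Tr e → Joins ends e (chd ends par e) (prt ends par e) × (Σ (List (Fin m)) λ es → toRoot (chd ends par e) ≡ e ∷ es)
  child-first e t with edge-case e (proj₁ (ends e)) (proj₂ (ends e)) t (inj₁ refl) | par e in eq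
  ... | inj₁ q | false = inj₁ refl , q
  ... | inj₂ q | true = inj₂ refl , q
  ... | inj₁ (es , q) | true = ⊥-elim (<-asym (closer (Equivalence.to (orient e t) eq))
          (≤-reflexive (sym (proj₂ (first-edge q (inj₁ refl))))))
  ... | inj₂ (es , q) | false = ⊥-elim (true≢false (Equivalence.from (orient e t)
          (closer⁻ (≤-reflexive (sym (proj₂ (first-edge q (inj₂ refl))))))) eq)

  toRoot-r : toRoot r ≡ []
  toRoot-r = path-unique (r ∷ [] , nil , [] ∷ [])

  ∷-inj : ∀ {A : Set} {x y : A} {xs ys : List A} → x ∷ xs ≡ y ∷ ys → x ≡ y
  ∷-inj refl = refl

  rooted : Rooted ends inT par r
  rooted = record
    { p = parent
    ; d = δ
    ; d-r = cong length toRoot-r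
    ; d-p = λ v q → let (e , x , es , t , j , eq) = root-or-step v q ; (px , dx) = first-edge eq j in
              trans dx (cong (suc ∘ δ) (sym px))
    ; pe = λ v q → let (e , x , es , t , j , eq) = root-or-step v q in e , t , child e t j eq
    ; chd≢r = λ e t q → let (es , eq) = proj₂ (child-first e t) in
              case trans (sym (trans (cong toRoot q) toRoot-r)) eq of λ ()
    ; prt-p = λ e t → let (j , es , eq) = child-first e t in sym (proj₁ (first-edge eq j))
    ; chd-inj = λ e f t t' q → let (es , eq) = proj₂ (child-first e t) ; (es' , eq') = proj₂ (child-first f t') in
              ∷-inj (trans (sym eq) (trans (cong toRoot q) eq'))
    }
    where
    child : ∀ {v x es} e → Tr e → Joins ends e v x → toRoot v ≡ e ∷ es → chd ends par e ≡ v
    child {v} {x} e t j eq with child-first e t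
    ... | j' , es' , eq' with chd ends par e ≟F v
    ...   | yes q = q
    ...   | no q = ⊥-elim (<-asym (≤-reflexive (sym (proj₂ (first-edge eq j)))) (≤-reflexive (trans (cong suc (cong δ (sym v≡prt))) (trans (sym (proj₂ (first-edge eq' j'))) (cong δ chd≡x)))))
      where
      both : ∀ {c q} → Joins ends e c q → c ≢ v → (c ≡ x) × (q ≡ v)
      both (inj₁ k) c≢ = case j of λ
        { (inj₁ l) → ⊥-elim (c≢ (cong proj₁ (trans (sym k) l)))
        ; (inj₂ l) → cong proj₁ (trans (sym k) l) , cong proj₂ (trans (sym k) l) }
      both (inj₂ k) c≢ = case j of λ
        { (inj₁ l) → cong proj₂ (trans (sym k) l) , cong proj₁ (trans (sym k) l)
        ; (inj₂ l) → ⊥-elim (c≢ (cong proj₂ (trans (sym k) l))) }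
      chd≡x = proj₁ (both j' q)
      v≡prt = proj₂ (both j' q)

search : ∀ {n} (f : Fin n → Bool) → (∃ λ i → f i ≡ true) ⊎ (∀ i → f i ≡ false)
search {zero} f = inj₂ λ ()
search {suc n} f with f zero in eq | search (f ∘ suc)
... | true | _ = inj₁ (zero , eq)
... | false | inj₁ (i , q) = inj₁ (suc i , q)
... | false | inj₂ q = inj₂ λ { zero → eq ; (suc i) → q i }

∑-strict : ∀ {n} {f g : Fin n → ℕ} j → (∀ i → f i ≤ g i) → f j < g j → ∑ f < ∑ g
∑-strict zero h l = +-mono-<-≤ l (∑-mono (h ∘ suc))
∑-strict (suc j) h l = +-mono-≤-< (h zero) (∑-strict j (h ∘ suc) l)

-- Ancestors, clusters and supernodes of a rooted tree

module TreeFacts {n m : ℕ} {ends : Fin m → Fin n × Fin n} {inT par : Fin m → Bool} {r : Fin n}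
                 (R : Rooted ends inT par r) where
  open Rooted R
  open Semantics ends using (sameSN; grow)
  open SupernodeBasics ends

  V : Set
  V = Fin n

  tree-ind : ∀ (Q : V → Set) → Q r → (∀ v → v ≢ r → Q (p v) → Q v) → ∀ v → Q v
  tree-ind Q z s v = go (d v) v ≤-refl
    where
    go : ∀ k v → d v ≤ k → Q v
    go k v h with v ≟F r
    ... | yes refl = z
    ... | no q with k | subst (_≤ k) (d-p v q) h
    ...   | suc k | s≤s h' = s v q (go k (p v) h')

  ancF : ℕ → V → V → Bool
  ancF zero    x v = x ≐ v
  ancF (suc f) x v = (x ≐ v) ∨ ancF f x (p v)

  anc : V → V → Bool
  anc x v = ancF (d v) x v

  anc-r : ∀ x → anc x r ≡ (x ≐ r)
  anc-r x rewrite d-r = refl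

  anc-p : ∀ x v → v ≢ r → anc x v ≡ (x ≐ v) ∨ anc x (p v)
  anc-p x v q rewrite d-p v q = refl

  anc-refl : ∀ v → anc v v ≡ true
  anc-refl v with v ≟F r
  ... | yes refl = trans (anc-r r) (≐-refl r)
  ... | no q = trans (anc-p v v q) (∨-l (≐-refl v))

  anc-up : ∀ x v → v ≢ r → anc x (p v) ≡ true → anc x v ≡ true
  anc-up x v q h = trans (anc-p x v q) (∨-r h)

  anc-down : ∀ x v → v ≢ r → anc x v ≡ true → x ≢ v → anc x (p v) ≡ true
  anc-down x v q h ne with ∨-e (trans (sym (anc-p x v q)) h)
  ... | inj₁ e = ⊥-elim (ne (≐-sound e))
  ... | inj₂ e = e

  d-p< : ∀ v → v ≢ r → d (p v) < d v
  d-p< v q = ≤-reflexive (sym (d-p v q))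

  anc-depth : ∀ x v → anc x v ≡ true → d x ≤ d v
  anc-depth x = tree-ind (λ v → anc x v ≡ true → d x ≤ d v)
    (λ h → ≤-reflexive (cong d (≐-sound (trans (sym (anc-r x)) h))))
    (λ v q ih h → case x ≟F v of λ { (yes refl) → ≤-refl ; (no ne) → ≤-trans (ih (anc-down x v q h ne)) (<⇒≤ (d-p< v q)) })

  anc-same : ∀ x v → anc x v ≡ true → d v ≤ d x → x ≡ v
  anc-same x v h l with x ≟F v
  ... | yes q = q
  ... | no ne with v ≟F r
  ...   | yes refl = ≐-sound (trans (sym (anc-r x)) h)
  ...   | no q = ⊥-elim (<⇒≱ (d-p< v q) (≤-trans l (anc-depth x (p v) (anc-down x v q h ne))))

  anc-trans : ∀ x y v → anc x y ≡ true → anc y v ≡ true → anc x v ≡ true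
  anc-trans x y v hxy = tree-ind (λ v → anc y v ≡ true → anc x v ≡ true)
    (λ h → subst (λ z → anc x z ≡ true) (≐-sound (trans (sym (anc-r y)) h)) hxy)
    (λ v q ih h → case y ≟F v of λ { (yes refl) → hxy ; (no ne) → anc-up x v q (ih (anc-down y v q h ne)) }) v

  anc-comp : ∀ x y v → anc x v ≡ true → anc y v ≡ true → d x ≤ d y → anc x y ≡ true
  anc-comp x y = tree-ind (λ v → anc x v ≡ true → anc y v ≡ true → d x ≤ d y → anc x y ≡ true)
    (λ h h' l → subst (λ z → anc x z ≡ true) (sym (≐-sound (trans (sym (anc-r y)) h'))) h)
    (λ v q ih h h' l → case y ≟F v of λ
      { (yes refl) → h
      ; (no ne) → ih (anc-down x v q h (λ { refl → ne (anc-same y x h' l) })) (anc-down y v q h' ne) l })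

  anc-root : ∀ v → anc r v ≡ true
  anc-root = tree-ind (λ v → anc r v ≡ true) (anc-refl r) (λ v q ih → anc-up r v q ih)

  anc-parent-false : ∀ v → v ≢ r → anc v (p v) ≡ false
  anc-parent-false v q = bool-false λ h → <⇒≱ (d-p< v q) (anc-depth v (p v) h)

  anc-edge : ∀ c v → v ≢ r → v ≢ c → anc c v ≡ anc c (p v)
  anc-edge c v q ne = trans (anc-p c v q) (cong (_∨ anc c (p v)) (≐-false (λ e → ne (sym e))))

  d≡0 : ∀ v → d v ≡ 0 → v ≡ r
  d≡0 v h with v ≟F r
  ... | yes q = q
  ... | no q = case trans (sym h) (d-p v q) of λ ()

  -- The ancestors of `v` are distinct nodes, one per depth up to that of `v`; counting them among
  -- all `n` nodes yields `depth<`.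
  ancestors-count : ∀ v → ∑ (λ x → 𝟙 (anc x v)) ≡ suc (d v)
  ancestors-count = tree-ind (λ v → ∑ (λ x → 𝟙 (anc x v)) ≡ suc (d v))
    (trans (fold-single add r (λ x ne → cong 𝟙 (trans (anc-r x) (≐-false ne)))) (trans (cong 𝟙 (anc-refl r)) (cong suc (sym d-r))))
    (λ v q ih → trans (fold-cong add (split v q)) (trans (∑-+ (λ x → 𝟙 (x ≐ v)) (λ x → 𝟙 (anc x (p v))))
      (trans (cong₂ _+_ (trans (fold-single add v (λ x ne → cong 𝟙 (≐-false ne))) (cong 𝟙 (≐-refl v))) ih) (cong suc (sym (d-p v q))))))
    where
    split : ∀ v → v ≢ r → ∀ x → 𝟙 (anc x v) ≡ 𝟙 (x ≐ v) + 𝟙 (anc x (p v))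
    split v q x rewrite anc-p x v q with x ≟F v
    ... | yes refl rewrite anc-parent-false v q = refl
    ... | no _ = refl

  depth< : ∀ v → d v < n
  depth< v = subst₂ _≤_ (ancestors-count v) (*-identityʳ n) (fold-bound add (λ x → 𝟙≤1 (anc x v)))
    where
    𝟙≤1 : ∀ b → 𝟙 b ≤ 1
    𝟙≤1 true = ≤-refl
    𝟙≤1 false = z≤n

  topF : (V → Bool) → ℕ → V → V
  topF k zero    v = v
  topF k (suc f) v = if k v then topF k f (p v) else v

  -- The highest node reachable from v through parent edges selected by k.
  top : (V → Bool) → V → V
  top k v = topF k (d v) v

  top-r : ∀ k → top k r ≡ r
  top-r k rewrite d-r = refl

  top-p : ∀ k v → v ≢ r → top k v ≡ (if k v then top k (p v) else v)
  top-p k v q rewrite d-p v q = refl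

  top-fix : ∀ k v → k v ≡ false → top k v ≡ v
  top-fix k v h with v ≟F r
  ... | yes refl = top-r k
  ... | no q = trans (top-p k v q) (cong (λ b → if b then top k (p v) else v) h)

  top-step : ∀ k v → v ≢ r → k v ≡ true → top k v ≡ top k (p v)
  top-step k v q h = trans (top-p k v q) (cong (λ b → if b then top k (p v) else v) h)

  top-ind : ∀ (k : V → Bool) (Q : V → Set) → (∀ v → (v ≡ r) ⊎ (k v ≡ false) → Q v) → (∀ v → v ≢ r → k v ≡ true → Q (p v) → Q v) → ∀ v → Q v
  top-ind k Q z s = tree-ind Q (z r (inj₁ refl)) (λ v q ih → case bool-case (k v) of λ
    { (inj₁ t) → s v q t ih ; (inj₂ f) → z v (inj₂ f) })

  top-fix' : ∀ k v → (v ≡ r) ⊎ (k v ≡ false) → top k v ≡ v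
  top-fix' k v (inj₁ refl) = top-r k
  top-fix' k v (inj₂ f) = top-fix k v f

  top-stop : ∀ k v → (top k v ≡ r) ⊎ (k (top k v) ≡ false)
  top-stop k = top-ind k (λ v → (top k v ≡ r) ⊎ (k (top k v) ≡ false))
    (λ v h → subst (λ z → (z ≡ r) ⊎ (k z ≡ false)) (sym (top-fix' k v h)) h)
    (λ v q t ih → subst (λ z → (z ≡ r) ⊎ (k z ≡ false)) (sym (top-step k v q t)) ih)

  top-anc : ∀ k v → anc (top k v) v ≡ true
  top-anc k = top-ind k (λ v → anc (top k v) v ≡ true)
    (λ v h → subst (λ z → anc z v ≡ true) (sym (top-fix' k v h)) (anc-refl v))
    (λ v q t ih → subst (λ z → anc z v ≡ true) (sym (top-step k v q t)) (anc-up _ v q ih))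

  top-mono : ∀ k k' → (∀ v → k v ≡ true → k' v ≡ true) → ∀ v → top k' (top k v) ≡ top k' v
  top-mono k k' sub = top-ind k (λ v → top k' (top k v) ≡ top k' v)
    (λ v h → cong (top k') (top-fix' k v h))
    (λ v q t ih → trans (cong (top k') (top-step k v q t)) (trans ih (sym (top-step k' v q (sub v t)))))

  top-blocked : ∀ k x v → anc x v ≡ true → k x ≡ false → anc x (top k v) ≡ true
  top-blocked k x v h kx = top-ind k (λ v → anc x v ≡ true → anc x (top k v) ≡ true)
    (λ v f h → subst (λ z → anc x z ≡ true) (sym (top-fix' k v f)) h)
    (λ v q t ih h → subst (λ z → anc x z ≡ true) (sym (top-step k v q t))
       (ih (anc-down x v q h (λ { refl → true≢false t kx })))) v h

  top-preserves : ∀ k {A : Set} (f : V → A) → (∀ v → v ≢ r → k v ≡ true → f v ≡ f (p v)) → ∀ v → f (top k v) ≡ f v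
  top-preserves k f h = top-ind k (λ v → f (top k v) ≡ f v)
    (λ v q → cong f (top-fix' k v q))
    (λ v q t ih → trans (cong f (top-step k v q t)) (trans ih (sym (h v q t))))

  -- When every node has at most one selected child, a class of `top k` is a vertical chain. Only
  -- the case of equal depth is new in the induction: there the parents of `u` and `v` are
  -- comparable at equal depth, hence equal, and so are their unique selected children.
  chain-comparable : ∀ k → (∀ c c' → c ≢ r → c' ≢ r → k c ≡ true → k c' ≡ true → p c ≡ p c' → c ≡ c') →
    ∀ v u → top k u ≡ top k v → d u ≤ d v → anc u v ≡ true
  chain-comparable k uniq = top-ind k (λ v → ∀ u → top k u ≡ top k v → d u ≤ d v → anc u v ≡ true)
    (λ v f u e l → let e' = trans e (top-fix' k v f)
                       v≤u = subst (λ z → anc z u ≡ true) e' (top-anc k u) in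
       subst (λ z → anc z v ≡ true) (anc-same v u v≤u l) (anc-refl v))
    step'
    where
    step' : ∀ v → v ≢ r → k v ≡ true → (∀ u → top k u ≡ top k (p v) → d u ≤ d (p v) → anc u (p v) ≡ true) →
            ∀ u → top k u ≡ top k v → d u ≤ d v → anc u v ≡ true
    step' v q t ih u e l with d u ≤? d (p v)
    ... | yes l' = anc-up u v q (ih u (trans e (top-step k v q t)) l')
    ... | no nl with u ≟F r | bool-case (k u)
    ...   | yes refl | _ = anc-root v
    ...   | no q' | inj₂ f = subst (λ z → anc z v ≡ true) (trans (sym e) (top-fix k u f)) (top-anc k v)
    ...   | no q' | inj₁ t' = subst (λ z → anc z v ≡ true) (uniq v u q q' t t' (sym same)) (anc-refl v)
      where
      du : d u ≡ d v
      du = ≤-antisym l (subst (_≤ d u) (sym (d-p v q)) (≰⇒> nl))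
      dp : d (p u) ≡ d (p v)
      dp = suc-injective (trans (sym (d-p u q')) (trans du (d-p v q)))
      same : p u ≡ p v
      same = anc-same (p u) (p v) (ih (p u) (trans (sym (top-step k u q' t')) (trans e (top-step k v q t))) (≤-reflexive dp)) (≤-reflexive (sym dp))

  top-idem : ∀ k v → top k (top k v) ≡ top k v
  top-idem k v = top-fix' k _ (top-stop k v)

  -- If only cluster tops carry a nonzero value, folding over a cluster hands the value of the top
  -- to all its members. This is the broadcast used throughout, for sums and maxima alike.
  gather : ∀ o k (z : V → ℕ) → (∀ u → u ≢ r → k u ≡ true → z u ≡ 0) → ∀ v →
    fold o (λ u → (top k u ≐ top k v) ▸ z u) ≡ z (top k v)
  gather o k z h v = trans (fold-single o (top k v) other) (cong (_▸ z (top k v)) (≐-true (top-idem k v)))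
    where
    other : ∀ u → u ≢ top k v → (top k u ≐ top k v) ▸ z u ≡ 0
    other u ne with top k u ≟F top k v
    ... | no _ = refl
    ... | yes e with u ≟F r | k u in eq
    ...   | yes refl | _ = ⊥-elim (ne (trans (sym (top-r k)) e))
    ...   | no q | true = h u q eq
    ...   | no q | false = ⊥-elim (ne (trans (sym (top-fix k u eq)) e))

  top-cong : ∀ {k k'} → (∀ v → k v ≡ k' v) → ∀ v → top k v ≡ top k' v
  top-cong {k} {k'} h = tree-ind (λ v → top k v ≡ top k' v) (trans (top-r k) (sym (top-r k')))
    λ v q ih → trans (top-p k v q) (trans (cong₂ (λ b z → if b then z else v) (h v) ih) (sym (top-p k' v q)))

  child-towards : ∀ a v → anc a v ≡ true → a ≢ v → Σ V λ x → (x ≢ r) × (p x ≡ a) × (anc x v ≡ true)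
  child-towards a = tree-ind (λ v → anc a v ≡ true → a ≢ v → Σ V λ x → (x ≢ r) × (p x ≡ a) × (anc x v ≡ true))
    (λ h ne → ⊥-elim (ne (≐-sound (trans (sym (anc-r a)) h))))
    λ v q ih h ne → case a ≟F p v of λ
      { (yes e) → v , q , sym e , anc-refl v
      ; (no ne') → let (x , xr , px , ax) = ih (anc-down a v q h ne) ne' in x , xr , px , anc-up x v q ax }

  module Supernodes (c : Fin m → Bool) (k : V → Bool) (c-eq : ∀ e → c e ≡ inT e ∧ k (chd ends par e)) where

    fst' snd' : Fin m → V
    fst' e = proj₁ (ends e)
    snd' e = proj₂ (ends e)

    ends-cases : ∀ e (Q : V → V → Set) → Q (chd ends par e) (prt ends par e) → Q (prt ends par e) (chd ends par e) → Q (fst' e) (snd' e)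
    ends-cases e Q a b with par e
    ... | true = b
    ... | false = a

    child-top : ∀ e → c e ≡ true → top k (chd ends par e) ≡ top k (prt ends par e)
    child-top e h = trans (top-step k _ (chd≢r e t) (∧-r {inT e} h')) (cong (top k) (sym (prt-p e t)))
      where
      h' = trans (sym (c-eq e)) h
      t = ∧-l h'

    edge-top : ∀ e → c e ≡ true → top k (fst' e) ≡ top k (snd' e)
    edge-top e h = ends-cases e (λ a b → top k a ≡ top k b) (child-top e h) (sym (child-top e h))

    or-∃ : ∀ {A : Set} (f : A → Bool) l → or (map f l) ≡ true → ∃ λ a → f a ≡ true
    or-∃ f (a ∷ l) h with f a in eq
    ... | true = a , eq
    ... | false = or-∃ f l h

    or-i : ∀ {n} (f : Fin n → Bool) e → f e ≡ true → or (map f (allFin n)) ≡ true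
    or-i f e h = trans (cong or (map-tabulate id f)) (go f e h)
      where
      go : ∀ {n} (f : Fin n → Bool) e → f e ≡ true → or (tabulate f) ≡ true
      go f zero h = ∨-l h
      go f (suc e) h = ∨-r {f zero} (go (f ∘ suc) e h)

    sound : ∀ v j u → iter j (grow c) (λ u → u ≐ v) u ≡ true → top k u ≡ top k v
    sound v zero u h = cong (top k) (≐-sound h)
    sound v (suc j) u h with ∨-e h
    ... | inj₁ q = sound v j u q
    ... | inj₂ q with or-∃ _ (allFin m) q
    ...   | e , z with ∨-e (∧-r {c e} z)
    ...     | inj₁ s = trans (cong (top k) (≐-sound (∧-r s))) (trans (sym (edge-top e (∧-l z))) (sound v j (fst' e) (∧-l s)))
    ...     | inj₂ s = trans (cong (top k) (≐-sound (∧-r s))) (trans (edge-top e (∧-l z)) (sound v j (snd' e) (∧-l s)))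

    Closed : (V → Bool) → Set
    Closed S = ∀ u → grow c S u ≡ true → S u ≡ true

    count : (V → Bool) → ℕ
    count S = ∑ (λ u → 𝟙 (S u))

    -- The set gains at least one node per iteration until it is closed. As there are only `n`
    -- nodes, `n` iterations reach closure.
    saturates : ∀ S → (∃ λ v → S v ≡ true) → ∀ j → Closed (iter j (grow c) S) ⊎ (suc j ≤ count (iter j (grow c) S))
    saturates S (v , hv) zero = inj₂ (≤-trans (≤-reflexive (cong 𝟙 (sym hv))) (fold-≥ add (λ u → 𝟙 (S u)) v))
    saturates S w (suc j) with saturates S w j
    ... | inj₁ cl = inj₁ λ u h → ∨-l (cl u (trans (grow-cong (λ _ → refl) stable u) h))
      where
      stable : ∀ u → iter j (grow c) S u ≡ grow c (iter j (grow c) S) u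
      stable u = bool-ext ∨-l (cl u)
    ... | inj₂ l with search (λ u → grow c (iter j (grow c) S) u ∧ not (iter j (grow c) S u))
    ...   | inj₁ (u , h) = inj₂ (≤-trans (s≤s l) (∑-strict u (λ i → mono i) strict))
      where
      mono : ∀ i → 𝟙 (iter j (grow c) S i) ≤ 𝟙 (grow c (iter j (grow c) S) i)
      mono i with iter j (grow c) S i
      ... | true = ≤-refl
      ... | false = z≤n
      strict : 𝟙 (iter j (grow c) S u) < 𝟙 (grow c (iter j (grow c) S) u)
      strict = subst₂ _<_ (cong 𝟙 (sym (not-f (∧-r h)))) (cong 𝟙 (sym (∧-l h))) (s≤s z≤n)
    ...   | inj₂ none = inj₁ λ u h → ∨-l (cl u (trans (grow-cong (λ _ → refl) stable u) h))
      where
      cl : Closed (iter j (grow c) S)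
      cl u h with bool-case (iter j (grow c) S u)
      ... | inj₁ t = t
      ... | inj₂ f = ⊥-elim (true≢false (∧-i h (not-t f)) (none u))
      stable : ∀ u → iter j (grow c) S u ≡ grow c (iter j (grow c) S) u
      stable u = bool-ext ∨-l (cl u)

    closed : ∀ v → Closed (sameSN c v)
    closed v with saturates (λ u → u ≐ v) (v , ≐-refl v) n
    ... | inj₁ cl = cl
    ... | inj₂ l = ⊥-elim (<⇒≱ l (subst (count (sameSN c v) ≤_) (*-identityʳ n) (fold-bound add (λ u → 𝟙≤1 (sameSN c v u)))))
      where
      𝟙≤1 : ∀ b → 𝟙 b ≤ 1
      𝟙≤1 true = ≤-refl
      𝟙≤1 false = z≤n

    pass : ∀ v e → c e ≡ true → (sameSN c v (fst' e) ≡ true → sameSN c v (snd' e) ≡ true) × (sameSN c v (snd' e) ≡ true → sameSN c v (fst' e) ≡ true)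
    pass v e h = (λ s → closed v _ (∨-r {sameSN c v (snd' e)} (or-i (cond (snd' e)) e (∧-i h (∨-l (∧-i s (≐-refl (snd' e))))))))
               , (λ s → closed v _ (∨-r {sameSN c v (fst' e)} (or-i (cond (fst' e)) e (∧-i h (∨-r {sameSN c v (fst' e) ∧ (fst' e ≐ snd' e)} (∧-i s (≐-refl (fst' e))))))))
      where
      cond : V → Fin m → Bool
      cond x e = c e ∧ ((sameSN c v (fst' e) ∧ (x ≐ snd' e)) ∨ (sameSN c v (snd' e) ∧ (x ≐ fst' e)))

    pass-p : ∀ v u → u ≢ r → k u ≡ true → sameSN c v u ≡ sameSN c v (p u)
    pass-p v u q t with pe u q
    ... | e , te , refl = trans (bool-ext (proj₁ both) (proj₂ both)) (cong (sameSN c v) (prt-p e te))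
      where
      ce : c e ≡ true
      ce = trans (c-eq e) (∧-i te t)
      both : (sameSN c v (chd ends par e) ≡ true → sameSN c v (prt ends par e) ≡ true) × (sameSN c v (prt ends par e) ≡ true → sameSN c v (chd ends par e) ≡ true)
      both with par e | pass v e ce
      ... | true | a , b = b , a
      ... | false | a , b = a , b

    -- Contracted edges preserve `top k`, so a supernode lies inside one fibre. Conversely a closed
    -- set passes along contracted edges, so every node shares the supernode of its top.
    sameSN-top : ∀ v u → sameSN c v u ≡ (top k u ≐ top k v)
    sameSN-top v u = bool-ext (λ h → ≐-true (sound v n u h)) λ h →
      trans (sym (pres u)) (trans (cong (sameSN c v) (≐-sound h)) (trans (pres v) (sameSN-refl c v)))
      where
      pres : ∀ u → sameSN c v (top k u) ≡ sameSN c v u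
      pres = top-preserves k (sameSN c v) (pass-p v)

-- An edge of G crosses the cut of a tree edge iff its ends are on different sides of the child.
module TreePaths {n m : ℕ} (ends : Fin m → Fin n × Fin n) (inT par : Fin m → Bool) (r : Fin n)
  (simple : SimpleGraph ends) (span : SpanningTree ends inT) (orient : RootOrientation ends inT r par) where

  open SpanningTreeFacts ends inT par r simple span orient
  open Rooted rooted
  open TreeFacts rooted
  open Walks ends (TreeEdge ends inT)

  module _ (e : Fin m) (te : inT e ≡ true) where

    c : Fin n
    c = chd ends par e

    not-crossing : ∀ f a b → inT f ≡ true → Joins ends f a b → f ≢ e → anc c a ≡ anc c b
    not-crossing f a b tf j ne = go j
      where
      base : anc c (chd ends par f) ≡ anc c (prt ends par f)
      base = trans (anc-edge c (chd ends par f) (chd≢r f tf) (λ q → ne (chd-inj f e tf te q))) (cong (anc c) (sym (prt-p f tf)))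
      fs : anc c (proj₁ (ends f)) ≡ anc c (proj₂ (ends f))
      fs with par f | base
      ... | true | q = sym q
      ... | false | q = q
      go : Joins ends f a b → anc c a ≡ anc c b
      go (inj₁ q) = subst₂ (λ x y → anc c x ≡ anc c y) (cong proj₁ q) (cong proj₂ q) fs
      go (inj₂ q) = sym (subst₂ (λ x y → anc c x ≡ anc c y) (cong proj₁ q) (cong proj₂ q) fs)

    crossing : ∀ a b → Joins ends e a b → anc c a ≢ anc c b
    crossing a b j = go j
      where
      base : anc c (chd ends par e) ≢ anc c (prt ends par e)
      base q = true≢false (anc-refl c) (trans q (trans (cong (anc c) (prt-p e te)) (anc-parent-false c (chd≢r e te))))
      fs : anc c (proj₁ (ends e)) ≢ anc c (proj₂ (ends e))
      fs = go' base
        where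
        go' : anc c (chd ends par e) ≢ anc c (prt ends par e) → anc c (proj₁ (ends e)) ≢ anc c (proj₂ (ends e))
        go' with par e
        ... | true = λ h q → h (sym q)
        ... | false = λ h q → h q
      go : Joins ends e a b → anc c a ≢ anc c b
      go (inj₁ q) z = fs (trans (cong (anc c) (cong proj₁ q)) (trans z (cong (anc c) (sym (cong proj₂ q)))))
      go (inj₂ q) z = fs (trans (cong (anc c) (cong proj₁ q)) (trans (sym z) (cong (anc c) (sym (cong proj₂ q)))))

    avoid : ∀ {a b es vs} → Walk ends (TreeEdge ends inT) a b es vs → ¬ (e ∈ es) → anc c a ≡ anc c b
    avoid nil h = refl
    avoid (cons t j w) h = trans (not-crossing _ _ _ t j (λ { refl → h (here refl) })) (avoid w (λ i → h (there i)))

    -- A simple path traverses `e` once, and every other tree edge has both ends on the same side of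
    -- `c`; hence the side changes exactly once.
    through : ∀ {a b es vs} → Walk ends (TreeEdge ends inT) a b es vs → Unique vs → e ∈ es → anc c a ≢ anc c b
    through (cons t j w) (q ∷ u) (here refl) z =
      crossing _ _ j (trans z (sym (avoid w (λ i → All-lookup q (ends-on-walk w i j) refl))))
    through (cons {e = f} t j w) (q ∷ u) (there i) z with f ≟F e
    ... | yes refl = All-lookup q (ends-on-walk w i j) refl
    ... | no ne = through w u i (trans (sym (not-crossing f _ _ t j ne)) z)

    on-path : ∀ g → OnTreePath ends inT e g → anc c (proj₁ (ends g)) xor anc c (proj₂ (ends g)) ≡ true
    on-path g (es , (vs , w , u) , i) = xor-≢ (through w u i)
      where
      xor-≢ : ∀ {a b} → a ≢ b → a xor b ≡ true
      xor-≢ {true} {true} h = ⊥-elim (h refl)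
      xor-≢ {true} {false} h = refl
      xor-≢ {false} {true} h = refl
      xor-≢ {false} {false} h = ⊥-elim (h refl)

    on-path⁻ : ∀ g → anc c (proj₁ (ends g)) xor anc c (proj₂ (ends g)) ≡ true → OnTreePath ends inT e g
    on-path⁻ g h with proj₁ span (proj₁ (ends g)) (proj₂ (ends g))
    ... | es , sp with member? e es
    ...   | inj₁ i = es , sp , i
    ...   | inj₂ ni = ⊥-elim (true≢false h (xor-same (avoid (proj₁ (proj₂ sp)) ni)))
      where
      xor-same : ∀ {a b} → a ≡ b → a xor b ≡ false
      xor-same {true} refl = refl
      xor-same {false} refl = refl

-- The effect of one step on a rooted tree, and weights of oriented edges

eq₃ : ℕ × ℕ × ℕ → ℕ × ℕ × ℕ → Bool
eq₃ (a , b , c) (a' , b' , c') = (a ≡ᵇ a') ∧ ((b ≡ᵇ b') ∧ (c ≡ᵇ c'))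

eq₃-sound : ∀ {x y} → eq₃ x y ≡ true → x ≡ y
eq₃-sound {a , b , c} {a' , b' , c'} h
  rewrite ==-sound {a} {a'} (∧-l h)
        | ==-sound {b} {b'} (∧-l (∧-r {a ≡ᵇ a'} h))
        | ==-sound {c} {c'} (∧-r {b ≡ᵇ b'} (∧-r {a ≡ᵇ a'} h)) = refl

eq₃-true : ∀ {x y} → x ≡ y → eq₃ x y ≡ true
eq₃-true {a , b , c} refl = ∧-i (==-true {a} refl) (∧-i (==-true {b} refl) (==-true {c} refl))

𝟙-* : ∀ b x → 𝟙 b * x ≡ b ▸ x
𝟙-* true x = +-identityʳ x
𝟙-* false x = refl

▸-∧ : ∀ a b x → (a ∧ b) ▸ x ≡ a ▸ b ▸ x
▸-∧ true b x = refl
▸-∧ false b x = refl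

𝟙-mono : ∀ {a b} → (a ≡ true → b ≡ true) → 𝟙 a ≤ 𝟙 b
𝟙-mono {true} {b} h rewrite h refl = ≤-refl
𝟙-mono {false} h = z≤n

module TreeRun {n m : ℕ} {ends : Fin m → Fin n × Fin n} {inT par : Fin m → Bool} {r : Fin n}
               (R : Rooted ends inT par r) (loopless : ∀ e → proj₁ (ends e) ≢ proj₂ (ends e)) (w : Fin m → ℕ) where
  open Rooted R
  open TreeFacts R
  open Ideal ends inT par w public

  kOf : Step → State → V → Bool
  kOf S σ v = not (v ≐ r) ∧ Step.contr S (σ v) (σ (p v))

  contracted-k : ∀ S σ e → contracted S σ e ≡ inT e ∧ kOf S σ (chd ends par e)
  contracted-k S σ e with inT e in t
  ... | false = refl
  ... | true rewrite ≐-false (chd≢r e t) | sym (prt-p e t) with par e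
  ...   | true = refl
  ...   | false = refl

  Y-top : ∀ S σ v → Yv S σ v ≡ fold (Step.opy S) (λ u → (top (kOf S σ) u ≐ top (kOf S σ) v) ▸ Xv S σ u)
  Y-top S σ v = fold-cong (Step.opy S) λ u →
    cong (_▸ Xv S σ u) (Supernodes.sameSN-top (contracted S σ) (kOf S σ) (contracted-k S σ) v u)

  Topmost : (V → ℕ × ℕ × ℕ) → V → Set
  Topmost φ v = (v ≡ r) ⊎ (φ v ≢ φ (p v))

  -- A class of equal keys is connected in the tree iff it has a single topmost node. In this form
  -- the condition compares keys of nodes and their parents only.
  Connected : (V → ℕ × ℕ × ℕ) → Set
  Connected φ = ∀ u v → φ u ≡ φ v → Topmost φ u → Topmost φ v → u ≡ v

  -- Contracting the tree edges with equal keys at both ends merges a class completely, because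
  -- separate pieces would have different topmost nodes.
  class-top : ∀ φ → Connected φ → let k = λ v → not (v ≐ r) ∧ eq₃ (φ v) (φ (p v)) in
    ∀ u v → (top k u ≐ top k v) ≡ eq₃ (φ u) (φ v)
  class-top φ conn u v = bool-ext
      (λ h → eq₃-true (trans (sym (pres u)) (trans (cong φ (≐-sound h)) (pres v))))
      (λ h → ≐-true (conn (top k u) (top k v) (trans (pres u) (trans (eq₃-sound h) (sym (pres v)))) (topmost u) (topmost v)))
    where
    k : V → Bool
    k v = not (v ≐ r) ∧ eq₃ (φ v) (φ (p v))
    pres : ∀ v → φ (top k v) ≡ φ v
    pres = top-preserves k φ (λ v q t → eq₃-sound (∧-r {not (v ≐ r)} t))
    topmost : ∀ v → Topmost φ (top k v)
    topmost v with top-stop k v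
    ... | inj₁ e = inj₁ e
    ... | inj₂ f = case top k v ≟F r of λ
      { (yes e) → inj₁ e
      ; (no ne) → inj₂ λ e → true≢false (∧-i (not-t (≐-false ne)) (eq₃-true e)) f }

  Y-class : ∀ S σ (φ : Mem → ℕ × ℕ × ℕ) → (∀ a b → Step.contr S a b ≡ eq₃ (φ a) (φ b)) → Connected (φ ∘ σ) →
    ∀ v → Yv S σ v ≡ fold (Step.opy S) (λ u → eq₃ (φ (σ u)) (φ (σ v)) ▸ Xv S σ u)
  Y-class S σ φ hc conn v = trans (fold-cong (Step.opy S) λ u →
      cong (_▸ Xv S σ u) (Supernodes.sameSN-top (contracted S σ) k c-eq v u))
    (fold-cong (Step.opy S) λ u → cong (_▸ Xv S σ u) (class-top (φ ∘ σ) conn u v))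
    where
    k : V → Bool
    k v = not (v ≐ r) ∧ eq₃ (φ (σ v)) (φ (σ (p v)))
    c-eq : ∀ e → contracted S σ e ≡ inT e ∧ k (chd ends par e)
    c-eq e = trans (contracted-k S σ e) (cong (λ b → inT e ∧ (not (chd ends par e ≐ r) ∧ b)) (hc _ _))

  Z-up : ∀ S σ (E : Mem → Mem → ℕ) → (∀ ε → eval (Step.emit S dn) ε ≡ 0) → (∀ ε → eval (Step.emit S flat) ε ≡ 0) →
    (∀ ρ ρ' x → eval (Step.emit S up) (emitEnv ρ ρ' x) ≡ E ρ ρ') →
    ∀ v → Zv S σ v ≡ not (v ≐ r) ▸ E (σ v) (σ (p v))
  Z-up S σ E hd hf hu v = trans (fold-cong (Step.opz S) shape) total
    where
    shape : ∀ e → contrib S σ v e ≡ (inT e ∧ (v ≐ chd ends par e)) ▸ E (σ v) (σ (p v))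
    shape e with inT e in t
    ... | false with v ≐ fst e | v ≐ snd e
    ...   | true | _ = hf _
    ...   | false | true = hf _
    ...   | false | false = refl
    shape e | true with par e in q | prt-p e t
    ... | true | pp with v ≟F fst e | v ≟F snd e
    ...   | yes refl | yes z = ⊥-elim (loopless e z)
    ...   | yes refl | no _ = hd _
    ...   | no _ | yes refl = trans (hu _ _ _) (cong (λ x → E (σ v) (σ x)) pp)
    ...   | no _ | no _ = refl
    shape e | true | false | pp with v ≟F fst e | v ≟F snd e
    ...   | yes refl | _ = trans (hu _ _ _) (cong (λ x → E (σ v) (σ x)) pp)
    ...   | no _ | yes refl = hd _
    ...   | no _ | no _ = refl
    total : fold (Step.opz S) (λ e → (inT e ∧ (v ≐ chd ends par e)) ▸ E (σ v) (σ (p v))) ≡ not (v ≐ r) ▸ E (σ v) (σ (p v))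
    total with v ≟F r
    ... | yes refl = fold-zero (Step.opz S) λ e → cong (_▸ E (σ r) (σ (p r))) (bool-false λ h → chd≢r e (∧-l h) (sym (≐-sound (∧-r {inT e} h))))
    ... | no q with pe v q
    ...   | e₀ , t₀ , refl = trans (fold-single (Step.opz S) e₀ (λ e ne → cong (_▸ E (σ v) (σ (p v))) (bool-false λ h →
                 ne (chd-inj e e₀ (∧-l h) t₀ (sym (≐-sound (∧-r {inT e} h)))))))
               (cong (_▸ E (σ v) (σ (p v))) (∧-i t₀ (≐-refl _)))

  -- Each non-root node is the lower end of exactly one tree edge, so the fold over edges can be
  -- indexed by children. This exchanges two sums, hence the restriction to addition.
  Z-dn : ∀ S σ (E : Mem → Mem → ℕ) → Step.opz S ≡ add → (∀ ε → eval (Step.emit S up) ε ≡ 0) → (∀ ε → eval (Step.emit S flat) ε ≡ 0) →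
    (∀ ρ ρ' x → eval (Step.emit S dn) (emitEnv ρ ρ' x) ≡ E ρ ρ') →
    ∀ v → Zv S σ v ≡ ∑ (λ c → (not (c ≐ r) ∧ (v ≐ p c)) ▸ E (σ v) (σ c))
  Z-dn S σ E refl hu hf hd v = begin
      ∑ (contrib S σ v)                                                                    ≡⟨ fold-cong add shape ⟩
      ∑ (λ e → (inT e ∧ (v ≐ prt ends par e)) ▸ E (σ v) (σ (chd ends par e)))                ≡⟨ fold-cong add spread ⟩
      ∑ (λ e → ∑ (λ c → (inT e ∧ (c ≐ chd ends par e)) ▸ (v ≐ p c) ▸ E (σ v) (σ c)))         ≡⟨ ∑-swap (λ e c → (inT e ∧ (c ≐ chd ends par e)) ▸ (v ≐ p c) ▸ E (σ v) (σ c)) ⟩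
      ∑ (λ c → ∑ (λ e → (inT e ∧ (c ≐ chd ends par e)) ▸ (v ≐ p c) ▸ E (σ v) (σ c)))         ≡⟨ fold-cong add collect ⟩
      ∑ (λ c → (not (c ≐ r) ∧ (v ≐ p c)) ▸ E (σ v) (σ c)) ∎
    where
    open ≡-Reasoning
    shape : ∀ e → contrib S σ v e ≡ (inT e ∧ (v ≐ prt ends par e)) ▸ E (σ v) (σ (chd ends par e))
    shape e with inT e in t
    ... | false with v ≐ fst e | v ≐ snd e
    ...   | true | _ = hf _
    ...   | false | true = hf _
    ...   | false | false = refl
    shape e | true with par e
    ... | true with v ≟F fst e | v ≟F snd e
    ...   | yes refl | _ = hd _ _ _
    ...   | no _ | yes refl = hu _
    ...   | no _ | no _ = refl
    shape e | true | false with v ≟F fst e | v ≟F snd e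
    ...   | yes refl | yes z = ⊥-elim (loopless e z)
    ...   | yes refl | no _ = hu _
    ...   | no _ | yes refl = hd _ _ _
    ...   | no _ | no _ = refl
    spread : ∀ e → (inT e ∧ (v ≐ prt ends par e)) ▸ E (σ v) (σ (chd ends par e)) ≡ ∑ (λ c → (inT e ∧ (c ≐ chd ends par e)) ▸ (v ≐ p c) ▸ E (σ v) (σ c))
    spread e with inT e in t
    ... | false = sym (fold-zero add {n} {λ _ → 0} (λ _ → refl))
    ... | true = sym (trans (fold-single add (chd ends par e) (λ c ne → cong (_▸ _) (≐-false ne)))
                   (trans (cong (_▸ ((v ≐ p (chd ends par e)) ▸ E (σ v) (σ (chd ends par e)))) (≐-refl (chd ends par e))) (cong (λ x → (v ≐ x) ▸ E (σ v) (σ (chd ends par e))) (sym (prt-p e t)))))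
    collect : ∀ c → ∑ (λ e → (inT e ∧ (c ≐ chd ends par e)) ▸ (v ≐ p c) ▸ E (σ v) (σ c)) ≡ (not (c ≐ r) ∧ (v ≐ p c)) ▸ E (σ v) (σ c)
    collect c with c ≟F r
    ... | yes refl = fold-zero add λ e → cong (_▸ _) (bool-false λ h → chd≢r e (∧-l h) (sym (≐-sound (∧-r {inT e} h))))
    ... | no q with pe c q
    ...   | e₀ , t₀ , refl = trans (fold-single add e₀ (λ e ne → cong (_▸ _) (bool-false λ h →
                 ne (chd-inj e e₀ (∧-l h) t₀ (sym (≐-sound (∧-r {inT e} h)))))))
               (cong (_▸ _) (∧-i t₀ (≐-refl _)))

  -- ⟪ F ⟫ is the total weight of the oriented edges (u , v) with F u v.
  wsum : (V → V → ℕ) → ℕ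
  wsum f = ∑ (λ e → f (fst e) (snd e) * w e + f (snd e) (fst e) * w e)

  opaque
    ⟪_⟫ : (V → V → Bool) → ℕ
    ⟪ F ⟫ = wsum (λ u v → 𝟙 (F u v))

    ⟪⟫-def : ∀ F → ⟪ F ⟫ ≡ wsum (λ u v → 𝟙 (F u v))
    ⟪⟫-def F = refl

  wsum-cong : ∀ {f g} → (∀ u v → f u v ≡ g u v) → wsum f ≡ wsum g
  wsum-cong h = fold-cong add λ e → cong₂ (λ a b → a * w e + b * w e) (h _ _) (h _ _)

  wsum-mono : ∀ {f g} → (∀ u v → f u v ≤ g u v) → wsum f ≤ wsum g
  wsum-mono h = ∑-mono λ e → +-mono-≤ (*-monoˡ-≤ (w e) (h _ _)) (*-monoˡ-≤ (w e) (h _ _))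

  wsum-+ : ∀ f g → wsum (λ u v → f u v + g u v) ≡ wsum f + wsum g
  wsum-+ f g = trans (fold-cong add λ e →
      solve 5 (λ a b c d x → (a :+ b) :* x :+ (c :+ d) :* x := (a :* x :+ c :* x) :+ (b :* x :+ d :* x)) refl
        (f (fst e) (snd e)) (g (fst e) (snd e)) (f (snd e) (fst e)) (g (snd e) (fst e)) (w e))
    (∑-+ (λ e → f (fst e) (snd e) * w e + f (snd e) (fst e) * w e) (λ e → g (fst e) (snd e) * w e + g (snd e) (fst e) * w e))
    where open +-*-Solver

  opaque
    unfolding ⟪_⟫

    ⟪⟫-cong : ∀ {F G : V → V → Bool} → (∀ u v → F u v ≡ G u v) → ⟪ F ⟫ ≡ ⟪ G ⟫
    ⟪⟫-cong h = wsum-cong (λ u v → cong 𝟙 (h u v))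

    ⟪⟫-mono : ∀ {F G : V → V → Bool} → (∀ u v → F u v ≡ true → G u v ≡ true) → ⟪ F ⟫ ≤ ⟪ G ⟫
    ⟪⟫-mono h = wsum-mono (λ u v → 𝟙-mono (h u v))

    ⟪⟫-sym : ∀ F → ⟪ F ⟫ ≡ ⟪ (λ u v → F v u) ⟫
    ⟪⟫-sym F = fold-cong add λ e → +-comm (𝟙 (F (fst e) (snd e)) * w e) _

    ⟪⟫-empty : ∀ {F : V → V → Bool} → (∀ u v → F u v ≡ false) → ⟪ F ⟫ ≡ 0
    ⟪⟫-empty h = fold-zero add λ e → cong₂ (λ a b → 𝟙 a * w e + 𝟙 b * w e) (h _ _) (h _ _)

    ⟪⟫-≢0 : ∀ {F : V → V → Bool} → ⟪ F ⟫ ≢ 0 → Σ (Fin m) λ e → (F (fst e) (snd e) ≡ true) ⊎ (F (snd e) (fst e) ≡ true)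
    ⟪⟫-≢0 {F} h with fold-≢0 add _ h
    ... | e , q with F (fst e) (snd e) in a | F (snd e) (fst e) in b
    ...   | true | _ = e , inj₁ a
    ...   | false | true = e , inj₂ b
    ...   | false | false = ⊥-elim (q refl)

    -- This lemma and the next two reduce relations between weights to a check of indicators at a
    -- single oriented edge. They are stated with sums on both sides to avoid truncated subtraction.
    ⟪⟫-add : ∀ {F A B : V → V → Bool} → (∀ u v → 𝟙 (F u v) ≡ 𝟙 (A u v) + 𝟙 (B u v)) → ⟪ F ⟫ ≡ ⟪ A ⟫ + ⟪ B ⟫
    ⟪⟫-add {F} {A} {B} h = trans (wsum-cong h) (wsum-+ (λ u v → 𝟙 (A u v)) (λ u v → 𝟙 (B u v)))

    ⟪⟫-balance : ∀ {A B C D : V → V → Bool} → (∀ u v → 𝟙 (A u v) + 𝟙 (B u v) ≤ 𝟙 (C u v) + 𝟙 (D u v)) → ⟪ A ⟫ + ⟪ B ⟫ ≤ ⟪ C ⟫ + ⟪ D ⟫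
    ⟪⟫-balance {A} {B} {C} {D} h = subst₂ _≤_ (wsum-+ (λ u v → 𝟙 (A u v)) (λ u v → 𝟙 (B u v))) (wsum-+ (λ u v → 𝟙 (C u v)) (λ u v → 𝟙 (D u v))) (wsum-mono h)

    ⟪⟫-split : ∀ {A B C D E : V → V → Bool} → (∀ u v → 𝟙 (A u v) + 𝟙 (B u v) ≡ (𝟙 (C u v) + 𝟙 (D u v)) + 𝟙 (E u v)) →
      ⟪ A ⟫ + ⟪ B ⟫ ≡ (⟪ C ⟫ + ⟪ D ⟫) + ⟪ E ⟫
    ⟪⟫-split {A} {B} {C} {D} {E} h = trans (sym (wsum-+ (λ u v → 𝟙 (A u v)) (λ u v → 𝟙 (B u v)))) (trans (wsum-cong h)
      (trans (wsum-+ (λ u v → 𝟙 (C u v) + 𝟙 (D u v)) (λ u v → 𝟙 (E u v))) (cong (_+ ⟪ E ⟫) (wsum-+ (λ u v → 𝟙 (C u v)) (λ u v → 𝟙 (D u v))))))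

  Z-all : ∀ S σ (E : Mem → Mem → ℕ → ℕ) → (∀ ro ρ ρ' x → eval (Step.emit S ro) (emitEnv ρ ρ' x) ≡ E ρ ρ' x) →
    ∀ v e → contrib S σ v e ≡ (if v ≐ fst e then E (σ v) (σ (snd e)) (w e) else if v ≐ snd e then E (σ v) (σ (fst e)) (w e) else 0)
  Z-all S σ E h v e with v ≟F fst e | v ≟F snd e
  ... | yes refl | _ = h _ _ _ _
  ... | no _ | yes refl = h _ _ _ _
  ... | no _ | no _ = refl

  -- Double counting: adding up over the nodes of `D` what each of them sees at its edges counts an
  -- edge once for each of its ends in `D` from which the test succeeds.
  Z-weight : ∀ S σ (C : Mem → Mem → Bool) → Step.opz S ≡ add → (∀ ro ρ ρ' x → eval (Step.emit S ro) (emitEnv ρ ρ' x) ≡ C ρ ρ' ▸ x) →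
    ∀ (D : V → Bool) → ∑ (λ v → D v ▸ Zv S σ v) ≡ ⟪ (λ u v → D u ∧ C (σ u) (σ v)) ⟫
  Z-weight S σ C refl h D = begin
      ∑ (λ v → D v ▸ ∑ (contrib S σ v))           ≡⟨ fold-cong add (λ v → trans (▸-∑ (D v) (contrib S σ v)) (fold-cong add (λ e → cong (D v ▸_) (sides v e)))) ⟩
      ∑ (λ v → ∑ (λ e → D v ▸ (at v (fst e) e (snd e) + at v (snd e) e (fst e))))   ≡⟨ ∑-swap (λ v e → D v ▸ (at v (fst e) e (snd e) + at v (snd e) e (fst e))) ⟩
      ∑ (λ e → ∑ (λ v → D v ▸ (at v (fst e) e (snd e) + at v (snd e) e (fst e))))   ≡⟨ fold-cong add collect ⟩
      wsum (λ u v → 𝟙 (D u ∧ C (σ u) (σ v)))      ≡⟨ sym (⟪⟫-def _) ⟩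
      ⟪ (λ u v → D u ∧ C (σ u) (σ v)) ⟫ ∎
    where
    open ≡-Reasoning
    at : V → V → Fin m → V → ℕ
    at v a e b = (v ≐ a) ▸ C (σ v) (σ b) ▸ w e
    sides : ∀ v e → contrib S σ v e ≡ at v (fst e) e (snd e) + at v (snd e) e (fst e)
    sides v e rewrite Z-all S σ (λ ρ ρ' x → C ρ ρ' ▸ x) h v e with v ≟F fst e | v ≟F snd e
    ... | yes refl | yes z = ⊥-elim (loopless e z)
    ... | yes refl | no _ = sym (+-identityʳ _)
    ... | no _ | yes refl = refl
    ... | no _ | no _ = refl
    one : ∀ e a b → ∑ (λ v → D v ▸ at v a e b) ≡ 𝟙 (D a ∧ C (σ a) (σ b)) * w e
    one e a b = trans (fold-single add a (λ v ne → trans (cong (λ z → D v ▸ z ▸ C (σ v) (σ b) ▸ w e) (≐-false ne)) (▸-0 (D v))))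
      (trans (cong (λ z → D a ▸ z ▸ C (σ a) (σ b) ▸ w e) (≐-refl a)) (trans (sym (▸-∧ (D a) (C (σ a) (σ b)) (w e))) (sym (𝟙-* (D a ∧ C (σ a) (σ b)) (w e)))))
      where
      ▸-0 : ∀ c → c ▸ 0 ≡ 0
      ▸-0 true = refl
      ▸-0 false = refl
    ▸-+ : ∀ c x y → c ▸ (x + y) ≡ (c ▸ x) + (c ▸ y)
    ▸-+ true x y = refl
    ▸-+ false x y = refl
    collect : ∀ e → ∑ (λ v → D v ▸ (at v (fst e) e (snd e) + at v (snd e) e (fst e)))
                  ≡ 𝟙 (D (fst e) ∧ C (σ (fst e)) (σ (snd e))) * w e + 𝟙 (D (snd e) ∧ C (σ (snd e)) (σ (fst e))) * w e
    collect e = trans (fold-cong add λ v → ▸-+ (D v) _ _) (trans (∑-+ (λ v → D v ▸ at v (fst e) e (snd e)) (λ v → D v ▸ at v (snd e) e (fst e))) (cong₂ _+_ (one e (fst e) (snd e)) (one e (snd e) (fst e))))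

  Z-max-≥ : ∀ S σ (E : Mem → Mem → ℕ) → (∀ ro ρ ρ' x → eval (Step.emit S ro) (emitEnv ρ ρ' x) ≡ E ρ ρ') →
    ∀ e → (E (σ (fst e)) (σ (snd e)) ≤ Zv S σ (fst e)) × (E (σ (snd e)) (σ (fst e)) ≤ Zv S σ (snd e))
  Z-max-≥ S σ E h e =
      ≤-trans (≤-reflexive (sym (trans (Z-all S σ (λ ρ ρ' _ → E ρ ρ') h (fst e) e) a))) (fold-≥ (Step.opz S) (contrib S σ (fst e)) e)
    , ≤-trans (≤-reflexive (sym (trans (Z-all S σ (λ ρ ρ' _ → E ρ ρ') h (snd e) e) b))) (fold-≥ (Step.opz S) (contrib S σ (snd e)) e)
    where
    a : (if fst e ≐ fst e then E (σ (fst e)) (σ (snd e)) else if fst e ≐ snd e then E (σ (fst e)) (σ (fst e)) else 0) ≡ E (σ (fst e)) (σ (snd e))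
    a rewrite ≐-refl (fst e) = refl
    b : (if snd e ≐ fst e then E (σ (snd e)) (σ (snd e)) else if snd e ≐ snd e then E (σ (snd e)) (σ (fst e)) else 0) ≡ E (σ (snd e)) (σ (fst e))
    b rewrite ≐-false {u = snd e} {fst e} (λ q → loopless e (sym q)) | ≐-refl (snd e) = refl

  Z-max-attained : ∀ S σ (E : Mem → Mem → ℕ) → Step.opz S ≡ mx → (∀ ro ρ ρ' x → eval (Step.emit S ro) (emitEnv ρ ρ' x) ≡ E ρ ρ') →
    ∀ v → Zv S σ v ≢ 0 → ∃ λ u → Zv S σ v ≡ E (σ v) (σ u)
  Z-max-attained S σ E refl h v nz with ⨆-attained (contrib S σ v) nz
  ... | e , q with trans (sym (Z-all S σ (λ ρ ρ' _ → E ρ ρ') h v e)) (sym q)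
  ...   | z with v ≐ fst e | v ≐ snd e
  ...     | true | _ = snd e , sym z
  ...     | false | true = fst e , sym z
  ...     | false | false = ⊥-elim (nz (sym z))

-- The numbering follows lifetimes, so that frame conditions are mostly initial intervals. Below 6
-- are the permanent data: `rTAU` names the subtree by its top node, `rKK` is the total weight over
-- both orientations. Below 10 are the data of one star: `rCR` and `rWW` are the cut and the cross
-- weight of the subtree of the nearest kept ancestor. Then follow the partner path `rMATE` and the
-- block and offset of the divide and conquer. The others are scratch, except `rSCORE`, which
-- collects the result.
rID rD rTAU rLEV rKK rCUT rPID rPOS rCR rWW rMATE rBLK rOFF rG rFS rCS rY rX rS rT rLAB rMRG rCNT rSCORE : Reg
rID = # 0
rD = # 1
rTAU = # 2
rLEV = # 3
rKK = # 4
rCUT = # 5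
rPID = # 6
rPOS = # 7
rCR = # 8
rWW = # 9
rMATE = # 10
rBLK = # 11
rOFF = # 12
rG = # 13
rFS = # 14
rCS = # 15
rY = # 16
rX = # 17
rS = # 18
rT = # 19
rLAB = # 20
rMRG = # 21
rCNT = # 22
rSCORE = # 23

infixl 9 _!_
_!_ : Mem → Reg → ℕ
ρ ! q = lookup ρ q

mk : (opz opy : Op) (emit : Role → Ex) (contr : Mem → Mem → Bool) (val : Ex) (upd : List (Reg × Ex)) →
  let s = suc (size (emit up) + (size (emit dn) + (size (emit flat) + (size val + updSize upd)))) in {T (s ≤ᵇ 64)} → Prog
mk a b c d e f {s} = step (mkStep a b c d e f s)

silent : Role → Ex
silent _ = con 0

upward downward everywhere : Ex → Role → Ex
upward e up = e
upward e dn = con 0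
upward e flat = con 0
downward e up = con 0
downward e dn = e
downward e flat = con 0
everywhere e _ = e

never : Mem → Mem → Bool
never _ _ = false

eqB : Bool → Bool → Bool
eqB a b = not (a xor b)

eqB-sound : ∀ {a b} → eqB a b ≡ true → a ≡ b
eqB-sound {true} {true} _ = refl
eqB-sound {false} {false} _ = refl

eqB-refl : ∀ a → eqB a a ≡ true
eqB-refl true = refl
eqB-refl false = refl

eqB-other : ∀ {a b} → a ≢ b → eqB a (not b) ≡ true
eqB-other {true} {true} h = ⊥-elim (h refl)
eqB-other {true} {false} h = refl
eqB-other {false} {true} h = refl
eqB-other {false} {false} h = ⊥-elim (h refl)

-- Depths.  Clusters of merged edges carry the ID of their top; a cluster merges into the
-- one above when bit i of its label is β and that of the upper label is not.

mergeCond : ℕ → Bool → Mem → Mem → Bool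
mergeCond i β a b = (a ! rMRG ≡ᵇ 0) ∧ (eqB (bit i (a ! rLAB)) β ∧ eqB (bit i (b ! rLAB)) (not β))

-- `rD` is the distance to the top of the own cluster. The added 1 is the connecting edge in
-- `mergeD`, whereas in `mergeL` it separates a label from the absence of a merge. `mergeD` comes
-- first because `mergeL` changes the labels and marks on which the merge condition depends.
mergeD mergeL merge : ℕ → Bool → Prog
mergeD i β = mk mx mx (upward (ite (λ ε → mergeCond i β (Env.own ε) (Env.oth ε)) (oth# rD ⊞ con 1) (con 0)))
  (λ a b → a ! rMRG ≡ᵇ 1) zz# ((rD , own# rD ⊞ yy#) ∷ [])
mergeL i β = mk mx mx (upward (ite (λ ε → mergeCond i β (Env.own ε) (Env.oth ε)) (oth# rLAB ⊞ con 1) (con 0)))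
  (λ a b → a ! rMRG ≡ᵇ 1) zz#
  ((rLAB , ite (λ ε → Env.yy ε ≡ᵇ 0) (own# rLAB) (yy# ⊟ con 1)) ∷ (rMRG , ite (λ ε → Env.zz ε ≡ᵇ 0) (own# rMRG) (con 1)) ∷ [])
merge i β = mergeD i β ⨾ mergeL i β

sweep : ℕ → Prog
sweep L = loop L (λ i → merge i false ⨾ merge i true)

depthProg : ℕ → ℕ → Prog
depthProg H L = mk add add silent never (con 0) ((rLAB , own# rID) ∷ []) ⨾ loop H (λ _ → sweep L)

module DepthPhase {n m : ℕ} {ends : Fin m → Fin n × Fin n} {inT par : Fin m → Bool} {r : Fin n}
               (R : Rooted ends inT par r) (loopless : ∀ e → proj₁ (ends e) ≢ proj₂ (ends e)) (w : Fin m → ℕ)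
               (ID : Fin n → ℕ) (ID-inj : ∀ u v → ID u ≡ ID v → u ≡ v) where
  open Rooted R
  open TreeFacts R
  open TreeRun R loopless w

  merged : State → V → Bool
  merged σ v = not (v ≐ r) ∧ (σ v ! rMRG ≡ᵇ 1)

  merged-r : ∀ σ → merged σ r ≡ false
  merged-r σ rewrite ≐-refl r = refl

  record DInv (σ : State) : Set where
    field
      id-ok : ∀ v → σ v ! rID ≡ ID v
      lab-ok : ∀ v → σ v ! rLAB ≡ ID (top (merged σ) v)
      off-ok : ∀ v → σ v ! rD + d (top (merged σ) v) ≡ d v
      mrg-ok : ∀ v → (σ v ! rMRG ≡ 0) ⊎ (σ v ! rMRG ≡ 1)

  joins? : ℕ → Bool → State → V → Bool
  joins? i β σ v = not (v ≐ r) ∧ mergeCond i β (σ v) (σ (p v))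

  module MergeStep (i : ℕ) (β : Bool) (σ : State) (I : DInv σ) where
    open DInv I

    C : V → Bool
    C = joins? i β σ

    k : V → Bool
    k = merged σ

    σ₁ σ₂ : State
    σ₁ = exec (mergeD i β) σ
    σ₂ = exec (mergeL i β) σ₁

    C-unmerged : ∀ u → u ≢ r → k u ≡ true → C u ≡ false
    C-unmerged u q t = bool-false λ h →
      case trans (sym (==-sound {σ u ! rMRG} (∧-r {not (u ≐ r)} t))) (==-sound {σ u ! rMRG} (∧-l (∧-r {not (u ≐ r)} h))) of λ ()

    SD SL : Step
    SD = record { opz = mx ; opy = mx ; emit = upward (ite (λ ε → mergeCond i β (Env.own ε) (Env.oth ε)) (oth# rD ⊞ con 1) (con 0))
                ; contr = λ a b → a ! rMRG ≡ᵇ 1 ; val = zz# ; upd = (rD , own# rD ⊞ yy#) ∷ [] ; small = tt }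
    SL = record { opz = mx ; opy = mx ; emit = upward (ite (λ ε → mergeCond i β (Env.own ε) (Env.oth ε)) (oth# rLAB ⊞ con 1) (con 0))
                ; contr = λ a b → a ! rMRG ≡ᵇ 1 ; val = zz#
                ; upd = (rLAB , ite (λ ε → Env.yy ε ≡ᵇ 0) (own# rLAB) (yy# ⊟ con 1)) ∷ (rMRG , ite (λ ε → Env.zz ε ≡ᵇ 0) (own# rMRG) (con 1)) ∷ [] ; small = tt }

    zD : ∀ v → Zv SD σ v ≡ C v ▸ suc (σ (p v) ! rD)
    zD v = trans (Z-up SD σ (λ ρ ρ' → mergeCond i β ρ ρ' ▸ (ρ' ! rD + 1)) (λ _ → refl) (λ _ → refl) (λ _ _ _ → refl) v)
      (trans (sym (▸-∧ (not (v ≐ r)) (mergeCond i β (σ v) (σ (p v))) _)) (cong (C v ▸_) (+-comm (σ (p v) ! rD) 1)))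

    zL : ∀ v → Zv SL σ₁ v ≡ C v ▸ suc (σ (p v) ! rLAB)
    zL v = trans (Z-up SL σ₁ (λ ρ ρ' → mergeCond i β ρ ρ' ▸ (ρ' ! rLAB + 1)) (λ _ → refl) (λ _ → refl) (λ _ _ _ → refl) v)
      (trans (sym (▸-∧ (not (v ≐ r)) (mergeCond i β (σ v) (σ (p v))) _)) (cong (C v ▸_) (+-comm (σ (p v) ! rLAB) 1)))

    yD : ∀ v → Yv SD σ v ≡ C (top k v) ▸ suc (σ (p (top k v)) ! rD)
    yD v = trans (Y-top SD σ v) (trans (gather mx k (Zv SD σ) (λ u q t → trans (zD u) (cong (_▸ _) (C-unmerged u q t))) v) (zD (top k v)))

    yL : ∀ v → Yv SL σ₁ v ≡ C (top k v) ▸ suc (σ (p (top k v)) ! rLAB)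
    yL v = trans (Y-top SL σ₁ v) (trans (gather mx k (Zv SL σ₁) (λ u q t → trans (zL u) (cong (_▸ _) (C-unmerged u q t))) v) (zL (top k v)))

    D₂ : ∀ v → σ₂ v ! rD ≡ σ v ! rD + (C (top k v) ▸ suc (σ (p (top k v)) ! rD))
    D₂ v = cong (σ v ! rD +_) (yD v)

    L₂ : ∀ v → σ₂ v ! rLAB ≡ (if C (top k v) then σ (p (top k v)) ! rLAB else σ v ! rLAB)
    L₂ v = trans (cong (λ y → if y ≡ᵇ 0 then σ v ! rLAB else y ∸ 1) (yL v)) (go (C (top k v)))
      where
      go : ∀ b → (if (b ▸ suc (σ (p (top k v)) ! rLAB)) ≡ᵇ 0 then σ v ! rLAB else (b ▸ suc (σ (p (top k v)) ! rLAB)) ∸ 1) ≡ (if b then σ (p (top k v)) ! rLAB else σ v ! rLAB)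
      go true = refl
      go false = refl

    M₂ : ∀ v → σ₂ v ! rMRG ≡ (if C v then 1 else σ v ! rMRG)
    M₂ v = trans (cong (λ z → if z ≡ᵇ 0 then σ v ! rMRG else 1) (zL v)) (go (C v))
      where
      go : ∀ b → (if (b ▸ suc (σ (p v) ! rLAB)) ≡ᵇ 0 then σ v ! rMRG else 1) ≡ (if b then 1 else σ v ! rMRG)
      go true = refl
      go false = refl

    merged₂ : ∀ v → merged σ₂ v ≡ k v ∨ C v
    merged₂ v = trans (cong (λ z → not (v ≐ r) ∧ (z ≡ᵇ 1)) (M₂ v)) (go (not (v ≐ r)) (mergeCond i β (σ v) (σ (p v))))
      where
      go : ∀ a b → a ∧ ((if a ∧ b then 1 else σ v ! rMRG) ≡ᵇ 1) ≡ (a ∧ (σ v ! rMRG ≡ᵇ 1)) ∨ (a ∧ b)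
      go false b = refl
      go true false = sym (∨-identityʳ _)
      go true true with σ v ! rMRG ≡ᵇ 1
      ... | true = refl
      ... | false = refl

    k⊆ : ∀ v → k v ≡ true → merged σ₂ v ≡ true
    k⊆ v h = trans (merged₂ v) (∨-l h)

    -- The upper cluster has the opposite bit `i` in its label, so it stays put in the same step.
    -- Merges never chain, and one broadcast per cluster suffices.
    not-both : ∀ t → C t ≡ true → C (top k (p t)) ≡ false
    not-both t h = bool-false λ h' → β-clash
        (eqB-sound (∧-l (∧-r {σ t' ! rMRG ≡ᵇ 0} (∧-r {not (t' ≐ r)} h'))))
        (trans (cong (bit i) (trans (trans (lab-ok t') (cong ID (top-idem k (p t)))) (sym (lab-ok (p t)))))
               (eqB-sound (∧-r {eqB (bit i (σ t ! rLAB)) β} (∧-r {σ t ! rMRG ≡ᵇ 0} (∧-r {not (t ≐ r)} h)))))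
      where
      t' = top k (p t)
      β-clash : ∀ {b} → b ≡ β → b ≡ not β → ⊥
      β-clash = not-self β
        where
        not-self : ∀ c {b} → b ≡ c → b ≡ not c → ⊥
        not-self true refl ()
        not-self false refl ()

    C≢r : ∀ v → C v ≡ true → v ≢ r
    C≢r v h refl = true≢false (∧-l h) (cong not (≐-refl v))

    top₂ : ∀ v → top (merged σ₂) v ≡ (if C (top k v) then top k (p (top k v)) else top k v)
    top₂ v = trans (sym (top-mono k (merged σ₂) k⊆ v)) (go (C t) refl)
      where
      t = top k v
      still : ∀ x → C (top k x) ≡ false → (top k x ≡ r) ⊎ (merged σ₂ (top k x) ≡ false)
      still x c with top-stop k x
      ... | inj₁ e = inj₁ e
      ... | inj₂ f = inj₂ (trans (merged₂ (top k x)) (cong₂ _∨_ f c))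
      go : ∀ b → C t ≡ b → top (merged σ₂) t ≡ (if b then top k (p t) else t)
      go false c = top-fix' (merged σ₂) t (still v c)
      go true c = trans (top-step (merged σ₂) t (C≢r t c) (trans (merged₂ t) (∨-r {k t} c)))
        (trans (sym (top-mono k (merged σ₂) k⊆ (p t))) (top-fix' (merged σ₂) (top k (p t)) (still (p t) (not-both t c))))

    inv : DInv σ₂
    inv = record
      { id-ok = id-ok
      ; lab-ok = λ v → trans (L₂ v) (trans (lab v (C (top k v)) refl) (cong ID (sym (top₂ v))))
      ; off-ok = λ v → trans (cong₂ (λ a b → a + d b) (D₂ v) (top₂ v)) (off v (C (top k v)) refl)
      ; mrg-ok = λ v → subst (λ z → (z ≡ 0) ⊎ (z ≡ 1)) (sym (M₂ v)) (mrg v (C v))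
      }
      where
      lab : ∀ v b → C (top k v) ≡ b → (if b then σ (p (top k v)) ! rLAB else σ v ! rLAB) ≡ ID (if b then top k (p (top k v)) else top k v)
      lab v true c = lab-ok (p (top k v))
      lab v false c = lab-ok v
      off : ∀ v b → C (top k v) ≡ b → (σ v ! rD + (b ▸ suc (σ (p (top k v)) ! rD))) + d (if b then top k (p (top k v)) else top k v) ≡ d v
      off v false c = trans (cong (_+ d (top k v)) (+-identityʳ _)) (off-ok v)
      off v true c = begin
          (σ v ! rD + suc (σ (p t) ! rD)) + d (top k (p t))    ≡⟨ +-assoc (σ v ! rD) _ _ ⟩
          σ v ! rD + suc (σ (p t) ! rD + d (top k (p t)))      ≡⟨ cong (λ z → σ v ! rD + suc z) (off-ok (p t)) ⟩
          σ v ! rD + suc (d (p t))                             ≡⟨ cong (σ v ! rD +_) (sym (d-p t (C≢r t c))) ⟩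
          σ v ! rD + d t                                       ≡⟨ off-ok v ⟩
          d v ∎
        where
        open ≡-Reasoning
        t = top k v
      mrg : ∀ v b → ((if b then 1 else σ v ! rMRG) ≡ 0) ⊎ ((if b then 1 else σ v ! rMRG) ≡ 1)
      mrg v true = inj₂ refl
      mrg v false = mrg-ok v

  unmerged-0 : ∀ {σ} → DInv σ → ∀ v → v ≢ r → merged σ v ≡ false → σ v ! rMRG ≡ 0
  unmerged-0 {σ} I v q f with DInv.mrg-ok I v
  ... | inj₁ z = z
  ... | inj₂ z = ⊥-elim (true≢false (∧-i (not-t (≐-false q)) (==-true z)) f)

  -- `k₀` is the clustering at the start of the sweep. If neither a cluster nor the one above it has
  -- merged upwards, both polarities of every processed bit have failed for this pair, so the labels
  -- agree on these bits; after `L` bits distinct IDs rule this out.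
  SweepInv : (V → Bool) → ℕ → State → Set
  SweepInv k₀ j σ = DInv σ × (∀ v → k₀ v ≡ true → merged σ v ≡ true) ×
    (∀ v → v ≢ r → merged σ v ≡ false → (merged σ (top k₀ (p v)) ≡ true) ⊎ (∀ i → i < j → bit i (ID v) ≡ bit i (ID (top k₀ (p v)))))

  record Merges (i : ℕ) (β : Bool) (σ σ' : State) : Set where
    field
      inv : DInv σ'
      merged-eq : ∀ v → merged σ' v ≡ merged σ v ∨ joins? i β σ v

  merge-spec : ∀ i β σ → DInv σ → Merges i β σ (exec (merge i β) σ)
  merge-spec i β σ I = record { inv = MergeStep.inv i β σ I ; merged-eq = MergeStep.merged₂ i β σ I }

  sweep-step : ∀ k₀ i σ σ' σ'' → Merges i false σ σ' → Merges i true σ' σ'' → SweepInv k₀ i σ → SweepInv k₀ (suc i) σ''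
  sweep-step k₀ i σ σ' σ'' m₁ m₂ (I , sub , prog) = Merges.inv m₂ , (λ v h → sub₂ v (sub₁ v (sub v h))) , next
    where
    sub₁ : ∀ v → merged σ v ≡ true → merged σ' v ≡ true
    sub₁ v h = trans (Merges.merged-eq m₁ v) (∨-l h)
    sub₂ : ∀ v → merged σ' v ≡ true → merged σ'' v ≡ true
    sub₂ v h = trans (Merges.merged-eq m₂ v) (∨-l h)
    back : ∀ {a b : Bool} → (a ≡ true → b ≡ true) → b ≡ false → a ≡ false
    back h f = bool-false λ t → true≢false (h t) f
    same-bit : ∀ β τ (J : DInv τ) → (∀ v → k₀ v ≡ true → merged τ v ≡ true) → ∀ v → v ≢ r → merged τ v ≡ false → merged τ (top k₀ (p v)) ≡ false →
      joins? i β τ v ≡ false → bit i (ID v) ≡ β → bit i (ID v) ≡ bit i (ID (top k₀ (p v)))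
    same-bit β τ J sub' v q mv mq nj b with bit i (ID (top k₀ (p v))) ≟B β
    ... | yes e = trans b (sym e)
    ... | no ne = ⊥-elim (true≢false (∧-i (not-t (≐-false q)) (∧-i (==-true (unmerged-0 J v q mv)) (∧-i bit₁ bit₂))) nj)
      where
      labv : τ v ! rLAB ≡ ID v
      labv = trans (DInv.lab-ok J v) (cong ID (top-fix (merged τ) v mv))
      labp : τ (p v) ! rLAB ≡ ID (top k₀ (p v))
      labp = trans (DInv.lab-ok J (p v)) (cong ID (trans (sym (top-mono k₀ (merged τ) sub' (p v))) (top-fix (merged τ) _ mq)))
      bit₁ : eqB (bit i (τ v ! rLAB)) β ≡ true
      bit₁ rewrite labv | b = eqB-refl β
      bit₂ : eqB (bit i (τ (p v) ! rLAB)) (not β) ≡ true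
      bit₂ rewrite labp = eqB-other ne
    next : ∀ v → v ≢ r → merged σ'' v ≡ false → (merged σ'' (top k₀ (p v)) ≡ true) ⊎ (∀ j → j < suc i → bit j (ID v) ≡ bit j (ID (top k₀ (p v))))
    next v q f with bool-case (merged σ'' (top k₀ (p v)))
    ... | inj₁ t = inj₁ t
    ... | inj₂ g = inj₂ λ j l → case m≤n⇒m<n∨m≡n (≤-pred l) of λ
        { (inj₁ j<i) → (case prog v q f₀ of λ { (inj₁ t) → ⊥-elim (true≢false (sub₂ _ (sub₁ _ t)) g) ; (inj₂ h) → h j j<i })
        ; (inj₂ refl) → (case bool-case (bit i (ID v)) of λ
            { (inj₂ b) → same-bit false σ I sub v q f₀ g₀ (back (λ t → trans (Merges.merged-eq m₁ v) (∨-r {merged σ v} t)) f₁) b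
            ; (inj₁ b) → same-bit true σ' (Merges.inv m₁) (λ v h → sub₁ v (sub v h)) v q f₁ g₁ (back (λ t → trans (Merges.merged-eq m₂ v) (∨-r {merged σ' v} t)) f) b }) }
      where
      f₁ = back (sub₂ v) f
      f₀ = back (sub₁ v) f₁
      g₁ = back (sub₂ (top k₀ (p v))) g
      g₀ = back (sub₁ (top k₀ (p v))) g₁

  cntF : (V → Bool) → ℕ → V → ℕ
  cntF k zero v = 0
  cntF k (suc f) v = 𝟙 (not (k v)) + cntF k f (p v)

  -- The number of edges outside k on the way to the root.
  cnt : (V → Bool) → V → ℕ
  cnt k v = cntF k (d v) v

  cnt-p : ∀ k v → v ≢ r → cnt k v ≡ 𝟙 (not (k v)) + cnt k (p v)
  cnt-p k v q rewrite d-p v q = refl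

  cnt-r : ∀ k → cnt k r ≡ 0
  cnt-r k rewrite d-r = refl

  cnt-skip : ∀ k v → v ≢ r → k v ≡ true → cnt k v ≡ cnt k (p v)
  cnt-skip k v q t = trans (cnt-p k v q) (cong (λ b → 𝟙 (not b) + cnt k (p v)) t)

  cnt-count : ∀ k v → v ≢ r → k v ≡ false → cnt k v ≡ suc (cnt k (p v))
  cnt-count k v q t = trans (cnt-p k v q) (cong (λ b → 𝟙 (not b) + cnt k (p v)) t)

  cnt≤d : ∀ k v → cnt k v ≤ d v
  cnt≤d k = tree-ind (λ v → cnt k v ≤ d v) (≤-trans (≤-reflexive (cnt-r k)) z≤n)
    λ v q ih → subst₂ _≤_ (sym (cnt-p k v q)) (sym (d-p v q)) (+-mono-≤ (𝟙-mono {b = true} (λ _ → refl)) ih)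

  -- After a sweep an unmerged edge is followed, one old cluster further up, by a merged one. So on
  -- every root path at least every second of the old cluster edges has disappeared.
  halves : ∀ k k' → k r ≡ false → k' r ≡ false → (∀ v → k v ≡ true → k' v ≡ true) → (∀ v → v ≢ r → k' v ≡ false → k' (top k (p v)) ≡ true) →
    ∀ N v → d v ≤ N → cnt k' v + cnt k' v ≤ cnt k v
  halves k k' kr k'r sub prog N v l with v ≟F r
  ... | yes refl = ≤-trans (≤-reflexive (cong₂ _+_ (cnt-r k') (cnt-r k'))) z≤n
  ... | no q with N | subst (_≤ N) (d-p v q) l
  ...   | suc N | s≤s l' with bool-case (k' v)
  ...     | inj₁ t = ≤-trans (≤-reflexive (cong₂ _+_ (cnt-skip k' v q t) (cnt-skip k' v q t)))
                       (≤-trans (halves k k' kr k'r sub prog N (p v) l') (≤-trans (m≤n+m _ _) (≤-reflexive (sym (cnt-p k v q)))))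
  ...     | inj₂ f = begin
                cnt k' v + cnt k' v                       ≡⟨ cong₂ _+_ eq' eq' ⟩
                suc (cnt k' (p t)) + suc (cnt k' (p t))   ≡⟨ cong suc (+-suc _ _) ⟩
                2 + (cnt k' (p t) + cnt k' (p t))         ≤⟨ +-monoʳ-≤ 2 (halves k k' kr k'r sub prog N (p t) (≤-trans (<⇒≤ (d-p< t t≢r)) (≤-trans (anc-depth t (p v) (top-anc k (p v))) l'))) ⟩
                2 + cnt k (p t)                           ≡⟨ sym eq ⟩
                cnt k v ∎
    where
    open ≤-Reasoning
    t = top k (p v)
    t' : k' t ≡ true
    t' = prog v q f
    t≢r : t ≢ r
    t≢r e = true≢false (trans (cong k' (sym e)) t') k'r
    kt : k t ≡ false
    kt with top-stop k (p v)
    ... | inj₁ e = ⊥-elim (t≢r e)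
    ... | inj₂ z = z
    kv : k v ≡ false
    kv = bool-false λ z → true≢false (sub v z) f
    eq' : cnt k' v ≡ suc (cnt k' (p t))
    eq' = trans (cnt-count k' v q f) (cong suc (trans (sym (top-preserves k (cnt k') (λ u uq ut → cnt-skip k' u uq (sub u ut)) (p v))) (cnt-skip k' t t≢r t')))
    eq : cnt k v ≡ 2 + cnt k (p t)
    eq = trans (cnt-count k v q kv) (cong suc (trans (sym (top-preserves k (cnt k) (cnt-skip k) (p v))) (cnt-count k t t≢r kt)))

  module _ (L : ℕ) (ID-bound : ∀ v → ID v < 2 ^ L) where

    sweep-inv : ∀ σ → DInv σ → SweepInv (merged σ) L (exec (sweep L) σ)
    sweep-inv σ I = loop-inv (SweepInv (merged σ)) L (λ i → merge i false ⨾ merge i true)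
      (λ i τ _ J → let s₁ = merge-spec i false τ (proj₁ J) in
         sweep-step (merged σ) i τ _ _ s₁ (merge-spec i true _ (Merges.inv s₁)) J)
      {σ} (I , (λ v h → h) , (λ v q f → inj₂ λ i ()))

    Halves : State → State → Set
    Halves σ σ' = DInv σ' × (∀ v → cnt (merged σ') v + cnt (merged σ') v ≤ cnt (merged σ) v)

    sweep-halves : ∀ σ σ' → SweepInv (merged σ) L σ' → Halves σ σ'
    sweep-halves σ σ' (I' , sub , prog) = I' , λ v → halves (merged σ) (merged σ') (merged-r σ) (merged-r σ') sub done (d v) v ≤-refl
      where
      done : ∀ v → v ≢ r → merged σ' v ≡ false → merged σ' (top (merged σ) (p v)) ≡ true
      done v q f with prog v q f
      ... | inj₁ t = t
      ... | inj₂ h = ⊥-elim (<⇒≱ (d-p< v q) (subst (λ z → d z ≤ d (p v)) (sym same) (anc-depth _ (p v) (top-anc (merged σ) (p v)))))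
        where
        same : v ≡ top (merged σ) (p v)
        same = ID-inj _ _ (bits-ext L _ _ (ID-bound v) (ID-bound _) h)

    Sweeps : ℕ → State → Set
    Sweeps h τ = DInv τ × (∀ v → 2 ^ h * cnt (merged τ) v ≤ d v)

    sweeps-step : ∀ h τ τ' → Halves τ τ' → Sweeps h τ → Sweeps (suc h) τ'
    sweeps-step h τ τ' (J' , hv) (J , c) = J' , λ v → begin
        2 ^ suc h * cnt (merged τ') v                         ≡⟨ solve 2 (λ a b → (con 2 :* a) :* b := a :* (b :+ b)) refl (2 ^ h) (cnt (merged τ') v) ⟩
        2 ^ h * (cnt (merged τ') v + cnt (merged τ') v)       ≤⟨ *-monoʳ-≤ (2 ^ h) (hv v) ⟩
        2 ^ h * cnt (merged τ) v                              ≤⟨ c v ⟩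
        d v ∎
      where
      open ≤-Reasoning
      open +-*-Solver using (solve; _:*_; _:+_; _:=_; con)

    sweeps-done : ∀ H τ → n ≤ 2 ^ H → Sweeps H τ → ∀ v → τ v ! rD ≡ d v
    sweeps-done H τ hn (I' , c) v = trans (sym (trans (cong (λ z → τ v ! rD + d z) top≡r) (trans (cong (τ v ! rD +_) d-r) (+-identityʳ _)))) (DInv.off-ok I' v)
      where
      cnt0 : ∀ v → cnt (merged τ) v ≡ 0
      cnt0 v with cnt (merged τ) v | c v
      ... | zero | _ = refl
      ... | suc c | l = ⊥-elim (<⇒≱ (depth< v) (≤-trans hn (≤-trans (≤-trans (≤-reflexive (sym (*-identityʳ _))) (*-monoʳ-≤ (2 ^ H) (s≤s z≤n))) l)))
      all-merged : ∀ v → v ≢ r → merged τ v ≡ true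
      all-merged v q with bool-case (merged τ v)
      ... | inj₁ t = t
      ... | inj₂ f = case trans (sym (cnt0 v)) (cnt-count (merged τ) v q f) of λ ()
      top≡r : top (merged τ) v ≡ r
      top≡r with top-stop (merged τ) v
      ... | inj₁ e = e
      ... | inj₂ f = case top (merged τ) v ≟F r of λ { (yes e) → e ; (no ne) → ⊥-elim (true≢false (all-merged _ ne) f) }

    DInv-start : ∀ σ → (∀ v → σ v ! rID ≡ ID v) → (∀ v → σ v ! rLAB ≡ ID v) → (∀ v → σ v ! rD ≡ 0) → (∀ v → σ v ! rMRG ≡ 0) → DInv σ
    DInv-start σ hid hl hd hm = record
      { id-ok = hid
      ; lab-ok = λ v → trans (hl v) (cong ID (sym (top-fix _ v (k0 v))))
      ; off-ok = λ v → trans (cong₂ (λ a b → a + d b) (hd v) (top-fix _ v (k0 v))) refl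
      ; mrg-ok = λ v → inj₁ (hm v) }
      where
      ∧-f : ∀ b → b ∧ false ≡ false
      ∧-f true = refl
      ∧-f false = refl
      k0 : ∀ v → merged σ v ≡ false
      k0 v = trans (cong (λ z → not (v ≐ r) ∧ (z ≡ᵇ 1)) (hm v)) (∧-f (not (v ≐ r)))

    depth-correct : ∀ H σ → n ≤ 2 ^ H → (∀ v → σ v ! rID ≡ ID v) → (∀ v → σ v ! rD ≡ 0) → (∀ v → σ v ! rMRG ≡ 0) →
      ∀ v → exec (depthProg H L) σ v ! rD ≡ d v
    depth-correct H σ hn hid hd hm = sweeps-done H _ hn
      (loop-inv Sweeps H (λ _ → sweep L)
        (λ h τ _ J → sweeps-step h τ _ (sweep-halves τ _ (sweep-inv τ (proj₁ J))) J)
        (I₀ , λ v → ≤-trans (≤-reflexive (*-identityˡ _)) (cnt≤d _ v)))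
      where
      I₀ = DInv-start (exec (mk add add silent never (con 0) ((rLAB , own# rID) ∷ [])) σ) hid hid hd hm

∑-two : ∀ {n} (f : Fin n → ℕ) i j → i ≢ j → f i + f j ≤ ∑ f
∑-two f zero zero ne = ⊥-elim (ne refl)
∑-two f zero (suc j) ne = +-monoʳ-≤ (f zero) (fold-≥ add (f ∘ suc) j)
∑-two f (suc i) zero ne = ≤-trans (≤-reflexive (+-comm (f (suc i)) (f zero))) (+-monoʳ-≤ (f zero) (fold-≥ add (f ∘ suc) i))
∑-two f (suc i) (suc j) ne = ≤-trans (∑-two (f ∘ suc) i j (λ { refl → ne refl })) (m≤n+m _ (f zero))

-- The division into subtrees is not given to the nodes. A subtree is recognised by its node of
-- depth 1: all tree edges with a deeper lower end are contracted, and the ID of that node is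
-- spread.
tauProg totalProg : Prog
tauProg = mk add mx silent (λ a b → 1 <ᵇ a ! rD) (ite (λ ε → Env.own ε ! rD ≡ᵇ 1) (own# rID) (con 0)) ((rTAU , yy#) ∷ [])
totalProg = mk add add (everywhere wt#) (λ _ _ → true) zz# ((rKK , yy#) ∷ [])

-- Levels (Strahler numbers).  Register T marks finished nodes; in each phase the nodes
-- whose unfinished part of the subtree is a path become finished.

levelCount levelMark : Prog
levelCount = mk add add (downward (ite (λ ε → Env.oth ε ! rT ≡ᵇ 0) (con 1) (con 0))) never (con 0) ((rCNT , zz#) ∷ [])
levelMark = mk add mx silent (λ a b → (a ! rT ≡ᵇ 0) ∧ (b ! rCNT <ᵇ 2))
  (ite (λ ε → (Env.own ε ! rT ≡ᵇ 0) ∧ (Env.own ε ! rCNT ≡ᵇ 0)) (con 1) (con 0))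
  ((rT , ite (λ ε → Env.yy ε ≡ᵇ 0) (own# rT) (con 1))
   ∷ (rLEV , ite (λ ε → (Env.own ε ! rT ≡ᵇ 0) ∧ (Env.yy ε ≡ᵇ 0)) (own# rLEV ⊞ con 1) (own# rLEV)) ∷ [])

levelProg : ℕ → Prog
levelProg H = loop H (λ _ → levelCount ⨾ levelMark)

module LevelPhase {n m : ℕ} {ends : Fin m → Fin n × Fin n} {inT par : Fin m → Bool} {r : Fin n}
               (R : Rooted ends inT par r) (loopless : ∀ e → proj₁ (ends e) ≢ proj₂ (ends e)) (w : Fin m → ℕ) where
  open Rooted R
  open TreeFacts R
  open TreeRun R loopless w

  deep : V → Bool
  deep v = not (v ≐ r) ∧ (1 <ᵇ d v)

  branch : V → V
  branch = top deep

  branch-depth : ∀ v → v ≢ r → d (branch v) ≡ 1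
  branch-depth = top-ind deep (λ v → v ≢ r → d (branch v) ≡ 1)
    (λ v h q → trans (cong d (top-fix' deep v h)) (case h of λ
      { (inj₁ e) → ⊥-elim (q e)
      ; (inj₂ f) → ≤-antisym (≮⇒≥ (λ l → true≢false (∧-i (not-t (≐-false q)) (<ᵇ-true l)) f))
                             (subst (1 ≤_) (sym (d-p v q)) (s≤s z≤n)) }))
    (λ v q t ih _ → trans (cong d (top-step deep v q t))
      (ih (λ e → <⇒≱ (<ᵇ-sound {1} (∧-r {not (v ≐ r)} t)) (≤-reflexive (trans (d-p v q) (cong suc (trans (cong d e) d-r)))))))

  branch-p : ∀ v → v ≢ r → p v ≢ r → branch v ≡ branch (p v)
  branch-p v q qp = top-step deep v q (∧-i (not-t (≐-false q)) (<ᵇ-true (subst (1 <_) (sym (d-p v q)) (s≤s (subst (1 ≤_) (sym (d-p (p v) qp)) (s≤s z≤n))))))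

  branch-anc : ∀ a v → a ≢ r → anc a v ≡ true → branch v ≡ branch a
  branch-anc a v qa = tree-ind (λ v → anc a v ≡ true → branch v ≡ branch a)
    (λ h → ⊥-elim (qa (≐-sound (trans (sym (anc-r a)) h))))
    (λ v q ih h → case a ≟F v of λ
      { (yes refl) → refl
      ; (no ne) → let ap = anc-down a v q h ne in
          trans (branch-p v q (λ e → qa (≐-sound (trans (sym (anc-r a)) (trans (cong (anc a) (sym e)) ap))))) (ih ap) }) v

  tau-correct : ∀ σ (ID : V → ℕ) → (∀ v → σ v ! rID ≡ ID v) → (∀ v → σ v ! rD ≡ d v) →
    ∀ v → v ≢ r → exec tauProg σ v ! rTAU ≡ ID (branch v)
  tau-correct σ ID hid hd v q = begin
      Yv S σ v                    ≡⟨ Y-top S σ v ⟩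
      _                           ≡⟨ gather mx (kOf S σ) (Xv S σ) zero-deep v ⟩
      Xv S σ (top (kOf S σ) v)    ≡⟨ cong (Xv S σ) (top-cong (λ u → cong (λ z → not (u ≐ r) ∧ (1 <ᵇ z)) (hd u)) v) ⟩
      Xv S σ (branch v)           ≡⟨ cong (λ b → if b then σ (branch v) ! rID else 0) (==-true (trans (hd (branch v)) (branch-depth v q))) ⟩
      σ (branch v) ! rID          ≡⟨ hid (branch v) ⟩
      ID (branch v) ∎
    where
    open ≡-Reasoning
    S : Step
    S = mkStep add mx silent (λ a b → 1 <ᵇ a ! rD) (ite (λ ε → Env.own ε ! rD ≡ᵇ 1) (own# rID) (con 0)) ((rTAU , yy#) ∷ []) tt
    zero-deep : ∀ u → u ≢ r → kOf S σ u ≡ true → Xv S σ u ≡ 0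
    zero-deep u _ t = cong (λ b → if b then σ u ! rID else 0) (==-false {σ u ! rD} (λ e → <⇒≱ (<ᵇ-sound {1} {σ u ! rD} (∧-r {not (u ≐ r)} t)) (≤-reflexive e)))

  total-correct : ∀ σ v → exec totalProg σ v ! rKK ≡ ⟪ (λ _ _ → true) ⟫
  total-correct σ v = trans (Y-top S σ v) (trans (fold-cong add (λ u → cong (_▸ Zv S σ u) (≐-true (trans (all-r u) (sym (all-r v))))))
      (Z-weight S σ (λ _ _ → true) refl (λ _ _ _ _ → refl) (λ _ → true)))
    where
    S : Step
    S = mkStep add add (everywhere wt#) (λ _ _ → true) zz# ((rKK , yy#) ∷ []) tt
    all-r : ∀ u → top (kOf S σ) u ≡ r
    all-r u with top-stop (kOf S σ) u
    ... | inj₁ e = e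
    ... | inj₂ f = case top (kOf S σ) u ≟F r of λ { (yes e) → e ; (no ne) → ⊥-elim (true≢false (∧-i (not-t (≐-false ne)) refl) f) }

  sz : V → ℕ
  sz v = ∑ (λ u → 𝟙 (anc v u))

  sz≤n : ∀ v → sz v ≤ n
  sz≤n v = subst (sz v ≤_) (*-identityʳ n) (fold-bound add {n} {λ u → 𝟙 (anc v u)} {1} (λ x → 𝟙-mono {b = true} (λ _ → refl)))

  sz-anc : ∀ a b → anc a b ≡ true → sz b ≤ sz a
  sz-anc a b h = ∑-mono λ u → 𝟙-mono (λ h' → anc-trans a b u h h')

  sz-children : ∀ a b → a ≢ r → b ≢ r → p a ≡ p b → a ≢ b → sz a + sz b ≤ sz (p a)
  sz-children a b qa qb e ne = subst (_≤ sz (p a)) (∑-+ (λ u → 𝟙 (anc a u)) (λ u → 𝟙 (anc b u))) (∑-mono pointwise)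
    where
    up₁ : ∀ x y u → x ≢ r → p x ≡ y → anc x u ≡ true → anc y u ≡ true
    up₁ x y u q refl h = anc-trans (p x) x u (anc-up (p x) x q (anc-refl (p x))) h
    da : d a ≡ d b
    da = trans (d-p a qa) (trans (cong (suc ∘ d) e) (sym (d-p b qb)))
    pointwise : ∀ u → 𝟙 (anc a u) + 𝟙 (anc b u) ≤ 𝟙 (anc (p a) u)
    pointwise u with anc a u in ha | anc b u in hb
    ... | false | false = z≤n
    ... | true | false rewrite up₁ a (p a) u qa refl ha = ≤-refl
    ... | false | true rewrite up₁ b (p a) u qb (sym e) hb = ≤-refl
    ... | true | true = ⊥-elim (ne (anc-same a b (anc-comp a b u ha hb (≤-reflexive da)) (≤-reflexive (sym da))))

  unf : State → V → Bool
  unf σ v = σ v ! rT ≡ᵇ 0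

  kids : State → V → ℕ
  kids σ v = ∑ (λ c → (not (c ≐ r) ∧ (v ≐ p c)) ▸ 𝟙 (unf σ c))

  kids-≥1 : ∀ σ v c → c ≢ r → p c ≡ v → unf σ c ≡ true → 1 ≤ kids σ v
  kids-≥1 σ v c q e h = ≤-trans (≤-reflexive (sym (one c q e h))) (fold-≥ add (λ c → (not (c ≐ r) ∧ (v ≐ p c)) ▸ 𝟙 (unf σ c)) c)
    where
    one : ∀ c → c ≢ r → p c ≡ v → unf σ c ≡ true → ((not (c ≐ r) ∧ (v ≐ p c)) ▸ 𝟙 (unf σ c)) ≡ 1
    one c q e h = cong₂ (λ a b → a ▸ 𝟙 b) (∧-i (not-t (≐-false q)) (≐-true (sym e))) h

  kids-≥2 : ∀ σ v c c' → c ≢ r → c' ≢ r → p c ≡ v → p c' ≡ v → unf σ c ≡ true → unf σ c' ≡ true → c ≢ c' → 2 ≤ kids σ v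
  kids-≥2 σ v c c' q q' e e' h h' ne = ≤-trans (≤-reflexive (sym (cong₂ _+_ (one c q e h) (one c' q' e' h')))) (∑-two (λ c → (not (c ≐ r) ∧ (v ≐ p c)) ▸ 𝟙 (unf σ c)) c c' ne)
    where
    one : ∀ c → c ≢ r → p c ≡ v → unf σ c ≡ true → ((not (c ≐ r) ∧ (v ≐ p c)) ▸ 𝟙 (unf σ c)) ≡ 1
    one c q e h = cong₂ (λ a b → a ▸ 𝟙 b) (∧-i (not-t (≐-false q)) (≐-true (sym e))) h

  kid : ∀ σ v c → ((not (c ≐ r) ∧ (v ≐ p c)) ▸ 𝟙 (unf σ c)) ≢ 0 → (c ≢ r) × (p c ≡ v) × (unf σ c ≡ true)
  kid σ v c h with not (c ≐ r) in a | v ≐ p c in b | unf σ c in u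
  ... | true | true | true = (λ e → true≢false (≐-true e) (not-f a)) , sym (≐-sound b) , refl
  ... | true | true | false = ⊥-elim (h refl)
  ... | true | false | _ = ⊥-elim (h refl)
  ... | false | _ | _ = ⊥-elim (h refl)

  contractible : State → V → Bool
  contractible σ v = not (v ≐ r) ∧ (unf σ v ∧ (kids σ (p v) <ᵇ 2))

  -- `big` is the Strahler bound: a node that survives `s` phases has a subtree of at least `2 ^ s`
  -- nodes, so logarithmically many phases suffice. `mono` and `chain` say that levels do not
  -- decrease towards the root and that a node has at most one child of its own level, so equal
  -- levels form vertical paths.
  record LInv (s : ℕ) (σ : State) : Set where
    field
      up-closed : ∀ v → v ≢ r → unf σ v ≡ true → unf σ (p v) ≡ true
      lev-unf : ∀ v → unf σ v ≡ true → σ v ! rLEV ≡ s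
      lev-fin : ∀ v → unf σ v ≡ false → σ v ! rLEV < s
      mono : ∀ v → v ≢ r → unf σ v ≡ false → unf σ (p v) ≡ false → σ v ! rLEV ≤ σ (p v) ! rLEV
      chain : ∀ c c' → c ≢ r → c' ≢ r → p c ≡ p c' → unf σ (p c) ≡ false →
        σ c ! rLEV ≡ σ (p c) ! rLEV → σ c' ! rLEV ≡ σ (p c) ! rLEV → c ≡ c'
      big : ∀ v → unf σ v ≡ true → 2 ^ s ≤ sz v

  -- For an unfinished node, `hit` means that its chain of contracted edges ends in an unfinished
  -- node without unfinished children, so that the unfinished part below it is a path.
  record LStep (σ σ' : State) : Set where
    field
      hit : V → Bool
      hit-i : ∀ u v → top (contractible σ) u ≡ top (contractible σ) v → unf σ u ≡ true → kids σ u ≡ 0 → hit v ≡ true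
      hit-e : ∀ v → hit v ≡ true → Σ V λ u → (top (contractible σ) u ≡ top (contractible σ) v) × (unf σ u ≡ true) × (kids σ u ≡ 0)
      unf' : ∀ v → unf σ' v ≡ unf σ v ∧ not (hit v)
      lev' : ∀ v → σ' v ! rLEV ≡ (if unf σ v ∧ not (hit v) then suc (σ v ! rLEV) else σ v ! rLEV)

  level-step-spec : ∀ σ → LStep σ (exec (levelCount ⨾ levelMark) σ)
  level-step-spec σ = record
    { hit = λ v → not (Yv S₂ σ₁ v ≡ᵇ 0)
    ; hit-i = λ u v e hu hk → not-t (==-false (λ z → case ≤-trans (≤-trans (≤-reflexive (sym (cong₂ (λ a b → a ▸ b) (≐-true e) (cong (λ b → if b then 1 else 0) (∧-i hu (==-true (trans (cnt₁ u) hk)))))))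
                                                          (fold-≥ mx (λ u → (top K u ≐ top K v) ▸ Xv S₂ σ₁ u) u)) (≤-reflexive (trans (sym (Y v)) z)) of λ ()))
    ; hit-e = λ v h → hit-e v (λ z → true≢false h (cong not (==-true z)))
    ; unf' = λ v → unf' (σ v ! rT) (Yv S₂ σ₁ v)
    ; lev' = λ v → lev' (σ v ! rT ≡ᵇ 0) (Yv S₂ σ₁ v ≡ᵇ 0) (σ v ! rLEV)
    }
    where
    S₁ S₂ : Step
    S₁ = mkStep add add (downward (ite (λ ε → Env.oth ε ! rT ≡ᵇ 0) (con 1) (con 0))) never (con 0) ((rCNT , zz#) ∷ []) tt
    S₂ = mkStep add mx silent (λ a b → (a ! rT ≡ᵇ 0) ∧ (b ! rCNT <ᵇ 2))
      (ite (λ ε → (Env.own ε ! rT ≡ᵇ 0) ∧ (Env.own ε ! rCNT ≡ᵇ 0)) (con 1) (con 0))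
      ((rT , ite (λ ε → Env.yy ε ≡ᵇ 0) (own# rT) (con 1))
       ∷ (rLEV , ite (λ ε → (Env.own ε ! rT ≡ᵇ 0) ∧ (Env.yy ε ≡ᵇ 0)) (own# rLEV ⊞ con 1) (own# rLEV)) ∷ []) tt
    σ₁ : State
    σ₁ = exec levelCount σ
    K : V → Bool
    K = contractible σ
    cnt₁ : ∀ v → σ₁ v ! rCNT ≡ kids σ v
    cnt₁ v = Z-dn S₁ σ (λ ρ ρ' → 𝟙 (ρ' ! rT ≡ᵇ 0)) refl (λ _ → refl) (λ _ → refl) (λ _ _ _ → refl) v
    K-eq : ∀ v → kOf S₂ σ₁ v ≡ K v
    K-eq v = cong (λ z → not (v ≐ r) ∧ (unf σ v ∧ (z <ᵇ 2))) (cnt₁ (p v))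
    Y : ∀ v → Yv S₂ σ₁ v ≡ ⨆ (λ u → (top K u ≐ top K v) ▸ Xv S₂ σ₁ u)
    Y v = trans (Y-top S₂ σ₁ v) (fold-cong mx λ u → cong₂ (λ a b → (a ≐ b) ▸ Xv S₂ σ₁ u) (top-cong K-eq u) (top-cong K-eq v))
    hit-e : ∀ v → Yv S₂ σ₁ v ≢ 0 → Σ V λ u → (top K u ≡ top K v) × (unf σ u ≡ true) × (kids σ u ≡ 0)
    hit-e v h with fold-≢0 mx (λ u → (top K u ≐ top K v) ▸ Xv S₂ σ₁ u) (λ z → h (trans (Y v) z))
    ... | u , q with top K u ≐ top K v in e | (unf σ u ∧ (σ₁ u ! rCNT ≡ᵇ 0)) in c
    ...   | true | true = u , ≐-sound e , ∧-l c , trans (sym (cnt₁ u)) (==-sound (∧-r {unf σ u} c))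
    ...   | true | false = ⊥-elim (q refl)
    ...   | false | _ = ⊥-elim (q refl)
    unf' : ∀ t y → ((if y ≡ᵇ 0 then t else 1) ≡ᵇ 0) ≡ (t ≡ᵇ 0) ∧ not (not (y ≡ᵇ 0))
    unf' zero zero = refl
    unf' (suc t) zero = refl
    unf' zero (suc y) = refl
    unf' (suc t) (suc y) = refl
    lev' : ∀ a b l → (if a ∧ b then l + 1 else l) ≡ (if a ∧ not (not b) then suc l else l)
    lev' true true l = +-comm l 1
    lev' true false l = refl
    lev' false _ l = refl

  module LevelStep (s : ℕ) (σ σ' : State) (I : LInv s σ) (st : LStep σ σ') where
    open LInv I
    open LStep st

    K : V → Bool
    K = contractible σ

    K-uniq : ∀ c c' → c ≢ r → c' ≢ r → K c ≡ true → K c' ≡ true → p c ≡ p c' → c ≡ c'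
    K-uniq c c' q q' h h' e with c ≟F c'
    ... | yes z = z
    ... | no ne = ⊥-elim (<⇒≱ (<ᵇ-sound {kids σ (p c)} (∧-r {unf σ c} (∧-r {not (c ≐ r)} h)))
        (kids-≥2 σ (p c) c c' q q' refl (sym e) (∧-l (∧-r {not (c ≐ r)} h)) (∧-l (∧-r {not (c' ≐ r)} h')) ne))

    unf-anc : ∀ a v → anc a v ≡ true → unf σ v ≡ true → unf σ a ≡ true
    unf-anc a = tree-ind (λ v → anc a v ≡ true → unf σ v ≡ true → unf σ a ≡ true)
      (λ h u → subst (λ z → unf σ z ≡ true) (sym (≐-sound (trans (sym (anc-r a)) h))) u)
      λ v q ih h u → case a ≟F v of λ { (yes refl) → u ; (no ne) → ih (anc-down a v q h ne) (up-closed v q u) }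

    -- The end of the chain of `v` cannot lie above `v`, as the path down to `v` would give it an
    -- unfinished child. So the chain continues below `v`, and contracting its next edge requires
    -- that `v` has fewer than two unfinished children.
    hit-kid : ∀ v c → c ≢ r → p c ≡ v → unf σ c ≡ true → unf σ v ≡ true → hit v ≡ true → K c ≡ true
    hit-kid v c q e uc uv h with hit-e v h
    ... | l , te , ul , kl = ∧-i (not-t (≐-false q)) (∧-i uc (<ᵇ-true (subst (λ z → kids σ z < 2) (sym e) (case ≤-total (d l) (d v) of λ { (inj₁ x) → above x ; (inj₂ x) → below x }))))
      where
      above : d l ≤ d v → kids σ v < 2
      above x with l ≟F v
      ... | yes refl = ⊥-elim (<⇒≱ (kids-≥1 σ v c q e uc) (≤-reflexive kl))
      ... | no ne with child-towards l v (chain-comparable K K-uniq v l te x) ne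
      ...   | y , yr , py , ay = ⊥-elim (<⇒≱ (kids-≥1 σ l y yr py (unf-anc y v ay uv)) (≤-reflexive kl))
      below : d v ≤ d l → kids σ v < 2
      below x with l ≟F v
      ... | yes refl = ⊥-elim (<⇒≱ (kids-≥1 σ v c q e uc) (≤-reflexive kl))
      ... | no ne with child-towards v l (chain-comparable K K-uniq l v (sym te) x) (λ z → ne (sym z))
      ...   | y , yr , refl , ay with bool-case (K y)
      ...     | inj₁ t = <ᵇ-sound (∧-r {unf σ y} (∧-r {not (y ≐ r)} t))
      ...     | inj₂ f = ⊥-elim (<⇒≱ (d-p< y yr) (≤-trans (anc-depth y (top K l) (top-blocked K y l ay f)) (≤-trans (≤-reflexive (cong d te)) (anc-depth _ v (top-anc K v)))))

    unf'-e : ∀ v → unf σ' v ≡ true → (unf σ v ≡ true) × (hit v ≡ false)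
    unf'-e v h = let q = trans (sym (unf' v)) h in ∧-l q , not-f (∧-r {unf σ v} q)

    fin'-e : ∀ v → unf σ' v ≡ false → (unf σ v ≡ false) ⊎ ((unf σ v ≡ true) × (hit v ≡ true))
    fin'-e v h with unf σ v | hit v | trans (sym (unf' v)) h
    ... | false | _ | _ = inj₁ refl
    ... | true | true | _ = inj₂ (refl , refl)

    lev-grow : ∀ v → unf σ' v ≡ true → σ' v ! rLEV ≡ suc s
    lev-grow v h = trans (lev' v) (trans (cong (λ b → if b then suc (σ v ! rLEV) else σ v ! rLEV) (trans (sym (unf' v)) h)) (cong suc (lev-unf v (proj₁ (unf'-e v h)))))

    lev-keep : ∀ v → unf σ' v ≡ false → σ' v ! rLEV ≡ σ v ! rLEV
    lev-keep v h = trans (lev' v) (cong (λ b → if b then suc (σ v ! rLEV) else σ v ! rLEV) (trans (sym (unf' v)) h))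

    hit-down : ∀ v → v ≢ r → unf σ v ≡ true → hit (p v) ≡ true → hit v ≡ true
    hit-down v q u h with hit-e (p v) h
    ... | l , te , ul , kl = hit-i l v (trans te (sym (top-step K v q (hit-kid (p v) v q refl u (up-closed v q u) h)))) ul kl

    -- A node that is not hit has unfinished children. Two of them have disjoint subtrees of `2 ^ s`
    -- nodes each; a single one is not hit either, and the search continues there. `N` bounds the
    -- depth still available.
    double-size : ∀ N v → n ∸ d v ≤ N → unf σ v ≡ true → hit v ≡ false → 2 ^ suc s ≤ sz v
    double-size N v l u h with kids σ v ≟ 0
    ... | yes z = ⊥-elim (true≢false (hit-i v v refl u z) h)
    ... | no nz with fold-≢0 add _ nz
    ...   | c , cz with kid σ v c cz
    ...     | q , e , uc with search (λ x → not (x ≐ c) ∧ (not (x ≐ r) ∧ ((v ≐ p x) ∧ unf σ x)))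
    ...       | inj₁ (x , hx) = subst (2 ^ suc s ≤_) (cong sz e) (begin
                    2 ^ suc s            ≡⟨ 2^suc s ⟩
                    2 ^ s + 2 ^ s        ≤⟨ +-mono-≤ (big c uc) (big x (∧-r {v ≐ p x} (∧-r {not (x ≐ r)} (∧-r {not (x ≐ c)} hx)))) ⟩
                    sz c + sz x          ≤⟨ sz-children c x q (λ z → true≢false (≐-true z) (not-f (∧-l (∧-r {not (x ≐ c)} hx)))) (trans e (≐-sound (∧-l {v ≐ p x} (∧-r {not (x ≐ r)} (∧-r {not (x ≐ c)} hx))))) (λ z → true≢false (≐-true (sym z)) (not-f (∧-l hx))) ⟩
                    sz (p c) ∎)
      where open ≤-Reasoning
    ...       | inj₂ none = ≤-trans (descend N l) (sz-anc v c (subst (λ z → anc z c ≡ true) e (anc-up (p c) c q (anc-refl (p c)))))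
      where
      single : kids σ v < 2
      single = s≤s (≤-trans (≤-reflexive (fold-single add c other)) (≤-trans (▸≤ (not (c ≐ r) ∧ (v ≐ p c)) (𝟙 (unf σ c))) (𝟙-mono {b = true} (λ _ → refl))))
        where
        ▸≤ : ∀ b x → b ▸ x ≤ x
        ▸≤ true x = ≤-refl
        ▸≤ false x = z≤n
        other : ∀ x → x ≢ c → ((not (x ≐ r) ∧ (v ≐ p x)) ▸ 𝟙 (unf σ x)) ≡ 0
        other x ne with not (x ≐ r) in a | v ≐ p x in b | unf σ x in ux
        ... | true | true | true = ⊥-elim (true≢false (∧-i (not-t (≐-false ne)) (∧-i a (∧-i b ux))) (none x))
        ... | true | true | false = refl
        ... | true | false | _ = refl
        ... | false | _ | _ = refl
      Kc : K c ≡ true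
      Kc = ∧-i (not-t (≐-false q)) (∧-i uc (<ᵇ-true (subst (λ z → kids σ z < 2) (sym e) single)))
      hc : hit c ≡ false
      hc = bool-false λ t → let (y , te , uy , ky) = hit-e c t in
        true≢false (hit-i y v (trans te (trans (top-step K c q Kc) (cong (top K) e))) uy ky) h
      dc : d c ≡ suc (d v)
      dc = trans (d-p c q) (cong (suc ∘ d) e)
      descend : ∀ N → n ∸ d v ≤ N → 2 ^ suc s ≤ sz c
      descend zero l = ⊥-elim (<⇒≱ (m<n⇒0<n∸m (depth< v)) l)
      descend (suc N) l = double-size N c (≤-pred (≤-trans (≤-reflexive (trans (cong (λ z → suc (n ∸ z)) dc) (sym (+-∸-assoc 1 (depth< v))))) l)) uc hc

    inv : LInv (suc s) σ'
    inv = record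
      { up-closed = λ v q h → let (u , nh) = unf'-e v h in
          trans (unf' (p v)) (∧-i (up-closed v q u) (not-t (bool-false λ t → true≢false (hit-down v q u t) nh)))
      ; lev-unf = lev-grow
      ; lev-fin = λ v h → subst (_< suc s) (sym (lev-keep v h)) (fin< v h)
      ; mono = λ v q h h' → subst₂ _≤_ (sym (lev-keep v h)) (sym (lev-keep (p v) h')) (mono' v q (fin'-e v h) (fin'-e (p v) h'))
      ; chain = chain'
      ; big = λ v h → let (u , nh) = unf'-e v h in double-size (n ∸ d v) v ≤-refl u nh
      }
      where
      fin< : ∀ v → unf σ' v ≡ false → σ v ! rLEV < suc s
      fin< v h with fin'-e v h
      ... | inj₁ f = <-trans (lev-fin v f) (n<1+n s)
      ... | inj₂ (u , _) = s≤s (≤-reflexive (lev-unf v u))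
      mono' : ∀ v → v ≢ r → (unf σ v ≡ false) ⊎ ((unf σ v ≡ true) × (hit v ≡ true)) → (unf σ (p v) ≡ false) ⊎ ((unf σ (p v) ≡ true) × (hit (p v) ≡ true)) → σ v ! rLEV ≤ σ (p v) ! rLEV
      mono' v q (inj₁ f) (inj₁ g) = mono v q f g
      mono' v q (inj₁ f) (inj₂ (u , _)) = ≤-trans (<⇒≤ (lev-fin v f)) (≤-reflexive (sym (lev-unf (p v) u)))
      mono' v q (inj₂ (u , _)) (inj₁ g) = ⊥-elim (true≢false (up-closed v q u) g)
      mono' v q (inj₂ (u , _)) (inj₂ (u' , _)) = ≤-reflexive (trans (lev-unf v u) (sym (lev-unf (p v) u')))
      fin-kid : ∀ c → c ≢ r → unf σ (p c) ≡ false → unf σ c ≡ false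
      fin-kid c q f = bool-false λ t → true≢false (up-closed c q t) f
      chain' : ∀ c c' → c ≢ r → c' ≢ r → p c ≡ p c' → unf σ' (p c) ≡ false → σ' c ! rLEV ≡ σ' (p c) ! rLEV → σ' c' ! rLEV ≡ σ' (p c) ! rLEV → c ≡ c'
      chain' c c' q q' e f l l' with fin'-e (p c) f
      ... | inj₁ g = chain c c' q q' e g (old c q refl l) (old c' q' e l')
        where
        old : ∀ x → x ≢ r → p c ≡ p x → σ' x ! rLEV ≡ σ' (p c) ! rLEV → σ x ! rLEV ≡ σ (p c) ! rLEV
        old x qx ex lx = trans (sym (lev-keep x (trans (unf' x) (cong (_∧ not (hit x)) (fin-kid x qx (trans (cong (unf σ) (sym ex)) g)))))) (trans lx (lev-keep (p c) f))
      ... | inj₂ (u , h) = K-uniq c c' q q' (hit-kid (p c) c q refl (new c q refl l) u h) (hit-kid (p c) c' q' (sym e) (new c' q' e l') u h) e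
        where
        new : ∀ x → x ≢ r → p c ≡ p x → σ' x ! rLEV ≡ σ' (p c) ! rLEV → unf σ x ≡ true
        new x qx ex lx with bool-case (unf σ x)
        ... | inj₁ t = t
        ... | inj₂ g = ⊥-elim (<⇒≱ (lev-fin x g) (≤-reflexive (trans (sym (lev-unf (p c) u)) (trans (sym (lev-keep (p c) f)) (trans (sym lx) (lev-keep x (trans (unf' x) (cong (_∧ not (hit x)) g))))))))

  record LevelsOK (H : ℕ) (lev : V → ℕ) : Set where
    field
      lev< : ∀ v → lev v < H
      lev-mono : ∀ v → v ≢ r → lev v ≤ lev (p v)
      lev-chain : ∀ c c' → c ≢ r → c' ≢ r → p c ≡ p c' → lev c ≡ lev (p c) → lev c' ≡ lev (p c) → c ≡ c'

  level-correct : ∀ H σ → n < 2 ^ H → (∀ v → σ v ! rT ≡ 0) → (∀ v → σ v ! rLEV ≡ 0) →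
    LevelsOK H (λ v → exec (levelProg H) σ v ! rLEV)
  level-correct H σ hn hT hL = finish _ (loop-inv LInv H (λ _ → levelCount ⨾ levelMark) (λ s τ _ I → LevelStep.inv s τ _ I (level-step-spec τ)) {σ} start)
    where
    un : ∀ v → unf σ v ≡ true
    un v = ==-true (hT v)
    start : LInv 0 σ
    start = record
      { up-closed = λ v _ _ → un (p v)
      ; lev-unf = λ v _ → hL v
      ; lev-fin = λ v f → ⊥-elim (true≢false (un v) f)
      ; mono = λ v _ f _ → ⊥-elim (true≢false (un v) f)
      ; chain = λ c c' _ _ _ f _ _ → ⊥-elim (true≢false (un (p c)) f)
      ; big = λ v _ → ≤-trans (≤-reflexive (cong 𝟙 (sym (anc-refl v)))) (fold-≥ add (λ u → 𝟙 (anc v u)) v) }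
    finish : ∀ τ → LInv H τ → LevelsOK H (λ v → τ v ! rLEV)
    finish τ I = record
      { lev< = λ v → LInv.lev-fin I v (fin v)
      ; lev-mono = λ v q → LInv.mono I v q (fin v) (fin (p v))
      ; lev-chain = λ c c' q q' e l l' → LInv.chain I c c' q q' e (fin (p c)) l l' }
      where
      fin : ∀ v → unf τ v ≡ false
      fin v = bool-false λ t → <⇒≱ hn (≤-trans (LInv.big I v t) (sz≤n v))

-- Stars of paths.  The kept edges (named by their children) form vertical paths; all other
-- tree edges are contracted.  PID is 1 + the ID of the top of the path of the nearest kept
-- ancestor (0 if there is none) and POS is 1 + twice the depth of that ancestor.

posProg pidProg setupProg : (Mem → Bool) → Prog
posProg keep = mk add mx silent (λ a b → not (keep a)) (ite (λ ε → keep (Env.own ε)) (own# rD ⊞ own# rD ⊞ con 1) (con 0)) ((rPOS , yy#) ∷ [])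
pidProg keep = mk mx mx (upward (ite (λ ε → keep (Env.oth ε)) (con 1) (con 0))) (λ a b → not (keep a) ∨ keep b)
  (ite (λ ε → keep (Env.own ε) ∧ (Env.zz ε ≡ᵇ 0)) (own# rID ⊞ con 1) (con 0)) ((rPID , yy#) ∷ (rBLK , con 0) ∷ [])
setupProg keep = posProg keep ⨾ pidProg keep

φ : ℕ → Mem → ℕ × ℕ × ℕ
φ h ρ = ρ ! rPID , ρ ! rBLK , shr h (ρ ! rPOS)

-- Suffix sums of register X along the segments of equal PID and BLK, by dyadic blocks of POS.
suffixStart : Prog
suffixStart = mk add add silent (λ a b → eq₃ (φ 0 a) (φ 0 b)) (own# rX) ((rS , yy#) ∷ [])

suffixStep : ℕ → Prog
suffixStep h = mk add add silent (λ a b → eq₃ (φ (suc h) a) (φ (suc h) b))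
  (ite (λ ε → bit h (Env.own ε ! rPOS)) (own# rX) (con 0))
  ((rS , ite (λ ε → bit h (Env.own ε ! rPOS)) (own# rS) (own# rS ⊞ yy#)) ∷ [])

suffixProg : ℕ → Prog
suffixProg H = suffixStart ⨾ loop H suffixStep

module StarPhase {n m : ℕ} {ends : Fin m → Fin n × Fin n} {inT par : Fin m → Bool} {r : Fin n}
               (R : Rooted ends inT par r) (loopless : ∀ e → proj₁ (ends e) ≢ proj₂ (ends e)) (w : Fin m → ℕ)
               (ID : Fin n → ℕ) (ID-inj : ∀ u v → ID u ≡ ID v → u ≡ v) where
  open Rooted R
  open TreeFacts R
  open TreeRun R loopless w

  -- `X` consists of the lower ends of the kept edges. `convex` can be iterated upwards, so a root
  -- path meets at most one of the paths; this is why contracting everything else leaves a star.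
  record Paths (X : V → Bool) : Set where
    field
      X-r : X r ≡ false
      convex : ∀ a v → X v ≡ true → X a ≡ true → anc a v ≡ true → a ≢ v → X (p v) ≡ true
      chain : ∀ c c' → c ≢ r → c' ≢ r → X c ≡ true → X c' ≡ true → p c ≡ p c' → X (p c) ≡ true → c ≡ c'

  -- Odd positions leave 0 free for nodes below no path and have their lowest bit set. The latter
  -- ends the recursion of the divide and conquer, whose last halving is by this bit.
  odd-of : ℕ → ℕ
  odd-of x = x + x + 1

  module Star (X : V → Bool) (P : Paths X) where
    open Paths P

    -- `k₁` leads from a node to its nearest kept ancestor, `k₂` continues along kept edges to the
    -- top of the path, and `k₃` moves within a path only.
    k₁ k₂ k₃ : V → Bool
    k₁ v = not (v ≐ r) ∧ not (X v)
    k₂ v = not (v ≐ r) ∧ (not (X v) ∨ X (p v))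
    k₃ v = X v ∧ X (p v)

    rep ptop : V → V
    rep = top k₁
    ptop = top k₂

    pos pid : V → ℕ
    pos v = X (rep v) ▸ odd-of (d (rep v))
    pid v = X (ptop v) ▸ (ID (ptop v) + 1)

    X≢r : ∀ v → X v ≡ true → v ≢ r
    X≢r v h refl = true≢false h X-r

    rep-X : ∀ v → (rep v ≡ r) ⊎ (X (rep v) ≡ true)
    rep-X v with top-stop k₁ v
    ... | inj₁ e = inj₁ e
    ... | inj₂ f = case rep v ≟F r of λ
      { (yes e) → inj₁ e
      ; (no ne) → inj₂ (case bool-case (X (rep v)) of λ { (inj₁ t) → t ; (inj₂ g) → ⊥-elim (true≢false (∧-i (not-t (≐-false ne)) (not-t g)) f) }) }

    rep-self : ∀ v → X v ≡ true → rep v ≡ v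
    rep-self v h = top-fix k₁ v (bool-false λ t → true≢false h (not-f (∧-r {not (v ≐ r)} t)))

    ptop-rep : ∀ v → ptop (rep v) ≡ ptop v
    ptop-rep = top-mono k₁ k₂ (λ v h → ∧-i (∧-l h) (∨-l (∧-r {not (v ≐ r)} h)))

    ptop-chain : ∀ v → X v ≡ true → ptop v ≡ top k₃ v
    ptop-chain = top-ind k₃ (λ v → X v ≡ true → ptop v ≡ top k₃ v)
      (λ v f h → case f of λ
        { (inj₁ e) → ⊥-elim (X≢r v h e)
        ; (inj₂ g) → trans (top-fix k₂ v (bool-false λ t → case ∨-e (∧-r {not (v ≐ r)} t) of λ
            { (inj₁ z) → true≢false h (not-f z) ; (inj₂ z) → true≢false (∧-i h z) g })) (sym (top-fix k₃ v g)) })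
      (λ v q t ih h → trans (top-step k₂ v q (∧-i (not-t (≐-false q)) (∨-r {not (X v)} (∧-r {X v} t)))) (trans (ih (∧-r {X v} t)) (sym (top-step k₃ v q t))))

    chain-X : ∀ v → X v ≡ true → X (top k₃ v) ≡ true
    chain-X = top-ind k₃ (λ v → X v ≡ true → X (top k₃ v) ≡ true)
      (λ v f h → trans (cong X (top-fix' k₃ v f)) h)
      (λ v q t ih h → trans (cong X (top-step k₃ v q t)) (ih (∧-r {X v} t)))

    ptop-X : ∀ v → X (rep v) ≡ true → X (ptop v) ≡ true
    ptop-X v h = trans (cong X (trans (sym (ptop-rep v)) (ptop-chain (rep v) h))) (chain-X (rep v) h)

    rep-ptop : ∀ v → X (ptop v) ≡ true → X (rep v) ≡ true
    rep-ptop v h with rep-X v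
    ... | inj₂ t = t
    ... | inj₁ e = ⊥-elim (true≢false h (trans (cong X (trans (sym (ptop-rep v)) (trans (cong ptop e) (top-r k₂)))) X-r))

    pid-X : ∀ v → pid v ≢ 0 → X (ptop v) ≡ true
    pid-X v h with X (ptop v)
    ... | true = refl
    ... | false = ⊥-elim (h refl)

    pid-val : ∀ v → X (ptop v) ≡ true → pid v ≡ ID (ptop v) + 1
    pid-val v h = cong (_▸ (ID (ptop v) + 1)) h

    pid-≢0 : ∀ v → X (ptop v) ≡ true → pid v ≢ 0
    pid-≢0 v h z = case trans (+-comm 1 (ID (ptop v))) (trans (sym (pid-val v h)) z) of λ ()

    pid-≢0-X : ∀ v → X v ≡ true → pid v ≢ 0
    pid-≢0-X v h = pid-≢0 v (ptop-X v (trans (cong X (rep-self v h)) h))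

    pos-X : ∀ v → X v ≡ true → pos v ≡ odd-of (d v)
    pos-X v h = trans (cong (λ z → X z ▸ odd-of (d z)) (rep-self v h)) (cong (_▸ odd-of (d v)) h)

    pos-0 : ∀ v → pid v ≡ 0 → pos v ≡ 0
    pos-0 v z = cong (_▸ odd-of (d (rep v))) (bool-false λ t → pid-≢0 v (ptop-X v t) z)

    pid-rep : ∀ v → pid (rep v) ≡ pid v
    pid-rep v = cong (λ z → X z ▸ (ID z + 1)) (ptop-rep v)

    pos-rep : ∀ v → pos (rep v) ≡ pos v
    pos-rep v = cong (λ z → X z ▸ odd-of (d z)) (top-idem k₁ v)

    same-chain : ∀ e v → X e ≡ true → X v ≡ true → anc e v ≡ true → top k₃ v ≡ top k₃ e
    same-chain e v he = tree-ind (λ v → X v ≡ true → anc e v ≡ true → top k₃ v ≡ top k₃ e)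
      (λ h _ → ⊥-elim (X≢r r h refl))
      (λ v q ih h a → case e ≟F v of λ
        { (yes refl) → refl
        ; (no ne) → let hp = convex e v h he a ne in trans (top-step k₃ v q (∧-i h hp)) (ih hp (anc-down e v q a ne)) }) v

    pid-ptop : ∀ u v → pid u ≡ pid v → pid v ≢ 0 → ptop u ≡ ptop v
    pid-ptop u v e nz = ID-inj _ _ (+-cancelʳ-≡ 1 _ _ (trans (sym (pid-val u (pid-X u (λ z → nz (trans (sym e) z))))) (trans e (pid-val v (pid-X v nz)))))

    comparable : ∀ u v → X u ≡ true → X v ≡ true → pid u ≡ pid v → d u ≤ d v → anc u v ≡ true
    comparable u v hu hv e l = chain-comparable k₃ (λ c c' q q' h h' pq → chain c c' q q' (∧-l h) (∧-l h') pq (∧-r {X c} h)) v u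
      (trans (sym (ptop-chain u hu)) (trans (pid-ptop u v e (pid-≢0-X v hv)) (ptop-chain v hv))) l

    odd-mono : ∀ {a b} → a ≤ b → odd-of a ≤ odd-of b
    odd-mono h = +-monoˡ-≤ 1 (+-mono-≤ h h)

    odd-cancel : ∀ {a b} → odd-of a ≤ odd-of b → a ≤ b
    odd-cancel {a} {b} h = ≮⇒≥ λ l → <⇒≱ (+-monoˡ-< 1 (+-mono-< l l)) h

    pid-same : ∀ e v → X e ≡ true → X v ≡ true → anc e v ≡ true → pid v ≡ pid e
    pid-same e v he hv a = cong (λ z → X z ▸ (ID z + 1)) (trans (ptop-chain v hv) (trans (same-chain e v he hv a) (sym (ptop-chain e he))))

    -- The purpose of names and positions: membership in the subtree below a kept edge becomes a
    -- comparison of two registers. Going down, the nearest kept ancestor stays on the path by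
    -- convexity; conversely, two kept nodes of one path are comparable by depth.
    sub : ∀ e u → X e ≡ true → anc e u ≡ (pid u ≡ᵇ pid e) ∧ (pos e ≤ᵇ pos u)
    sub e u he = bool-ext to from
      where
      to : anc e u ≡ true → (pid u ≡ᵇ pid e) ∧ (pos e ≤ᵇ pos u) ≡ true
      to a = ∧-i (==-true (trans (sym (pid-rep u)) (pid-same e (rep u) he hr ar)))
                 (≤ᵇ-true (subst₂ _≤_ (sym (pos-X e he)) (trans (sym (pos-X (rep u) hr)) (pos-rep u)) (odd-mono (anc-depth e (rep u) ar))))
        where
        ar : anc e (rep u) ≡ true
        ar = top-blocked k₁ e u a (bool-false λ t → true≢false he (not-f (∧-r {not (e ≐ r)} t)))
        hr : X (rep u) ≡ true
        hr with rep-X u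
        ... | inj₂ t = t
        ... | inj₁ z = ⊥-elim (X≢r e he (≐-sound (trans (sym (anc-r e)) (trans (cong (anc e) (sym z)) ar))))
      from : (pid u ≡ᵇ pid e) ∧ (pos e ≤ᵇ pos u) ≡ true → anc e u ≡ true
      from h = anc-trans e (rep u) u (comparable e (rep u) he hr (trans (sym pq) (sym (pid-rep u))) (odd-cancel (subst₂ _≤_ (pos-X e he) (trans (sym (pos-rep u)) (pos-X (rep u) hr)) (≤ᵇ-sound (∧-r {pid u ≡ᵇ pid e} h))))) (top-anc k₁ u)
        where
        pq : pid u ≡ pid e
        pq = ==-sound (∧-l h)
        hr : X (rep u) ≡ true
        hr = rep-ptop u (pid-X u (λ z → pid-≢0-X e he (trans (sym pq) z)))

    Monotone : (V → ℕ) → Set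
    Monotone b = ∀ u v → pid u ≡ pid v → pos u ≤ pos v → b u ≤ b v

    -- Along a path a monotone key takes each value on an interval, and the other nodes inherit name
    -- and position from their nearest kept ancestor. The nodes of name 0 form the class of the
    -- root.
    connected : ∀ b g → Monotone b → Monotone g → Connected (λ v → pid v , b v , g v)
    connected b g mb mg u v e tu tv with pid v ≟ 0
    ... | yes z = trans (root u (trans (cong proj₁ e) z) tu) (sym (root v z tv))
      where
      root : ∀ v → pid v ≡ 0 → Topmost (λ v → pid v , b v , g v) v → v ≡ r
      root v z (inj₁ q) = q
      root v z (inj₂ ne) with v ≟F r
      ... | yes q = q
      ... | no q = ⊥-elim (ne (cong₂ _,_ pq (cong₂ _,_ (both mb) (both mg))))
        where
        kv : k₂ v ≡ true
        kv with bool-case (k₂ v)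
        ... | inj₁ t = t
        ... | inj₂ f = ⊥-elim (pid-≢0 v (trans (cong X (top-fix k₂ v f)) keptv) z)
          where
          keptv : X v ≡ true
          keptv with bool-case (X v)
          ... | inj₁ t = t
          ... | inj₂ g' = ⊥-elim (true≢false (∧-i (not-t (≐-false q)) (∨-l (not-t g'))) f)
        pq : pid v ≡ pid (p v)
        pq = cong (λ z → X z ▸ (ID z + 1)) (top-step k₂ v q kv)
        ps : pos v ≡ pos (p v)
        ps = trans (pos-0 v z) (sym (pos-0 (p v) (trans (sym pq) z)))
        both : ∀ {h} → Monotone h → h v ≡ h (p v)
        both m = ≤-antisym (m v (p v) pq (≤-reflexive ps)) (m (p v) v (sym pq) (≤-reflexive (sym ps)))
    ... | no nz = case ≤-total (d u) (d v) of λ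
      { (inj₁ l) → join u v e (kept u (λ z → nz (trans (sym (cong proj₁ e)) z)) tu) (kept v nz tv) tv l
      ; (inj₂ l) → sym (join v u (sym e) (kept v nz tv) (kept u (λ z → nz (trans (sym (cong proj₁ e)) z)) tu) tu l) }
      where
      kept : ∀ u → pid u ≢ 0 → Topmost (λ v → pid v , b v , g v) u → X u ≡ true
      kept u nz t with bool-case (X u)
      ... | inj₁ h = h
      ... | inj₂ f = case t of λ
        { (inj₁ q) → ⊥-elim (nz (trans (cong pid q) pid-r))
        ; (inj₂ ne) → case u ≟F r of λ
          { (yes q) → ⊥-elim (nz (trans (cong pid q) pid-r))
          ; (no q) → ⊥-elim (ne (same q)) } }
        where
        pid-r : pid r ≡ 0
        pid-r = cong (_▸ (ID (ptop r) + 1)) (trans (cong X (top-r k₂)) X-r)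
        same : u ≢ r → (pid u , b u , g u) ≡ (pid (p u) , b (p u) , g (p u))
        same q = cong₂ _,_ pq (cong₂ _,_ (both mb) (both mg))
          where
          k1u : k₁ u ≡ true
          k1u = ∧-i (not-t (≐-false q)) (not-t f)
          rp : rep u ≡ rep (p u)
          rp = top-step k₁ u q k1u
          pq : pid u ≡ pid (p u)
          pq = trans (sym (pid-rep u)) (trans (cong pid rp) (pid-rep (p u)))
          ps : pos u ≡ pos (p u)
          ps = cong (λ z → X z ▸ odd-of (d z)) rp
          both : ∀ {h} → Monotone h → h u ≡ h (p u)
          both m = ≤-antisym (m u (p u) pq (≤-reflexive ps)) (m (p u) u (sym pq) (≤-reflexive (sym ps)))
      join : ∀ u v → (pid u , b u , g u) ≡ (pid v , b v , g v) → X u ≡ true → X v ≡ true → Topmost (λ v → pid v , b v , g v) v → d u ≤ d v → u ≡ v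
      join u v e hu hv t l with u ≟F v
      ... | yes q = q
      ... | no ne = ⊥-elim (case t of λ { (inj₁ q) → X≢r v hv q ; (inj₂ nt) → nt (cong₂ _,_ pq (cong₂ _,_ (sq mb (cong (proj₁ ∘ proj₂) e)) (sq mg (cong (proj₂ ∘ proj₂) e)))) })
        where
        a : anc u v ≡ true
        a = comparable u v hu hv (cong proj₁ e) l
        q = X≢r v hv
        hp : X (p v) ≡ true
        hp = convex u v hv hu a ne
        ap : anc u (p v) ≡ true
        ap = anc-down u v q a ne
        pq : pid v ≡ pid (p v)
        pq = pid-same (p v) v hp hv (anc-up (p v) v q (anc-refl (p v)))
        l₁ : pos u ≤ pos (p v)
        l₁ = subst₂ _≤_ (sym (pos-X u hu)) (sym (pos-X (p v) hp)) (odd-mono (anc-depth u (p v) ap))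
        l₂ : pos (p v) ≤ pos v
        l₂ = subst₂ _≤_ (sym (pos-X (p v) hp)) (sym (pos-X v hv)) (odd-mono (<⇒≤ (d-p< v q)))
        sq : ∀ {h} → Monotone h → h u ≡ h v → h v ≡ h (p v)
        sq m eq = ≤-antisym (≤-trans (≤-reflexive (sym eq)) (m u (p v) (trans (cong proj₁ e) pq) l₁)) (m (p v) v (sym pq) l₂)

    setup-correct : ∀ keep σ → (∀ v → keep (σ v) ≡ X v) → (∀ v → keep (exec (posProg keep) σ v) ≡ X v) →
      (∀ v → σ v ! rD ≡ d v) → (∀ v → σ v ! rID ≡ ID v) →
      ∀ v → (exec (setupProg keep) σ v ! rPOS ≡ pos v) × (exec (setupProg keep) σ v ! rPID ≡ pid v)
    setup-correct keep σ hk hk' hd hid v = pos-ok , pid-ok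
      where
      S₁ S₂ : Step
      S₁ = mkStep add mx silent (λ a b → not (keep a)) (ite (λ ε → keep (Env.own ε)) (own# rD ⊞ own# rD ⊞ con 1) (con 0)) ((rPOS , yy#) ∷ []) tt
      S₂ = mkStep mx mx (upward (ite (λ ε → keep (Env.oth ε)) (con 1) (con 0))) (λ a b → not (keep a) ∨ keep b)
             (ite (λ ε → keep (Env.own ε) ∧ (Env.zz ε ≡ᵇ 0)) (own# rID ⊞ con 1) (con 0)) ((rPID , yy#) ∷ (rBLK , con 0) ∷ []) tt
      σ₁ : State
      σ₁ = exec (posProg keep) σ
      x₁ : ∀ u → Xv S₁ σ u ≡ X u ▸ odd-of (d u)
      x₁ u = cong₂ (λ b z → if b then z + z + 1 else 0) (hk u) (hd u)
      pos-ok : Yv S₁ σ v ≡ pos v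
      pos-ok = trans (Y-top S₁ σ v) (trans (fold-cong mx λ u → cong₂ (λ a b → (a ≐ b) ▸ Xv S₁ σ u) (top-cong keq u) (top-cong keq v))
          (trans (gather mx k₁ (Xv S₁ σ) (λ u q t → trans (x₁ u) (cong (_▸ odd-of (d u)) (not-f (∧-r {not (u ≐ r)} t)))) v) (x₁ (rep v))))
        where
        keq : ∀ u → kOf S₁ σ u ≡ k₁ u
        keq u = cong (λ b → not (u ≐ r) ∧ not b) (hk u)
      z₂ : ∀ u → Zv S₂ σ₁ u ≡ not (u ≐ r) ▸ X (p u) ▸ 1
      z₂ u = trans (Z-up S₂ σ₁ (λ ρ ρ' → keep ρ' ▸ 1) (λ _ → refl) (λ _ → refl) (λ _ _ _ → refl) u) (cong (λ b → not (u ≐ r) ▸ b ▸ 1) (hk' (p u)))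
      x₂ : ∀ u → Xv S₂ σ₁ u ≡ (X u ∧ ((not (u ≐ r) ▸ X (p u) ▸ 1) ≡ᵇ 0)) ▸ (ID u + 1)
      x₂ u = cong₂ (λ b z → if b then z + 1 else 0) (cong₂ (λ b z → b ∧ (z ≡ᵇ 0)) (hk' u) (z₂ u)) (hid u)
      keq : ∀ u → kOf S₂ σ₁ u ≡ k₂ u
      keq u = cong₂ (λ a b → not (u ≐ r) ∧ (not a ∨ b)) (hk' u) (hk' (p u))
      vanish : ∀ u → u ≢ r → k₂ u ≡ true → Xv S₂ σ₁ u ≡ 0
      vanish u q t = trans (x₂ u) (cong (_▸ (ID u + 1)) (bool-false λ h → case ∨-e (∧-r {not (u ≐ r)} t) of λ
        { (inj₁ z) → true≢false (∧-l h) (not-f z)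
        ; (inj₂ z) → case trans (sym (cong₂ (λ a b → not a ▸ b ▸ 1) (≐-false q) z)) (==-sound {not (u ≐ r) ▸ X (p u) ▸ 1} (∧-r {X u} h)) of λ () }))
      at-top : Xv S₂ σ₁ (ptop v) ≡ pid v
      at-top = trans (x₂ (ptop v)) (cong (_▸ (ID (ptop v) + 1)) (simp (top-stop k₂ v)))
        where
        t = ptop v
        simp : (t ≡ r) ⊎ (k₂ t ≡ false) → X t ∧ ((not (t ≐ r) ▸ X (p t) ▸ 1) ≡ᵇ 0) ≡ X t
        simp (inj₁ e) = trans (cong (_∧ ((not (t ≐ r) ▸ X (p t) ▸ 1) ≡ᵇ 0)) Xt) (sym Xt)
          where
          Xt : X t ≡ false
          Xt = trans (cong X e) X-r
        simp (inj₂ f) = cases (not (t ≐ r)) (X t) (X (p t)) f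
          where
          cases : ∀ a b c → a ∧ (not b ∨ c) ≡ false → b ∧ ((a ▸ c ▸ 1) ≡ᵇ 0) ≡ b
          cases true true false _ = refl
          cases false true c _ = refl
          cases a false c _ = refl
      pid-ok : Yv S₂ σ₁ v ≡ pid v
      pid-ok = trans (Y-top S₂ σ₁ v) (trans (fold-cong mx λ u → cong₂ (λ a b → (a ≐ b) ▸ Xv S₂ σ₁ u) (top-cong keq u) (top-cong keq v))
          (trans (gather mx k₂ (Xv S₂ σ₁) vanish v) at-top))

  below : (pid blk pos : V → ℕ) → V → V → Bool
  below pid blk pos v u = (pid u ≡ᵇ pid v) ∧ ((blk u ≡ᵇ blk v) ∧ (pos v ≤ᵇ pos u))

  -- When the blocks double, a position in the upper half of its new block has nothing to add, and
  -- one in the lower half adds the whole upper half. Bit `h` tells the halves apart.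
  dyadic : ∀ h pu pv x → (shr (suc h) pu ≡ᵇ shr (suc h) pv) ∧ (pv ≤ᵇ pu) ▸ x
    ≡ (if bit h pv then (shr h pu ≡ᵇ shr h pv) ∧ (pv ≤ᵇ pu) ▸ x
       else ((shr h pu ≡ᵇ shr h pv) ∧ (pv ≤ᵇ pu) ▸ x) + ((shr (suc h) pu ≡ᵇ shr (suc h) pv) ▸ bit h pu ▸ x))
  dyadic h pu pv x with shr (suc h) pu ≟ shr (suc h) pv
  ... | no ne rewrite ==-false ne | ==-false {shr h pu} {shr h pv} (λ e → ne (trans (shr-suc h pu) (trans (cong ⌊_/2⌋ e) (sym (shr-suc h pv))))) with bit h pv
  ...   | true = refl
  ...   | false = refl
  dyadic h pu pv x | yes e rewrite ==-true e with bit h pu in bu | bit h pv in bv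
  ... | true | true rewrite ==-true (trans (shr-split h pu) (trans (cong₂ (λ a b → 𝟙 a + (b + b)) (trans bu (sym bv)) e) (sym (shr-split h pv)))) = refl
  ... | false | false rewrite ==-true (trans (shr-split h pu) (trans (cong₂ (λ a b → 𝟙 a + (b + b)) (trans bu (sym bv)) e) (sym (shr-split h pv)))) = sym (+-identityʳ _)
  ... | true | false = trans (cong (_▸ x) (≤ᵇ-true (<⇒≤ less))) (sym (cong (λ b → (b ∧ (pv ≤ᵇ pu) ▸ x) + x) (==-false (λ z → <⇒≢ slt (sym z)))))
    where
    slt : shr h pv < shr h pu
    slt rewrite shr-split h pu | shr-split h pv | bu | bv | e = ≤-refl
    less : pv < pu
    less = ≰⇒> λ l → <⇒≱ slt (shr-mono h l)
  ... | false | true = trans (cong (_▸ x) (bool-false λ z → <⇒≱ slt (shr-mono h (≤ᵇ-sound z)))) (sym (cong (λ b → b ∧ (pv ≤ᵇ pu) ▸ x) (==-false (<⇒≢ slt))))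
    where
    slt : shr h pu < shr h pv
    slt rewrite shr-split h pu | shr-split h pv | bu | bv | e = ≤-refl

  -- At height `h` a node knows the sum over its own dyadic block from its own position on; once a
  -- block comprises all positions this is the suffix sum.
  record SufInv (σ : State) (h : ℕ) (τ : State) : Set where
    field
      pid-eq : ∀ v → τ v ! rPID ≡ σ v ! rPID
      blk-eq : ∀ v → τ v ! rBLK ≡ σ v ! rBLK
      pos-eq : ∀ v → τ v ! rPOS ≡ σ v ! rPOS
      x-eq : ∀ v → τ v ! rX ≡ σ v ! rX
      sum-eq : ∀ v → τ v ! rS ≡ ∑ (λ u → eq₃ (φ h (σ u)) (φ h (σ v)) ∧ (σ v ! rPOS ≤ᵇ σ u ! rPOS) ▸ σ u ! rX)

  suffix-correct : ∀ H σ → (∀ h → Connected (φ h ∘ σ)) → (∀ v → σ v ! rPOS < 2 ^ H) →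
    ∀ v → exec (suffixProg H) σ v ! rS ≡ ∑ (λ u → below (λ v → σ v ! rPID) (λ v → σ v ! rBLK) (λ v → σ v ! rPOS) v u ▸ σ u ! rX)
  suffix-correct H σ conn hpos v = finish _ (loop-inv (SufInv σ) H suffixStep (λ h τ _ → stepInv h τ) start)
    where
    S₀ : Step
    S₀ = mkStep add add silent (λ a b → eq₃ (φ 0 a) (φ 0 b)) (own# rX) ((rS , yy#) ∷ []) tt
    start : SufInv σ 0 (exec suffixStart σ)
    start = record { pid-eq = λ _ → refl ; blk-eq = λ _ → refl ; pos-eq = λ _ → refl ; x-eq = λ _ → refl
                   ; sum-eq = λ v → trans (Y-class S₀ σ (φ 0) (λ _ _ → refl) (conn 0) v) (fold-cong add λ u → cong (_▸ σ u ! rX) (implied u v)) }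
      where
      implied : ∀ u v → eq₃ (φ 0 (σ u)) (φ 0 (σ v)) ≡ eq₃ (φ 0 (σ u)) (φ 0 (σ v)) ∧ (σ v ! rPOS ≤ᵇ σ u ! rPOS)
      implied u v = bool-ext (λ t → ∧-i t (≤ᵇ-true (≤-reflexive (sym (cong (proj₂ ∘ proj₂) (eq₃-sound {φ 0 (σ u)} {φ 0 (σ v)} t)))))) ∧-l
    stepInv : ∀ h τ → SufInv σ h τ → SufInv σ (suc h) (exec (suffixStep h) τ)
    stepInv h τ I = record { pid-eq = pid-eq ; blk-eq = blk-eq ; pos-eq = pos-eq ; x-eq = x-eq ; sum-eq = total }
      where
      open SufInv I
      S : Step
      S = mkStep add add silent (λ a b → eq₃ (φ (suc h) a) (φ (suc h) b))
        (ite (λ ε → bit h (Env.own ε ! rPOS)) (own# rX) (con 0))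
        ((rS , ite (λ ε → bit h (Env.own ε ! rPOS)) (own# rS) (own# rS ⊞ yy#)) ∷ []) tt
      φ-eq : ∀ h v → φ h (τ v) ≡ φ h (σ v)
      φ-eq h v = cong₂ _,_ (pid-eq v) (cong₂ _,_ (blk-eq v) (cong (shr h) (pos-eq v)))
      conn' : Connected (φ (suc h) ∘ τ)
      conn' u v e tu tv = conn (suc h) u v (trans (sym (φ-eq (suc h) u)) (trans e (φ-eq (suc h) v))) (conv u tu) (conv v tv)
        where
        conv : ∀ u → Topmost (φ (suc h) ∘ τ) u → Topmost (φ (suc h) ∘ σ) u
        conv u (inj₁ q) = inj₁ q
        conv u (inj₂ ne) = inj₂ λ e → ne (trans (φ-eq (suc h) u) (trans e (sym (φ-eq (suc h) (p u)))))
      y-eq : ∀ v → Yv S τ v ≡ ∑ (λ u → eq₃ (φ (suc h) (σ u)) (φ (suc h) (σ v)) ▸ bit h (σ u ! rPOS) ▸ σ u ! rX)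
      y-eq v = trans (Y-class S τ (φ (suc h)) (λ _ _ → refl) conn' v) (fold-cong add λ u →
        cong₂ _▸_ (cong₂ eq₃ (φ-eq (suc h) u) (φ-eq (suc h) v)) (cong₂ (λ a b → bit h a ▸ b) (pos-eq u) (x-eq u)))
      A : V → V → ℕ
      A v u = eq₃ (φ h (σ u)) (φ h (σ v)) ∧ (σ v ! rPOS ≤ᵇ σ u ! rPOS) ▸ σ u ! rX
      B : V → V → ℕ
      B v u = eq₃ (φ (suc h) (σ u)) (φ (suc h) (σ v)) ▸ bit h (σ u ! rPOS) ▸ σ u ! rX
      pointwise : ∀ v u → eq₃ (φ (suc h) (σ u)) (φ (suc h) (σ v)) ∧ (σ v ! rPOS ≤ᵇ σ u ! rPOS) ▸ σ u ! rX ≡ (if bit h (σ v ! rPOS) then A v u else A v u + B v u)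
      pointwise v u with σ u ! rPID ≡ᵇ σ v ! rPID | σ u ! rBLK ≡ᵇ σ v ! rBLK
      ... | true | true = dyadic h (σ u ! rPOS) (σ v ! rPOS) (σ u ! rX)
      ... | true | false with bit h (σ v ! rPOS)
      ...   | true = refl
      ...   | false = refl
      pointwise v u | false | _ with bit h (σ v ! rPOS)
      ...   | true = refl
      ...   | false = refl
      total : ∀ v → exec (suffixStep h) τ v ! rS ≡ ∑ (λ u → eq₃ (φ (suc h) (σ u)) (φ (suc h) (σ v)) ∧ (σ v ! rPOS ≤ᵇ σ u ! rPOS) ▸ σ u ! rX)
      total v = trans (cong₂ (λ b y → if b then τ v ! rS else τ v ! rS + y) (cong (bit h) (pos-eq v)) (y-eq v))
        (trans (cong (λ s → if bit h (σ v ! rPOS) then s else s + ∑ (B v)) (sum-eq v)) (trans (go (bit h (σ v ! rPOS))) (fold-cong add λ u → sym (pointwise v u))))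
        where
        go : ∀ b → (if b then ∑ (A v) else ∑ (A v) + ∑ (B v)) ≡ ∑ (λ u → if b then A v u else A v u + B v u)
        go true = refl
        go false = sym (∑-+ (A v) (B v))
    finish : ∀ τ → SufInv σ H τ → τ v ! rS ≡ ∑ (λ u → below (λ v → σ v ! rPID) (λ v → σ v ! rBLK) (λ v → σ v ! rPOS) v u ▸ σ u ! rX)
    finish τ I = trans (SufInv.sum-eq I v) (fold-cong add λ u → cong (_▸ σ u ! rX) (simp u))
      where
      simp : ∀ u → eq₃ (φ H (σ u)) (φ H (σ v)) ∧ (σ v ! rPOS ≤ᵇ σ u ! rPOS) ≡ below (λ v → σ v ! rPID) (λ v → σ v ! rBLK) (λ v → σ v ! rPOS) v u
      simp u rewrite shr-0 H (hpos u) | shr-0 H (hpos v) with σ u ! rPID ≡ᵇ σ v ! rPID | σ u ! rBLK ≡ᵇ σ v ! rBLK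
      ... | true | true = refl
      ... | true | false = refl
      ... | false | _ = refl

-- Values of the 1-respecting cuts

weightProg : (Mem → Mem → Bool) → Prog
weightProg C = mk add add (everywhere (ite (λ ε → C (Env.own ε) (Env.oth ε)) wt# (con 0))) never (con 0) ((rX , zz#) ∷ [])

copyProg : Prog
copyProg = mk add add silent never (con 0) ((rG , own# rS) ∷ [])

-- A suffix sum adds quantities known at single nodes, and whether an edge leaves the suffix is not
-- one of them, since it depends on the suffix. These two tests compare the ends of an edge with
-- each other instead.
plusC minusC : Mem → Mem → Bool
plusC a b = not (a ! rPID ≡ᵇ b ! rPID) ∨ (b ! rPOS <ᵇ a ! rPOS)
minusC a b = (a ! rPID ≡ᵇ b ! rPID) ∧ (a ! rPOS <ᵇ b ! rPOS)

keepLevel : ℕ → Mem → Bool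
keepLevel s ρ = (0 <ᵇ ρ ! rD) ∧ (ρ ! rLEV ≡ᵇ s)

writeCut : ℕ → Prog
writeCut s = mk add add silent never (con 0) ((rCUT , ite (λ ε → keepLevel s (Env.own ε)) (own# rG ⊟ own# rS) (own# rCUT)) ∷ [])

cutTail₁ cutTail₂ cutTail₃ cutLevel : ℕ → ℕ → Prog
cutTail₁ H s = (weightProg minusC ⨾ suffixProg H) ⨾ writeCut s
cutTail₂ H s = copyProg ⨾ cutTail₁ H s
cutTail₃ H s = (weightProg plusC ⨾ suffixProg H) ⨾ cutTail₂ H s
cutLevel H s = setupProg (keepLevel s) ⨾ cutTail₃ H s

cutProg : ℕ → ℕ → Prog
cutProg K H = loop K (cutLevel H)

module CutPhase {n m : ℕ} {ends : Fin m → Fin n × Fin n} {inT par : Fin m → Bool} {r : Fin n}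
               (R : Rooted ends inT par r) (loopless : ∀ e → proj₁ (ends e) ≢ proj₂ (ends e)) (w : Fin m → ℕ)
               (ID : Fin n → ℕ) (ID-inj : ∀ u v → ID u ≡ ID v → u ≡ v) where
  open Rooted R
  open TreeFacts R
  open TreeRun R loopless w
  open LevelPhase R loopless w using (LevelsOK; branch)
  open StarPhase R loopless w ID ID-inj

  -- Everything except the two registers written by a suffix sum.
  notXS : Reg → Bool
  notXS q = not ((toℕ q ≡ᵇ 17) ∨ (toℕ q ≡ᵇ 18))

  sufweight-frame : ∀ C H σ v q → notXS q ≡ true → Run (weightProg C ⨾ suffixProg H) σ v ! q ≡ σ v ! q
  sufweight-frame C H σ v q h = frame-run notXS (weightProg C ⨾ suffixProg H) (tt , tt , λ _ → tt) σ v q h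

  belowσ : State → V → V → Bool
  belowσ σ = below (λ v → σ v ! rPID) (λ v → σ v ! rBLK) (λ v → σ v ! rPOS)

  sufweight : ∀ C H σ → (∀ h → Connected (φ h ∘ σ)) → (∀ v → σ v ! rPOS < 2 ^ H) →
    ∀ v → Run (weightProg C ⨾ suffixProg H) σ v ! rS ≡ ⟪ (λ u x → belowσ σ v u ∧ C (σ u) (σ x)) ⟫
  sufweight C H σ conn hpos v = toRun (λ τ → τ v ! rS ≡ ⟪ (λ u x → belowσ σ v u ∧ C (σ u) (σ x)) ⟫) (weightProg C ⨾ suffixProg H) σ (trans (suffix-correct H (exec (weightProg C) σ) conn hpos v)
      (Z-weight S σ C refl (λ _ _ _ _ → refl) (belowσ σ v)))
    where
    S : Step
    S = mkStep add add (everywhere (ite (λ ε → C (Env.own ε) (Env.oth ε)) wt# (con 0))) never (con 0) ((rX , zz#) ∷ []) tt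

  cutval : (V → Bool) → ℕ
  cutval A = ⟪ (λ u x → A u ∧ not (A x)) ⟫

  at-below : (pid pos : V → ℕ) → V → V → Bool
  at-below pid pos v u = (pid u ≡ᵇ pid v) ∧ (pos v ≤ᵇ pos u)

  -- An edge inside the suffix is counted on the left at its deeper end and by the last sum at its
  -- shallower end, or by neither if the positions agree. An edge leaving the suffix goes to another
  -- path or to a smaller position and is counted on the left only.
  cut-formula : ∀ (pid pos : V → ℕ) v → let A = at-below pid pos v in
    ⟪ (λ u x → A u ∧ (not (pid u ≡ᵇ pid x) ∨ (pos x <ᵇ pos u))) ⟫ ≡ cutval A + ⟪ (λ u x → A u ∧ ((pid u ≡ᵇ pid x) ∧ (pos u <ᵇ pos x))) ⟫
  cut-formula pid pos v = begin
      ⟪ (λ u x → A u ∧ (not (pid u ≡ᵇ pid x) ∨ (pos x <ᵇ pos u))) ⟫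
        ≡⟨ ⟪⟫-add split ⟩
      cutval A + ⟪ (λ u x → A u ∧ (A x ∧ (pos x <ᵇ pos u))) ⟫
        ≡⟨ cong (cutval A +_) (trans (⟪⟫-sym (λ u x → A u ∧ (A x ∧ (pos x <ᵇ pos u)))) (⟪⟫-cong inner)) ⟩
      cutval A + ⟪ (λ u x → A u ∧ ((pid u ≡ᵇ pid x) ∧ (pos u <ᵇ pos x))) ⟫ ∎
    where
    open ≡-Reasoning
    A : V → Bool
    A = at-below pid pos v
    A-pid : ∀ {u} → A u ≡ true → pid u ≡ pid v
    A-pid h = ==-sound (∧-l h)
    A-pos : ∀ {u} → A u ≡ true → pos v ≤ pos u
    A-pos {u} h = ≤ᵇ-sound (∧-r {pid u ≡ᵇ pid v} h)
    A-i : ∀ {u} → pid u ≡ pid v → pos v ≤ pos u → A u ≡ true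
    A-i e l = ∧-i (==-true e) (≤ᵇ-true l)
    split : ∀ u x → 𝟙 (A u ∧ (not (pid u ≡ᵇ pid x) ∨ (pos x <ᵇ pos u))) ≡ 𝟙 (A u ∧ not (A x)) + 𝟙 (A u ∧ (A x ∧ (pos x <ᵇ pos u)))
    split u x with A u in hu
    ... | false = refl
    ... | true with A x in hx
    ...   | true rewrite ==-true (trans (A-pid hu) (sym (A-pid hx))) = refl
    ...   | false = cong 𝟙 out
      where
      out : not (pid u ≡ᵇ pid x) ∨ (pos x <ᵇ pos u) ≡ true
      out with pid u ≟ pid x
      ... | no ne = ∨-l (not-t (==-false ne))
      ... | yes e = ∨-r {not (pid u ≡ᵇ pid x)} (<ᵇ-true (≰⇒> λ l → true≢false (A-i (trans (sym e) (A-pid hu)) (≤-trans (A-pos hu) l)) hx))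
    inner : ∀ u x → A x ∧ (A u ∧ (pos u <ᵇ pos x)) ≡ A u ∧ ((pid u ≡ᵇ pid x) ∧ (pos u <ᵇ pos x))
    inner u x = bool-ext
      (λ h → let hx = ∧-l h ; hu = ∧-l (∧-r {A x} h) in ∧-i hu (∧-i (==-true (trans (A-pid hu) (sym (A-pid hx)))) (∧-r {A u} (∧-r {A x} h))))
      (λ h → let hu = ∧-l h ; l = ∧-r {pid u ≡ᵇ pid x} (∧-r {A u} h) in
        ∧-i (A-i (trans (sym (==-sound {pid u} (∧-l (∧-r {A u} h)))) (A-pid hu)) (≤-trans (A-pos hu) (<⇒≤ (<ᵇ-sound l)))) (∧-i hu l))

  record Perm (lev : V → ℕ) (σ : State) : Set where
    field
      D-ok : ∀ v → σ v ! rD ≡ d v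
      ID-ok : ∀ v → σ v ! rID ≡ ID v
      LEV-ok : ∀ v → σ v ! rLEV ≡ lev v

  lev-anc : ∀ {H lev} → LevelsOK H lev → ∀ a v → anc a v ≡ true → lev v ≤ lev a
  lev-anc ok a = tree-ind (λ v → anc a v ≡ true → _ ≤ _)
    (λ h → ≤-reflexive (cong _ (sym (≐-sound (trans (sym (anc-r a)) h)))))
    λ v q ih h → case a ≟F v of λ { (yes refl) → ≤-refl ; (no ne) → ≤-trans (LevelsOK.lev-mono ok v q) (ih (anc-down a v q h ne)) }

  -- Levels do not decrease towards the root, so equal levels at two comparable nodes force the same
  -- level in between. The wanted level may vary as long as it is inherited from parents of depth at
  -- least `m₀`; this allows different levels for the two colours.
  level-paths : ∀ {H lev} → LevelsOK H lev → ∀ (want : V → ℕ) m₀ → 1 ≤ m₀ → (∀ v → v ≢ r → m₀ ≤ d (p v) → want v ≡ want (p v)) →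
    Paths (λ v → (m₀ ≤ᵇ d v) ∧ (lev v ≡ᵇ want v))
  level-paths {H} {lev} ok want m₀ pos₀ stable = record
    { X-r = bool-false λ h → <⇒≱ (≤-trans pos₀ (≤ᵇ-sound (∧-l h))) (≤-reflexive d-r)
    ; convex = λ a v hv ha an ne →
        let q : v ≢ r
            q e = ne (trans (≐-sound (trans (sym (anc-r a)) (trans (cong (anc a) (sym e)) an))) (sym e))
            ap = anc-down a v q an ne
            dp : m₀ ≤ d (p v)
            dp = ≤-trans (≤ᵇ-sound (∧-l ha)) (anc-depth a (p v) ap)
            wa : want v ≡ want a
            wa = want-anc a v (≤ᵇ-sound (∧-l ha)) an
            lv = ==-sound {lev v} (∧-r {m₀ ≤ᵇ d v} hv)
            la = ==-sound {lev a} (∧-r {m₀ ≤ᵇ d a} ha)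
        in ∧-i (≤ᵇ-true dp) (==-true (trans (≤-antisym
              (≤-trans (lev-anc ok a (p v) ap) (≤-reflexive (trans la (trans (sym wa) (sym lv)))))
              (LevelsOK.lev-mono ok v q)) (trans lv (stable v q dp))))
    ; chain = λ c c' q q' h h' e hp →
        let dp = ≤ᵇ-sound {m₀} (∧-l hp)
            l = ==-sound {lev c} (∧-r {m₀ ≤ᵇ d c} h)
            l' = ==-sound {lev c'} (∧-r {m₀ ≤ᵇ d c'} h')
            lp = ==-sound {lev (p c)} (∧-r {m₀ ≤ᵇ d (p c)} hp)
        in LevelsOK.lev-chain ok c c' q q' e (trans l (trans (stable c q dp) (sym lp)))
             (trans l' (trans (stable c' q' (subst (λ z → m₀ ≤ d z) e dp)) (trans (cong want (sym e)) (sym lp))))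
    }
    where
    want-anc : ∀ a v → m₀ ≤ d a → anc a v ≡ true → want v ≡ want a
    want-anc a v l = tree-ind (λ v → anc a v ≡ true → want v ≡ want a)
      (λ h → cong want (sym (≐-sound (trans (sym (anc-r a)) h))))
      (λ v q ih h → case a ≟F v of λ { (yes refl) → refl ; (no ne) →
        let ap = anc-down a v q h ne in trans (stable v q (≤-trans l (anc-depth a (p v) ap))) (ih ap) }) v

  pos-bound : ∀ {X} (P : Paths X) K v → n ≤ 2 ^ K → Star.pos X P v < 2 ^ suc K
  pos-bound {X} P K v hn with X (Star.rep X P v)
  ... | false = m^n>0 2 (suc K)
  ... | true = subst₂ _≤_ (trans (+-suc (suc x) x) (cong suc (+-comm 1 (x + x)))) (sym (2^suc K)) (+-mono-≤ lt lt)
    where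
    x = d (Star.rep X P v)
    lt : suc x ≤ 2 ^ K
    lt = ≤-trans (depth< _) hn

  module _ {K : ℕ} {lev : V → ℕ} (ok : LevelsOK K lev) (hn : n ≤ 2 ^ K) where

    cut-level : ∀ s σ → Perm lev σ → ∀ v →
      Run (cutLevel (suc K) s) σ v ! rCUT ≡ (if (0 <ᵇ d v) ∧ (lev v ≡ᵇ s) then cutval (anc v) else σ v ! rCUT)
    cut-level s σ I v =
      seq Sp₁ Goal (setupProg (keepLevel s)) (cutTail₃ (suc K) s) σ (setup , setup-blk , (λ v q h → frame-run P₆ (setupProg (keepLevel s)) (tt , tt) σ v q h)) λ σ₁ (hs , hb , f₁) →
      seq (Sp₂ σ₁) Goal (weightProg plusC ⨾ suffixProg (suc K)) (cutTail₂ (suc K) s) σ₁ ((λ v → sufweight plusC (suc K) σ₁ (conn σ₁ hs hb) (bnd σ₁ hs) v) , sufweight-frame plusC (suc K) σ₁) λ σ₂ (s₂ , f₂) →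
      seq (Sp₃ σ₂) Goal copyProg (cutTail₁ (suc K) s) σ₂ (toRun (λ τ → ∀ v → τ v ! rG ≡ σ₂ v ! rS) copyProg σ₂ (λ v → refl) , (λ v q h → frame-run P₁₃ copyProg tt σ₂ v q h)) λ σ₃ (g₃ , f₃) →
      let hs₃ = λ v → trans (f₃ v rPOS refl) (trans (f₂ v rPOS refl) (proj₁ (hs v))) , trans (f₃ v rPID refl) (trans (f₂ v rPID refl) (proj₂ (hs v)))
          hb₃ = λ v → trans (f₃ v rBLK refl) (trans (f₂ v rBLK refl) (hb v)) in
      seq (Sp₄ σ₃) Goal (weightProg minusC ⨾ suffixProg (suc K)) (writeCut s) σ₃ ((λ v → sufweight minusC (suc K) σ₃ (conn σ₃ hs₃ hb₃) (bnd σ₃ hs₃) v) , sufweight-frame minusC (suc K) σ₃) λ σ₄ (s₄ , f₄) →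
      let fr = λ q (h : P₆ q ≡ true) (h' : notXS q ≡ true) (h'' : P₁₃ q ≡ true) → trans (f₄ v q h') (trans (f₃ v q h'') (trans (f₂ v q h') (f₁ v q h))) in
      toRun Goal (writeCut s) σ₄ (collect σ₁ σ₂ σ₃ σ₄ hs hb hs₃ hb₃ s₂ g₃ s₄ f₄
        (trans (cong₂ (λ a b → (0 <ᵇ a) ∧ (b ≡ᵇ s)) (fr rD refl refl refl) (fr rLEV refl refl refl)) (keep-eq v)) (fr rCUT refl refl refl))
      where
      X : V → Bool
      X v = (0 <ᵇ d v) ∧ (lev v ≡ᵇ s)
      Pth : Paths X
      Pth = level-paths ok (λ _ → s) 1 ≤-refl (λ _ _ _ → refl)
      open Star X Pth
      P₆ P₁₃ : Reg → Bool
      P₆ q = toℕ q <ᵇ 6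
      P₁₃ q = toℕ q <ᵇ 13
      Goal : State → Set
      Goal τ = τ v ! rCUT ≡ (if X v then cutval (anc v) else σ v ! rCUT)
      Sp₁ : State → Set
      Sp₁ τ = (∀ v → (τ v ! rPOS ≡ pos v) × (τ v ! rPID ≡ pid v)) × (∀ v → τ v ! rBLK ≡ 0) × (∀ v q → P₆ q ≡ true → τ v ! q ≡ σ v ! q)
      Sp₂ Sp₃ Sp₄ : State → State → Set
      Sp₂ σ₁ τ = (∀ v → τ v ! rS ≡ ⟪ (λ u x → belowσ σ₁ v u ∧ plusC (σ₁ u) (σ₁ x)) ⟫) × (∀ v q → notXS q ≡ true → τ v ! q ≡ σ₁ v ! q)
      Sp₃ σ₂ τ = (∀ v → τ v ! rG ≡ σ₂ v ! rS) × (∀ v q → P₁₃ q ≡ true → τ v ! q ≡ σ₂ v ! q)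
      Sp₄ σ₃ τ = (∀ v → τ v ! rS ≡ ⟪ (λ u x → belowσ σ₃ v u ∧ minusC (σ₃ u) (σ₃ x)) ⟫) × (∀ v q → notXS q ≡ true → τ v ! q ≡ σ₃ v ! q)
      keep-eq : ∀ v → keepLevel s (σ v) ≡ X v
      keep-eq v = cong₂ (λ a b → (0 <ᵇ a) ∧ (b ≡ᵇ s)) (Perm.D-ok I v) (Perm.LEV-ok I v)
      setup : ∀ v → (Run (setupProg (keepLevel s)) σ v ! rPOS ≡ pos v) × (Run (setupProg (keepLevel s)) σ v ! rPID ≡ pid v)
      setup = toRun (λ τ → ∀ v → (τ v ! rPOS ≡ pos v) × (τ v ! rPID ≡ pid v)) (setupProg (keepLevel s)) σ (setup-correct (keepLevel s) σ keep-eq keep-eq (Perm.D-ok I) (Perm.ID-ok I))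
      setup-blk : ∀ v → Run (setupProg (keepLevel s)) σ v ! rBLK ≡ 0
      setup-blk = toRun (λ τ → ∀ v → τ v ! rBLK ≡ 0) (setupProg (keepLevel s)) σ (λ v → refl)
      φ-eq : ∀ τ → (∀ v → (τ v ! rPOS ≡ pos v) × (τ v ! rPID ≡ pid v)) → (∀ v → τ v ! rBLK ≡ 0) → ∀ h v → φ h (τ v) ≡ (pid v , 0 , shr h (pos v))
      φ-eq τ hs hb h v = cong₂ _,_ (proj₂ (hs v)) (cong₂ _,_ (hb v) (cong (shr h) (proj₁ (hs v))))
      conn : ∀ τ → (∀ v → (τ v ! rPOS ≡ pos v) × (τ v ! rPID ≡ pid v)) → (∀ v → τ v ! rBLK ≡ 0) → ∀ h → Connected (φ h ∘ τ)
      conn τ hs hb h u v e tu tv = connected (λ _ → 0) (λ v → shr h (pos v)) (λ _ _ _ _ → z≤n) (λ _ _ _ l → shr-mono h l) u v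
          (trans (sym (φ-eq τ hs hb h u)) (trans e (φ-eq τ hs hb h v))) (conv u tu) (conv v tv)
        where
        conv : ∀ u → Topmost (φ h ∘ τ) u → Topmost (λ v → pid v , 0 , shr h (pos v)) u
        conv u (inj₁ q) = inj₁ q
        conv u (inj₂ ne) = inj₂ λ e → ne (trans (φ-eq τ hs hb h u) (trans e (sym (φ-eq τ hs hb h (p u)))))
      bnd : ∀ τ → (∀ v → (τ v ! rPOS ≡ pos v) × (τ v ! rPID ≡ pid v)) → ∀ v → τ v ! rPOS < 2 ^ suc K
      bnd τ hs v = subst (_< 2 ^ suc K) (sym (proj₁ (hs v))) (pos-bound Pth K v hn)
      collect : ∀ σ₁ σ₂ σ₃ σ₄ → (hs : ∀ v → (σ₁ v ! rPOS ≡ pos v) × (σ₁ v ! rPID ≡ pid v)) → (∀ v → σ₁ v ! rBLK ≡ 0) →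
        (hs₃ : ∀ v → (σ₃ v ! rPOS ≡ pos v) × (σ₃ v ! rPID ≡ pid v)) → (∀ v → σ₃ v ! rBLK ≡ 0) →
        (∀ v → σ₂ v ! rS ≡ ⟪ (λ u x → belowσ σ₁ v u ∧ plusC (σ₁ u) (σ₁ x)) ⟫) → (∀ v → σ₃ v ! rG ≡ σ₂ v ! rS) →
        (∀ v → σ₄ v ! rS ≡ ⟪ (λ u x → belowσ σ₃ v u ∧ minusC (σ₃ u) (σ₃ x)) ⟫) → (∀ v q → notXS q ≡ true → σ₄ v ! q ≡ σ₃ v ! q) →
        keepLevel s (σ₄ v) ≡ X v → σ₄ v ! rCUT ≡ σ v ! rCUT →
        (if keepLevel s (σ₄ v) then σ₄ v ! rG ∸ σ₄ v ! rS else σ₄ v ! rCUT) ≡ (if X v then cutval (anc v) else σ v ! rCUT)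
      collect σ₁ σ₂ σ₃ σ₄ hs hb hs₃ hb₃ s₂ g₃ s₄ f₄ kk kc = trans (cong₂ (λ b c → if b then σ₄ v ! rG ∸ σ₄ v ! rS else c) kk kc) (go (X v) refl)
        where
        A : V → Bool
        A = at-below pid pos v
        bel : ∀ τ → (∀ v → (τ v ! rPOS ≡ pos v) × (τ v ! rPID ≡ pid v)) → (∀ v → τ v ! rBLK ≡ 0) → ∀ u → belowσ τ v u ≡ A u
        bel τ hs hb u = cong₂ _∧_ (cong₂ _≡ᵇ_ (proj₂ (hs u)) (proj₂ (hs v)))
          (cong₂ _∧_ (cong₂ _≡ᵇ_ (hb u) (hb v)) (cong₂ _≤ᵇ_ (proj₁ (hs v)) (proj₁ (hs u))))
        plus≡ : σ₄ v ! rG ≡ ⟪ (λ u x → A u ∧ (not (pid u ≡ᵇ pid x) ∨ (pos x <ᵇ pos u))) ⟫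
        plus≡ = trans (f₄ v rG refl) (trans (g₃ v) (trans (s₂ v) (⟪⟫-cong λ u x →
          cong₂ _∧_ (bel σ₁ hs hb u) (cong₂ (λ a b → not a ∨ b) (cong₂ _≡ᵇ_ (proj₂ (hs u)) (proj₂ (hs x))) (cong₂ _<ᵇ_ (proj₁ (hs x)) (proj₁ (hs u)))))))
        minus≡ : σ₄ v ! rS ≡ ⟪ (λ u x → A u ∧ ((pid u ≡ᵇ pid x) ∧ (pos u <ᵇ pos x))) ⟫
        minus≡ = trans (s₄ v) (⟪⟫-cong λ u x →
          cong₂ _∧_ (bel σ₃ hs₃ hb₃ u) (cong₂ _∧_ (cong₂ _≡ᵇ_ (proj₂ (hs₃ u)) (proj₂ (hs₃ x))) (cong₂ _<ᵇ_ (proj₁ (hs₃ u)) (proj₁ (hs₃ x)))))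
        go : ∀ b → X v ≡ b → (if b then σ₄ v ! rG ∸ σ₄ v ! rS else σ v ! rCUT) ≡ (if b then cutval (anc v) else σ v ! rCUT)
        go false _ = refl
        go true h = trans (cong₂ _∸_ plus≡ minus≡) (trans (cong (_∸ ⟪ (λ u x → A u ∧ ((pid u ≡ᵇ pid x) ∧ (pos u <ᵇ pos x))) ⟫) (cut-formula pid pos v))
          (trans (m+n∸n≡m (cutval A) ⟪ (λ u x → A u ∧ ((pid u ≡ᵇ pid x) ∧ (pos u <ᵇ pos x))) ⟫) (⟪⟫-cong λ u x → cong₂ (λ a b → a ∧ not b) (sym (sub v u h)) (sym (sub v x h)))))

    P₅ : Reg → Bool
    P₅ q = toℕ q <ᵇ 5

    cutLevel-frame : ∀ s → Frame P₅ (cutLevel (suc K) s)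
    cutLevel-frame s = (tt , tt) , (tt , tt , λ _ → tt) , tt , (tt , tt , λ _ → tt) , tt

    cut-correct : ∀ σ → Perm lev σ → ∀ v → v ≢ r → Run (cutProg K (suc K)) σ v ! rCUT ≡ cutval (anc v)
    cut-correct σ I v q = proj₂ final v q (LevelsOK.lev< ok v)
      where
      Inv : ℕ → State → Set
      Inv s τ = Perm lev τ × (∀ v → v ≢ r → lev v < s → τ v ! rCUT ≡ cutval (anc v))
      next : ∀ s τ τ' → (∀ v → τ' v ! rCUT ≡ (if (0 <ᵇ d v) ∧ (lev v ≡ᵇ s) then cutval (anc v) else τ v ! rCUT)) →
        (∀ v q → P₅ q ≡ true → τ' v ! q ≡ τ v ! q) → Inv s τ → Inv (suc s) τ'
      next s τ τ' c f (J , h) = record { D-ok = λ v → trans (f v rD refl) (Perm.D-ok J v) ; ID-ok = λ v → trans (f v rID refl) (Perm.ID-ok J v) ; LEV-ok = λ v → trans (f v rLEV refl) (Perm.LEV-ok J v) }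
        , λ v q l → trans (c v) (case m≤n⇒m<n∨m≡n (≤-pred l) of λ
            { (inj₁ l') → trans (cong (λ b → if b then cutval (anc v) else τ v ! rCUT) (bool-false λ t → <⇒≢ l' (==-sound {lev v} (∧-r {0 <ᵇ d v} t)))) (h v q l')
            ; (inj₂ e) → cong (λ b → if b then cutval (anc v) else τ v ! rCUT) (∧-i (<ᵇ-true (subst (0 <_) (sym (d-p v q)) (s≤s z≤n))) (==-true e)) })
      final : Inv K (Run (cutProg K (suc K)) σ)
      final = loop-run Inv K (cutLevel (suc K)) (λ s τ _ J → next s τ _ (cut-level s τ (proj₁ J)) (λ v q h → frame-run P₅ (cutLevel (suc K) s) (cutLevel-frame s) τ v q h) J)
        σ (I , λ v q ())

-- Partners.  If M(e,f) < Cut(e), more than half of the weight leaving the subtree of e goes to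
-- the path of f.  For the scale j with 2^(j-1) ≤ WW(e) < 2^j this path carries more than a quarter
-- of the cross weight T of {WW < 2^j}, so it covers one of the quartiles 0, T/4, T/2, 3T/4 when the
-- weights are laid out by PID; the quartile is found by binary search.

blue : ℕ → Mem → Bool
blue i ρ = not (ρ ! rPID ≡ᵇ 0) ∧ bit i (ρ ! rTAU)

cross : ℕ → Mem → Mem → Bool
cross i a b = not (a ! rPID ≡ᵇ 0) ∧ (not (b ! rPID ≡ᵇ 0) ∧ (bit i (a ! rTAU) xor bit i (b ! rTAU)))

-- Scale and quartile are chosen separately for red and blue paths. The right values differ from
-- pair to pair, so all combinations are run through.
record Params : Set where
  field
    jr kr jb kb : ℕ

pick : ℕ → ℕ → ℕ → Mem → ℕ
pick i a b ρ = if blue i ρ then b else a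

light : ℕ → Params → Mem → Bool
light i π ρ = ρ ! rWW <ᵇ 2 ^ pick i (Params.jr π) (Params.jb π) ρ

φP : Mem → ℕ × ℕ × ℕ
φP ρ = ρ ! rPID , 0 , 0

-- `rMATE` holds the leading bits of the name sought. Continued by a bit 1 they form the threshold,
-- so the weight measured goes to names that have a smaller prefix or the same prefix followed by 0.
probe : ℕ → ℕ → Mem → Mem → Bool
probe i l a b = cross i a b ∧ (shr l (b ! rPID) <ᵇ a ! rMATE + a ! rMATE + 1)

mateStart : ℕ → Params → Prog
mateStart i π = mk add add (everywhere (ite (λ ε → cross i (Env.own ε) (Env.oth ε)) wt# (con 0))) (λ a b → eq₃ (φP a) (φP b))
  (ite (λ ε → light i π (Env.own ε)) zz# (con 0)) ((rT , yy#) ∷ (rMATE , con 0) ∷ [])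

mateStep : ℕ → Params → ℕ → Prog
mateStep i π l = mk add add (everywhere (ite (λ ε → probe i l (Env.own ε) (Env.oth ε)) wt# (con 0))) (λ a b → eq₃ (φP a) (φP b))
  (ite (λ ε → light i π (Env.own ε)) zz# (con 0))
  ((rMATE , ite (λ ε → 4 * Env.yy ε ≤ᵇ pick i (Params.kr π) (Params.kb π) (Env.own ε) * Env.own ε ! rT)
      (own# rMATE ⊞ own# rMATE ⊞ con 1) (own# rMATE ⊞ own# rMATE)) ∷ [])

mateProg : ℕ → ℕ → Params → Prog
mateProg L i π = mateStart i π ⨾ down L (mateStep i π)

argmin : ∀ {n} (f : Fin n → Bool) (g : Fin n → ℕ) N u → g u ≤ N → f u ≡ true → ∃ λ t → (f t ≡ true) × (∀ x → f x ≡ true → g t ≤ g x)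
argmin f g N u l h with search (λ x → f x ∧ (g x <ᵇ g u))
... | inj₂ none = u , h , λ x hx → <ᵇ-no {g x} (bool-false λ z → true≢false (∧-i {f x} hx z) (none x))
... | inj₁ (x , hx) with N
...   | zero = ⊥-elim (<⇒≱ (≤-trans (<ᵇ-sound {g x} (∧-r {f x} hx)) l) z≤n)
...   | suc N' = argmin f g N' x (≤-pred (≤-trans (<ᵇ-sound {g x} (∧-r {f x} hx)) l)) (∧-l {f x} hx)

log-bracket : ∀ x → 1 ≤ x → ∃ λ j → (2 ^ j ≤ x) × (x < 2 ^ suc j)
log-bracket x h = go x 0 h (≤-trans (n<2^n x) (≤-reflexive (cong (2 ^_) (sym (+-identityʳ x)))))
  where
  n<2^n : ∀ x → x < 2 ^ x
  n<2^n zero = s≤s z≤n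
  n<2^n (suc x) = subst (suc x <_) (sym (2^suc x)) (+-mono-≤-< (m^n>0 2 x) (n<2^n x))
  go : ∀ k j → 2 ^ j ≤ x → x < 2 ^ (k + j) → ∃ λ j → (2 ^ j ≤ x) × (x < 2 ^ suc j)
  go zero j l u = ⊥-elim (<⇒≱ u l)
  go (suc k) j l u with 2 ^ suc j ≤? x
  ... | yes l' = go k (suc j) l' (subst (λ z → x < 2 ^ z) (sym (+-suc k j)) u)
  ... | no nl = j , l , ≰⇒> nl

-- An interval of length above `T / 4` inside the range from 0 to `T` contains a multiple of
-- `T / 4`. Since `4 s₀ ≤ 4 T - 4 q < 3 T`, a factor of at most 3 suffices.
quartile : ∀ T s₀ q → 1 ≤ T → s₀ + q ≤ T → T < 4 * q → ∃ λ k → (k < 4) × (4 * s₀ ≤ k * T) × (k * T < 4 * (s₀ + q))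
quartile T s₀ q hT hs hq = go
  where
  open ≤-Reasoning
  up₁ : ∀ k → k * T ≤ 4 * s₀ → suc k * T < 4 * (s₀ + q)
  up₁ k l = begin-strict
    T + k * T        <⟨ +-mono-<-≤ hq l ⟩
    4 * q + 4 * s₀   ≡⟨ trans (sym (*-distribˡ-+ 4 q s₀)) (cong (4 *_) (+-comm q s₀)) ⟩
    4 * (s₀ + q) ∎
  s₀≤3 : 4 * s₀ ≤ 3 * T
  s₀≤3 = +-cancelˡ-≤ (4 * q) _ _ (begin
    4 * q + 4 * s₀   ≡⟨ trans (sym (*-distribˡ-+ 4 q s₀)) (cong (4 *_) (+-comm q s₀)) ⟩
    4 * (s₀ + q)     ≤⟨ *-monoʳ-≤ 4 hs ⟩
    T + 3 * T        ≤⟨ +-monoˡ-≤ (3 * T) (<⇒≤ hq) ⟩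
    4 * q + 3 * T ∎)
  go : ∃ λ k → (k < 4) × (4 * s₀ ≤ k * T) × (k * T < 4 * (s₀ + q))
  go with s₀ ≟ 0
  ... | yes refl = 0 , s≤s z≤n , z≤n , ≤-trans (≤-<-trans z≤n hq) (≤-refl)
  ... | no _ with 4 * s₀ ≤? 1 * T
  ...   | yes l = 1 , s≤s (s≤s z≤n) , l , up₁ 0 z≤n
  ...   | no nl with 4 * s₀ ≤? 2 * T
  ...     | yes l = 2 , s≤s (s≤s (s≤s z≤n)) , l , up₁ 1 (<⇒≤ (≰⇒> nl))
  ...     | no nl' = 3 , ≤-refl , s₀≤3 , up₁ 2 (<⇒≤ (≰⇒> nl'))

-- Correctness of the search for partners

module PairPhase {n m : ℕ} {ends : Fin m → Fin n × Fin n} {inT par : Fin m → Bool} {r : Fin n}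
               (R : Rooted ends inT par r) (loopless : ∀ e → proj₁ (ends e) ≢ proj₂ (ends e)) (w : Fin m → ℕ)
               (ID : Fin n → ℕ) (ID-inj : ∀ u v → ID u ≡ ID v → u ≡ v) (i : ℕ) where
  open Rooted R
  open TreeFacts R
  open TreeRun R loopless w
  open StarPhase R loopless w ID ID-inj using (below)
  open CutPhase R loopless w ID ID-inj using (cutval; at-below; belowσ; sufweight; sufweight-frame; notXS)

  PID POS : State → V → ℕ
  PID σ v = σ v ! rPID
  POS σ v = σ v ! rPOS

  Mono : State → (V → ℕ) → Set
  Mono σ b = ∀ u v → PID σ u ≡ PID σ v → POS σ u ≤ POS σ v → b u ≤ b v

  suf : State → V → V → Bool
  suf σ = at-below (PID σ) (POS σ)

  -- What the later phases assume of a star, in terms of registers. Connectedness is kept for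
  -- arbitrary monotone keys because the blocks of the divide and conquer arise only later.
  record Ctx (H : ℕ) (σ : State) : Set where
    field
      conn : ∀ b g → Mono σ b → Mono σ g → Connected (λ v → PID σ v , b v , g v)
      col-pid : ∀ u v → PID σ u ≡ PID σ v → PID σ v ≢ 0 → bit i (σ u ! rTAU) ≡ bit i (σ v ! rTAU)
      pos-odd : ∀ v → PID σ v ≢ 0 → odd (POS σ v) ≡ true
      pos< : ∀ v → POS σ v < 2 ^ H
      kk : ∀ v → σ v ! rKK ≡ ⟪ (λ _ _ → true) ⟫
      cr : ∀ v → PID σ v ≢ 0 → σ v ! rCR ≡ cutval (suf σ v)
      ww : ∀ v → σ v ! rWW ≡ ⟪ (λ u x → suf σ v u ∧ cross i (σ u) (σ x)) ⟫

  low : ℕ → Reg → Bool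
  low k q = toℕ q <ᵇ k

  Same : ℕ → State → State → Set
  Same k σ τ = ∀ v q → low k q ≡ true → τ v ! q ≡ σ v ! q

  cross-same : ∀ σ τ → Same 10 σ τ → ∀ u x → cross i (τ u) (τ x) ≡ cross i (σ u) (σ x)
  cross-same σ τ s u x = cong₂ _∧_ (cong (λ z → not (z ≡ᵇ 0)) (s u rPID refl)) (cong₂ _∧_ (cong (λ z → not (z ≡ᵇ 0)) (s x rPID refl))
    (cong₂ (λ a b → bit i a xor bit i b) (s u rTAU refl) (s x rTAU refl)))

  blue-same : ∀ σ τ → Same 10 σ τ → ∀ u → blue i (τ u) ≡ blue i (σ u)
  blue-same σ τ s u = cong₂ (λ a b → not (a ≡ᵇ 0) ∧ bit i b) (s u rPID refl) (s u rTAU refl)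

  conn-same : ∀ {H} σ τ → Ctx H σ → Same 10 σ τ → ∀ b g → Mono σ b → Mono σ g → Connected (λ v → PID τ v , b v , g v)
  conn-same σ τ C s b g mb mg u v e tu tv = Ctx.conn C b g mb mg u v (trans (sym (eqp u)) (trans e (eqp v))) (conv u tu) (conv v tv)
    where
    eqp : ∀ v → (PID τ v , b v , g v) ≡ (PID σ v , b v , g v)
    eqp v = cong (_, (b v , g v)) (s v rPID refl)
    conv : ∀ u → Topmost (λ v → PID τ v , b v , g v) u → Topmost (λ v → PID σ v , b v , g v) u
    conv u (inj₁ q) = inj₁ q
    conv u (inj₂ ne) = inj₂ λ e → ne (trans (eqp u) (trans e (sym (eqp (p u)))))

  eqP : ∀ (σ τ : State) → Same 10 σ τ → ∀ u v → eq₃ (φP (τ u)) (φP (τ v)) ≡ (PID σ u ≡ᵇ PID σ v)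
  eqP σ τ s u v rewrite s u rPID refl | s v rPID refl with PID σ u ≡ᵇ PID σ v
  ... | true = refl
  ... | false = refl

  module MatePhase (H : ℕ) (σ : State) (C : Ctx H σ) (π : Params) where
    open Ctx C

    lite : V → Bool
    lite v = light i π (σ v)

    kq : V → ℕ
    kq v = pick i (Params.kr π) (Params.kb π) (σ v)

    members : V → V → Bool
    members v u = (PID σ u ≡ᵇ PID σ v) ∧ lite u

    Tot : V → ℕ
    Tot v = ⟪ (λ u x → members v u ∧ cross i (σ u) (σ x)) ⟫

    Low : ℕ → ℕ → V → ℕ
    Low l c v = ⟪ (λ u x → members v u ∧ (cross i (σ u) (σ x) ∧ (shr l (PID σ x) <ᵇ c))) ⟫

    light-same : ∀ τ → Same 10 σ τ → ∀ u → light i π (τ u) ≡ lite u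
    light-same τ s u = cong₂ (λ a b → a <ᵇ 2 ^ (if b then Params.jb π else Params.jr π)) (s u rWW refl) (blue-same σ τ s u)

    -- With `l` bits still open, `lo` and `hi` place the quartile between the weight below the
    -- prefix found so far and the weight below its successor. With no bit left the prefix is the
    -- name of the path that covers the quartile.
    record MInv (l : ℕ) (τ : State) : Set where
      field
        same : Same 10 σ τ
        tot : ∀ v → τ v ! rT ≡ Tot v
        const : ∀ u v → PID σ u ≡ PID σ v → τ u ! rMATE ≡ τ v ! rMATE
        lo : ∀ v → 1 ≤ Tot v → 4 * Low l (τ v ! rMATE) v ≤ kq v * Tot v
        hi : ∀ v → kq v < 4 → 1 ≤ Tot v → kq v * Tot v < 4 * Low l (suc (τ v ! rMATE)) v

    classSum : ∀ S τ (D : Mem → Mem → Bool) → Same 10 σ τ → Step.opz S ≡ add → Step.opy S ≡ add →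
      (∀ a b → Step.contr S a b ≡ eq₃ (φP a) (φP b)) →
      (∀ ro ρ ρ' x → eval (Step.emit S ro) (emitEnv ρ ρ' x) ≡ D ρ ρ' ▸ x) →
      (∀ v → Xv S τ v ≡ light i π (τ v) ▸ Zv S τ v) →
      ∀ v → Yv S τ v ≡ ⟪ (λ u x → members v u ∧ D (τ u) (τ x)) ⟫
    classSum S τ D s refl refl hc he hx v =
      trans (Y-class S τ φP hc (conn-same σ τ C s (λ _ → 0) (λ _ → 0) (λ _ _ _ _ → z≤n) (λ _ _ _ _ → z≤n)) v)
      (trans (fold-cong add λ u → trans (cong₂ _▸_ (eqP σ τ s u v) (trans (hx u) (cong (_▸ Zv S τ u) (light-same τ s u)))) (sym (▸-∧ (PID σ u ≡ᵇ PID σ v) (lite u) (Zv S τ u))))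
        (Z-weight S τ D refl he (members v)))

    start : ∀ L τ → Same 10 σ τ → (∀ v → PID σ v < 2 ^ L) → MInv L (Run (mateStart i π) τ)
    start L τ s hL = toRun (MInv L) (mateStart i π) τ record
        { same = λ v q h → trans (frame (low 10) (mateStart i π) tt τ v q h) (s v q h)
        ; tot = tot'
        ; const = λ u v _ → refl
        ; lo = λ v _ → ≤-trans (≤-reflexive (cong (4 *_) (⟪⟫-empty λ u x → bool-false λ h → case <ᵇ-sound {shr L (PID σ x)} {0} (∧-r {cross i (σ u) (σ x)} (∧-r {members v u} h)) of λ ()))) z≤n
        ; hi = λ v k<4 t → subst (λ z → kq v * Tot v < 4 * z) (⟪⟫-cong λ u x → cong (members v u ∧_) (sym (trans (cong (cross i (σ u) (σ x) ∧_) (<ᵇ-true (subst (_< 1) (sym (shr-0 L (hL x))) (s≤s z≤n)))) (∧-t (cross i (σ u) (σ x))))))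
            (*-monoˡ-< (Tot v) ⦃ nz t ⦄ k<4)
        }
      where
      S : Step
      S = mkStep add add (everywhere (ite (λ ε → cross i (Env.own ε) (Env.oth ε)) wt# (con 0))) (λ a b → eq₃ (φP a) (φP b))
            (ite (λ ε → light i π (Env.own ε)) zz# (con 0)) ((rT , yy#) ∷ (rMATE , con 0) ∷ []) tt
      tot' : ∀ v → Yv S τ v ≡ Tot v
      tot' v = trans (classSum S τ (cross i) s refl refl (λ _ _ → refl) (λ _ _ _ _ → refl) (λ _ → refl) v)
        (⟪⟫-cong λ u x → cong (members v u ∧_) (cross-same σ τ s u x))
      ∧-t : ∀ b → b ∧ true ≡ b
      ∧-t true = refl
      ∧-t false = refl
      nz : ∀ {x} → 1 ≤ x → NonZero x
      nz (s≤s z≤n) = _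

    shr-half : ∀ l x c → (shr l x <ᵇ c + c) ≡ (shr (suc l) x <ᵇ c)
    shr-half l x c = bool-ext
      (λ h → <ᵇ-true (subst (_< c) (sym (shr-suc l x)) (half-< (<ᵇ-sound {shr l x} h))))
      (λ h → <ᵇ-true (subst (_< c + c) (sym (shr-split l x)) (below2 (bit l x) (<ᵇ-sound {shr (suc l) x} h))))
      where
      below2 : ∀ b {y} → y < c → 𝟙 b + (y + y) < c + c
      below2 b {y} q = ≤-trans (≤-trans (s≤s (+-monoˡ-≤ (y + y) (𝟙-mono {b} {true} (λ _ → refl)))) (≤-reflexive (cong suc (sym (+-suc y y))))) (+-mono-≤ q q)

    Low-half : ∀ l c v → Low l (c + c) v ≡ Low (suc l) c v
    Low-half l c v = ⟪⟫-cong λ u x → cong (λ b → members v u ∧ (cross i (σ u) (σ x) ∧ b)) (shr-half l (PID σ x) c)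

    next : ∀ l τ → MInv (suc l) τ → MInv l (Run (mateStep i π l) τ)
    next l τ I = toRun (MInv l) (mateStep i π l) τ record
        { same = λ v q h → trans (frame (low 10) (mateStep i π l) tt τ v q h) (same v q h)
        ; tot = tot
        ; const = λ u v e → cong₂ (λ (b : Bool) c → if b then c + c + 1 else c + c) (test-class u v e) (const u v e)
        ; lo = λ v t → bracket-lo v t (testb v) refl
        ; hi = λ v k t → bracket-hi v k t (testb v) refl
        }
      where
      open MInv I
      S : Step
      S = mkStep add add (everywhere (ite (λ ε → probe i l (Env.own ε) (Env.oth ε)) wt# (con 0))) (λ a b → eq₃ (φP a) (φP b))
        (ite (λ ε → light i π (Env.own ε)) zz# (con 0))
        ((rMATE , ite (λ ε → 4 * Env.yy ε ≤ᵇ pick i (Params.kr π) (Params.kb π) (Env.own ε) * Env.own ε ! rT)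
            (own# rMATE ⊞ own# rMATE ⊞ con 1) (own# rMATE ⊞ own# rMATE)) ∷ []) tt
      c : V → ℕ
      c v = τ v ! rMATE
      testb : V → Bool
      testb v = 4 * Yv S τ v ≤ᵇ pick i (Params.kr π) (Params.kb π) (τ v) * τ v ! rT
      Y≡ : ∀ v → Yv S τ v ≡ Low l (c v + c v + 1) v
      Y≡ v = trans (classSum S τ (probe i l) same refl refl (λ _ _ → refl) (λ _ _ _ _ → refl) (λ _ → refl) v)
        (⟪⟫-cong λ u x → ∧-cong-if (members v u) λ h → cong₂ _∧_ (cross-same σ τ same u x)
          (cong₂ _<ᵇ_ (cong (shr l) (same x rPID refl)) (cong (λ z → z + z + 1) (const u v (==-sound (∧-l h))))))
        where
        ∧-cong-if : ∀ a {b b'} → (a ≡ true → b ≡ b') → a ∧ b ≡ a ∧ b'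
        ∧-cong-if true f = f refl
        ∧-cong-if false f = refl
      test≡ : ∀ v → testb v ≡ (4 * Low l (c v + c v + 1) v ≤ᵇ kq v * Tot v)
      test≡ v = cong₂ _≤ᵇ_ (cong (4 *_) (Y≡ v)) (cong₂ _*_ (cong (λ b → if b then Params.kb π else Params.kr π) (blue-same σ τ same v)) (tot v))
      test-class : ∀ u v → PID σ u ≡ PID σ v → testb u ≡ testb v
      test-class u v e = cong₂ _≤ᵇ_ (cong (4 *_) (trans (Y≡ u) (trans (cong (λ z → Low l (z + z + 1) u) (const u v e)) (trans (Low-class u v e {c v + c v + 1}) (sym (Y≡ v))))))
          (trans (cong₂ _*_ (cong (λ b → if b then Params.kb π else Params.kr π) (trans (blue-same σ τ same u) (trans (blue-class u v e) (sym (blue-same σ τ same v))))) (trans (tot u) (trans (Tot-class u v e) (sym (tot v))))) refl)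
        where
        mem-class : ∀ u v → PID σ u ≡ PID σ v → ∀ y → members u y ≡ members v y
        mem-class u v e y = cong (λ z → (PID σ y ≡ᵇ z) ∧ lite y) e
        Low-class : ∀ u v → PID σ u ≡ PID σ v → ∀ {z} → Low l z u ≡ Low l z v
        Low-class u v e {z} = ⟪⟫-cong λ y x → cong (_∧ (cross i (σ y) (σ x) ∧ (shr l (PID σ x) <ᵇ z))) (mem-class u v e y)
        Tot-class : ∀ u v → PID σ u ≡ PID σ v → Tot u ≡ Tot v
        Tot-class u v e = ⟪⟫-cong λ y x → cong (_∧ cross i (σ y) (σ x)) (mem-class u v e y)
        blue-class : ∀ u v → PID σ u ≡ PID σ v → blue i (σ u) ≡ blue i (σ v)
        blue-class u v e with PID σ v ≟ 0
        ... | yes z rewrite ==-true (trans e z) | ==-true z = refl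
        ... | no nz = cong₂ (λ a b → not (a ≡ᵇ 0) ∧ b) e (col-pid u v e nz)
      bracket-lo : ∀ v → 1 ≤ Tot v → ∀ b → testb v ≡ b → 4 * Low l (if b then c v + c v + 1 else c v + c v) v ≤ kq v * Tot v
      bracket-lo v t true h = ≤ᵇ-sound (trans (sym (test≡ v)) h)
      bracket-lo v t false h = subst (λ z → 4 * z ≤ kq v * Tot v) (sym (Low-half l (c v) v)) (lo v t)
      bracket-hi : ∀ v → kq v < 4 → 1 ≤ Tot v → ∀ b → testb v ≡ b → kq v * Tot v < 4 * Low l (suc (if b then c v + c v + 1 else c v + c v)) v
      bracket-hi v k t false h = subst (λ z → kq v * Tot v < 4 * Low l z v) (+-comm (c v + c v) 1) (≤ᵇ-no (trans (sym (test≡ v)) h))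
      bracket-hi v k t true h = subst (λ z → kq v * Tot v < 4 * z) (trans (sym (Low-half l (suc (c v)) v)) (cong (λ z → Low l z v) (trans (cong suc (+-suc (c v) (c v))) (cong suc (+-comm 1 (c v + c v)))))) (hi v k t)

    mate-correct : ∀ L τ → Same 10 σ τ → (∀ v → PID σ v < 2 ^ L) → MInv 0 (Run (mateProg L i π) τ)
    mate-correct L τ s hL = seq (MInv L) (MInv 0) (mateStart i π) (down L (mateStep i π)) τ (start L τ s hL)
      λ τ I → down-run MInv L (mateStep i π) (λ l τ' _ → next l τ') τ I

    mate-found : ∀ τ → MInv 0 τ → ∀ v q → kq v < 4 → 1 ≤ Tot v → 4 * Low 0 q v ≤ kq v * Tot v → kq v * Tot v < 4 * Low 0 (suc q) v → τ v ! rMATE ≡ q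
    mate-found τ I v q k t l h = ≤-antisym
        (≮⇒≥ λ lt → <⇒≱ h (≤-trans (*-monoʳ-≤ 4 (Low-mono lt)) (MInv.lo I v t)))
        (≮⇒≥ λ lt → <⇒≱ (MInv.hi I v k t) (≤-trans (*-monoʳ-≤ 4 (Low-mono lt)) l))
      where
      Low-mono : ∀ {a b} → a ≤ b → Low 0 a v ≤ Low 0 b v
      Low-mono {a} {b} le = ⟪⟫-mono λ u x hh →
        let hc = ∧-r {members v u} hh in
        ∧-i {members v u} {cross i (σ u) (σ x) ∧ (PID σ x <ᵇ b)} (∧-l {members v u} hh)
          (∧-i {cross i (σ u) (σ x)} {PID σ x <ᵇ b} (∧-l {cross i (σ u) (σ x)} hc) (<ᵇ-true (≤-trans (<ᵇ-sound {PID σ x} {a} (∧-r {cross i (σ u) (σ x)} hc)) le)))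

  wp : State → V → V → ℕ
  wp σ a b = ⟪ (λ u x → suf σ a u ∧ suf σ b x) ⟫

  cross-pid : ∀ {H} σ → Ctx H σ → ∀ u x → cross i (σ u) (σ x) ≡ true → PID σ u ≢ PID σ x
  cross-pid σ C u x h e = same-xor (Ctx.col-pid C u x e (λ z → true≢false (==-true z) (not-f (∧-l (∧-r {not (PID σ u ≡ᵇ 0)} h)))))
      (∧-r {not (PID σ x ≡ᵇ 0)} (∧-r {not (PID σ u ≡ᵇ 0)} h))
    where
    same-xor : ∀ {a b} → a ≡ b → (a xor b) ≡ true → ⊥
    same-xor {true} refl ()
    same-xor {false} refl ()

  cross-i : ∀ {H} σ → Ctx H σ → ∀ a b u x → PID σ a ≢ 0 → PID σ b ≢ 0 → bit i (σ a ! rTAU) xor bit i (σ b ! rTAU) ≡ true →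
    PID σ u ≡ PID σ a → PID σ x ≡ PID σ b → cross i (σ u) (σ x) ≡ true
  cross-i σ C a b u x na nb hx eu ex = ∧-i (not-t (==-false (λ z → na (trans (sym eu) z)))) (∧-i (not-t (==-false (λ z → nb (trans (sym ex) z))))
    (trans (cong₂ _xor_ (Ctx.col-pid C u a eu na) (Ctx.col-pid C x b ex nb)) hx))

  suf-pid : ∀ σ a u → suf σ a u ≡ true → PID σ u ≡ PID σ a
  suf-pid σ a u h = ==-sound {PID σ u} {PID σ a} (∧-l {PID σ u ≡ᵇ PID σ a} h)

  suf-pos : ∀ σ a u → suf σ a u ≡ true → POS σ a ≤ POS σ u
  suf-pos σ a u h = ≤ᵇ-sound {POS σ a} {POS σ u} (∧-r {PID σ u ≡ᵇ PID σ a} h)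

  suf-i : ∀ σ a u → PID σ u ≡ PID σ a → POS σ a ≤ POS σ u → suf σ a u ≡ true
  suf-i σ a u e l = ∧-i {PID σ u ≡ᵇ PID σ a} (==-true e) (≤ᵇ-true l)

  module MateExists {H J : ℕ} (σ : State) (C : Ctx H σ) (a b : V) (na : PID σ a ≢ 0) (nb : PID σ b ≢ 0)
    (hx : bit i (σ a ! rTAU) xor bit i (σ b ! rTAU) ≡ true) (hJ : ⟪ (λ _ _ → true) ⟫ < 2 ^ J) (hw : σ a ! rCR < wp σ a b + wp σ a b) where
    open Ctx C

    W w₀ : ℕ
    W = σ a ! rWW
    w₀ = wp σ a b

    W≤CR : W ≤ σ a ! rCR
    W≤CR = subst₂ _≤_ (sym (ww a)) (sym (cr a na)) (⟪⟫-mono λ u x h →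
      let hs = ∧-l {suf σ a u} h ; hc = ∧-r {suf σ a u} h in
      ∧-i {suf σ a u} hs (not-t (bool-false λ hx' → cross-pid σ C u x hc (trans (suf-pid σ a u hs) (sym (suf-pid σ a x hx'))))))

    w₀≤W : w₀ ≤ W
    w₀≤W = subst (w₀ ≤_) (sym (ww a)) (⟪⟫-mono λ u x h →
      let hs = ∧-l {suf σ a u} h ; hb = ∧-r {suf σ a u} h in
      ∧-i {suf σ a u} hs (cross-i σ C a b u x na nb hx (suf-pid σ a u hs) (suf-pid σ b x hb)))

    w₀≥1 : 1 ≤ w₀
    w₀≥1 = pos hw
      where
      pos : ∀ {x y} → x < y + y → 1 ≤ y
      pos {x} {zero} ()
      pos {x} {suc y} _ = s≤s z≤n

    br : ∃ λ j → (2 ^ j ≤ W) × (W < 2 ^ suc j)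
    br = log-bracket W (≤-trans w₀≥1 w₀≤W)

    j' : ℕ
    j' = proj₁ br

    2^j'≤W : 2 ^ j' ≤ W
    2^j'≤W = proj₁ (proj₂ br)

    W<2^j : W < 2 ^ suc j'
    W<2^j = proj₂ (proj₂ br)

    j'<J : j' < J
    j'<J = ≰⇒> λ l → <⇒≱ hJ (≤-trans (^-monoʳ-≤ 2 l) (≤-trans 2^j'≤W (≤-trans (≤-reflexive (ww a)) (⟪⟫-mono λ _ _ _ → refl))))

    lite' mem : V → Bool
    lite' u = σ u ! rWW <ᵇ 2 ^ suc j'
    mem u = (PID σ u ≡ᵇ PID σ a) ∧ lite' u

    mem-pid : ∀ u → mem u ≡ true → PID σ u ≡ PID σ a
    mem-pid u h = ==-sound {PID σ u} {PID σ a} (∧-l {PID σ u ≡ᵇ PID σ a} h)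

    Tot' At : ℕ
    Tot' = ⟪ (λ u x → mem u ∧ cross i (σ u) (σ x)) ⟫
    At = ⟪ (λ u x → mem u ∧ (cross i (σ u) (σ x) ∧ (PID σ x ≡ᵇ PID σ b))) ⟫

    Low' : ℕ → ℕ
    Low' c = ⟪ (λ u x → mem u ∧ (cross i (σ u) (σ x) ∧ (PID σ x <ᵇ c))) ⟫

    ww-mono : ∀ u → suf σ a u ≡ true → σ u ! rWW ≤ W
    ww-mono u h = subst₂ _≤_ (sym (ww u)) (sym (ww a)) (⟪⟫-mono λ y x hy →
      let hs = ∧-l {suf σ u y} hy in
      ∧-i {suf σ a y} (suf-i σ a y (trans (suf-pid σ u y hs) (suf-pid σ a u h)) (≤-trans (suf-pos σ a u h) (suf-pos σ u y hs))) (∧-r {suf σ u y} hy))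

    -- The cross weight shrinks when going down a path, so with `a` its whole suffix passes the test
    -- of the scale.
    suf-mem : ∀ u → suf σ a u ≡ true → mem u ≡ true
    suf-mem u h = ∧-i {PID σ u ≡ᵇ PID σ a} (==-true (suf-pid σ a u h)) (<ᵇ-true (≤-<-trans (ww-mono u h) W<2^j))

    w₀≤At : w₀ ≤ At
    w₀≤At = ⟪⟫-mono λ u x h →
      let hs = ∧-l {suf σ a u} h ; hb = suf-pid σ b x (∧-r {suf σ a u} h) in
      ∧-i {mem u} (suf-mem u hs) (∧-i {cross i (σ u) (σ x)} (cross-i σ C a b u x na nb hx (suf-pid σ a u hs) hb) (==-true hb))

    -- The members form a suffix of the path, so their cross weight is WW at the topmost one.
    Tot'<2^j : Tot' < 2 ^ suc j'
    Tot'<2^j = bounded (argmin mem (POS σ) (POS σ a) a ≤-refl (suf-mem a (suf-i σ a a refl ≤-refl)))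
      where
      bounded : (Σ V λ t → (mem t ≡ true) × (∀ x → mem x ≡ true → POS σ t ≤ POS σ x)) → Tot' < 2 ^ suc j'
      bounded (t , ht , least) = ≤-<-trans (subst (Tot' ≤_) (sym (ww t)) (⟪⟫-mono λ u x h →
            let hm = ∧-l {mem u} h in
            ∧-i {suf σ t u} (suf-i σ t u (trans (mem-pid u hm) (sym (mem-pid t ht))) (least u hm)) (∧-r {mem u} h)))
        (<ᵇ-sound {σ t ! rWW} (∧-r {PID σ t ≡ᵇ PID σ a} ht))

    -- Here the majority becomes a quarter: `Tot'` is below twice `2 ^ j'`, and `2 ^ j'` is at most
    -- `W`, hence at most the cut of `a`, which is below twice the joint weight and so below
    -- `2 * At`.
    T<4At : Tot' < 4 * At
    T<4At = begin-strict
        Tot'                       <⟨ Tot'<2^j ⟩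
        2 ^ suc j'                 ≡⟨ 2^suc j' ⟩
        2 ^ j' + 2 ^ j'            ≤⟨ +-mono-≤ l l ⟩
        (At + At) + (At + At)      ≡⟨ solve 1 (λ x → (x :+ x) :+ (x :+ x) := con 4 :* x) refl At ⟩
        4 * At ∎
      where
      open ≤-Reasoning
      open +-*-Solver
      l : 2 ^ j' ≤ At + At
      l = ≤-trans 2^j'≤W (≤-trans W≤CR (≤-trans (<⇒≤ hw) (+-mono-≤ w₀≤At w₀≤At)))

    Low-suc : Low' (suc (PID σ b)) ≡ Low' (PID σ b) + At
    Low-suc = ⟪⟫-add pointwise
      where
      lt : ∀ x y → 𝟙 (x <ᵇ suc y) ≡ 𝟙 (x <ᵇ y) + 𝟙 (x ≡ᵇ y)
      lt x y with <-cmp x y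
      ... | tri< l ne _ = trans (cong 𝟙 (<ᵇ-true (m<n⇒m<1+n l))) (sym (cong₂ (λ p q → 𝟙 p + 𝟙 q) (<ᵇ-true l) (==-false ne)))
      ... | tri≈ nl refl _ = trans (cong 𝟙 (<ᵇ-true (n<1+n x))) (sym (cong₂ (λ p q → 𝟙 p + 𝟙 q) (<ᵇ-false {x} {x} ≤-refl) (==-true {x} refl)))
      ... | tri> nl ne g = trans (cong 𝟙 (<ᵇ-false {x} {suc y} g)) (sym (cong₂ (λ p q → 𝟙 p + 𝟙 q) (<ᵇ-false {x} {y} (<⇒≤ g)) (==-false ne)))
      both : ∀ m c l l' e → 𝟙 l ≡ 𝟙 l' + 𝟙 e → 𝟙 (m ∧ (c ∧ l)) ≡ 𝟙 (m ∧ (c ∧ l')) + 𝟙 (m ∧ (c ∧ e))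
      both true true l l' e h = h
      both true false l l' e h = refl
      both false c l l' e h = refl
      pointwise : ∀ u x → 𝟙 (mem u ∧ (cross i (σ u) (σ x) ∧ (PID σ x <ᵇ suc (PID σ b)))) ≡ 𝟙 (mem u ∧ (cross i (σ u) (σ x) ∧ (PID σ x <ᵇ PID σ b))) + 𝟙 (mem u ∧ (cross i (σ u) (σ x) ∧ (PID σ x ≡ᵇ PID σ b)))
      pointwise u x = both (mem u) (cross i (σ u) (σ x)) _ _ _ (lt (PID σ x) (PID σ b))

    Low-Tot : Low' (PID σ b) + At ≤ Tot'
    Low-Tot = subst (_≤ Tot') Low-suc (⟪⟫-mono λ u x h → ∧-i {mem u} (∧-l {mem u} h) (∧-l {cross i (σ u) (σ x)} (∧-r {mem u} h)))

    Tot'≥1 : 1 ≤ Tot'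
    Tot'≥1 = ≤-trans w₀≥1 (≤-trans w₀≤At (≤-trans (m≤n+m At (Low' (PID σ b))) Low-Tot))

    qt : ∃ λ k → (k < 4) × (4 * Low' (PID σ b) ≤ k * Tot') × (k * Tot' < 4 * (Low' (PID σ b) + At))
    qt = quartile Tot' (Low' (PID σ b)) At Tot'≥1 Low-Tot T<4At

    k : ℕ
    k = proj₁ qt

    found : ∀ π → pick i (Params.jr π) (Params.jb π) (σ a) ≡ suc j' → pick i (Params.kr π) (Params.kb π) (σ a) ≡ k →
      ∀ (C' : Ctx H σ) τ → MatePhase.MInv H σ C' π 0 τ → τ a ! rMATE ≡ PID σ b
    found π ej ek C' τ I = mate-found τ I a (PID σ b) (subst (_< 4) (sym ek) (proj₁ (proj₂ qt))) (subst (1 ≤_) (sym Tot≡) Tot'≥1)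
        (subst₂ _≤_ (cong (4 *_) (sym (Low≡ (PID σ b)))) (sym (cong₂ _*_ ek Tot≡)) (proj₁ (proj₂ (proj₂ qt))))
        (subst₂ _<_ (sym (cong₂ _*_ ek Tot≡)) (cong (4 *_) (trans (sym Low-suc) (sym (Low≡ (suc (PID σ b)))))) (proj₂ (proj₂ (proj₂ qt))))
      where
      open MatePhase H σ C' π using (mate-found; members; Tot; Low)
      mem≡ : ∀ u → members a u ≡ mem u
      mem≡ u = go (PID σ u ≡ᵇ PID σ a) refl
        where
        go : ∀ c → (PID σ u ≡ᵇ PID σ a) ≡ c → c ∧ light i π (σ u) ≡ c ∧ lite' u
        go false _ = refl
        go true h = let e = ==-sound {PID σ u} h in cong (λ z → σ u ! rWW <ᵇ 2 ^ z) (trans (cong (λ b → if b then Params.jb π else Params.jr π) (cong₂ (λ a b → not (a ≡ᵇ 0) ∧ b) e (col-pid u a e na))) ej)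
      Tot≡ : Tot a ≡ Tot'
      Tot≡ = ⟪⟫-cong λ u x → cong (_∧ cross i (σ u) (σ x)) (mem≡ u)
      Low≡ : ∀ c → Low 0 c a ≡ Low' c
      Low≡ c = ⟪⟫-cong λ u x → cong (_∧ (cross i (σ u) (σ x) ∧ (PID σ x <ᵇ c))) (mem≡ u)

  -- Only the parameters of the colour of `a` matter, so the conclusion covers every choice that
  -- agrees with them at `a`; the choices made for `a` and for its partner can then be combined.
  mate-exists : ∀ {H J} σ → Ctx H σ → ∀ a b → PID σ a ≢ 0 → PID σ b ≢ 0 → bit i (σ a ! rTAU) xor bit i (σ b ! rTAU) ≡ true →
    ⟪ (λ _ _ → true) ⟫ < 2 ^ J → σ a ! rCR < wp σ a b + wp σ a b →
    Σ ℕ λ j → Σ ℕ λ k → (j < suc J) × (k < 4) ×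
      (∀ π → pick i (Params.jr π) (Params.jb π) (σ a) ≡ j → pick i (Params.kr π) (Params.kb π) (σ a) ≡ k →
        ∀ (C : Ctx H σ) τ → MatePhase.MInv H σ C π 0 τ → τ a ! rMATE ≡ PID σ b)
  mate-exists {H} {J} σ C a b na nb hx hJ hw = suc j' , k , s≤s j'<J , proj₁ (proj₂ qt) , found
    where open MateExists {H} {J} σ C a b na nb hx hJ hw

-- Divide and conquer on matched pairs of paths.  The rows are halved by the bits of POS; BLK names
-- the block of a red node and the partner block of a blue one.  On a pair of blocks,
-- w(a,b) = OFF a + OFF b + (weight of the inner edges below a and b), and FS is the best column
-- for the row at which the block is cut.

inner : ℕ → Mem → Mem → Bool
inner i a b = cross i a b ∧ ((a ! rMATE ≡ᵇ b ! rPID) ∧ ((b ! rMATE ≡ᵇ a ! rPID) ∧ (a ! rBLK ≡ᵇ b ! rBLK)))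

gC : ℕ → ℕ → Mem → Mem → Bool
gC i h a b = blue i a ∧ (inner i a b ∧ bit h (b ! rPOS))

hC : ℕ → Mem → Mem → Bool
hC i a b = not (blue i a) ∧ (inner i a b ∧ (b ! rFS ≤ᵇ b ! rPOS))

φB : Mem → ℕ × ℕ × ℕ
φB ρ = ρ ! rPID , ρ ! rBLK , 0

byBlock : Mem → Mem → Bool
byBlock a b = eq₃ (φB a) (φB b)

-- For a fixed row the value of a pair depends on the column only through `CR` minus twice
-- `OFF + G`, where `G` is the inner weight between the rows below the cut and the columns below the
-- own one. The best column maximises the negative of this; adding `KK`, which bounds every cut,
-- keeps the subtraction exact.
score₀ : Mem → ℕ
score₀ ρ = ρ ! rKK + (ρ ! rOFF + ρ ! rG) + (ρ ! rOFF + ρ ! rG) ∸ ρ ! rCR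

-- Among optimal columns `bestColumn` takes the deepest position. `columnValue` leaves out the inner
-- weight `G` of the cutting row, because each red row adds its own inner weight.
bestValue bestColumn columnValue : Prog
bestValue = mk add mx silent byBlock (own# rKK ⊞ (own# rOFF ⊞ own# rS) ⊞ (own# rOFF ⊞ own# rS) ⊟ own# rCR) ((rY , yy#) ∷ (rG , own# rS) ∷ [])
bestColumn = mk add mx silent byBlock (ite (λ ε → score₀ (Env.own ε) ≡ᵇ Env.own ε ! rY) (own# rPOS) (con 0)) ((rFS , yy#) ∷ [])
columnValue = mk add mx silent byBlock (ite (λ ε → Env.own ε ! rPOS ≡ᵇ Env.own ε ! rFS) (own# rKK ⊞ own# rOFF ⊞ own# rOFF ⊟ own# rCR) (con 0)) ((rCS , yy#) ∷ [])

-- The added 1 distinguishes a column value 0 from the absence of inner edges. A red block hears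
-- from its partner block only over an inner edge; without one it records nothing.
sendColumn : ℕ → Prog
sendColumn i = mk mx mx (everywhere (ite (λ ε → not (blue i (Env.own ε)) ∧ inner i (Env.own ε) (Env.oth ε)) (oth# rCS ⊞ con 1) (con 0)))
  byBlock zz# ((rCS , ite (λ ε → blue i (Env.own ε)) (own# rCS) yy#) ∷ [])

lower : ℕ → ℕ → Mem → Bool
lower i h ρ = if blue i ρ then ρ ! rFS ≤ᵇ ρ ! rPOS else bit h (ρ ! rPOS)

-- Let `L` be the rows and `F` the columns of the lower halves. For an upper row and column with
-- suffixes `U` and `V`, `w(U,V) = w(U,F) - w(L,F) + w(L,V) + w(U - L, V - F)`. The first two terms
-- go to the offset of the row, the third to that of the column; lower nodes keep their offsets. The
-- recorded score is that of the own row with column `rFS`.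
split : ℕ → ℕ → Prog
split i h = mk add add silent byBlock (ite (λ ε → bit h (Env.own ε ! rPOS)) (own# rX) (con 0))
  ((rSCORE , ite (λ ε → not (blue i (Env.own ε)) ∧ not (Env.own ε ! rCS ≡ᵇ 0))
      (own# rSCORE ⊔# (own# rKK ⊞ con 1 ⊟ (own# rCR ⊞ own# rKK ⊟ (own# rCS ⊟ con 1 ⊞ (own# rOFF ⊞ own# rS) ⊞ (own# rOFF ⊞ own# rS))))) (own# rSCORE))
   ∷ (rOFF , ite (λ ε → lower i h (Env.own ε)) (own# rOFF) (ite (λ ε → blue i (Env.own ε)) (own# rOFF ⊞ own# rG) (own# rOFF ⊞ (own# rS ⊟ yy#))))
   ∷ (rBLK , ite (λ ε → lower i h (Env.own ε)) (own# rBLK ⊞ own# rBLK ⊞ con 1) (own# rBLK ⊞ own# rBLK)) ∷ [])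

stage₁ stage₂ stage₃ stage₄ stage₅ stage : ℕ → ℕ → ℕ → Prog
stage₁ H i h = (weightProg (hC i) ⨾ suffixProg H) ⨾ split i h
stage₂ H i h = sendColumn i ⨾ stage₁ H i h
stage₃ H i h = columnValue ⨾ stage₂ H i h
stage₄ H i h = bestColumn ⨾ stage₃ H i h
stage₅ H i h = bestValue ⨾ stage₄ H i h
stage H i h = (weightProg (gC i h) ⨾ suffixProg H) ⨾ stage₅ H i h

-- The registers after one stage of the divide and conquer

module StagePhase {n m : ℕ} {ends : Fin m → Fin n × Fin n} {inT par : Fin m → Bool} {r : Fin n}
               (R : Rooted ends inT par r) (loopless : ∀ e → proj₁ (ends e) ≢ proj₂ (ends e)) (w : Fin m → ℕ)
               (ID : Fin n → ℕ) (ID-inj : ∀ u v → ID u ≡ ID v → u ≡ v) (i : ℕ) where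
  open Rooted R
  open TreeFacts R
  open TreeRun R loopless w
  open StarPhase R loopless w ID ID-inj using (below; suffix-correct)
  open CutPhase R loopless w ID ID-inj using (cutval; at-below; belowσ; sufweight; sufweight-frame; notXS)
  open PairPhase R loopless w ID ID-inj i

  sufweight-X : ∀ C H σ (D : V → Bool) → ∑ (λ v → D v ▸ Run (weightProg C ⨾ suffixProg H) σ v ! rX) ≡ ⟪ (λ u x → D u ∧ C (σ u) (σ x)) ⟫
  sufweight-X C H σ D = seq (λ τ → ∀ v → τ v ! rX ≡ Zv S σ v) (λ τ → ∑ (λ v → D v ▸ τ v ! rX) ≡ ⟪ (λ u x → D u ∧ C (σ u) (σ x)) ⟫)
      (weightProg C) (suffixProg H) σ (toRun (λ τ → ∀ v → τ v ! rX ≡ Zv S σ v) (weightProg C) σ (λ v → refl))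
      λ τ hX → trans (fold-cong add λ v → cong (D v ▸_) (trans (frame-run notS (suffixProg H) (tt , λ _ → tt) τ v rX refl) (hX v)))
                     (Z-weight S σ C refl (λ _ _ _ _ → refl) D)
    where
    S : Step
    S = mkStep add add (everywhere (ite (λ ε → C (Env.own ε) (Env.oth ε)) wt# (con 0))) never (con 0) ((rX , zz#) ∷ []) tt
    notS : Reg → Bool
    notS q = not (toℕ q ≡ᵇ 18)

  module StageTerms (h : ℕ) (τ : State) where
    pid pos blk off cr kk : V → ℕ
    pid v = τ v ! rPID
    pos v = τ v ! rPOS
    blk v = τ v ! rBLK
    off v = τ v ! rOFF
    cr v = τ v ! rCR
    kk v = τ v ! rKK

    bl : V → Bool
    bl v = blue i (τ v)

    inn cls seg : V → V → Bool
    inn u x = inner i (τ u) (τ x)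
    cls a u = (pid u ≡ᵇ pid a) ∧ (blk u ≡ᵇ blk a)
    seg a u = (pid u ≡ᵇ pid a) ∧ ((blk u ≡ᵇ blk a) ∧ (pos a ≤ᵇ pos u))

    g : V → ℕ
    g v = ⟪ (λ y x → seg v y ∧ (bl y ∧ (inn y x ∧ bit h (pos x)))) ⟫

    val : V → ℕ
    val v = kk v + (off v + g v) + (off v + g v) ∸ cr v

    hhF xxF : (V → ℕ) → V → ℕ
    hhF fs v = ⟪ (λ u x → seg v u ∧ (not (bl u) ∧ (inn u x ∧ (fs x ≤ᵇ pos x)))) ⟫
    xxF fs v = ⟪ (λ u x → (cls v u ∧ bit h (pos u)) ∧ (not (bl u) ∧ (inn u x ∧ (fs x ≤ᵇ pos x)))) ⟫

    lwF : (V → ℕ) → V → Bool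
    lwF fs v = if bl v then fs v ≤ᵇ pos v else bit h (pos v)

    -- The contract of a stage, independent of its execution: all that the argument about cut values
    -- uses. The column value `cs` is described by a bound and a witness because several nodes may
    -- share the optimal position.
    record StageOut (τ' : State) : Set where
      field
        fs cs rc : V → ℕ
        fs-best : ∀ v → Σ V λ b → (cls v b ≡ true) × (pos b ≡ fs v) × (∀ u → cls v u ≡ true → val u ≤ val b)
        fs-class : ∀ u v → cls v u ≡ true → fs u ≡ fs v
        cs-≥ : ∀ v b → cls v b ≡ true → pos b ≡ fs v → kk b + off b + off b ∸ cr b ≤ cs v
        cs-att : ∀ v → cs v ≢ 0 → Σ V λ b → (cls v b ≡ true) × (pos b ≡ fs v) × (cs v ≡ kk b + off b + off b ∸ cr b)
        rc-e : ∀ v → rc v ≢ 0 → Σ V λ u → Σ V λ x → (cls v u ≡ true) × (bl u ≡ false) × (inn u x ≡ true) × (rc v ≡ suc (cs x))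
        rc-i : ∀ v u x → cls v u ≡ true → bl u ≡ false → inn u x ≡ true → (Σ (Fin m) λ e → ((fst e ≡ u) × (snd e ≡ x)) ⊎ ((fst e ≡ x) × (snd e ≡ u))) → rc v ≢ 0

        score' : ∀ v → bl v ≡ false → τ' v ! rSCORE ≡ (if not (rc v ≡ᵇ 0) then τ v ! rSCORE ⊔ (kk v + 1 ∸ (cr v + kk v ∸ ((rc v ∸ 1) + (off v + hhF fs v) + (off v + hhF fs v)))) else τ v ! rSCORE)
        score'-blue : ∀ v → bl v ≡ true → τ' v ! rSCORE ≡ τ v ! rSCORE
        off' : ∀ v → τ' v ! rOFF ≡ (if lwF fs v then off v else if bl v then off v + g v else off v + (hhF fs v ∸ xxF fs v))
        blk' : ∀ v → τ' v ! rBLK ≡ (if lwF fs v then blk v + blk v + 1 else blk v + blk v)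
        keep : ∀ v q → low 11 q ≡ true → τ' v ! q ≡ τ v ! q

  module _ (H : ℕ) (h : ℕ) (τ : State) (conn : ∀ t → Connected (φ t ∘ τ)) (connB : Connected (φB ∘ τ)) (pos< : ∀ v → τ v ! rPOS < 2 ^ H) where
    open StageTerms h τ

    cls-eq : ∀ (τ' : State) → (∀ v → τ' v ! rPID ≡ pid v) → (∀ v → τ' v ! rBLK ≡ blk v) → ∀ u v → eq₃ (φB (τ' u)) (φB (τ' v)) ≡ cls v u
    cls-eq τ' hp hb u v = trans (cong₂ _∧_ (cong₂ _≡ᵇ_ (hp u) (hp v)) (cong₂ (λ a b → (a ≡ᵇ b) ∧ true) (hb u) (hb v))) (cong ((pid u ≡ᵇ pid v) ∧_) (∧-true (blk u ≡ᵇ blk v)))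
      where
      ∧-true : ∀ b → b ∧ true ≡ b
      ∧-true true = refl
      ∧-true false = refl

    Y-cls : ∀ S (τ' : State) → (∀ a b → Step.contr S a b ≡ byBlock a b) → (∀ v → τ' v ! rPID ≡ pid v) → (∀ v → τ' v ! rBLK ≡ blk v) →
      ∀ v → Yv S τ' v ≡ fold (Step.opy S) (λ u → cls v u ▸ Xv S τ' u)
    Y-cls S τ' hc hp hb v = trans (Y-class S τ' φB hc conn' v) (fold-cong (Step.opy S) λ u → cong (_▸ Xv S τ' u) (cls-eq τ' hp hb u v))
      where
      eqφ : ∀ v → φB (τ' v) ≡ φB (τ v)
      eqφ v = cong₂ (λ a b → a , b , 0) (hp v) (hb v)
      conn' : Connected (φB ∘ τ')
      conn' u v e tu tv = connB u v (trans (sym (eqφ u)) (trans e (eqφ v))) (conv u tu) (conv v tv)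
        where
        conv : ∀ u → Topmost (φB ∘ τ') u → Topmost (φB ∘ τ) u
        conv u (inj₁ q) = inj₁ q
        conv u (inj₂ ne) = inj₂ λ e → ne (trans (eqφ u) (trans e (sym (eqφ (p u)))))

    cls-refl : ∀ v → cls v v ≡ true
    cls-refl v = ∧-i {pid v ≡ᵇ pid v} (==-true {pid v} refl) (==-true {blk v} refl)

    cls-pid : ∀ v u → cls v u ≡ true → pid u ≡ pid v
    cls-pid v u c = ==-sound {pid u} (∧-l {pid u ≡ᵇ pid v} c)

    cls-blk : ∀ v u → cls v u ≡ true → blk u ≡ blk v
    cls-blk v u c = ==-sound {blk u} (∧-r {pid u ≡ᵇ pid v} c)

    cls-cong : ∀ u v → cls v u ≡ true → ∀ x → cls u x ≡ cls v x
    cls-cong u v c x = cong₂ (λ a b → (pid x ≡ᵇ a) ∧ (blk x ≡ᵇ b)) (cls-pid v u c) (cls-blk v u c)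

    ▸-true : ∀ {b} x → b ≡ true → b ▸ x ≡ x
    ▸-true x refl = refl

    ▸-≢0 : ∀ b {x} → b ▸ x ≢ 0 → (b ≡ true) × (b ▸ x ≡ x)
    ▸-≢0 true _ = refl , refl
    ▸-≢0 false h = ⊥-elim (h refl)

    max≥ : ∀ v (f : V → ℕ) u → cls v u ≡ true → f u ≤ ⨆ (λ u → cls v u ▸ f u)
    max≥ v f u c = ≤-trans (≤-reflexive (sym (▸-true (f u) c))) (fold-≥ mx (λ u → cls v u ▸ f u) u)

    max-att : ∀ v (f : V → ℕ) → Σ V λ u → (cls v u ≡ true) × (f u ≡ ⨆ (λ u → cls v u ▸ f u))
    max-att v f with ⨆ (λ u → cls v u ▸ f u) ≟ 0
    ... | yes z = v , cls-refl v , ≤-antisym (max≥ v f v (cls-refl v)) (≤-trans (≤-reflexive z) z≤n)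
    ... | no nz with ⨆-attained (λ u → cls v u ▸ f u) nz
    ...   | u , e with ▸-≢0 (cls v u) (λ z → nz (trans e z))
    ...     | c , q = u , c , sym (trans e q)

    max-class : ∀ u v (f : V → ℕ) → cls v u ≡ true → ⨆ (λ x → cls u x ▸ f x) ≡ ⨆ (λ x → cls v x ▸ f x)
    max-class u v f c = fold-cong mx λ x → cong (_▸ f x) (cls-cong u v c x)

    Y* FS* CS* : V → ℕ
    Y* v = ⨆ (λ u → cls v u ▸ val u)
    FS* v = ⨆ (λ u → cls v u ▸ ((val u ≡ᵇ Y* u) ▸ pos u))
    CS* v = ⨆ (λ u → cls v u ▸ ((pos u ≡ᵇ FS* u) ▸ (kk u + off u + off u ∸ cr u)))

    best : ∀ v → Σ V λ b → (cls v b ≡ true) × (pos b ≡ FS* v) × (∀ u → cls v u ≡ true → val u ≤ val b)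
    best v with max-att v (λ u → (val u ≡ᵇ Y* u) ▸ pos u)
    ... | b , c , e with val b ≡ᵇ Y* b in q
    ...   | true = b , c , e , λ u cu → ≤-trans (max≥ v val u cu) (≤-reflexive (sym (trans (==-sound {val b} q) (max-class b v val c))))
    -- The mask fails at the maximiser only when the maximum is 0; then a node of maximal value has
    -- position 0 as well.
    ...   | false with max-att v val
    ...     | b' , c' , e' = b' , c' , trans z (trans e refl) , λ u cu → ≤-trans (max≥ v val u cu) (≤-reflexive (sym e'))
      where
      hit : (val b' ≡ᵇ Y* b') ≡ true
      hit = ==-true (trans e' (sym (max-class b' v val c')))
      z : pos b' ≡ 0
      z = n≤0⇒n≡0 (≤-trans (≤-trans (≤-reflexive (sym (▸-true (pos b') hit))) (max≥ v (λ u → (val u ≡ᵇ Y* u) ▸ pos u) b' c')) (≤-reflexive (sym e)))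

    fs-cls : ∀ u v → cls v u ≡ true → FS* u ≡ FS* v
    fs-cls u v c = max-class u v (λ u → (val u ≡ᵇ Y* u) ▸ pos u) c

    P-common : Reg → Bool
    P-common q = low 13 q ∨ (toℕ q ≡ᵇ 23)

    Sp₁ Sp₂ Sp₃ Sp₄ : State → Set
    Sp₁ τ₁ = (∀ v → τ₁ v ! rS ≡ g v) × (∀ v q → P-common q ≡ true → τ₁ v ! q ≡ τ v ! q)
    Sp₂ τ₂ = (∀ v → τ₂ v ! rG ≡ g v) × (∀ v → τ₂ v ! rY ≡ Y* v) × (∀ v q → P-common q ≡ true → τ₂ v ! q ≡ τ v ! q)
    Sp₃ τ₃ = (∀ v → τ₃ v ! rG ≡ g v) × (∀ v → τ₃ v ! rFS ≡ FS* v) × (∀ v q → P-common q ≡ true → τ₃ v ! q ≡ τ v ! q)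
    Sp₄ τ₄ = (∀ v → τ₄ v ! rG ≡ g v) × (∀ v → τ₄ v ! rFS ≡ FS* v) × (∀ v → τ₄ v ! rCS ≡ CS* v) × (∀ v q → P-common q ≡ true → τ₄ v ! q ≡ τ v ! q)

    record RC (rc : V → ℕ) : Set where
      field
        rc-e : ∀ v → rc v ≢ 0 → Σ V λ u → Σ V λ x → (cls v u ≡ true) × (bl u ≡ false) × (inn u x ≡ true) × (rc v ≡ suc (CS* x))
        rc-i : ∀ v u x → cls v u ≡ true → bl u ≡ false → inn u x ≡ true → (Σ (Fin m) λ e → ((fst e ≡ u) × (snd e ≡ x)) ⊎ ((fst e ≡ x) × (snd e ≡ u))) → rc v ≢ 0

    Sp₅ : State → Set
    Sp₅ τ₅ = (∀ v → τ₅ v ! rG ≡ g v) × (∀ v → τ₅ v ! rFS ≡ FS* v) × (Σ (V → ℕ) λ rc → RC rc × (∀ v → bl v ≡ false → τ₅ v ! rCS ≡ rc v)) × (∀ v q → P-common q ≡ true → τ₅ v ! q ≡ τ v ! q)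

    step₁ : Sp₁ (Run (weightProg (gC i h) ⨾ suffixProg H) τ)
    step₁ = sufweight (gC i h) H τ conn pos< , λ v q hq → sufweight-frame (gC i h) H τ v q (impl q hq)
      where
      impl : ∀ q → P-common q ≡ true → notXS q ≡ true
      impl q hq with ∨-e {low 13 q} hq
      ... | inj₁ l = not-t (bool-false λ z → case ∨-e {toℕ q ≡ᵇ 17} z of λ
              { (inj₁ e) → <⇒≱ (<ᵇ-sound {toℕ q} {13} l) (≤-trans (m≤m+n 13 4) (≤-reflexive (sym (==-sound {toℕ q} e))))
              ; (inj₂ e) → <⇒≱ (<ᵇ-sound {toℕ q} {13} l) (≤-trans (m≤m+n 13 5) (≤-reflexive (sym (==-sound {toℕ q} e)))) })
      ... | inj₂ e = cong (λ z → not ((z ≡ᵇ 17) ∨ (z ≡ᵇ 18))) (==-sound {toℕ q} e)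

    step₂ : ∀ τ₁ → Sp₁ τ₁ → Sp₂ (Run bestValue τ₁)
    step₂ τ₁ (hS , f) = toRun Sp₂ bestValue τ₁
      (hS , (λ v → trans (Y-cls S τ₁ (λ _ _ → refl) (λ v → f v rPID refl) (λ v → f v rBLK refl) v) (fold-cong mx λ u → cong (cls v u ▸_) (x-eq u)))
      , (λ v q hq → trans (frame P-common bestValue tt τ₁ v q hq) (f v q hq)))
      where
      S : Step
      S = mkStep add mx silent byBlock (own# rKK ⊞ (own# rOFF ⊞ own# rS) ⊞ (own# rOFF ⊞ own# rS) ⊟ own# rCR) ((rY , yy#) ∷ (rG , own# rS) ∷ []) tt
      x-eq : ∀ u → Xv S τ₁ u ≡ val u
      x-eq u = cong₂ _∸_ (cong₂ (λ a b → a + b + b) (f u rKK refl) (cong₂ _+_ (f u rOFF refl) (hS u))) (f u rCR refl)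

    step₃ : ∀ τ₂ → Sp₂ τ₂ → Sp₃ (Run bestColumn τ₂)
    step₃ τ₂ (hG , hY , f) = toRun Sp₃ bestColumn τ₂
      (hG , (λ v → trans (Y-cls S τ₂ (λ _ _ → refl) (λ v → f v rPID refl) (λ v → f v rBLK refl) v) (fold-cong mx λ u → cong (cls v u ▸_) (x-eq u)))
      , (λ v q hq → trans (frame P-common bestColumn tt τ₂ v q hq) (f v q hq)))
      where
      S : Step
      S = mkStep add mx silent byBlock (ite (λ ε → score₀ (Env.own ε) ≡ᵇ Env.own ε ! rY) (own# rPOS) (con 0)) ((rFS , yy#) ∷ []) tt
      x-eq : ∀ u → Xv S τ₂ u ≡ (val u ≡ᵇ Y* u) ▸ pos u
      x-eq u = cong₂ (λ a b → if a then b else 0)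
        (cong₂ _≡ᵇ_ (cong₂ _∸_ (cong₂ (λ a b → a + b + b) (f u rKK refl) (cong₂ _+_ (f u rOFF refl) (hG u))) (f u rCR refl)) (hY u)) (f u rPOS refl)

    step₄ : ∀ τ₃ → Sp₃ τ₃ → Sp₄ (Run columnValue τ₃)
    step₄ τ₃ (hG , hF , f) = toRun Sp₄ columnValue τ₃
      (hG , hF , (λ v → trans (Y-cls S τ₃ (λ _ _ → refl) (λ v → f v rPID refl) (λ v → f v rBLK refl) v) (fold-cong mx λ u → cong (cls v u ▸_) (x-eq u)))
      , (λ v q hq → trans (frame P-common columnValue tt τ₃ v q hq) (f v q hq)))
      where
      S : Step
      S = mkStep add mx silent byBlock (ite (λ ε → Env.own ε ! rPOS ≡ᵇ Env.own ε ! rFS) (own# rKK ⊞ own# rOFF ⊞ own# rOFF ⊟ own# rCR) (con 0)) ((rCS , yy#) ∷ []) tt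
      x-eq : ∀ u → Xv S τ₃ u ≡ (pos u ≡ᵇ FS* u) ▸ (kk u + off u + off u ∸ cr u)
      x-eq u = cong₂ (λ a b → if a then b else 0) (cong₂ _≡ᵇ_ (f u rPOS refl) (hF u))
        (cong₂ _∸_ (cong₂ (λ a b → a + b + b) (f u rKK refl) (f u rOFF refl)) (f u rCR refl))

    blue-eq : ∀ (τ' : State) → (∀ v q → P-common q ≡ true → τ' v ! q ≡ τ v ! q) → ∀ u → blue i (τ' u) ≡ bl u
    blue-eq τ' f u = cong₂ (λ a b → not (a ≡ᵇ 0) ∧ bit i b) (f u rPID refl) (f u rTAU refl)

    inner-eq : ∀ (τ' : State) → (∀ v q → P-common q ≡ true → τ' v ! q ≡ τ v ! q) → ∀ u x → inner i (τ' u) (τ' x) ≡ inn u x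
    inner-eq τ' f u x = cong₂ _∧_
      (cong₂ _∧_ (cong (λ z → not (z ≡ᵇ 0)) (f u rPID refl)) (cong₂ _∧_ (cong (λ z → not (z ≡ᵇ 0)) (f x rPID refl)) (cong₂ (λ a b → bit i a xor bit i b) (f u rTAU refl) (f x rTAU refl))))
      (cong₂ _∧_ (cong₂ _≡ᵇ_ (f u rMATE refl) (f x rPID refl)) (cong₂ _∧_ (cong₂ _≡ᵇ_ (f x rMATE refl) (f u rPID refl)) (cong₂ _≡ᵇ_ (f u rBLK refl) (f x rBLK refl))))

    step₅ : ∀ τ₄ → Sp₄ τ₄ → Sp₅ (Run (sendColumn i) τ₄)
    step₅ τ₄ (hG , hF , hC' , f) = toRun Sp₅ (sendColumn i) τ₄
      (hG , hF , (Yv S τ₄ , record { rc-e = rce ; rc-i = rci } , λ v b → cong (λ z → if z then τ₄ v ! rCS else Yv S τ₄ v) (trans (blue-eq τ₄ f v) b))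
      , (λ v q hq → trans (frame P-common (sendColumn i) tt τ₄ v q hq) (f v q hq)))
      where
      S : Step
      S = mkStep mx mx (everywhere (ite (λ ε → not (blue i (Env.own ε)) ∧ inner i (Env.own ε) (Env.oth ε)) (oth# rCS ⊞ con 1) (con 0)))
            byBlock zz# ((rCS , ite (λ ε → blue i (Env.own ε)) (own# rCS) yy#) ∷ []) tt
      E : Mem → Mem → ℕ
      E ρ ρ' = (not (blue i ρ) ∧ inner i ρ ρ') ▸ (ρ' ! rCS + 1)
      E-eq : ∀ u x → E (τ₄ u) (τ₄ x) ≡ (not (bl u) ∧ inn u x) ▸ suc (CS* x)
      E-eq u x = cong₂ _▸_ (cong₂ (λ a b → not a ∧ b) (blue-eq τ₄ f u) (inner-eq τ₄ f u x)) (trans (+-comm _ 1) (cong suc (hC' x)))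
      Y-eq : ∀ v → Yv S τ₄ v ≡ ⨆ (λ u → cls v u ▸ Zv S τ₄ u)
      Y-eq v = Y-cls S τ₄ (λ _ _ → refl) (λ v → f v rPID refl) (λ v → f v rBLK refl) v
      rce : ∀ v → Yv S τ₄ v ≢ 0 → Σ V λ u → Σ V λ x → (cls v u ≡ true) × (bl u ≡ false) × (inn u x ≡ true) × (Yv S τ₄ v ≡ suc (CS* x))
      rce v nz =
        let (u , c , e) = max-att v (Zv S τ₄)
            (x , ex) = Z-max-attained S τ₄ E refl (λ _ _ _ _ → refl) u (λ z → nz (trans (Y-eq v) (trans (sym e) z)))
            all = trans (Y-eq v) (trans (sym e) (trans ex (E-eq u x)))
            (t , q) = ▸-≢0 (not (bl u) ∧ inn u x) {suc (CS* x)} (λ z → nz (trans all z))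
        in u , x , c , not-f (∧-l {not (bl u)} t) , ∧-r {not (bl u)} t , trans all q
      pos-at : ∀ u x → bl u ≡ false → inn u x ≡ true → 1 ≤ E (τ₄ u) (τ₄ x)
      pos-at u x b t = subst (1 ≤_) (sym (trans (E-eq u x) (▸-true _ (∧-i {not (bl u)} (not-t b) t)))) (s≤s z≤n)
      rci : ∀ v u x → cls v u ≡ true → bl u ≡ false → inn u x ≡ true → (Σ (Fin m) λ e → ((fst e ≡ u) × (snd e ≡ x)) ⊎ ((fst e ≡ x) × (snd e ≡ u))) → Yv S τ₄ v ≢ 0
      rci v u x c b t (e , je) z = <⇒≱ (≤-trans (pos-at u x b t) zu) (≤-trans (max≥ v (Zv S τ₄) u c) (≤-reflexive (trans (sym (Y-eq v)) z)))
        where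
        zz = Z-max-≥ S τ₄ E (λ _ _ _ _ → refl) e
        zu' : ∀ {u x} → ((fst e ≡ u) × (snd e ≡ x)) ⊎ ((fst e ≡ x) × (snd e ≡ u)) → E (τ₄ u) (τ₄ x) ≤ Zv S τ₄ u
        zu' (inj₁ (refl , refl)) = proj₁ zz
        zu' (inj₂ (refl , refl)) = proj₂ zz
        zu : E (τ₄ u) (τ₄ x) ≤ Zv S τ₄ u
        zu = zu' je

    Frm : State → Set
    Frm τ₆ = ∀ v q → P-common q ≡ true → τ₆ v ! q ≡ τ v ! q

    record Sp₆ (rc : V → ℕ) (τ₆ : State) : Set where
      field
        hG : ∀ v → τ₆ v ! rG ≡ g v
        hF : ∀ v → τ₆ v ! rFS ≡ FS* v
        hR : ∀ v → bl v ≡ false → τ₆ v ! rCS ≡ rc v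
        hS : ∀ v → τ₆ v ! rS ≡ hhF FS* v
        hX : ∀ v → ∑ (λ u → (cls v u ∧ bit h (pos u)) ▸ τ₆ u ! rX) ≡ xxF FS* v
        fr : Frm τ₆

    step₆ : ∀ τ₅ (s : Sp₅ τ₅) → Sp₆ (proj₁ (proj₁ (proj₂ (proj₂ s)))) (Run (weightProg (hC i) ⨾ suffixProg H) τ₅)
    step₆ τ₅ (hG , hF , (rc , _ , hR) , f) = record
        { hG = λ v → trans (fr' v rG refl) (hG v)
        ; hF = λ v → trans (fr' v rFS refl) (hF v)
        ; hR = λ v b → trans (fr' v rCS refl) (hR v b)
        ; hS = λ v → trans (sufweight (hC i) H τ₅ (λ t → transfer (φ t) (φ-eq t) (conn t)) (λ v → subst (_< 2 ^ H) (sym (f v rPOS refl)) (pos< v)) v)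
                 (⟪⟫-cong λ u x → cong₂ _∧_ (below-eq v u) (C-eq u x))
        ; hX = λ v → trans (sufweight-X (hC i) H τ₅ (λ u → cls v u ∧ bit h (pos u))) (⟪⟫-cong λ u x → cong ((cls v u ∧ bit h (pos u)) ∧_) (C-eq u x))
        ; fr = λ v q hq → trans (fr' v q (impl q hq)) (f v q hq)
        }
      where
      fr' = sufweight-frame (hC i) H τ₅
      impl : ∀ q → P-common q ≡ true → notXS q ≡ true
      impl q hq with ∨-e {low 13 q} hq
      ... | inj₁ l = not-t (bool-false λ z → case ∨-e {toℕ q ≡ᵇ 17} z of λ
              { (inj₁ e) → <⇒≱ (<ᵇ-sound {toℕ q} {13} l) (≤-trans (m≤m+n 13 4) (≤-reflexive (sym (==-sound {toℕ q} e))))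
              ; (inj₂ e) → <⇒≱ (<ᵇ-sound {toℕ q} {13} l) (≤-trans (m≤m+n 13 5) (≤-reflexive (sym (==-sound {toℕ q} e)))) })
      ... | inj₂ e = cong (λ z → not ((z ≡ᵇ 17) ∨ (z ≡ᵇ 18))) (==-sound {toℕ q} e)
      φ-eq : ∀ t v → φ t (τ₅ v) ≡ φ t (τ v)
      φ-eq t v = cong₂ _,_ (f v rPID refl) (cong₂ _,_ (f v rBLK refl) (cong (shr t) (f v rPOS refl)))
      transfer : ∀ (ψ : Mem → ℕ × ℕ × ℕ) → (∀ v → ψ (τ₅ v) ≡ ψ (τ v)) → Connected (ψ ∘ τ) → Connected (ψ ∘ τ₅)
      transfer ψ eq cn u v e tu tv = cn u v (trans (sym (eq u)) (trans e (eq v))) (conv u tu) (conv v tv)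
        where
        conv : ∀ u → Topmost (ψ ∘ τ₅) u → Topmost (ψ ∘ τ) u
        conv u (inj₁ q) = inj₁ q
        conv u (inj₂ ne) = inj₂ λ e → ne (trans (eq u) (trans e (sym (eq (p u)))))
      below-eq : ∀ v u → belowσ τ₅ v u ≡ seg v u
      below-eq v u = cong₂ _∧_ (cong₂ _≡ᵇ_ (f u rPID refl) (f v rPID refl)) (cong₂ _∧_ (cong₂ _≡ᵇ_ (f u rBLK refl) (f v rBLK refl)) (cong₂ _≤ᵇ_ (f v rPOS refl) (f u rPOS refl)))
      C-eq : ∀ u x → hC i (τ₅ u) (τ₅ x) ≡ not (bl u) ∧ (inn u x ∧ (FS* x ≤ᵇ pos x))
      C-eq u x = cong₂ (λ a b → not a ∧ b) (blue-eq τ₅ f u) (cong₂ _∧_ (inner-eq τ₅ f u x) (cong₂ _≤ᵇ_ (hF x) (f x rPOS refl)))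

    step₇ : ∀ rc → RC rc → ∀ τ₆ → Sp₆ rc τ₆ → StageOut (Run (split i h) τ₆)
    step₇ rc rcok τ₆ s = toRun StageOut (split i h) τ₆ record
        { fs = FS* ; cs = CS* ; rc = rc
        ; fs-best = best
        ; fs-class = fs-cls
        ; cs-≥ = λ v b c e → ≤-trans (≤-reflexive (sym (▸-true _ (==-true (trans e (sym (fs-cls b v c))))))) (max≥ v (λ u → (pos u ≡ᵇ FS* u) ▸ (kk u + off u + off u ∸ cr u)) b c)
        ; cs-att = csatt
        ; rc-e = RC.rc-e rcok
        ; rc-i = RC.rc-i rcok
        ; score' = λ v b → cong₂ (λ c t → if c then τ₆' v rSCORE ⊔ (τ₆' v rKK + 1 ∸ (τ₆' v rCR + τ₆' v rKK ∸ t)) else τ₆' v rSCORE)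
              (cong₂ (λ a c → not a ∧ not (c ≡ᵇ 0)) (trans (blue-eq τ₆ fr v) b) (hR v b))
              (cong₂ (λ a c → (a ∸ 1) + c + c) (hR v b) (cong₂ _+_ (fr v rOFF refl) (hS v)))
            ⟫= subst-regs v
        ; score'-blue = λ v b → trans (cong (λ c → if not c ∧ not (τ₆ v ! rCS ≡ᵇ 0) then τ₆' v rSCORE ⊔ (τ₆' v rKK + 1 ∸ (τ₆' v rCR + τ₆' v rKK ∸ (τ₆' v rCS ∸ 1 + (τ₆' v rOFF + τ₆' v rS) + (τ₆' v rOFF + τ₆' v rS)))) else τ₆' v rSCORE) (trans (blue-eq τ₆ fr v) b)) (fr v rSCORE refl)
        ; off' = λ v → trans (cong₂ (λ a c → if a then τ₆' v rOFF else if c then τ₆' v rOFF + τ₆' v rG else τ₆' v rOFF + (τ₆' v rS ∸ Yv S τ₆ v)) (lw-eq v) (blue-eq τ₆ fr v))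
              (trans (cong₂ (λ o e → if lw* v then o else if bl v then o + e else o + (τ₆' v rS ∸ Yv S τ₆ v)) (fr v rOFF refl) (hG v))
                (cong₂ (λ e x → if lw* v then off v else if bl v then off v + g v else off v + (e ∸ x)) (hS v) (Y-eq v)))
        ; blk' = λ v → cong₂ (λ a c → if a then c + c + 1 else c + c) (lw-eq v) (fr v rBLK refl)
        ; keep = λ v q hq → trans (frame (low 11) (split i h) tt τ₆ v q hq) (fr v q (∨-l {low 13 q} (<ᵇ-true (≤-trans (<ᵇ-sound {toℕ q} {11} hq) (m≤m+n 11 2)))))
        }
      where
      open Sp₆ s
      infixl 1 _⟫=_
      _⟫=_ : ∀ {A : Set} {x y z : A} → x ≡ y → y ≡ z → x ≡ z
      _⟫=_ = trans
      τ₆' : V → Reg → ℕ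
      τ₆' v q = τ₆ v ! q
      S : Step
      S = mkStep add add silent byBlock (ite (λ ε → bit h (Env.own ε ! rPOS)) (own# rX) (con 0))
        ((rSCORE , ite (λ ε → not (blue i (Env.own ε)) ∧ not (Env.own ε ! rCS ≡ᵇ 0))
            (own# rSCORE ⊔# (own# rKK ⊞ con 1 ⊟ (own# rCR ⊞ own# rKK ⊟ (own# rCS ⊟ con 1 ⊞ (own# rOFF ⊞ own# rS) ⊞ (own# rOFF ⊞ own# rS))))) (own# rSCORE))
         ∷ (rOFF , ite (λ ε → lower i h (Env.own ε)) (own# rOFF) (ite (λ ε → blue i (Env.own ε)) (own# rOFF ⊞ own# rG) (own# rOFF ⊞ (own# rS ⊟ yy#))))
         ∷ (rBLK , ite (λ ε → lower i h (Env.own ε)) (own# rBLK ⊞ own# rBLK ⊞ con 1) (own# rBLK ⊞ own# rBLK)) ∷ []) tt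
      lw* : V → Bool
      lw* v = if bl v then FS* v ≤ᵇ pos v else bit h (pos v)
      lw-eq : ∀ v → lower i h (τ₆ v) ≡ lw* v
      lw-eq v = trans (cong (λ b → if b then τ₆' v rFS ≤ᵇ τ₆' v rPOS else bit h (τ₆' v rPOS)) (blue-eq τ₆ fr v))
        (cong₂ (λ a c → if bl v then a ≤ᵇ c else bit h c) (hF v) (fr v rPOS refl))
      subst-regs : ∀ v → (if not (rc v ≡ᵇ 0) then τ₆' v rSCORE ⊔ (τ₆' v rKK + 1 ∸ (τ₆' v rCR + τ₆' v rKK ∸ ((rc v ∸ 1) + (off v + hhF FS* v) + (off v + hhF FS* v)))) else τ₆' v rSCORE)
        ≡ (if not (rc v ≡ᵇ 0) then τ v ! rSCORE ⊔ (kk v + 1 ∸ (cr v + kk v ∸ ((rc v ∸ 1) + (off v + hhF FS* v) + (off v + hhF FS* v)))) else τ v ! rSCORE)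
      subst-regs v rewrite fr v rSCORE refl | fr v rKK refl | fr v rCR refl = refl
      Y-eq : ∀ v → Yv S τ₆ v ≡ xxF FS* v
      Y-eq v = trans (Y-cls S τ₆ (λ _ _ → refl) (λ v → fr v rPID refl) (λ v → fr v rBLK refl) v)
        (trans (fold-cong add λ u → trans (cong (λ z → cls v u ▸ (bit h z ▸ τ₆' u rX)) (fr u rPOS refl)) (sym (▸-∧ (cls v u) (bit h (pos u)) (τ₆' u rX)))) (hX v))
      csatt : ∀ v → CS* v ≢ 0 → Σ V λ b → (cls v b ≡ true) × (pos b ≡ FS* v) × (CS* v ≡ kk b + off b + off b ∸ cr b)
      csatt v nz =
        let (b , c , e) = max-att v (λ u → (pos u ≡ᵇ FS* u) ▸ (kk u + off u + off u ∸ cr u))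
            (t , q) = ▸-≢0 (pos b ≡ᵇ FS* b) (λ z → nz (trans (sym e) z))
        in b , c , trans (==-sound {pos b} t) (fs-cls b v c) , trans (sym e) q

    stage-out : StageOut (Run (stage H i h) τ)
    stage-out =
      seq Sp₁ StageOut (weightProg (gC i h) ⨾ suffixProg H) (stage₅ H i h) τ step₁ λ τ₁ s₁ →
      seq Sp₂ StageOut bestValue (stage₄ H i h) τ₁ (step₂ τ₁ s₁) λ τ₂ s₂ →
      seq Sp₃ StageOut bestColumn (stage₃ H i h) τ₂ (step₃ τ₂ s₂) λ τ₃ s₃ →
      seq Sp₄ StageOut columnValue (stage₂ H i h) τ₃ (step₄ τ₃ s₃) λ τ₄ s₄ →
      seq Sp₅ StageOut (sendColumn i) (stage₁ H i h) τ₄ (step₅ τ₄ s₄) λ τ₅ s₅ →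
      seq (Sp₆ (proj₁ (proj₁ (proj₂ (proj₂ s₅))))) StageOut (weightProg (hC i) ⨾ suffixProg H) (split i h) τ₅ (step₆ τ₅ s₅) λ τ₆ s₆ →
      step₇ (proj₁ (proj₁ (proj₂ (proj₂ s₅)))) (proj₁ (proj₂ (proj₁ (proj₂ (proj₂ s₅))))) τ₆ s₆

-- `U` and `V` are the suffixes of row and column of a pair, `L` and `F` those of the cutting row
-- and its best column. In a mixed quadrant the inclusions run in opposite directions, and then the
-- advantage of `V` over `F` is no larger for `U` than for `L`, where `F` is optimal.
quad-≤ : ∀ U V L F → ((U ≡ true → L ≡ true) × (F ≡ true → V ≡ true)) ⊎ ((L ≡ true → U ≡ true) × (V ≡ true → F ≡ true)) →
  𝟙 (U ∧ V) + 𝟙 (L ∧ F) ≤ 𝟙 (U ∧ F) + 𝟙 (L ∧ V)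
quad-≤ true  V true  F _ = ≤-reflexive (+-comm (𝟙 V) (𝟙 F))
quad-≤ false V false F _ = z≤n
quad-≤ true  V false F (inj₁ (f , _)) = case f refl of λ ()
quad-≤ false V true  F (inj₂ (f , _)) = case f refl of λ ()
quad-≤ true  V false F (inj₂ (_ , f)) = +-monoˡ-≤ 0 (𝟙-mono f)
quad-≤ false V true  F (inj₁ (_ , f)) = 𝟙-mono f

-- In the other two quadrants the exchange is exact up to the weight of one corner. So a pair beats
-- the best column only if this corner contains an edge. The same identity underlies the update of
-- the offsets.
quad-up : ∀ U V L F → (L ≡ true → U ≡ true) → (F ≡ true → V ≡ true) →
  𝟙 (U ∧ V) + 𝟙 (L ∧ F) ≡ (𝟙 (U ∧ F) + 𝟙 (L ∧ V)) + 𝟙 ((U ∧ not L) ∧ (V ∧ not F))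
quad-up true  true  true  true  _ _ = refl
quad-up true  true  true  false _ _ = refl
quad-up true  true  false true  _ _ = refl
quad-up true  true  false false _ _ = refl
quad-up U false L true _ f = case f refl of λ ()
quad-up true  false true  false _ _ = refl
quad-up true  false false false _ _ = refl
quad-up false V true F f _ = case f refl of λ ()
quad-up false V false F _ _ = refl

∸-swap : ∀ x y z t → x + t ≤ y + z → x ∸ z ≤ y ∸ t
∸-swap x y z t h = m≤n+o⇒m∸n≤o x z (case ≤-total t y of λ
  { (inj₁ l) → +-cancelʳ-≤ t x (z + (y ∸ t)) (≤-trans h (≤-reflexive (trans (+-comm y z) (sym (trans (+-assoc z (y ∸ t) t) (cong (z +_) (m∸n+n≡m l)))))))
  ; (inj₂ l) → ≤-trans (+-cancelʳ-≤ t x z (≤-trans h (≤-trans (+-monoˡ-≤ z l) (≤-reflexive (+-comm t z))))) (m≤m+n z (y ∸ t)) })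

-- A new block number is twice the old one plus the half, so equal new numbers mean equal old blocks
-- and equal halves.
parity : ∀ {x y} (b c : Bool) → (if b then x + x + 1 else x + x) ≡ (if c then y + y + 1 else y + y) → (x ≡ y) × (b ≡ c)
parity {x} {y} true true e = halve (+-cancelʳ-≡ 1 (x + x) (y + y) e) , refl
  where
  halve : ∀ {x y} → x + x ≡ y + y → x ≡ y
  halve {x} {y} e with <-cmp x y
  ... | tri< l _ _ = ⊥-elim (<⇒≢ (+-mono-< l l) e)
  ... | tri≈ _ q _ = q
  ... | tri> _ _ l = ⊥-elim (<⇒≢ (+-mono-< l l) (sym e))
parity {x} {y} false false e = halve e , refl
  where
  halve : ∀ {x y} → x + x ≡ y + y → x ≡ y
  halve {x} {y} e with <-cmp x y
  ... | tri< l _ _ = ⊥-elim (<⇒≢ (+-mono-< l l) e)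
  ... | tri≈ _ q _ = q
  ... | tri> _ _ l = ⊥-elim (<⇒≢ (+-mono-< l l) (sym e))
parity {x} {y} true false e = ⊥-elim (odd≢even x y e)
  where
  odd≢even : ∀ x y → x + x + 1 ≡ y + y → ⊥
  odd≢even zero (suc y) e = case trans e (cong suc (+-suc y y)) of λ ()
  odd≢even (suc x) (suc y) e = odd≢even x y (suc-injective (suc-injective (trans (cong (λ z → suc z + 1) (sym (+-suc x x))) (trans e (cong suc (+-suc y y))))))
parity {x} {y} false true e = ⊥-elim (odd≢even y x (sym e))
  where
  odd≢even : ∀ x y → x + x + 1 ≡ y + y → ⊥
  odd≢even zero (suc y) e = case trans e (cong suc (+-suc y y)) of λ ()
  odd≢even (suc x) (suc y) e = odd≢even x y (suc-injective (suc-injective (trans (cong (λ z → suc z + 1) (sym (+-suc x x))) (trans e (cong suc (+-suc y y))))))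

-- Analysis of a matched pair of blocks in one stage

module DivideConquer {n m : ℕ} {ends : Fin m → Fin n × Fin n} {inT par : Fin m → Bool} {r : Fin n}
               (R : Rooted ends inT par r) (loopless : ∀ e → proj₁ (ends e) ≢ proj₂ (ends e)) (w : Fin m → ℕ)
               (ID : Fin n → ℕ) (ID-inj : ∀ u v → ID u ≡ ID v → u ≡ v) (i : ℕ) where
  open Rooted R
  open TreeFacts R
  open TreeRun R loopless w
  open CutPhase R loopless w ID ID-inj using (cutval; at-below)
  open PairPhase R loopless w ID ID-inj i
  open StagePhase R loopless w ID ID-inj i

  suf-same : ∀ σ τ → Same 10 σ τ → ∀ a u → suf τ a u ≡ suf σ a u
  suf-same σ τ s a u = cong₂ _∧_ (cong₂ _≡ᵇ_ (s u rPID refl) (s a rPID refl)) (cong₂ _≤ᵇ_ (s a rPOS refl) (s u rPOS refl))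

  wp-same : ∀ σ τ → Same 10 σ τ → ∀ a b → wp τ a b ≡ wp σ a b
  wp-same σ τ s a b = ⟪⟫-cong λ u x → cong₂ _∧_ (suf-same σ τ s a u) (suf-same σ τ s b x)

  Ctx-same : ∀ {H} σ τ → Same 10 σ τ → Ctx H σ → Ctx H τ
  Ctx-same {H} σ τ s C = record
    { conn = λ b g mb mg → conn-same σ τ C s b g (mono b mb) (mono g mg)
    ; col-pid = λ u v e nz → trans (cong (bit i) (s u rTAU refl)) (trans (col-pid u v (trans (sym (s u rPID refl)) (trans e (s v rPID refl))) (λ z → nz (trans (s v rPID refl) z))) (sym (cong (bit i) (s v rTAU refl))))
    ; pos-odd = λ v nz → trans (cong odd (s v rPOS refl)) (pos-odd v (λ z → nz (trans (s v rPID refl) z)))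
    ; pos< = λ v → subst (_< 2 ^ H) (sym (s v rPOS refl)) (pos< v)
    ; kk = λ v → trans (s v rKK refl) (kk v)
    ; cr = λ v nz → trans (s v rCR refl) (trans (cr v (λ z → nz (trans (s v rPID refl) z))) (⟪⟫-cong λ u x → sym (cong₂ (λ a b → a ∧ not b) (suf-same σ τ s v u) (suf-same σ τ s v x))))
    ; ww = λ v → trans (s v rWW refl) (trans (ww v) (⟪⟫-cong λ u x → sym (cong₂ _∧_ (suf-same σ τ s v u) (cross-same σ τ s u x))))
    }
    where
    open Ctx C
    mono : ∀ b → Mono τ b → Mono σ b
    mono b mb u v e l = mb u v (trans (s u rPID refl) (trans e (sym (s v rPID refl)))) (subst₂ _≤_ (sym (s u rPOS refl)) (sym (s v rPOS refl)) l)

  K : ℕ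
  K = ⟪ (λ _ _ → true) ⟫

  Mv : State → V → V → ℕ
  Mv τ a b = τ a ! rCR + τ b ! rCR ∸ (wp τ a b + wp τ a b)

  record Matched (τ : State) (a b : V) : Set where
    field
      bla : blue i (τ a) ≡ false
      blb : blue i (τ b) ≡ true
      na : PID τ a ≢ 0
      ma : τ a ! rMATE ≡ PID τ b
      mb : τ b ! rMATE ≡ PID τ a

  segσ : State → V → V → Bool
  segσ τ a u = (PID τ u ≡ᵇ PID τ a) ∧ ((τ u ! rBLK ≡ᵇ τ a ! rBLK) ∧ (POS τ a ≤ᵇ POS τ u))

  clsσ : State → V → V → Bool
  clsσ τ a u = (PID τ u ≡ᵇ PID τ a) ∧ (τ u ! rBLK ≡ᵇ τ a ! rBLK)

  module WithSound (H : ℕ) (Sound : ℕ → Set) where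

    -- `split-eq` is the core: for a matched pair in a common block the joint weight is the sum of
    -- the two offsets and the weight of the inner edges below both. `Sound` stays abstract and is
    -- only required for the scores of pairs of different colours.
    record SInv (q : ℕ) (τ : State) : Set where
      field
        ctx : Ctx H τ
        pairs : ∀ a b → PID τ a ≢ 0 → PID τ b ≢ 0 → bit i (τ a ! rTAU) xor bit i (τ b ! rTAU) ≡ true → Sound (K + 1 ∸ Mv τ a b)
        mate-class : ∀ u v → PID τ u ≡ PID τ v → τ u ! rMATE ≡ τ v ! rMATE
        red-blk : ∀ v → blue i (τ v) ≡ false → τ v ! rBLK ≡ shr q (POS τ v)
        blk-mono : Mono τ (λ v → τ v ! rBLK)
        off-class : ∀ u v → PID τ u ≡ PID τ v → POS τ u ≡ POS τ v → τ u ! rOFF ≡ τ v ! rOFF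
        split-eq : ∀ a b → Matched τ a b → τ a ! rBLK ≡ τ b ! rBLK → wp τ a b ≡ (τ a ! rOFF + τ b ! rOFF) + ⟪ (λ u x → segσ τ a u ∧ segσ τ b x) ⟫
        sound : ∀ v → (τ v ! rSCORE ≡ 0) ⊎ Sound (τ v ! rSCORE)

    Covered : V → V → State → Set
    Covered a b τ = Σ V λ v → K + 1 ∸ Mv τ a b ≤ τ v ! rSCORE

    -- The invariant of a pair not yet covered. The joining edge is what lets the red block hear
    -- from its partner.
    Linked : V → V → State → Set
    Linked a b τ = (τ a ! rBLK ≡ τ b ! rBLK) × (⟪ (λ u x → clsσ τ a u ∧ clsσ τ b x) ⟫ ≢ 0)

    module StageMath (h : ℕ) (τ τ' : State) (I : SInv (suc h) τ) (o : StageTerms.StageOut h τ τ') where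
      open SInv I
      open Ctx ctx hiding (cr; kk)
      open StageTerms h τ
      open StageOut o

      hh xx : V → ℕ
      hh = hhF fs
      xx = xxF fs

      lw : V → Bool
      lw = lwF fs

      keep10 : Same 10 τ τ'
      keep10 v q hq = keep v q (<ᵇ-true (≤-trans (<ᵇ-sound {toℕ q} {10} hq) (m≤m+n 10 1)))

      ctx' : Ctx H τ'
      ctx' = Ctx-same τ τ' keep10 ctx

      bl-same : ∀ v → blue i (τ' v) ≡ bl v
      bl-same = blue-same τ τ' keep10

      bl-class : ∀ u v → pid u ≡ pid v → bl u ≡ bl v
      bl-class u v e with pid v ≟ 0
      ... | yes z = trans (cong (λ q → not q ∧ bit i (τ u ! rTAU)) (==-true (trans e z))) (sym (cong (λ q → not q ∧ bit i (τ v ! rTAU)) (==-true z)))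
      ... | no nz = cong₂ (λ a b → not (a ≡ᵇ 0) ∧ b) e (col-pid u v e nz)

      blk-eq : ∀ u v → pid u ≡ pid v → pos u ≡ pos v → blk u ≡ blk v
      blk-eq u v e q = ≤-antisym (blk-mono u v e (≤-reflexive q)) (blk-mono v u (sym e) (≤-reflexive (sym q)))

      red-half : ∀ v → bl v ≡ false → shr h (pos v) ≡ 𝟙 (bit h (pos v)) + (blk v + blk v)
      red-half v b = trans (shr-split h (pos v)) (cong (λ z → 𝟙 (bit h (pos v)) + (z + z)) (sym (red-blk v b)))

      -- A red block consists of positions with common leading bits, so inside it bit `h` is
      -- monotone in the position.
      red-bit : ∀ u v → bl u ≡ false → bl v ≡ false → blk u ≡ blk v → pos v ≤ pos u → bit h (pos v) ≡ true → bit h (pos u) ≡ true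
      red-bit u v bu bv e l t with bool-case (bit h (pos u))
      ... | inj₁ q = q
      ... | inj₂ f = ⊥-elim (<⇒≱ (subst₂ _<_ (sym (trans (red-half u bu) (cong (λ z → 𝟙 z + (blk u + blk u)) f))) (sym (trans (red-half v bv) (cong₂ (λ z b → 𝟙 z + (b + b)) t (sym e)))) ≤-refl) (shr-mono h l))

      seg-e : ∀ a u → seg a u ≡ true → (pid u ≡ pid a) × (blk u ≡ blk a) × (pos a ≤ pos u)
      seg-e a u s = ==-sound {pid u} (∧-l {pid u ≡ᵇ pid a} s) , ==-sound {blk u} (∧-l {blk u ≡ᵇ blk a} (∧-r {pid u ≡ᵇ pid a} s)) , ≤ᵇ-sound {pos a} (∧-r {blk u ≡ᵇ blk a} (∧-r {pid u ≡ᵇ pid a} s))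

      seg-i : ∀ a u → pid u ≡ pid a → blk u ≡ blk a → pos a ≤ pos u → seg a u ≡ true
      seg-i a u e b l = ∧-i {pid u ≡ᵇ pid a} (==-true e) (∧-i {blk u ≡ᵇ blk a} (==-true b) (≤ᵇ-true l))

      cls-e : ∀ a u → cls a u ≡ true → (pid u ≡ pid a) × (blk u ≡ blk a)
      cls-e a u s = ==-sound {pid u} (∧-l {pid u ≡ᵇ pid a} s) , ==-sound {blk u} (∧-r {pid u ≡ᵇ pid a} s)

      cls-i : ∀ a u → pid u ≡ pid a → blk u ≡ blk a → cls a u ≡ true
      cls-i a u e b = ∧-i {pid u ≡ᵇ pid a} (==-true e) (==-true b)

      blue-pid : ∀ v → bl v ≡ true → (pid v ≢ 0) × (bit i (τ v ! rTAU) ≡ true)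
      blue-pid v b = (λ z → true≢false (==-true z) (not-f (∧-l {not (pid v ≡ᵇ 0)} b))) , ∧-r {not (pid v ≡ᵇ 0)} b

      red-bit-tau : ∀ v → bl v ≡ false → pid v ≢ 0 → bit i (τ v ! rTAU) ≡ false
      red-bit-tau v b nz = bool-false λ t → true≢false (∧-i {not (pid v ≡ᵇ 0)} (not-t (==-false nz)) t) b

      inn-e : ∀ u x → inn u x ≡ true → (cross i (τ u) (τ x) ≡ true) × (τ u ! rMATE ≡ pid x) × (τ x ! rMATE ≡ pid u) × (blk u ≡ blk x)
      inn-e u x t = ∧-l {cross i (τ u) (τ x)} t
        , ==-sound {τ u ! rMATE} (∧-l {τ u ! rMATE ≡ᵇ pid x} t₁)
        , ==-sound {τ x ! rMATE} (∧-l {τ x ! rMATE ≡ᵇ pid u} (∧-r {τ u ! rMATE ≡ᵇ pid x} t₁))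
        , ==-sound {blk u} (∧-r {τ x ! rMATE ≡ᵇ pid u} (∧-r {τ u ! rMATE ≡ᵇ pid x} t₁))
        where
        t₁ = ∧-r {cross i (τ u) (τ x)} t

      inn-i : ∀ u x → cross i (τ u) (τ x) ≡ true → τ u ! rMATE ≡ pid x → τ x ! rMATE ≡ pid u → blk u ≡ blk x → inn u x ≡ true
      inn-i u x c a b e = ∧-i {cross i (τ u) (τ x)} c (∧-i {τ u ! rMATE ≡ᵇ pid x} (==-true a) (∧-i {τ x ! rMATE ≡ᵇ pid u} (==-true b) (==-true e)))

      Val : V → V → ℕ
      Val a b = (off a + off b) + ⟪ (λ u x → seg a u ∧ seg b x) ⟫

      cr-class : ∀ u v → pid u ≡ pid v → pos u ≡ pos v → pid v ≢ 0 → cr u ≡ cr v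
      cr-class u v e q nz = trans (Ctx.cr ctx u (λ z → nz (trans (sym e) z))) (trans (⟪⟫-cong λ y x → cong₂ (λ a b → a ∧ not b) (suf-eq y) (suf-eq x)) (sym (Ctx.cr ctx v nz)))
        where
        suf-eq : ∀ y → suf τ u y ≡ suf τ v y
        suf-eq y = cong₂ (λ a b → (pid y ≡ᵇ a) ∧ (b ≤ᵇ pos y)) e q

      seg-class : ∀ u v → pid u ≡ pid v → pos u ≡ pos v → ∀ y → seg u y ≡ seg v y
      seg-class u v e q y = trans (cong₂ (λ a b → (pid y ≡ᵇ a) ∧ ((blk y ≡ᵇ blk u) ∧ (b ≤ᵇ pos y))) e q)
        (cong (λ z → (pid y ≡ᵇ pid v) ∧ ((blk y ≡ᵇ z) ∧ (pos v ≤ᵇ pos y))) (blk-eq u v e q))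

      cr≤K : ∀ v → pid v ≢ 0 → cr v ≤ K
      cr≤K v nz = subst (_≤ K) (sym (Ctx.cr ctx v nz)) (⟪⟫-mono λ _ _ _ → refl)

      module Pair (a b : V) (M : Matched τ a b) (e : blk a ≡ blk b) where
        open Matched M

        nb : pid b ≢ 0
        nb = proj₁ (blue-pid b blb)

        tau-xor : bit i (τ a ! rTAU) xor bit i (τ b ! rTAU) ≡ true
        tau-xor = cong₂ _xor_ (red-bit-tau a bla na) (proj₂ (blue-pid b blb))

        tau-xor' : bit i (τ b ! rTAU) xor bit i (τ a ! rTAU) ≡ true
        tau-xor' = cong₂ _xor_ (proj₂ (blue-pid b blb)) (red-bit-tau a bla na)

        -- Partners are constant on paths, so any two nodes of a matched pair of blocks pass the
        -- test for inner edges; weights between subsets of the blocks need no further condition.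
        link : ∀ u x → cls a u ≡ true → cls b x ≡ true → inn u x ≡ true
        link u x cu cx = let (eu , bu) = cls-e a u cu ; (ex , bx) = cls-e b x cx in
          inn-i u x (cross-i τ ctx a b u x na nb tau-xor eu ex) (trans (mate-class u a eu) (trans ma (sym ex))) (trans (mate-class x b ex) (trans mb (sym eu))) (trans bu (trans e (sym bx)))

        link' : ∀ u x → cls a u ≡ true → cls b x ≡ true → inn x u ≡ true
        link' u x cu cx = let (eu , bu) = cls-e a u cu ; (ex , bx) = cls-e b x cx in
          inn-i x u (cross-i τ ctx b a x u nb na tau-xor' ex eu) (trans (mate-class x b ex) (trans mb (sym eu))) (trans (mate-class u a eu) (trans ma (sym ex))) (trans bx (trans (sym e) (sym bu)))

        to-b : ∀ u x → cls a u ≡ true → inn u x ≡ true → cls b x ≡ true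
        to-b u x cu t = let (eu , bu) = cls-e a u cu ; (_ , m₁ , _ , q) = inn-e u x t in
          cls-i b x (trans (sym m₁) (trans (mate-class u a eu) ma)) (trans (sym q) (trans bu e))

        to-a : ∀ y x → cls b y ≡ true → inn y x ≡ true → cls a x ≡ true
        to-a y x cy t = let (ey , by) = cls-e b y cy ; (_ , m₁ , _ , q) = inn-e y x t in
          cls-i a x (trans (sym m₁) (trans (mate-class y b ey) mb)) (trans (sym q) (trans by (sym e)))

        red : ∀ u → cls a u ≡ true → bl u ≡ false
        red u cu = trans (bl-class u a (proj₁ (cls-e a u cu))) bla

        blu : ∀ x → cls b x ≡ true → bl x ≡ true
        blu x cx = trans (bl-class x b (proj₁ (cls-e b x cx))) blb

        L F : V → Bool
        L u = cls a u ∧ bit h (pos u)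
        F x = cls b x ∧ (fs b ≤ᵇ pos x)

        seg-cls : ∀ c v u → cls c v ≡ true → seg v u ≡ true → cls c u ≡ true
        seg-cls c v u cv s = let (ev , bv) = cls-e c v cv ; (eu , bu , _) = seg-e v u s in cls-i c u (trans eu ev) (trans bu bv)

        g-eq : ∀ v → cls b v ≡ true → g v ≡ ⟪ (λ u x → L u ∧ seg v x) ⟫
        g-eq v cv = trans (⟪⟫-sym (λ y x → seg v y ∧ (bl y ∧ (inn y x ∧ bit h (pos x))))) (⟪⟫-cong λ u x → bool-ext
          (λ t → let s = ∧-l {seg v x} t ; t₁ = ∧-r {seg v x} t ; t₂ = ∧-r {bl x} t₁ in
             ∧-i {L u} (∧-i {cls a u} (to-a x u (seg-cls b v x cv s) (∧-l {inn x u} t₂)) (∧-r {inn x u} t₂)) s)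
          (λ t → let s = ∧-r {L u} t ; lu = ∧-l {L u} t ; cx = seg-cls b v x cv s in
             ∧-i {seg v x} s (∧-i {bl x} (blu x cx) (∧-i {inn x u} (link' u x (∧-l {cls a u} lu) cx) (∧-r {cls a u} lu)))))

        far : ∀ x → cls b x ≡ true → (fs x ≤ᵇ pos x) ≡ (fs b ≤ᵇ pos x)
        far x cx = cong (_≤ᵇ pos x) (fs-class x b cx)

        hx-eq : ∀ (A : V → Bool) → (∀ u → A u ≡ true → cls a u ≡ true) →
          ⟪ (λ u x → A u ∧ (not (bl u) ∧ (inn u x ∧ (fs x ≤ᵇ pos x)))) ⟫ ≡ ⟪ (λ u x → A u ∧ F x) ⟫
        hx-eq A sub = ⟪⟫-cong λ u x → bool-ext
          (λ t → let s = ∧-l {A u} t ; t₂ = ∧-r {not (bl u)} (∧-r {A u} t) ; cx = to-b u x (sub u s) (∧-l {inn u x} t₂) in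
             ∧-i {A u} s (∧-i {cls b x} cx (trans (sym (far x cx)) (∧-r {inn u x} t₂))))
          (λ t → let s = ∧-l {A u} t ; f = ∧-r {A u} t ; cx = ∧-l {cls b x} f in
             ∧-i {A u} s (∧-i {not (bl u)} (not-t (red u (sub u s))) (∧-i {inn u x} (link u x (sub u s) cx) (trans (far x cx) (∧-r {cls b x} f)))))

        hh-eq : hh a ≡ ⟪ (λ u x → seg a u ∧ F x) ⟫
        hh-eq = hx-eq (seg a) (λ u s → seg-cls a a u (cls-i a a refl refl) s)

        xx-eq : xx a ≡ ⟪ (λ u x → L u ∧ F x) ⟫
        xx-eq = hx-eq L (λ u t → ∧-l {cls a u} t)

        seg-F : ∀ b* → cls b b* ≡ true → pos b* ≡ fs b → ∀ x → seg b* x ≡ F x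
        seg-F b* c q x = let (eb , bb) = cls-e b b* c in bool-ext
          (λ s → let (ex , bx , l) = seg-e b* x s in ∧-i {cls b x} (cls-i b x (trans ex eb) (trans bx bb)) (≤ᵇ-true (subst (_≤ pos x) q l)))
          (λ f → let (ex , bx) = cls-e b x (∧-l {cls b x} f) in seg-i b* x (trans ex (sym eb)) (trans bx (sym bb)) (subst (_≤ pos x) (sym q) (≤ᵇ-sound {fs b} (∧-r {cls b x} f))))

        matched-in-class : ∀ b* → cls b b* ≡ true → Matched τ a b* × (blk a ≡ blk b*)
        matched-in-class b* c = let (eb , bb) = cls-e b b* c in
          record { bla = bla ; blb = blu b* c ; na = na ; ma = trans ma (sym eb) ; mb = trans (mate-class b* b eb) mb } , trans e (sym bb)

        -- The received value contains `K` and the terms of the column; adding the terms of the row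
        -- turns `split-eq` into the cut value. `CR ≤ K` makes the subtraction inside the received
        -- value exact.
        column-value : ∀ b* → cls b b* ≡ true → pos b* ≡ fs b → ∀ c → c ≡ K + off b* + off b* ∸ cr b* →
          kk a + 1 ∸ (cr a + kk a ∸ (c + (off a + hh a) + (off a + hh a))) ≡ K + 1 ∸ Mv τ a b*
        column-value b* c q cv hc = cong₂ _∸_ (cong (_+ 1) (Ctx.kk ctx a)) (begin
            cr a + kk a ∸ (cv + (off a + hh a) + (off a + hh a))     ≡⟨ cong₂ (λ k z → cr a + k ∸ (cv + (off a + z) + (off a + z))) (Ctx.kk ctx a) hval ⟩
            cr a + K ∸ (cv + (off a + Z) + (off a + Z))              ≡⟨ cong₂ (λ k z → cr a + k ∸ (z + (off a + Z) + (off a + Z))) (sym (m∸n+n≡m (cr≤K b* nb*))) cval ⟩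
            cr a + (D + cr b*) ∸ (D + off b* + off b* + (off a + Z) + (off a + Z))
               ≡⟨ cong₂ _∸_ (solve 3 (λ x y z → x :+ (y :+ z) := y :+ (x :+ z)) refl (cr a) D (cr b*))
                            (solve 4 (λ d ob oa z → d :+ ob :+ ob :+ (oa :+ z) :+ (oa :+ z) := d :+ ((oa :+ ob :+ z) :+ (oa :+ ob :+ z))) refl D (off b*) (off a) Z) ⟩
            D + (cr a + cr b*) ∸ (D + (Val a b* + Val a b*))         ≡⟨ [m+n]∸[m+o]≡n∸o D (cr a + cr b*) (Val a b* + Val a b*) ⟩
            cr a + cr b* ∸ (Val a b* + Val a b*)                     ≡⟨ cong (λ z → cr a + cr b* ∸ (z + z)) (sym (split-eq a b* (proj₁ mc) (proj₂ mc))) ⟩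
            Mv τ a b* ∎)
          where
          open ≡-Reasoning
          open +-*-Solver using (solve; _:+_; _:=_)
          mc = matched-in-class b* c
          nb* : pid b* ≢ 0
          nb* = proj₁ (blue-pid b* (blu b* c))
          Z D : ℕ
          Z = ⟪ (λ u x → seg a u ∧ seg b* x) ⟫
          D = K ∸ cr b*
          hval : hh a ≡ Z
          hval = trans hh-eq (⟪⟫-cong λ u x → cong (seg a u ∧_) (sym (seg-F b* c q x)))
          cval : cv ≡ D + off b* + off b*
          cval = trans hc (trans (cong (_∸ cr b*) (+-assoc K (off b*) (off b*))) (trans (+-∸-comm (off b* + off b*) (cr≤K b* nb*)) (sym (+-assoc D (off b*) (off b*)))))

        -- The choice of `b*` compares the two columns on the cutting row, and `hE` transfers the
        -- comparison to row `a`, whose own terms occur on both sides.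
        column-better : ∀ b* → cls b b* ≡ true → pos b* ≡ fs b → val b ≤ val b* →
          ⟪ (λ u x → seg a u ∧ seg b x) ⟫ + ⟪ (λ u x → L u ∧ F x) ⟫ ≤ ⟪ (λ u x → seg a u ∧ F x) ⟫ + ⟪ (λ u x → L u ∧ seg b x) ⟫ →
          Mv τ a b* ≤ Mv τ a b
        column-better b* c q hv hE = ∸-swap (cr a + cr b*) (cr a + cr b) (wp τ a b* + wp τ a b*) (wp τ a b + wp τ a b)
            (subst₂ (λ y z → cr a + cr b* + (y + y) ≤ cr a + cr b + (z + z)) (sym (split-eq a b M e)) (sym (split-eq a b* (proj₁ mc) (proj₂ mc)))
            (begin
              cr a + cr b* + ((off a + off b + A) + (off a + off b + A))
                 ≡⟨ solve 5 (λ ca cb oa ob x → ca :+ cb :+ ((oa :+ ob :+ x) :+ (oa :+ ob :+ x)) := (ca :+ (oa :+ oa)) :+ ((cb :+ (ob :+ ob)) :+ (x :+ x))) refl (cr a) (cr b*) (off a) (off b) A ⟩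
              (cr a + (off a + off a)) + ((cr b* + (off b + off b)) + (A + A))
                 ≤⟨ +-monoʳ-≤ (cr a + (off a + off a)) core ⟩
              (cr a + (off a + off a)) + ((cr b + (off b* + off b*)) + (Z + Z))
                 ≡⟨ sym (solve 5 (λ ca cb oa ob x → ca :+ cb :+ ((oa :+ ob :+ x) :+ (oa :+ ob :+ x)) := (ca :+ (oa :+ oa)) :+ ((cb :+ (ob :+ ob)) :+ (x :+ x))) refl (cr a) (cr b) (off a) (off b*) Z) ⟩
              cr a + cr b + ((off a + off b* + Z) + (off a + off b* + Z)) ∎))
          where
          open ≤-Reasoning
          open +-*-Solver using (solve; _:+_; _:=_)
          mc = matched-in-class b* c
          A Z G G* : ℕ
          A = ⟪ (λ u x → seg a u ∧ seg b x) ⟫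
          Z = ⟪ (λ u x → seg a u ∧ seg b* x) ⟫
          G = g b
          G* = g b*
          E' : A + G* ≤ Z + G
          E' = subst₂ _≤_ (cong (A +_) (sym (trans (g-eq b* c) (⟪⟫-cong λ u x → cong (L u ∧_) (seg-F b* c q x)))))
                          (cong₂ _+_ (⟪⟫-cong λ u x → cong (seg a u ∧_) (sym (seg-F b* c q x))) (sym (g-eq b (cls-i b b refl refl)))) hE
          nb* : pid b* ≢ 0
          nb* = proj₁ (blue-pid b* (blu b* c))
          -- Both values exceed the cuts subtracted in them, since `CR ≤ K`; so their comparison can
          -- be rewritten without truncated subtraction.
          vv : cr b* + (off b + G + (off b + G)) ≤ cr b + (off b* + G* + (off b* + G*))
          vv = +-cancelˡ-≤ K _ _ (begin
              K + (cr b* + (off b + G + (off b + G)))      ≡⟨ solve 3 (λ k c y → k :+ (c :+ (y :+ y)) := (k :+ y :+ y) :+ c) refl K (cr b*) (off b + G) ⟩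
              (K + (off b + G) + (off b + G)) + cr b*       ≤⟨ +-monoˡ-≤ (cr b*) (≤-trans (≤-reflexive (sym (m∸n+n≡m (≤-trans (cr≤K b nb) (≤-trans (m≤m+n K _) (m≤m+n _ (off b + G))))))) (+-monoˡ-≤ (cr b) hv')) ⟩
              ((K + (off b* + G*) + (off b* + G*)) ∸ cr b* + cr b) + cr b*   ≡⟨ solve 3 (λ x y z → (x :+ y) :+ z := (x :+ z) :+ y) refl (K + (off b* + G*) + (off b* + G*) ∸ cr b*) (cr b) (cr b*) ⟩
              ((K + (off b* + G*) + (off b* + G*)) ∸ cr b* + cr b*) + cr b   ≡⟨ cong (_+ cr b) (m∸n+n≡m (≤-trans (cr≤K b* nb*) (≤-trans (m≤m+n K _) (m≤m+n _ (off b* + G*))))) ⟩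
              (K + (off b* + G*) + (off b* + G*)) + cr b    ≡⟨ sym (solve 3 (λ k c y → k :+ (c :+ (y :+ y)) := (k :+ y :+ y) :+ c) refl K (cr b) (off b* + G*)) ⟩
              K + (cr b + (off b* + G* + (off b* + G*))) ∎)
            where
            hv' : K + (off b + G) + (off b + G) ∸ cr b ≤ K + (off b* + G*) + (off b* + G*) ∸ cr b*
            hv' = subst₂ (λ x y → x + (off b + G) + (off b + G) ∸ cr b ≤ y + (off b* + G*) + (off b* + G*) ∸ cr b*) (Ctx.kk ctx b) (Ctx.kk ctx b*) hv
          core : (cr b* + (off b + off b)) + (A + A) ≤ (cr b + (off b* + off b*)) + (Z + Z)
          core = +-cancelʳ-≤ ((G + G) + (G* + G*)) _ _ (begin
              (cr b* + (off b + off b)) + (A + A) + ((G + G) + (G* + G*))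
                ≡⟨ solve 5 (λ c ob x y z → (c :+ (ob :+ ob)) :+ (x :+ x) :+ ((y :+ y) :+ (z :+ z)) := (c :+ (ob :+ y :+ (ob :+ y))) :+ ((x :+ z) :+ (x :+ z))) refl (cr b*) (off b) A G G* ⟩
              (cr b* + (off b + G + (off b + G))) + ((A + G*) + (A + G*))
                ≤⟨ +-mono-≤ vv (+-mono-≤ E' E') ⟩
              (cr b + (off b* + G* + (off b* + G*))) + ((Z + G) + (Z + G))
                ≡⟨ solve 5 (λ c ob x y z → (c :+ (ob :+ z :+ (ob :+ z))) :+ ((x :+ y) :+ (x :+ y)) := (c :+ (ob :+ ob)) :+ (x :+ x) :+ ((y :+ y) :+ (z :+ z))) refl (cr b) (off b*) Z G G* ⟩
              (cr b + (off b* + off b*)) + (Z + Z) + ((G + G) + (G* + G*)) ∎)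

        U→L : bit h (pos a) ≡ true → ∀ u → seg a u ≡ true → L u ≡ true
        U→L t u s = let cu = seg-cls a a u (cls-i a a refl refl) s ; (_ , bu , l) = seg-e a u s in
          ∧-i {cls a u} cu (red-bit u a (red u cu) bla bu l t)

        L→U : bit h (pos a) ≡ false → ∀ u → L u ≡ true → seg a u ≡ true
        L→U f u lu = let cu = ∧-l {cls a u} lu ; (eu , bu) = cls-e a u cu in
          seg-i a u eu bu (≮⇒≥ λ lt → true≢false (red-bit a u bla (red u cu) (sym bu) (<⇒≤ lt) (∧-r {cls a u} lu)) f)

        F→V : (fs b ≤ᵇ pos b) ≡ false → ∀ x → F x ≡ true → seg b x ≡ true
        F→V f x t = let (ex , bx) = cls-e b x (∧-l {cls b x} t) in
          seg-i b x ex bx (<⇒≤ (<-≤-trans (≤ᵇ-no {fs b} f) (≤ᵇ-sound {fs b} (∧-r {cls b x} t))))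

        V→F : (fs b ≤ᵇ pos b) ≡ true → ∀ x → seg b x ≡ true → F x ≡ true
        V→F t x s = let (ex , bx , l) = seg-e b x s in ∧-i {cls b x} (cls-i b x ex bx) (≤ᵇ-true (≤-trans (≤ᵇ-sound {fs b} t) l))

-- Induction over the stages

dcStart : Prog
dcStart = mk add add silent never (con 0) ((rBLK , con 0) ∷ (rOFF , con 0) ∷ [])

dcProg : ℕ → ℕ → Prog
dcProg H i = dcStart ⨾ down H (stage H i)

module DivideConquerRun {n m : ℕ} {ends : Fin m → Fin n × Fin n} {inT par : Fin m → Bool} {r : Fin n}
               (R : Rooted ends inT par r) (loopless : ∀ e → proj₁ (ends e) ≢ proj₂ (ends e)) (w : Fin m → ℕ)
               (ID : Fin n → ℕ) (ID-inj : ∀ u v → ID u ≡ ID v → u ≡ v) (i : ℕ) where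
  open Rooted R
  open TreeFacts R
  open TreeRun R loopless w
  open CutPhase R loopless w ID ID-inj using (cutval; at-below)
  open PairPhase R loopless w ID ID-inj i
  open StagePhase R loopless w ID ID-inj i
  open DivideConquer R loopless w ID ID-inj i

  Mv-same : ∀ σ τ → Same 10 σ τ → ∀ a b → Mv τ a b ≡ Mv σ a b
  Mv-same σ τ s a b = cong₂ _∸_ (cong₂ _+_ (s a rCR refl) (s b rCR refl)) (cong₂ _+_ (wp-same σ τ s a b) (wp-same σ τ s a b))

  module _ (H : ℕ) (Sound : ℕ → Set) where
    open WithSound H Sound

    module StageInv (h : ℕ) (τ τ' : State) (I : SInv (suc h) τ) (o : StageTerms.StageOut h τ τ') where
      open SInv I
      open StageTerms h τ
      open StageTerms.StageOut o
      open StageMath h τ τ' I o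

      dbl : Bool → ℕ → ℕ
      dbl b x = if b then x + x + 1 else x + x

      dbl-𝟙 : ∀ b x → dbl b x ≡ 𝟙 b + (x + x)
      dbl-𝟙 true x = +-comm (x + x) 1
      dbl-𝟙 false x = refl

      lw-red : ∀ v → bl v ≡ false → lw v ≡ bit h (pos v)
      lw-red v b = cong (λ z → if z then fs v ≤ᵇ pos v else bit h (pos v)) b

      lw-blue : ∀ v → bl v ≡ true → lw v ≡ (fs v ≤ᵇ pos v)
      lw-blue v b = cong (λ z → if z then fs v ≤ᵇ pos v else bit h (pos v)) b

      blk'-red : ∀ v → bl v ≡ false → τ' v ! rBLK ≡ shr h (pos v)
      blk'-red v b = trans (blk' v) (trans (cong (λ z → dbl z (blk v)) (lw-red v b)) (trans (dbl-𝟙 (bit h (pos v)) (blk v)) (sym (red-half v b))))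

      pid-keep : ∀ v → τ' v ! rPID ≡ pid v
      pid-keep v = keep v rPID refl

      pos-keep : ∀ v → τ' v ! rPOS ≡ pos v
      pos-keep v = keep v rPOS refl

      -- This keeps the blocks admissible as keys of contractions: a blue block is divided by a
      -- threshold common to the block, a red one by a bit of the position, and both respect the
      -- order.
      blk-mono' : Mono τ' (λ v → τ' v ! rBLK)
      blk-mono' u v e' l' = case bool-case (bl v) of λ
          { (inj₂ b) → subst₂ _≤_ (sym (blk'-red u (trans (bl-class u v e) b))) (sym (blk'-red v b)) (shr-mono h l)
          ; (inj₁ b) → subst₂ _≤_ (sym (trans (blk' u) (cong (λ z → dbl z (blk u)) (lw-blue u (trans (bl-class u v e) b))))) (sym (trans (blk' v) (cong (λ z → dbl z (blk v)) (lw-blue v b)))) (blue-case b) }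
        where
        e : pid u ≡ pid v
        e = trans (sym (pid-keep u)) (trans e' (pid-keep v))
        l : pos u ≤ pos v
        l = subst₂ _≤_ (pos-keep u) (pos-keep v) l'
        blue-case : bl v ≡ true → dbl (fs u ≤ᵇ pos u) (blk u) ≤ dbl (fs v ≤ᵇ pos v) (blk v)
        blue-case b = case m≤n⇒m<n∨m≡n (blk-mono u v e l) of λ
          { (inj₁ lt) → ≤-trans (up₁ (fs u ≤ᵇ pos u) (blk u)) (≤-trans (≤-reflexive (sym (+-suc (suc (blk u)) (blk u)))) (≤-trans (+-mono-≤ lt lt) (dn₁ (fs v ≤ᵇ pos v) (blk v))))
          ; (inj₂ q) → subst₂ _≤_ (sym (dbl-𝟙 (fs u ≤ᵇ pos u) (blk u))) (sym (dbl-𝟙 (fs v ≤ᵇ pos v) (blk v)))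
              (+-mono-≤ (𝟙-mono λ t → ≤ᵇ-true (≤-trans (≤-reflexive (sym (fs-class u v (cls-i v u e q)))) (≤-trans (≤ᵇ-sound {fs u} t) l))) (≤-reflexive (cong₂ _+_ q q))) }
          where
          up₁ : ∀ b x → dbl b x ≤ suc (suc (x + x))
          up₁ true x = ≤-trans (≤-reflexive (+-comm (x + x) 1)) (n≤1+n _)
          up₁ false x = ≤-trans (n≤1+n _) (n≤1+n _)
          dn₁ : ∀ b x → x + x ≤ dbl b x
          dn₁ true x = m≤m+n (x + x) 1
          dn₁ false x = ≤-refl

      off-class' : ∀ u v → PID τ' u ≡ PID τ' v → POS τ' u ≡ POS τ' v → τ' u ! rOFF ≡ τ' v ! rOFF
      off-class' u v e' q' = trans (off' u) (trans (cong₂ (λ z y → if z then y else if bl u then y + g u else y + (hh u ∸ xx u)) lw-eq (off-class u v e q))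
          (trans (cong₂ (λ z y → if lw v then off v else if z then off v + y else off v + (hh u ∸ xx u)) (bl-class u v e) g-eq')
            (trans (cong₂ (λ z y → if lw v then off v else if bl v then off v + g v else off v + (z ∸ y)) hh-eq' xx-eq') (sym (off' v)))))
        where
        e : pid u ≡ pid v
        e = trans (sym (pid-keep u)) (trans e' (pid-keep v))
        q : pos u ≡ pos v
        q = trans (sym (pos-keep u)) (trans q' (pos-keep v))
        bq : blk u ≡ blk v
        bq = blk-eq u v e q
        lw-eq : lw u ≡ lw v
        lw-eq = trans (cong₂ (λ z y → if z then y else bit h (pos u)) (bl-class u v e) (cong₂ _≤ᵇ_ (fs-class u v (cls-i v u e bq)) q)) (cong (λ z → if bl v then fs v ≤ᵇ pos v else bit h z) q)
        g-eq' : g u ≡ g v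
        g-eq' = ⟪⟫-cong λ y x → cong (_∧ (bl y ∧ (inn y x ∧ bit h (pos x)))) (seg-class u v e q y)
        hh-eq' : hh u ≡ hh v
        hh-eq' = ⟪⟫-cong λ y x → cong (_∧ (not (bl y) ∧ (inn y x ∧ (fs x ≤ᵇ pos x)))) (seg-class u v e q y)
        xx-eq' : xx u ≡ xx v
        xx-eq' = ⟪⟫-cong λ y x → cong (λ z → (z ∧ bit h (pos y)) ∧ (not (bl y) ∧ (inn y x ∧ (fs x ≤ᵇ pos x)))) (cong₂ (λ a b → (pid y ≡ᵇ a) ∧ (blk y ≡ᵇ b)) e bq)

      matched-back : ∀ a b → Matched τ' a b → Matched τ a b
      matched-back a b M = record
        { bla = trans (sym (bl-same a)) bla ; blb = trans (sym (bl-same b)) blb ; na = λ z → na (trans (pid-keep a) z)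
        ; ma = trans (sym (keep a rMATE refl)) (trans ma (pid-keep b)) ; mb = trans (sym (keep b rMATE refl)) (trans mb (pid-keep a)) }
        where open Matched M

      seg'-eq : ∀ c (D : V → Bool) → (∀ u → D u ≡ true → (pid u ≡ pid c) × (pos c ≤ pos u) × (τ' u ! rBLK ≡ τ' c ! rBLK)) →
        (∀ u → pid u ≡ pid c → pos c ≤ pos u → τ' u ! rBLK ≡ τ' c ! rBLK → D u ≡ true) → ∀ u → segσ τ' c u ≡ D u
      seg'-eq c D to from u = bool-ext
        (λ s → from u (trans (sym (pid-keep u)) (trans (==-sound {PID τ' u} (∧-l {PID τ' u ≡ᵇ PID τ' c} s)) (pid-keep c)))
                 (subst₂ _≤_ (pos-keep c) (pos-keep u) (≤ᵇ-sound {POS τ' c} (∧-r {τ' u ! rBLK ≡ᵇ τ' c ! rBLK} (∧-r {PID τ' u ≡ᵇ PID τ' c} s))))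
                 (==-sound {τ' u ! rBLK} (∧-l {τ' u ! rBLK ≡ᵇ τ' c ! rBLK} (∧-r {PID τ' u ≡ᵇ PID τ' c} s))))
        (λ t → let (e , l , q) = to u t in ∧-i {PID τ' u ≡ᵇ PID τ' c} (==-true (trans (pid-keep u) (trans e (sym (pid-keep c)))))
                 (∧-i {τ' u ! rBLK ≡ᵇ τ' c ! rBLK} (==-true q) (≤ᵇ-true (subst₂ _≤_ (sym (pos-keep c)) (sym (pos-keep u)) l))))

      blk'-dbl : ∀ v → τ' v ! rBLK ≡ dbl (lw v) (blk v)
      blk'-dbl = blk'

      module NewPair (a b : V) (M : Matched τ a b) (e' : τ' a ! rBLK ≡ τ' b ! rBLK) where
        open Matched M

        par' : (blk a ≡ blk b) × (lw a ≡ lw b)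
        par' = parity (lw a) (lw b) (trans (sym (blk'-dbl a)) (trans e' (blk'-dbl b)))

        e : blk a ≡ blk b
        e = proj₁ par'

        open Pair a b M e

        lwa : lw a ≡ bit h (pos a)
        lwa = lw-red a bla

        lwb : lw b ≡ (fs b ≤ᵇ pos b)
        lwb = lw-blue b blb

        lw-of-a : ∀ u → cls a u ≡ true → lw u ≡ bit h (pos u)
        lw-of-a u cu = lw-red u (red u cu)

        lw-of-b : ∀ x → cls b x ≡ true → lw x ≡ (fs b ≤ᵇ pos x)
        lw-of-b x cx = trans (lw-blue x (blu x cx)) (far x cx)

        same-block : ∀ c u → cls c u ≡ true → lw u ≡ lw c → τ' u ! rBLK ≡ τ' c ! rBLK
        same-block c u cu q = trans (blk' u) (trans (cong₂ dbl q (proj₂ (cls-e c u cu))) (sym (blk' c)))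

        new-block : ∀ c u → τ' u ! rBLK ≡ τ' c ! rBLK → (blk u ≡ blk c) × (lw u ≡ lw c)
        new-block c u q = parity (lw u) (lw c) (trans (sym (blk'-dbl u)) (trans q (blk'-dbl c)))

        wp' : wp τ' a b ≡ Val a b
        wp' = trans (wp-same τ τ' keep10 a b) (split-eq a b M e)

        low-case : lw a ≡ true → wp τ' a b ≡ (τ' a ! rOFF + τ' b ! rOFF) + ⟪ (λ u x → segσ τ' a u ∧ segσ τ' b x) ⟫
        low-case t = trans wp' (cong₂ _+_ (cong₂ _+_ (sym (off-low a t)) (sym (off-low b tb))) (⟪⟫-cong λ u x → sym (cong₂ _∧_
            (seg'-eq a (seg a) (λ u s → let (eu , bu , l) = seg-e a u s ; cu = cls-i a u eu bu in eu , l , same-block a u cu (trans (lw-of-a u cu) (trans (∧-r {cls a u} (U→L ta u s)) (sym t))))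
                (λ u eu l q → seg-i a u eu (proj₁ (new-block a u q)) l) u)
            (seg'-eq b (seg b) (λ x s → let (ex , bx , l) = seg-e b x s ; cx = cls-i b x ex bx in ex , l , same-block b x cx (trans (lw-of-b x cx) (trans (∧-r {cls b x} (V→F tb' x s)) (sym tb))))
                (λ x ex l q → seg-i b x ex (proj₁ (new-block b x q)) l) x))))
          where
          tb = trans (sym (proj₂ par')) t
          ta = trans (sym lwa) t
          tb' = trans (sym lwb) tb
          off-low : ∀ c → lw c ≡ true → τ' c ! rOFF ≡ off c
          off-low c q = trans (off' c) (cong (λ z → if z then off c else if bl c then off c + g c else off c + (hh c ∸ xx c)) q)

        -- `quad-up` with three of its terms absorbed by the new offsets; the remaining corner is
        -- the weight between the segments of the new blocks.
        up-case : lw a ≡ false → wp τ' a b ≡ (τ' a ! rOFF + τ' b ! rOFF) + ⟪ (λ u x → segσ τ' a u ∧ segσ τ' b x) ⟫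
        up-case f = trans wp' (begin
            (off a + off b) + A                                   ≡⟨ cong (off a + off b +_) inner-split ⟩
            (off a + off b) + ((hh a ∸ xx a) + g b + A')          ≡⟨ solve 5 (λ x y z t s → (x :+ y) :+ (z :+ t :+ s) := ((x :+ z) :+ (y :+ t)) :+ s) refl (off a) (off b) (hh a ∸ xx a) (g b) A' ⟩
            ((off a + (hh a ∸ xx a)) + (off b + g b)) + A'        ≡⟨ cong₂ _+_ (cong₂ _+_ (sym off-a) (sym off-b)) (⟪⟫-cong λ u x → sym (cong₂ _∧_ (seg-a u) (seg-b x))) ⟩
            (τ' a ! rOFF + τ' b ! rOFF) + ⟪ (λ u x → segσ τ' a u ∧ segσ τ' b x) ⟫ ∎)
          where
          open ≡-Reasoning
          open +-*-Solver using (solve; _:+_; _:=_)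
          fa = trans (sym lwa) f
          fb : (fs b ≤ᵇ pos b) ≡ false
          fb = trans (sym lwb) (trans (sym (proj₂ par')) f)
          A A' : ℕ
          A = ⟪ (λ u x → seg a u ∧ seg b x) ⟫
          A' = ⟪ (λ u x → (seg a u ∧ not (L u)) ∧ (seg b x ∧ not (F x))) ⟫
          off-a : τ' a ! rOFF ≡ off a + (hh a ∸ xx a)
          off-a = trans (off' a) (cong₂ (λ z y → if z then off a else if y then off a + g a else off a + (hh a ∸ xx a)) f bla)
          off-b : τ' b ! rOFF ≡ off b + g b
          off-b = trans (off' b) (cong₂ (λ z y → if z then off b else if y then off b + g b else off b + (hh b ∸ xx b)) (trans (sym (proj₂ par')) f) blb)
          bal : A + xx a ≡ (hh a + g b) + A'
          bal = trans (cong (A +_) xx-eq) (trans (⟪⟫-split λ u x → quad-up (seg a u) (seg b x) (L u) (F x) (L→U fa u) (F→V fb x))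
                  (cong (_+ A') (cong₂ _+_ (sym hh-eq) (sym (g-eq b (cls-i b b refl refl))))))
          xx≤hh : xx a ≤ hh a
          xx≤hh = subst₂ _≤_ (sym xx-eq) (sym hh-eq) (⟪⟫-mono λ u x t → ∧-i {seg a u} (L→U fa u (∧-l {L u} t)) (∧-r {L u} t))
          inner-split : A ≡ (hh a ∸ xx a) + g b + A'
          inner-split = +-cancelʳ-≡ (xx a) A _ (trans bal (trans (cong (λ z → z + g b + A') (sym (m∸n+n≡m xx≤hh)))
            (solve 4 (λ x y z t → x :+ y :+ z :+ t := x :+ z :+ t :+ y) refl (hh a ∸ xx a) (xx a) (g b) A')))
          seg-a : ∀ u → segσ τ' a u ≡ seg a u ∧ not (L u)
          seg-a = seg'-eq a (λ u → seg a u ∧ not (L u))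
            (λ u t → let s = ∧-l {seg a u} t ; (eu , bu , l) = seg-e a u s ; cu = cls-i a u eu bu in
               eu , l , same-block a u cu (trans (lw-of-a u cu) (trans (bool-false λ z → true≢false (∧-i {cls a u} cu z) (not-f (∧-r {seg a u} t))) (sym f))))
            (λ u eu l q → let (bu , lq) = new-block a u q ; cu = cls-i a u eu bu in
               ∧-i {seg a u} (seg-i a u eu bu l) (not-t (bool-false λ z → true≢false (trans (lw-of-a u cu) (∧-r {cls a u} z)) (trans lq f))))
          seg-b : ∀ x → segσ τ' b x ≡ seg b x ∧ not (F x)
          seg-b = seg'-eq b (λ x → seg b x ∧ not (F x))
            (λ x t → let s = ∧-l {seg b x} t ; (ex , bx , l) = seg-e b x s ; cx = cls-i b x ex bx in
               ex , l , same-block b x cx (trans (lw-of-b x cx) (trans (bool-false λ z → true≢false (∧-i {cls b x} cx z) (not-f (∧-r {seg b x} t))) (sym (trans (sym (proj₂ par')) f)))))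
            (λ x ex l q → let (bx , lq) = new-block b x q ; cx = cls-i b x ex bx in
               ∧-i {seg b x} (seg-i b x ex bx l) (not-t (bool-false λ z → true≢false (trans (lw-of-b x cx) (∧-r {cls b x} z)) (trans lq (trans (sym (proj₂ par')) f)))))

        split' : wp τ' a b ≡ (τ' a ! rOFF + τ' b ! rOFF) + ⟪ (λ u x → segσ τ' a u ∧ segσ τ' b x) ⟫
        split' = case bool-case (lw a) of λ { (inj₁ t) → low-case t ; (inj₂ f) → up-case f }

      Received : V → V → Set
      Received a b = Σ V λ b* → (cls b b* ≡ true) × (pos b* ≡ fs b) × (∀ u → cls b u ≡ true → val u ≤ val b*) × (rc a ∸ 1 ≡ K + off b* + off b* ∸ cr b*)

      received : ∀ a → rc a ≢ 0 → Σ V λ b → Matched τ a b × (blk a ≡ blk b) × Received a b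
      received a nz =
        let (u , x , cu , bu , t , rx) = rc-e a nz
            (eu , qu) = cls-e a u cu
            (cr' , m₁ , m₂ , q) = inn-e u x t
            nu : pid u ≢ 0
            nu z = true≢false (==-true z) (not-f (∧-l {not (pid u ≡ᵇ 0)} cr'))
            c₂ = ∧-r {not (pid u ≡ᵇ 0)} cr'
            nx : pid x ≢ 0
            nx z = true≢false (==-true z) (not-f (∧-l {not (pid x ≡ᵇ 0)} c₂))
            bx : bit i (τ x ! rTAU) ≡ true
            bx = trans (sym (cong (_xor bit i (τ x ! rTAU)) (red-bit-tau u bu nu))) (∧-r {not (pid x ≡ᵇ 0)} c₂)
            (b* , c* , p* , best*) = fs-best x
        in x , record { bla = trans (bl-class a u (sym eu)) bu
                      ; blb = ∧-i {not (pid x ≡ᵇ 0)} (not-t (==-false nx)) bx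
                      ; na = λ z → nu (trans eu z)
                      ; ma = trans (mate-class a u (sym eu)) m₁
                      ; mb = trans m₂ eu }
         , trans (sym qu) q
         , b* , c* , p* , best* , trans (cong (_∸ 1) rx) (trans (cs-val x b* nx c* p*) (cong (λ z → z + off b* + off b* ∸ cr b*) (Ctx.kk ctx b*)))
        where
        -- Nodes of the same path and position have equal cuts and offsets, so it does not matter
        -- which witness of the column supplied the value.
        cs-val : ∀ x b* → pid x ≢ 0 → cls x b* ≡ true → pos b* ≡ fs x → cs x ≡ kk b* + off b* + off b* ∸ cr b*
        cs-val x b* nx c p* = ≤-antisym (case cs x ≟ 0 of λ
            { (yes z) → ≤-trans (≤-reflexive z) z≤n
            ; (no nz) → let (b , cb , pb , eb) = cs-att x nz
                            e = trans (proj₁ (cls-e x b cb)) (sym (proj₁ (cls-e x b* c)))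
                            q = trans pb (sym p*)
                        in ≤-reflexive (trans eb (cong₂ _∸_ (cong₂ (λ k y → k + y + y) (trans (Ctx.kk ctx b) (sym (Ctx.kk ctx b*))) (off-class b b* e q)) (cr-class b b* e q (λ z → nx (trans (sym (proj₁ (cls-e x b* c))) z))))) })
          (cs-≥ x b* c p*)

      score-term : V → ℕ
      score-term a = kk a + 1 ∸ (cr a + kk a ∸ ((rc a ∸ 1) + (off a + hh a) + (off a + hh a)))

      score-value : ∀ a b → (M : Matched τ a b) → (e : blk a ≡ blk b) → (R : Received a b) → score-term a ≡ K + 1 ∸ Mv τ a (proj₁ R)
      score-value a b M e (b* , c , q , _ , hc) = Pair.column-value a b M e b* c q (rc a ∸ 1) hc

      sound' : ∀ v → (τ' v ! rSCORE ≡ 0) ⊎ Sound (τ' v ! rSCORE)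
      sound' v = case bool-case (bl v) of λ
        { (inj₁ b) → subst (λ z → (z ≡ 0) ⊎ Sound z) (sym (score'-blue v b)) (sound v)
        ; (inj₂ b) → subst (λ z → (z ≡ 0) ⊎ Sound z) (sym (score' v b)) (by-rc (rc v ≡ᵇ 0) refl) }
        where
        by-rc : ∀ c → (rc v ≡ᵇ 0) ≡ c → ((if not c then τ v ! rSCORE ⊔ score-term v else τ v ! rSCORE) ≡ 0) ⊎ Sound (if not c then τ v ! rSCORE ⊔ score-term v else τ v ! rSCORE)
        by-rc true _ = sound v
        by-rc false f =
          let (b , M , e , Rc) = received v (λ z → true≢false (==-true z) f)
              b* = proj₁ Rc
              mc = Pair.matched-in-class v b M e b* (proj₁ (proj₂ Rc))
              s : Sound (score-term v)
              s = subst Sound (sym (score-value v b M e Rc)) (pairs v b* (Matched.na M) (proj₁ (blue-pid b* (Matched.blb (proj₁ mc))))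
                    (Pair.tau-xor v b* (proj₁ mc) (proj₂ mc)))
          in case ⊔-sel (τ v ! rSCORE) (score-term v) of λ
               { (inj₁ q) → subst (λ z → (z ≡ 0) ⊎ Sound z) (sym q) (sound v)
               ; (inj₂ q) → inj₂ (subst Sound (sym q) s) }

      inv' : SInv h τ'
      inv' = record
        { ctx = ctx'
        ; pairs = λ a b na nb x → subst (λ z → Sound (K + 1 ∸ z)) (sym (Mv-same τ τ' keep10 a b))
            (pairs a b (λ z → na (trans (pid-keep a) z)) (λ z → nb (trans (pid-keep b) z)) (trans (sym (cong₂ (λ p q → bit i p xor bit i q) (keep a rTAU refl) (keep b rTAU refl))) x))
        ; mate-class = λ u v e → trans (keep u rMATE refl) (trans (mate-class u v (trans (sym (pid-keep u)) (trans e (pid-keep v)))) (sym (keep v rMATE refl)))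
        ; red-blk = λ v b → trans (blk'-red v (trans (sym (bl-same v)) b)) (cong (shr h) (sym (pos-keep v)))
        ; blk-mono = blk-mono'
        ; off-class = off-class'
        ; split-eq = λ a b M e → NewPair.split' a b (matched-back a b M) e
        ; sound = sound'
        }

      score-mono : ∀ v → τ v ! rSCORE ≤ τ' v ! rSCORE
      score-mono v = case bool-case (bl v) of λ
        { (inj₁ b) → ≤-reflexive (sym (score'-blue v b))
        ; (inj₂ b) → ≤-trans (by (rc v ≡ᵇ 0)) (≤-reflexive (sym (score' v b))) }
        where
        by : ∀ c → τ v ! rSCORE ≤ (if not c then τ v ! rSCORE ⊔ score-term v else τ v ! rSCORE)
        by true = ≤-refl
        by false = m≤m⊔n _ _

      -- Recorded for the end of the recursion: a pair surviving in the lower quadrant owes this to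
      -- an edge at a row strictly above `a` in the new block.
      Tight : V → Set
      Tight a = bit h (pos a) ≡ true → Σ V λ u → (pid u ≡ pid a) × (τ' u ! rBLK ≡ τ' a ! rBLK) × (pos u < pos a)

      -- Mixed quadrants are covered by `quad-≤`. In the other two `quad-up` applies, with the roles
      -- of its sets depending on the side: an empty corner again gives coverage, and an edge in the
      -- corner links the new blocks.
      outcome : ∀ a b → Matched τ a b → Linked a b τ → Covered a b τ' ⊎ (Linked a b τ' × Tight a)
      outcome a b M (e , nz) = go (bool-case (bit h (pos a))) (bool-case (fs b ≤ᵇ pos b))
        where
        open Matched M
        open Pair a b M e
        rc≢0 : rc a ≢ 0
        rc≢0 = let (ed , q) = ⟪⟫-≢0 nz in case q of λ
          { (inj₁ t) → let cu = ∧-l {cls a (fst ed)} t ; cx = ∧-r {cls a (fst ed)} t in rc-i a (fst ed) (snd ed) cu (red _ cu) (link _ _ cu cx) (ed , inj₁ (refl , refl))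
          ; (inj₂ t) → let cu = ∧-l {cls a (snd ed)} t ; cx = ∧-r {cls a (snd ed)} t in rc-i a (snd ed) (fst ed) cu (red _ cu) (link _ _ cu cx) (ed , inj₂ (refl , refl)) }
        rec : Received a b
        rec = let (b₁ , M₁ , e₁ , b* , c , q , best , hc) = received a rc≢0
                  eb : pid b ≡ pid b₁
                  eb = trans (sym ma) (Matched.ma M₁)
                  qb : blk b ≡ blk b₁
                  qb = trans (sym e) e₁
                  tr : ∀ u → cls b u ≡ cls b₁ u
                  tr u = cong₂ (λ x y → (pid u ≡ᵇ x) ∧ (blk u ≡ᵇ y)) eb qb
              in b* , trans (tr b*) c , trans q (sym (fs-class b b₁ (cls-i b₁ b eb qb))) , (λ u cu → best u (trans (sym (tr u)) cu)) , hc
        covered : ⟪ (λ u x → seg a u ∧ seg b x) ⟫ + ⟪ (λ u x → L u ∧ F x) ⟫ ≤ ⟪ (λ u x → seg a u ∧ F x) ⟫ + ⟪ (λ u x → L u ∧ seg b x) ⟫ → Covered a b τ'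
        covered hE = a , ≤-trans (≤-trans (∸-monoʳ-≤ (K + 1) (subst (Mv τ a b* ≤_) (sym (Mv-same τ τ' keep10 a b)) (column-better b* c q (opt b (cls-i b b refl refl)) hE))) (≤-reflexive (sym (score-value a b M e rec))))
            (≤-trans (m≤n⊔m (τ a ! rSCORE) (score-term a)) (≤-reflexive (sym (trans (score' a bla) (cong (λ z → if not z then τ a ! rSCORE ⊔ score-term a else τ a ! rSCORE) (==-false rc≢0))))))
          where
          b* = proj₁ rec
          c = proj₁ (proj₂ rec)
          q = proj₁ (proj₂ (proj₂ rec))
          opt = proj₁ (proj₂ (proj₂ (proj₂ rec)))
        -- Otherwise the quadrant of (a , b) contains inner edges, and the pair survives.
        survive : ∀ t → lw a ≡ t → lw b ≡ t → (D E : V → Bool) → (∀ u → D u ≡ true → (cls a u ≡ true) × (lw u ≡ t)) → (∀ x → E x ≡ true → (cls b x ≡ true) × (lw x ≡ t)) →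
          ⟪ (λ u x → D u ∧ E x) ⟫ ≢ 0 → Linked a b τ'
        survive t la lb D E hD hE nz' = trans (blk' a) (trans (cong₂ dbl (trans la (sym lb)) e) (sym (blk' b)))
          , λ z → nz' (n≤0⇒n≡0 (≤-trans (⟪⟫-mono λ u x hh' → ∧-i {clsσ τ' a u} (in-cls a u la (hD u (∧-l {D u} hh'))) (in-cls b x lb (hE x (∧-r {D u} hh')))) (≤-reflexive z)))
          where
          in-cls : ∀ c u → lw c ≡ t → (cls c u ≡ true) × (lw u ≡ t) → clsσ τ' c u ≡ true
          in-cls c u lc (cu , lu) = ∧-i {PID τ' u ≡ᵇ PID τ' c} (==-true (trans (pid-keep u) (trans (proj₁ (cls-e c u cu)) (sym (pid-keep c)))))
            (==-true (trans (blk' u) (trans (cong₂ dbl (trans lu (sym lc)) (proj₂ (cls-e c u cu))) (sym (blk' c)))))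
        drop0 : ∀ {x y z} → x ≡ y + z → z ≡ 0 → x ≡ y
        drop0 {x} {y} e z = trans e (trans (cong (y +_) z) (+-identityʳ y))
        comm₂ : ∀ a b c d → b + a ≡ d + c → a + b ≡ c + d
        comm₂ a b c d e = trans (+-comm a b) (trans e (+-comm d c))
        go : (bit h (pos a) ≡ true) ⊎ (bit h (pos a) ≡ false) → ((fs b ≤ᵇ pos b) ≡ true) ⊎ ((fs b ≤ᵇ pos b) ≡ false) → Covered a b τ' ⊎ (Linked a b τ' × Tight a)
        go (inj₁ t) (inj₂ f) = inj₁ (covered (⟪⟫-balance λ u x → quad-≤ (seg a u) (seg b x) (L u) (F x) (inj₁ (U→L t u , F→V f x))))
        go (inj₂ f) (inj₁ t) = inj₁ (covered (⟪⟫-balance λ u x → quad-≤ (seg a u) (seg b x) (L u) (F x) (inj₂ (L→U f u , V→F t x))))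
        go (inj₁ t) (inj₁ s) = case ⟪ (λ u x → (L u ∧ not (seg a u)) ∧ (F x ∧ not (seg b x))) ⟫ ≟ 0 of λ
          { (yes z) → inj₁ (covered (≤-reflexive (comm₂ ⟪ (λ u x → seg a u ∧ seg b x) ⟫ ⟪ (λ u x → L u ∧ F x) ⟫ ⟪ (λ u x → seg a u ∧ F x) ⟫ ⟪ (λ u x → L u ∧ seg b x) ⟫ (drop0 bal z))))
          ; (no nz') → inj₂ (survive true (trans (lw-red a bla) t) (trans (lw-blue b blb) s) (λ u → L u ∧ not (seg a u)) (λ x → F x ∧ not (seg b x))
              (λ u d → let lu = ∧-l {L u} d ; cu = ∧-l {cls a u} lu in cu , trans (lw-red u (red u cu)) (∧-r {cls a u} lu))
              (λ x d → let fx = ∧-l {F x} d ; cx = ∧-l {cls b x} fx in cx , trans (lw-blue x (blu x cx)) (trans (far x cx) (∧-r {cls b x} fx)))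
              nz' , λ _ → tight nz') }
          where
          bal : ⟪ (λ u x → L u ∧ F x) ⟫ + ⟪ (λ u x → seg a u ∧ seg b x) ⟫ ≡ (⟪ (λ u x → L u ∧ seg b x) ⟫ + ⟪ (λ u x → seg a u ∧ F x) ⟫) + ⟪ (λ u x → (L u ∧ not (seg a u)) ∧ (F x ∧ not (seg b x))) ⟫
          bal = ⟪⟫-split λ u x → quad-up (L u) (F x) (seg a u) (seg b x) (U→L t u) (V→F s x)
          tight : ⟪ (λ u x → (L u ∧ not (seg a u)) ∧ (F x ∧ not (seg b x))) ⟫ ≢ 0 → Σ V λ u → (pid u ≡ pid a) × (τ' u ! rBLK ≡ τ' a ! rBLK) × (pos u < pos a)
          tight nz' = let (ed , q) = ⟪⟫-≢0 nz' in case q of λ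
              { (inj₁ z) → fst ed , at (fst ed) (∧-l {L (fst ed) ∧ not (seg a (fst ed))} z) ; (inj₂ z) → snd ed , at (snd ed) (∧-l {L (snd ed) ∧ not (seg a (snd ed))} z) }
            where
            at : ∀ u → L u ∧ not (seg a u) ≡ true → (pid u ≡ pid a) × (τ' u ! rBLK ≡ τ' a ! rBLK) × (pos u < pos a)
            at u d = let lu = ∧-l {L u} d ; cu = ∧-l {cls a u} lu ; (eu , bu) = cls-e a u cu in
              eu , trans (blk' u) (trans (cong₂ dbl (trans (lw-red u (red u cu)) (trans (∧-r {cls a u} lu) (sym (trans (lw-red a bla) t)))) bu) (sym (blk' a)))
              , ≰⇒> λ l → true≢false (seg-i a u eu bu l) (not-f (∧-r {L u} d))
        go (inj₂ f) (inj₂ s) = case ⟪ (λ u x → (seg a u ∧ not (L u)) ∧ (seg b x ∧ not (F x))) ⟫ ≟ 0 of λ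
          { (yes z) → inj₁ (covered (≤-reflexive (drop0 bal z)))
          ; (no nz') → inj₂ (survive false (trans (lw-red a bla) f) (trans (lw-blue b blb) s) (λ u → seg a u ∧ not (L u)) (λ x → seg b x ∧ not (F x))
              (λ u d → let su = ∧-l {seg a u} d ; (eu , bu , _) = seg-e a u su ; cu = cls-i a u eu bu in
                cu , trans (lw-red u (red u cu)) (bool-false λ z → true≢false (∧-i {cls a u} cu z) (not-f (∧-r {seg a u} d))))
              (λ x d → let sx = ∧-l {seg b x} d ; (ex , bx , _) = seg-e b x sx ; cx = cls-i b x ex bx in
                cx , trans (lw-blue x (blu x cx)) (trans (far x cx) (bool-false λ z → true≢false (∧-i {cls b x} cx z) (not-f (∧-r {seg b x} d)))))
              nz' , λ t → ⊥-elim (true≢false t f)) }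
          where
          bal : ⟪ (λ u x → seg a u ∧ seg b x) ⟫ + ⟪ (λ u x → L u ∧ F x) ⟫ ≡ (⟪ (λ u x → seg a u ∧ F x) ⟫ + ⟪ (λ u x → L u ∧ seg b x) ⟫) + ⟪ (λ u x → (seg a u ∧ not (L u)) ∧ (seg b x ∧ not (F x))) ⟫
          bal = ⟪⟫-split λ u x → quad-up (seg a u) (seg b x) (L u) (F x) (L→U f u) (F→V s x)

module DivideConquerLoop {n m : ℕ} {ends : Fin m → Fin n × Fin n} {inT par : Fin m → Bool} {r : Fin n}
               (R : Rooted ends inT par r) (loopless : ∀ e → proj₁ (ends e) ≢ proj₂ (ends e)) (w : Fin m → ℕ)
               (ID : Fin n → ℕ) (ID-inj : ∀ u v → ID u ≡ ID v → u ≡ v) (i : ℕ) where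
  open Rooted R
  open TreeFacts R
  open TreeRun R loopless w
  open CutPhase R loopless w ID ID-inj using (cutval; at-below)
  open PairPhase R loopless w ID ID-inj i
  open StagePhase R loopless w ID ID-inj i
  open DivideConquer R loopless w ID ID-inj i
  open DivideConquerRun R loopless w ID ID-inj i

  Reached : ℕ → State → Set
  Reached c τ = Σ V λ v → c ≤ τ v ! rSCORE

  matched-same : ∀ σ τ → Same 11 σ τ → ∀ a b → Matched σ a b → Matched τ a b
  matched-same σ τ s a b M = record
    { bla = trans (cong₂ (λ x y → not (x ≡ᵇ 0) ∧ bit i y) (s a rPID refl) (s a rTAU refl)) bla
    ; blb = trans (cong₂ (λ x y → not (x ≡ᵇ 0) ∧ bit i y) (s b rPID refl) (s b rTAU refl)) blb
    ; na = λ z → na (trans (sym (s a rPID refl)) z)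
    ; ma = trans (s a rMATE refl) (trans ma (sym (s b rPID refl)))
    ; mb = trans (s b rMATE refl) (trans mb (sym (s a rPID refl))) }
    where open Matched M

  Same-weaken : ∀ σ τ → Same 11 σ τ → Same 10 σ τ
  Same-weaken σ τ s v q h = s v q (<ᵇ-true (≤-trans (<ᵇ-sound {toℕ q} {10} h) (m≤m+n 10 1)))

  module _ (H : ℕ) (Sound : ℕ → Set) (σ : State) (C : Ctx H σ) (H≢0 : H ≢ 0)
           (prs : ∀ a b → PID σ a ≢ 0 → PID σ b ≢ 0 → bit i (σ a ! rTAU) xor bit i (σ b ! rTAU) ≡ true → Sound (K + 1 ∸ Mv σ a b))
           (mcl : ∀ u v → PID σ u ≡ PID σ v → σ u ! rMATE ≡ σ v ! rMATE)
           (snd₀ : ∀ v → (σ v ! rSCORE ≡ 0) ⊎ Sound (σ v ! rSCORE)) where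
    open WithSound H Sound

    -- The alternative of `done` that leaves a pair uncovered carries `q ≢ 0`, so that after the
    -- last stage only coverage remains.
    record Loop (q : ℕ) (τ : State) : Set where
      field
        sinv : SInv q τ
        grows : ∀ v → σ v ! rSCORE ≤ τ v ! rSCORE
        frm : Same 11 σ τ
        done : ∀ a b → Matched σ a b → wp σ a b ≢ 0 → Reached (K + 1 ∸ Mv σ a b) τ ⊎ (Linked a b τ × (q ≢ 0))

    start : Loop H (Run dcStart σ)
    start = toRun (Loop H) dcStart σ (begin-at σ' (λ v q h → frame (λ q → low 11 q ∨ (toℕ q ≡ᵇ 23)) dcStart tt σ v q h) (λ _ → refl) (λ _ → refl))
      where
      σ' : State
      σ' = exec dcStart σ
      begin-at : ∀ τ → (∀ v q → low 11 q ∨ (toℕ q ≡ᵇ 23) ≡ true → τ v ! q ≡ σ v ! q) → (∀ v → τ v ! rBLK ≡ 0) → (∀ v → τ v ! rOFF ≡ 0) → Loop H τ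
      begin-at τ f hb ho = record
        { sinv = record
          { ctx = ctx
          ; pairs = λ a b na nb x → subst (λ z → Sound (K + 1 ∸ z)) (sym (Mv-same σ τ s a b))
              (prs a b (λ z → na (trans (s a rPID refl) z)) (λ z → nb (trans (s b rPID refl) z)) (trans (sym (cong₂ (λ p q → bit i p xor bit i q) (s a rTAU refl) (s b rTAU refl))) x))
          ; mate-class = λ u v e → trans (s₁₁ u rMATE refl) (trans (mcl u v (trans (sym (s u rPID refl)) (trans e (s v rPID refl)))) (sym (s₁₁ v rMATE refl)))
          ; red-blk = λ v _ → trans (hb v) (sym (shr-0 H (Ctx.pos< ctx v)))
          ; blk-mono = λ u v _ _ → ≤-reflexive (trans (hb u) (sym (hb v)))
          ; off-class = λ u v _ _ → trans (ho u) (sym (ho v))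
          ; split-eq = λ a b _ _ → trans (⟪⟫-cong λ u x → sym (cong₂ _∧_ (seg-suf a u) (seg-suf b x))) (sym (cong₂ (λ p q → p + q + ⟪ (λ u x → segσ τ a u ∧ segσ τ b x) ⟫) (ho a) (ho b)))
          ; sound = λ v → subst (λ z → (z ≡ 0) ⊎ Sound z) (sym (f v rSCORE refl)) (snd₀ v)
          }
        ; grows = λ v → ≤-reflexive (sym (f v rSCORE refl))
        ; frm = s₁₁
        ; done = λ a b M nz → inj₂ ((trans (hb a) (sym (hb b)) , λ z → nz (n≤0⇒n≡0 (≤-trans (⟪⟫-mono λ u x t →
              ∧-i {clsσ τ a u} (suf-cls a u (∧-l {suf σ a u} t)) (suf-cls b x (∧-r {suf σ a u} t))) (≤-reflexive z)))) , H≢0)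
        }
        where
        s₁₁ : Same 11 σ τ
        s₁₁ v q h = f v q (∨-l h)
        s : Same 10 σ τ
        s = Same-weaken σ τ s₁₁
        ctx = Ctx-same σ τ s C
        seg-suf : ∀ a u → segσ τ a u ≡ suf τ a u
        seg-suf a u = cong (λ z → (PID τ u ≡ᵇ PID τ a) ∧ (z ∧ (POS τ a ≤ᵇ POS τ u))) (==-true (trans (hb u) (sym (hb a))))
        suf-cls : ∀ a u → suf σ a u ≡ true → clsσ τ a u ≡ true
        suf-cls a u t = ∧-i {PID τ u ≡ᵇ PID τ a} (==-true (trans (s u rPID refl) (trans (suf-pid σ a u t) (sym (s a rPID refl))))) (==-true (trans (hb u) (sym (hb a))))

    next : ∀ h τ τ' (o : StageTerms.StageOut h τ τ') → Loop (suc h) τ → Loop h τ'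
    next h τ τ' o L = record
      { sinv = inv'
      ; grows = λ v → ≤-trans (grows v) (score-mono v)
      ; frm = frm'
      ; done = λ a b M nz → case done a b M nz of λ
          { (inj₁ (v , l)) → inj₁ (v , ≤-trans l (score-mono v))
          ; (inj₂ (lk , _)) → case outcome a b (matched-same σ τ frm a b M) lk of λ
              { (inj₁ (v , l)) → inj₁ (v , subst (λ z → K + 1 ∸ z ≤ τ' v ! rSCORE) (Mv-same σ τ' (Same-weaken σ τ' frm') a b) l)
              ; (inj₂ (lk' , tight)) → inj₂ (lk' , λ h0 → last h0 a (matched-same σ τ frm a b M) tight) } }
      }
      where
      open Loop L
      open StageInv H Sound h τ τ' sinv o
      frm' : Same 11 σ τ'
      frm' v q hq = trans (StageTerms.StageOut.keep o v q hq) (frm v q hq)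
      -- At the last stage every row is the cut row of its block.
      last : h ≡ 0 → ∀ a {b} → Matched τ a b → Tight a → ⊥
      last refl a M tight =
        let (u , e , q , l) = tight (Ctx.pos-odd (SInv.ctx sinv) a (Matched.na M))
            bu = trans (StageMath.bl-class h τ τ' sinv o u a e) (Matched.bla M)
        in <⇒≢ l (trans (sym (blk'-red u bu)) (trans q (blk'-red a (Matched.bla M))))

    dc-correct : Loop 0 (Run (dcProg H i) σ)
    dc-correct = seq (Loop H) (Loop 0) dcStart (down H (stage H i)) σ start λ τ L →
      down-run Loop H (stage H i) (λ h τ' _ L' → let I = Loop.sinv L' ; c = SInv.ctx I in
        next h τ' _ (stage-out H h τ'
          (λ t → Ctx.conn c (λ v → τ' v ! rBLK) (λ v → shr t (POS τ' v)) (SInv.blk-mono I) (λ u v _ l → shr-mono t l))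
          (Ctx.conn c (λ v → τ' v ! rBLK) (λ _ → 0) (SInv.blk-mono I) (λ _ _ _ _ → z≤n))
          (Ctx.pos< c)) L') τ L

  dcResult : ∀ (H : ℕ) (Sound : ℕ → Set) σ → State → Set
  dcResult H Sound σ τ = (∀ v → (τ v ! rSCORE ≡ 0) ⊎ Sound (τ v ! rSCORE)) × (∀ v → σ v ! rSCORE ≤ τ v ! rSCORE) × Same 11 σ τ
    × (∀ a b → Matched σ a b → wp σ a b ≢ 0 → Reached (K + 1 ∸ Mv σ a b) τ)

  dc-result : ∀ H Sound σ → Ctx H σ → H ≢ 0 →
    (∀ a b → PID σ a ≢ 0 → PID σ b ≢ 0 → bit i (σ a ! rTAU) xor bit i (σ b ! rTAU) ≡ true → Sound (K + 1 ∸ Mv σ a b)) →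
    (∀ u v → PID σ u ≡ PID σ v → σ u ! rMATE ≡ σ v ! rMATE) → (∀ v → (σ v ! rSCORE ≡ 0) ⊎ Sound (σ v ! rSCORE)) →
    dcResult H Sound σ (Run (dcProg H i) σ)
  dc-result H Sound σ C h0 prs mcl sn = let L = dc-correct H Sound σ C h0 prs mcl sn in
    WithSound.SInv.sound (Loop.sinv L) , Loop.grows L , Loop.frm L
    , λ a b M nz → case Loop.done L a b M nz of λ { (inj₁ c) → c ; (inj₂ (_ , z)) → ⊥-elim (z refl) }

-- Construction of the stars and the main loop

keepPair : ℕ → ℕ → ℕ → Mem → Bool
keepPair i s s' ρ = (2 ≤ᵇ ρ ! rD) ∧ (ρ ! rLEV ≡ᵇ (if bit i (ρ ! rTAU) then s' else s))

-- Only kept nodes use their own cut value. A class of equal nonzero name and position contains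
-- exactly one kept node, so the maximum hands its cut to all nodes hanging from it.
crProg : (Mem → Bool) → Prog
crProg keep = mk add mx silent (λ a b → eq₃ (φ 0 a) (φ 0 b)) (ite (λ ε → keep (Env.own ε)) (own# rCUT) (con 0)) ((rCR , yy#) ∷ [])

wwProg : Prog
wwProg = mk add add silent never (con 0) ((rWW , own# rS) ∷ [])

starTail₁ starTail₂ : ℕ → ℕ → ℕ → ℕ → Prog
starTail₁ H i s s' = (weightProg (cross i) ⨾ suffixProg H) ⨾ wwProg
starTail₂ H i s s' = crProg (keepPair i s s') ⨾ starTail₁ H i s s'

starProg : ℕ → ℕ → ℕ → ℕ → Prog
starProg H i s s' = setupProg (keepPair i s s') ⨾ starTail₂ H i s s'

pairProg : ℕ → ℕ → ℕ → Params → Prog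
pairProg L H i π = mateProg L i π ⨾ dcProg H i

allPairs : ℕ → ℕ → ℕ → ℕ → Prog
allPairs L H J i = loop (suc J) λ jr → loop 4 λ kr → loop (suc J) λ jb → loop 4 λ kb →
  pairProg L H i (record { jr = jr ; kr = kr ; jb = jb ; kb = kb })

-- Two subtrees differ in some bit of the IDs of their top nodes, which serves as colour; the levels
-- of the two edges are tried independently. Names are IDs plus 1, hence `suc L` bits.
mainProg : ℕ → ℕ → ℕ → ℕ → Prog
mainProg L N H J = loop L λ i → loop N λ s → loop N λ s' → starProg H i s s' ⨾ allPairs (suc L) H J i

module MainPhase {n m : ℕ} {ends : Fin m → Fin n × Fin n} {inT par : Fin m → Bool} {r : Fin n}
               (R : Rooted ends inT par r) (loopless : ∀ e → proj₁ (ends e) ≢ proj₂ (ends e)) (w : Fin m → ℕ)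
               (ID : Fin n → ℕ) (ID-inj : ∀ u v → ID u ≡ ID v → u ≡ v)
               (L N J : ℕ) (ID< : ∀ v → ID v < 2 ^ L) (n≤ : n ≤ 2 ^ N) where
  open Rooted R
  open TreeFacts R
  open TreeRun R loopless w
  open LevelPhase R loopless w using (LevelsOK; branch; branch-p; branch-anc)
  open StarPhase R loopless w ID ID-inj
  open CutPhase R loopless w ID ID-inj

  H : ℕ
  H = suc N

  module _ (lev : V → ℕ) (ok : LevelsOK N lev) where

    K₀ : ℕ
    K₀ = ⟪ (λ _ _ → true) ⟫

    record Facts (σ : State) : Set where
      field
        D-ok : ∀ v → σ v ! rD ≡ d v
        ID-ok : ∀ v → σ v ! rID ≡ ID v
        LEV-ok : ∀ v → σ v ! rLEV ≡ lev v
        TAU-ok : ∀ v → v ≢ r → σ v ! rTAU ≡ ID (branch v)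
        KK-ok : ∀ v → σ v ! rKK ≡ K₀
        CUT-ok : ∀ v → v ≢ r → σ v ! rCUT ≡ cutval (anc v)

    perm : Reg → Bool
    perm q = (toℕ q <ᵇ 6) ∨ (toℕ q ≡ᵇ 23)

    Facts-same : ∀ σ τ → (∀ v q → (toℕ q <ᵇ 6) ≡ true → τ v ! q ≡ σ v ! q) → Facts σ → Facts τ
    Facts-same σ τ s F = record
      { D-ok = λ v → trans (s v rD refl) (D-ok v) ; ID-ok = λ v → trans (s v rID refl) (ID-ok v)
      ; LEV-ok = λ v → trans (s v rLEV refl) (LEV-ok v) ; TAU-ok = λ v q → trans (s v rTAU refl) (TAU-ok v q)
      ; KK-ok = λ v → trans (s v rKK refl) (KK-ok v) ; CUT-ok = λ v q → trans (s v rCUT refl) (CUT-ok v q) }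
      where open Facts F

    W₂ treeM : V → V → ℕ
    W₂ a b = ⟪ (λ u x → anc a u ∧ anc b x) ⟫
    treeM a b = cutval (anc a) + cutval (anc b) ∸ (W₂ a b + W₂ a b)

    -- A score is sound if it belongs to any pair of edges from different subtrees, whether or not
    -- this pair was being looked for. Wrong parameters can therefore do no harm.
    Sound : ℕ → Set
    Sound c = Σ V λ a → Σ V λ b → (2 ≤ d a) × (2 ≤ d b) × (branch a ≢ branch b) × (c ≡ K₀ + 1 ∸ treeM a b)

    AllSound : State → Set
    AllSound τ = ∀ v → (τ v ! rSCORE ≡ 0) ⊎ Sound (τ v ! rSCORE)

    module AtStar (i s s' : ℕ) where
      open PairPhase R loopless w ID ID-inj i
      open DivideConquer R loopless w ID ID-inj i
      open DivideConquerLoop R loopless w ID ID-inj i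

      want : V → ℕ
      want v = if bit i (ID (branch v)) then s' else s

      X : V → Bool
      X v = (2 ≤ᵇ d v) ∧ (lev v ≡ᵇ want v)

      -- Depth 2 is the least that counts: edges at the root lie in no subtree, and from depth 2 on
      -- a node has the branch of its parent, so that the wanted level is inherited.
      pths : Paths X
      pths = level-paths ok want 2 (s≤s z≤n) λ v q l → cong (λ z → if bit i (ID z) then s' else s) (branch-p v q (λ e → case subst (λ z → 2 ≤ z) (trans (cong d e) d-r) l of λ ()))

      open Star X pths

      record StarOut (σ τ : State) : Set where
        field
          ctx : Ctx H τ
          pid-ok : ∀ v → τ v ! rPID ≡ pid v
          pos-ok : ∀ v → τ v ! rPOS ≡ pos v
          perm-ok : ∀ v q → perm q ≡ true → τ v ! q ≡ σ v ! q

      keep-eq : ∀ σ → Facts σ → ∀ v → keepPair i s s' (σ v) ≡ X v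
      keep-eq σ F v with v ≟F r
      ... | no q = cong₂ _∧_ (cong (2 ≤ᵇ_) (D-ok v)) (cong₂ (λ x y → x ≡ᵇ (if bit i y then s' else s)) (LEV-ok v) (TAU-ok v q))
        where open Facts F
      ... | yes refl = trans (cong (λ z → (2 ≤ᵇ z) ∧ (σ v ! rLEV ≡ᵇ (if bit i (σ v ! rTAU) then s' else s))) (trans (Facts.D-ok F v) d-r)) (sym (cong (λ z → (2 ≤ᵇ z) ∧ (lev v ≡ᵇ want v)) d-r))

      odd-odd : ∀ x → odd (odd-of x) ≡ true
      odd-odd zero = refl
      odd-odd (suc x) = trans (cong (λ z → odd (suc z + 1)) (+-suc x x)) (odd-odd x)

      pid≢r : ∀ v → pid v ≢ 0 → v ≢ r
      pid≢r v nz refl = nz (cong (_▸ (ID (ptop v) + 1)) (trans (cong X (top-r k₂)) (Paths.X-r pths)))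

      branch-ptop : ∀ v → pid v ≢ 0 → branch v ≡ branch (ptop v)
      branch-ptop v nz = branch-anc (ptop v) v (X≢r _ (pid-X v nz)) (top-anc k₂ v)

      suf-rep : ∀ v → pid v ≢ 0 → ∀ u → at-below pid pos v u ≡ anc (rep v) u
      suf-rep v nz u = sym (trans (sub (rep v) u (rep-ptop v (pid-X v nz))) (cong₂ (λ a b → (pid u ≡ᵇ a) ∧ (b ≤ᵇ pos u)) (pid-rep v) (pos-rep v)))

      assemble : ∀ σ τ → Facts σ → (∀ v q → perm q ≡ true → τ v ! q ≡ σ v ! q) → (∀ v → τ v ! rPID ≡ pid v) → (∀ v → τ v ! rPOS ≡ pos v) →
        (∀ v → pid v ≢ 0 → τ v ! rCR ≡ cutval (anc (rep v))) →
        (∀ v → τ v ! rWW ≡ ⟪ (λ u x → at-below (λ v → τ v ! rPID) (λ v → τ v ! rPOS) v u ∧ cross i (τ u) (τ x)) ⟫) → StarOut σ τ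
      assemble σ τ F f hp ho hcr hww = record
        { ctx = record
          { conn = λ b g mb mg u v e tu tv → connected b g (mono b mb) (mono g mg) u v (trans (sym (eqp b g u)) (trans e (eqp b g v))) (conv b g u tu) (conv b g v tv)
          ; col-pid = λ u v e nz → let nv = λ z → nz (trans (hp v) z) ; ev = trans (sym (hp u)) (trans e (hp v)) ; nu = λ z → nv (trans (sym ev) z) in
              cong (bit i) (trans (trans (f u rTAU refl) (TAU-ok u (pid≢r u nu))) (trans (cong ID (trans (branch-ptop u nu) (trans (cong branch (pid-ptop u v ev nv)) (sym (branch-ptop v nv))))) (sym (trans (f v rTAU refl) (TAU-ok v (pid≢r v nv))))))
          ; pos-odd = λ v nz → trans (cong odd (trans (ho v) (cong (_▸ odd-of (d (rep v))) (rep-ptop v (pid-X v (λ z → nz (trans (hp v) z))))))) (odd-odd (d (rep v)))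
          ; pos< = λ v → subst (_< 2 ^ H) (sym (ho v)) (pos-bound pths N v n≤)
          ; kk = λ v → trans (f v rKK refl) (KK-ok v)
          ; cr = λ v nz → let nv = λ z → nz (trans (hp v) z) in trans (hcr v nv) (⟪⟫-cong λ u x → cong₂ (λ a b → a ∧ not b) (sym (sufτ v nv u)) (sym (sufτ v nv x)))
          ; ww = hww
          }
        ; pid-ok = hp ; pos-ok = ho ; perm-ok = f }
        where
        open Facts F
        eqp : ∀ b g v → (τ v ! rPID , b v , g v) ≡ (pid v , b v , g v)
        eqp b g v = cong (_, (b v , g v)) (hp v)
        mono : ∀ b → Mono τ b → Monotone b
        mono b mb u v e l = mb u v (trans (hp u) (trans e (sym (hp v)))) (subst₂ _≤_ (sym (ho u)) (sym (ho v)) l)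
        conv : ∀ b g u → Topmost (λ v → τ v ! rPID , b v , g v) u → Topmost (λ v → pid v , b v , g v) u
        conv b g u (inj₁ q) = inj₁ q
        conv b g u (inj₂ ne) = inj₂ λ e → ne (trans (eqp b g u) (trans e (sym (eqp b g (p u)))))
        sufτ : ∀ v → pid v ≢ 0 → ∀ u → suf τ v u ≡ anc (rep v) u
        sufτ v nv u = trans (cong₂ _∧_ (cong₂ _≡ᵇ_ (hp u) (hp v)) (cong₂ _≤ᵇ_ (ho v) (ho u))) (suf-rep v nv u)

      module _ (σ : State) (F : Facts σ) where
        open Facts F

        kp : Mem → Bool
        kp = keepPair i s s'

        Sp₁ Sp₂ : State → Set
        Sp₁ τ = (∀ v → (τ v ! rPOS ≡ pos v) × (τ v ! rPID ≡ pid v)) × (∀ v → τ v ! rBLK ≡ 0) × (∀ v q → perm q ≡ true → τ v ! q ≡ σ v ! q)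
        Sp₂ τ = Sp₁ τ × (∀ v → pid v ≢ 0 → τ v ! rCR ≡ cutval (anc (rep v)))

        Sp₃ : State → State → Set
        Sp₃ τ₂ τ = (∀ v → τ v ! rS ≡ ⟪ (λ u x → belowσ τ₂ v u ∧ cross i (τ₂ u) (τ₂ x)) ⟫) × (∀ v q → notXS q ≡ true → τ v ! q ≡ τ₂ v ! q)

        φ-eq : ∀ τ → Sp₁ τ → ∀ t v → φ t (τ v) ≡ (pid v , 0 , shr t (pos v))
        φ-eq τ (hs , hb , _) t v = cong₂ _,_ (proj₂ (hs v)) (cong₂ _,_ (hb v) (cong (shr t) (proj₁ (hs v))))

        conn' : ∀ τ → Sp₁ τ → ∀ t → Connected (φ t ∘ τ)
        conn' τ S t u v e tu tv = connected (λ _ → 0) (λ v → shr t (pos v)) (λ _ _ _ _ → z≤n) (λ _ _ _ l → shr-mono t l) u v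
            (trans (sym (φ-eq τ S t u)) (trans e (φ-eq τ S t v))) (conv u tu) (conv v tv)
          where
          conv : ∀ u → Topmost (φ t ∘ τ) u → Topmost (λ v → pid v , 0 , shr t (pos v)) u
          conv u (inj₁ q) = inj₁ q
          conv u (inj₂ ne) = inj₂ λ e → ne (trans (φ-eq τ S t u) (trans e (sym (φ-eq τ S t (p u)))))

        step₁ : Sp₁ (Run (setupProg kp) σ)
        step₁ = toRun (λ τ → ∀ v → (τ v ! rPOS ≡ pos v) × (τ v ! rPID ≡ pid v)) (setupProg kp) σ (setup-correct kp σ (keep-eq σ F) (keep-eq σ F) D-ok ID-ok)
              , toRun (λ τ → ∀ v → τ v ! rBLK ≡ 0) (setupProg kp) σ (λ _ → refl)
              , λ v q h → frame-run perm (setupProg kp) (tt , tt) σ v q h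

        keep-at : ∀ τ → Sp₁ τ → ∀ v → kp (τ v) ≡ X v
        keep-at τ (_ , _ , f) = keep-eq τ (Facts-same σ τ (λ v q h → f v q (∨-l h)) F)

        step₂ : ∀ τ → Sp₁ τ → Sp₂ (Run (crProg kp) τ)
        step₂ τ S@(hs , hb , f) = toRun Sp₂ (crProg kp) τ ((hs , hb , (λ v q h → trans (frame perm (crProg kp) tt τ v q h) (f v q h))) , cr-ok)
          where
          C : Step
          C = mkStep add mx silent (λ a b → eq₃ (φ 0 a) (φ 0 b)) (ite (λ ε → kp (Env.own ε)) (own# rCUT) (con 0)) ((rCR , yy#) ∷ []) tt
          cr-ok : ∀ v → pid v ≢ 0 → Yv C τ v ≡ cutval (anc (rep v))
          cr-ok v nz = trans (Y-class C τ (φ 0) (λ _ _ → refl) (conn' τ S 0) v) (trans (fold-single mx (rep v) other)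
              (trans (cong (_▸ Xv C τ (rep v)) (eq₃-true {φ 0 (τ (rep v))} {φ 0 (τ v)} (trans (φ-eq τ S 0 (rep v)) (trans (cong₂ (λ a b → a , 0 , b) (pid-rep v) (pos-rep v)) (sym (φ-eq τ S 0 v))))))
                (trans (cong (λ b → if b then τ (rep v) ! rCUT else 0) (trans (keep-at τ S (rep v)) hr)) (trans (f (rep v) rCUT refl) (CUT-ok (rep v) (X≢r _ hr))))))
            where
            hr : X (rep v) ≡ true
            hr = rep-ptop v (pid-X v nz)
            other : ∀ u → u ≢ rep v → eq₃ (φ 0 (τ u)) (φ 0 (τ v)) ▸ Xv C τ u ≡ 0
            other u ne = go (eq₃ (φ 0 (τ u)) (φ 0 (τ v))) (X u) refl refl
              where
              go : ∀ c x → eq₃ (φ 0 (τ u)) (φ 0 (τ v)) ≡ c → X u ≡ x → c ▸ Xv C τ u ≡ 0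
              go false x _ _ = refl
              go true false _ hx = cong (λ b → if b then τ u ! rCUT else 0) (trans (keep-at τ S u) hx)
              go true true hc hx = ⊥-elim (ne (anc-same u (rep v) (comparable u (rep v) hx hr pe' (≤-reflexive dd)) (≤-reflexive (sym dd))))
                where
                e = trans (sym (φ-eq τ S 0 u)) (trans (eq₃-sound {φ 0 (τ u)} {φ 0 (τ v)} hc) (φ-eq τ S 0 v))
                pe' : pid u ≡ pid (rep v)
                pe' = trans (cong proj₁ e) (sym (pid-rep v))
                po : odd-of (d u) ≡ odd-of (d (rep v))
                po = trans (sym (pos-X u hx)) (trans (cong (proj₂ ∘ proj₂) e) (trans (sym (pos-rep v)) (pos-X (rep v) hr)))
                dd : d u ≡ d (rep v)
                dd = ≤-antisym (odd-cancel (≤-reflexive po)) (odd-cancel (≤-reflexive (sym po)))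

        star-correct : StarOut σ (Run (starProg H i s s') σ)
        star-correct =
          seq Sp₁ (StarOut σ) (setupProg kp) (starTail₂ H i s s') σ step₁ λ τ₁ s₁ →
          seq Sp₂ (StarOut σ) (crProg kp) (starTail₁ H i s s') τ₁ (step₂ τ₁ s₁) λ τ₂ s₂ →
          seq (Sp₃ τ₂) (StarOut σ) (weightProg (cross i) ⨾ suffixProg H) wwProg τ₂
            (sufweight (cross i) H τ₂ (conn' τ₂ (proj₁ s₂)) (λ v → subst (_< 2 ^ H) (sym (proj₁ (proj₁ (proj₁ s₂) v))) (pos-bound pths N v n≤)) , sufweight-frame (cross i) H τ₂) λ τ₃ s₃ →
          toRun (StarOut σ) wwProg τ₃ (finish τ₂ τ₃ (exec wwProg τ₃) s₂ s₃ (λ _ → refl) (λ v q h → frame (λ q → not (toℕ q ≡ᵇ 9)) wwProg tt τ₃ v q h))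
          where
          finish : ∀ τ₂ τ₃ τ₄ → Sp₂ τ₂ → Sp₃ τ₂ τ₃ → (∀ v → τ₄ v ! rWW ≡ τ₃ v ! rS) → (∀ v q → not (toℕ q ≡ᵇ 9) ≡ true → τ₄ v ! q ≡ τ₃ v ! q) → StarOut σ τ₄
          finish τ₂ τ₃ τ₄ ((hs , hb , f) , hcr) (hS , fx) hw fw = assemble σ τ₄ F
              (λ v q h → trans (fr v q (perm-notXS q h) (perm-not9 q h)) (f v q h))
              (λ v → trans (fr v rPID refl refl) (proj₂ (hs v))) (λ v → trans (fr v rPOS refl refl) (proj₁ (hs v)))
              (λ v nz → trans (fr v rCR refl refl) (hcr v nz))
              (λ v → trans (hw v) (trans (hS v) (⟪⟫-cong λ u x → cong₂ _∧_ (below-eq v u) (cross-eq u x))))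
            where
            fr : ∀ v q → notXS q ≡ true → not (toℕ q ≡ᵇ 9) ≡ true → τ₄ v ! q ≡ τ₂ v ! q
            fr v q h h' = trans (fw v q h') (fx v q h)
            small : ∀ q k → (toℕ q <ᵇ 6) ≡ true → 6 ≤ k → (toℕ q ≡ᵇ k) ≡ false
            small q k l h = ==-false {toℕ q} λ e → <⇒≱ (<ᵇ-sound {toℕ q} {6} l) (≤-trans h (≤-reflexive (sym e)))
            perm-notXS : ∀ q → perm q ≡ true → notXS q ≡ true
            perm-notXS q h = case ∨-e {toℕ q <ᵇ 6} h of λ
              { (inj₁ l) → cong₂ (λ a b → not (a ∨ b)) (small q 17 l (m≤m+n 6 11)) (small q 18 l (m≤m+n 6 12))
              ; (inj₂ e) → cong (λ z → not ((z ≡ᵇ 17) ∨ (z ≡ᵇ 18))) (==-sound {toℕ q} e) }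
            perm-not9 : ∀ q → perm q ≡ true → not (toℕ q ≡ᵇ 9) ≡ true
            perm-not9 q h = case ∨-e {toℕ q <ᵇ 6} h of λ
              { (inj₁ l) → cong not (small q 9 l (m≤m+n 6 3)) ; (inj₂ e) → cong (λ z → not (z ≡ᵇ 9)) (==-sound {toℕ q} e) }
            below-eq : ∀ v u → belowσ τ₂ v u ≡ at-below (λ v → τ₄ v ! rPID) (λ v → τ₄ v ! rPOS) v u
            below-eq v u = cong₂ _∧_ (sym (cong₂ _≡ᵇ_ (fr u rPID refl refl) (fr v rPID refl refl)))
              (trans (cong (_∧ (τ₂ v ! rPOS ≤ᵇ τ₂ u ! rPOS)) (==-true (trans (hb u) (sym (hb v))))) (sym (cong₂ _≤ᵇ_ (fr v rPOS refl refl) (fr u rPOS refl refl))))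
            cross-eq : ∀ u x → cross i (τ₂ u) (τ₂ x) ≡ cross i (τ₄ u) (τ₄ x)
            cross-eq u x = sym (cong₂ _∧_ (cong (λ z → not (z ≡ᵇ 0)) (fr u rPID refl refl)) (cong₂ _∧_ (cong (λ z → not (z ≡ᵇ 0)) (fr x rPID refl refl))
              (cong₂ (λ a b → bit i a xor bit i b) (fr u rTAU refl refl) (fr x rTAU refl refl))))

-- Every pair that can beat its single edges is found

module MainLoop {n m : ℕ} {ends : Fin m → Fin n × Fin n} {inT par : Fin m → Bool} {r : Fin n}
               (R : Rooted ends inT par r) (loopless : ∀ e → proj₁ (ends e) ≢ proj₂ (ends e)) (w : Fin m → ℕ)
               (ID : Fin n → ℕ) (ID-inj : ∀ u v → ID u ≡ ID v → u ≡ v)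
               (L N J : ℕ) (ID< : ∀ v → ID v < 2 ^ L) (n≤ : n ≤ 2 ^ N)
               (lev : Fin n → ℕ) (ok : LevelPhase.LevelsOK R loopless w N lev)
               (J-big : TreeRun.⟪_⟫ R loopless w (λ _ _ → true) < 2 ^ J) where
  open Rooted R
  open TreeFacts R
  open TreeRun R loopless w
  open LevelPhase R loopless w using (LevelsOK; branch; branch-anc)
  open StarPhase R loopless w ID ID-inj
  open CutPhase R loopless w ID ID-inj
  open MainPhase R loopless w ID ID-inj L N J ID< n≤

  F : State → Set
  F = Facts lev ok

  tM : V → V → ℕ
  tM = treeM lev ok

  K₁ : ℕ
  K₁ = ⟪ (λ _ _ → true) ⟫

  Snd : State → Set
  Snd = AllSound lev ok

  Reaches : ℕ → State → Set
  Reaches c τ = Σ V λ v → c ≤ τ v ! rSCORE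

  Good : (State → Set) → Prog → Set
  Good I q = ∀ τ → I τ → I (Run q τ) × (∀ v → τ v ! rSCORE ≤ Run q τ v ! rSCORE)

  good-loop : ∀ I k f → (∀ i → Good I (f i)) → Good I (loop k f)
  good-loop I k f h τ z = loop-run (λ _ τ' → I τ' × (∀ v → τ v ! rSCORE ≤ τ' v ! rSCORE)) k f
    (λ i τ' _ (z' , l) → let (a , b) = h i τ' z' in a , λ v → ≤-trans (l v) (b v)) τ (z , λ v → ≤-refl)

  -- Scores never decrease, so one successful iteration is enough, whatever admissible state it
  -- starts from.
  hit-loop : ∀ I k f → (∀ i → Good I (f i)) → ∀ c j → j < k → (∀ τ → I τ → Reaches c (Run (f j) τ)) → ∀ τ → I τ → Reaches c (Run (loop k f) τ)
  hit-loop I k f h c j j<k hit τ z = proj₂ (loop-run (λ i τ' → I τ' × (j < i → Reaches c τ')) k f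
      (λ i τ' _ (z' , l) → let (a , b) = h i τ' z' in a , λ j<i → case m≤n⇒m<n∨m≡n (≤-pred j<i) of λ
        { (inj₁ lt) → let (v , q) = l lt in v , ≤-trans q (b v)
        ; (inj₂ refl) → hit τ' z' }) τ (z , λ ())) j<k

  module Pairs (i s s' : ℕ) where
    open PairPhase R loopless w ID ID-inj i
    open DivideConquer R loopless w ID ID-inj i
    open DivideConquerRun R loopless w ID ID-inj i using (Mv-same)
    open DivideConquerLoop R loopless w ID ID-inj i
    open AtStar lev ok i s s'
    open Star X pths

    module _ (σ* : State) (F* : F σ*) (C* : Ctx H σ*) (pid* : ∀ v → σ* v ! rPID ≡ pid v) (pos* : ∀ v → σ* v ! rPOS ≡ pos v) where

      Inner : State → Set
      Inner τ = Same 10 σ* τ × Snd τ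

      suf* : ∀ v → pid v ≢ 0 → ∀ u → suf σ* v u ≡ anc (rep v) u
      suf* v nv u = trans (cong₂ _∧_ (cong₂ _≡ᵇ_ (pid* u) (pid* v)) (cong₂ _≤ᵇ_ (pos* v) (pos* u))) (suf-rep v nv u)

      wp* : ∀ a b → pid a ≢ 0 → pid b ≢ 0 → wp σ* a b ≡ W₂ lev ok (rep a) (rep b)
      wp* a b na nb = ⟪⟫-cong λ u x → cong₂ _∧_ (suf* a na u) (suf* b nb x)

      cr* : ∀ a → pid a ≢ 0 → σ* a ! rCR ≡ cutval (anc (rep a))
      cr* a na = trans (Ctx.cr C* a (λ z → na (trans (sym (pid* a)) z))) (⟪⟫-cong λ u x → cong₂ (λ p q → p ∧ not q) (suf* a na u) (suf* a na x))

      Mv* : ∀ a b → pid a ≢ 0 → pid b ≢ 0 → Mv σ* a b ≡ tM (rep a) (rep b)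
      Mv* a b na nb = cong₂ _∸_ (cong₂ _+_ (cr* a na) (cr* b nb)) (cong₂ _+_ (wp* a b na nb) (wp* a b na nb))

      tau* : ∀ a → pid a ≢ 0 → σ* a ! rTAU ≡ ID (branch (rep a))
      tau* a na = trans (Facts.TAU-ok F* a (pid≢r a na)) (cong ID (branch-anc (rep a) a (X≢r _ (rep-ptop a (pid-X a na))) (top-anc k₁ a)))

      X-deep : ∀ v → X v ≡ true → 2 ≤ d v
      X-deep v h = ≤ᵇ-sound {2} (∧-l {2 ≤ᵇ d v} h)

      pairs* : ∀ a b → PID σ* a ≢ 0 → PID σ* b ≢ 0 → bit i (σ* a ! rTAU) xor bit i (σ* b ! rTAU) ≡ true → Sound lev ok (K + 1 ∸ Mv σ* a b)
      pairs* a b na' nb' x = rep a , rep b , X-deep (rep a) (rep-ptop a (pid-X a na)) , X-deep (rep b) (rep-ptop b (pid-X b nb)) , differ , cong (K + 1 ∸_) (Mv* a b na nb)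
        where
        na : pid a ≢ 0
        na z = na' (trans (pid* a) z)
        nb : pid b ≢ 0
        nb z = nb' (trans (pid* b) z)
        self : ∀ b → b xor b ≡ false
        self true = refl
        self false = refl
        differ : branch (rep a) ≢ branch (rep b)
        differ e = true≢false x (trans (cong₂ (λ p q → bit i p xor bit i q) (trans (tau* a na) (cong ID e)) (tau* b nb)) (self (bit i (ID (branch (rep b))))))

      pid< : ∀ v → PID σ* v < 2 ^ suc L
      pid< v = subst (_< 2 ^ suc L) (sym (pid* v)) bound
        where
        bound : pid v < 2 ^ suc L
        bound with X (ptop v)
        ... | false = m^n>0 2 (suc L)
        ... | true = subst₂ _≤_ (cong suc (+-comm 1 (ID (ptop v)))) (sym (2^suc L)) (+-mono-≤ (m^n>0 2 L) (ID< (ptop v)))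

      After : Params → State → State → Set
      After π τ₀ τ = MatePhase.MInv H σ* C* π 0 τ × (∀ v → τ v ! rSCORE ≡ τ₀ v ! rSCORE)

      mate-after : ∀ π τ → Inner τ → After π τ (Run (mateProg (suc L) i π) τ)
      mate-after π τ (sm , _) = MatePhase.mate-correct H σ* C* π (suc L) τ sm pid<
        , λ v → frame-run (λ q → toℕ q ≡ᵇ 23) (mateProg (suc L) i π) (tt , λ _ → tt) τ v rSCORE refl

      Outcome : Params → State → State → Set
      Outcome π τ τ' = Inner τ' × (∀ v → τ v ! rSCORE ≤ τ' v ! rSCORE) ×
        (Σ State λ τ₁ → MatePhase.MInv H σ* C* π 0 τ₁ × (∀ a b → Matched τ₁ a b → wp τ₁ a b ≢ 0 → Reached (K + 1 ∸ Mv τ₁ a b) τ'))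

      pair-outcome : ∀ π τ → Inner τ → Outcome π τ (Run (pairProg (suc L) H i π) τ)
      pair-outcome π τ In@(sm , sn) = seq (After π τ) (Outcome π τ) (mateProg (suc L) i π) (dcProg H i) τ (mate-after π τ In) λ τ₁ (I , fsc) →
        let sm₁ = MatePhase.MInv.same I
            C₁ = Ctx-same σ* τ₁ sm₁ C*
            (sn' , gr , fr , cov) = dc-result H (Sound lev ok) τ₁ C₁ (λ ())
              (λ a b na nb x → subst (λ z → Sound lev ok (K + 1 ∸ z)) (sym (Mv-same σ* τ₁ sm₁ a b))
                (pairs* a b (λ z → na (trans (sm₁ a rPID refl) z)) (λ z → nb (trans (sm₁ b rPID refl) z)) (trans (sym (cong₂ (λ p q → bit i p xor bit i q) (sm₁ a rTAU refl) (sm₁ b rTAU refl))) x)))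
              (λ u v e → MatePhase.MInv.const I u v (trans (sym (sm₁ u rPID refl)) (trans e (sm₁ v rPID refl))))
              (λ v → subst (λ z → (z ≡ 0) ⊎ Sound lev ok z) (sym (fsc v)) (sn v))
        in ((λ v q h → trans (Same-weaken τ₁ (Run (dcProg H i) τ₁) fr v q h) (sm₁ v q h)) , sn')
           , (λ v → ≤-trans (≤-reflexive (sym (fsc v))) (gr v))
           , τ₁ , I , cov

      good-pair : ∀ π → Good Inner (pairProg (suc L) H i π)
      good-pair π τ In = let (a , b , _) = pair-outcome π τ In in a , b

      params : ℕ → ℕ → ℕ → ℕ → Params
      params jr kr jb kb = record { jr = jr ; kr = kr ; jb = jb ; kb = kb }

      P₁ : ℕ → ℕ → ℕ → Prog
      P₁ jr kr jb = loop 4 λ kb → pairProg (suc L) H i (params jr kr jb kb)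
      P₂ : ℕ → ℕ → Prog
      P₂ jr kr = loop (suc J) (P₁ jr kr)
      P₃ : ℕ → Prog
      P₃ jr = loop 4 (P₂ jr)

      g₁ : ∀ jr kr jb → Good Inner (P₁ jr kr jb)
      g₁ jr kr jb = good-loop Inner 4 _ (λ kb → good-pair (params jr kr jb kb))
      g₂ : ∀ jr kr → Good Inner (P₂ jr kr)
      g₂ jr kr = good-loop Inner (suc J) _ (g₁ jr kr)
      g₃ : ∀ jr → Good Inner (P₃ jr)
      g₃ jr = good-loop Inner 4 _ (g₂ jr)
      g₄ : Good Inner (allPairs (suc L) H J i)
      g₄ = good-loop Inner (suc J) P₃ g₃

      -- The majority condition holds from both sides, so each path singles out the other one. As
      -- red and blue parameters are independent, some turn of the four nested loops makes both
      -- choices right, and the paths are matched mutually.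
      hit-pairs : ∀ a b → X a ≡ true → X b ≡ true → bit i (ID (branch a)) ≡ false → bit i (ID (branch b)) ≡ true →
        cutval (anc a) < W₂ lev ok a b + W₂ lev ok a b → cutval (anc b) < W₂ lev ok a b + W₂ lev ok a b →
        ∀ τ → Inner τ → Reaches (K₁ + 1 ∸ tM a b) (Run (allPairs (suc L) H J i) τ)
      hit-pairs a b xa xb ta tb ca cb = choose (mate-exists {H} {J} σ* C* a b na' nb' xab J-big lta) (mate-exists {H} {J} σ* C* b a nb' na' xba J-big ltb)
        where
        na : pid a ≢ 0
        na = pid-≢0-X a xa
        nb : pid b ≢ 0
        nb = pid-≢0-X b xb
        na' : PID σ* a ≢ 0
        na' z = na (trans (sym (pid* a)) z)
        nb' : PID σ* b ≢ 0
        nb' z = nb (trans (sym (pid* b)) z)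
        tau-a : bit i (σ* a ! rTAU) ≡ false
        tau-a = trans (cong (bit i) (trans (tau* a na) (cong (ID ∘ branch) (rep-self a xa)))) ta
        tau-b : bit i (σ* b ! rTAU) ≡ true
        tau-b = trans (cong (bit i) (trans (tau* b nb) (cong (ID ∘ branch) (rep-self b xb)))) tb
        xab : bit i (σ* a ! rTAU) xor bit i (σ* b ! rTAU) ≡ true
        xab = cong₂ _xor_ tau-a tau-b
        xba : bit i (σ* b ! rTAU) xor bit i (σ* a ! rTAU) ≡ true
        xba = cong₂ _xor_ tau-b tau-a
        bla : blue i (σ* a) ≡ false
        bla = trans (cong (not (PID σ* a ≡ᵇ 0) ∧_) tau-a) (∧-f (not (PID σ* a ≡ᵇ 0)))
          where
          ∧-f : ∀ c → c ∧ false ≡ false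
          ∧-f true = refl
          ∧-f false = refl
        blb : blue i (σ* b) ≡ true
        blb = ∧-i {not (PID σ* b ≡ᵇ 0)} (not-t (==-false nb')) tau-b
        wab : wp σ* a b ≡ W₂ lev ok a b
        wab = trans (wp* a b na nb) (cong₂ (W₂ lev ok) (rep-self a xa) (rep-self b xb))
        wba : wp σ* b a ≡ W₂ lev ok a b
        wba = trans (⟪⟫-sym _) (trans (⟪⟫-cong λ u x → ∧-flip (suf σ* b x) (suf σ* a u)) wab)
          where
          ∧-flip : ∀ p q → p ∧ q ≡ q ∧ p
          ∧-flip true true = refl
          ∧-flip true false = refl
          ∧-flip false true = refl
          ∧-flip false false = refl
        cra : σ* a ! rCR ≡ cutval (anc a)
        cra = trans (cr* a na) (cong (cutval ∘ anc) (rep-self a xa))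
        crb : σ* b ! rCR ≡ cutval (anc b)
        crb = trans (cr* b nb) (cong (cutval ∘ anc) (rep-self b xb))
        lta : σ* a ! rCR < wp σ* a b + wp σ* a b
        lta = subst₂ _<_ (sym cra) (sym (cong₂ _+_ wab wab)) ca
        ltb : σ* b ! rCR < wp σ* b a + wp σ* b a
        ltb = subst₂ _<_ (sym crb) (sym (cong₂ _+_ wba wba)) cb
        w≢0 : W₂ lev ok a b ≢ 0
        w≢0 z = <⇒≱ ca (≤-trans (≤-reflexive (cong₂ _+_ z z)) z≤n)
        c : ℕ
        c = K₁ + 1 ∸ tM a b
        Finds : V → V → ℕ → ℕ → Set
        Finds x y j k = ∀ π → pick i (Params.jr π) (Params.jb π) (σ* x) ≡ j → pick i (Params.kr π) (Params.kb π) (σ* x) ≡ k →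
          ∀ (C : Ctx H σ*) τ → MatePhase.MInv H σ* C π 0 τ → τ x ! rMATE ≡ PID σ* y
        conclude : ∀ π → pick i (Params.jr π) (Params.jb π) (σ* a) ≡ Params.jr π → pick i (Params.kr π) (Params.kb π) (σ* a) ≡ Params.kr π →
          pick i (Params.jr π) (Params.jb π) (σ* b) ≡ Params.jb π → pick i (Params.kr π) (Params.kb π) (σ* b) ≡ Params.kb π →
          Finds a b (Params.jr π) (Params.kr π) → Finds b a (Params.jb π) (Params.kb π) → ∀ τ τ' → Outcome π τ τ' → Reaches c τ'
        conclude π ja ka jb' kb' fa fb τ τ' (_ , _ , τ₁ , I , cov) = found (cov a b M (λ z → w≢0 (trans (sym (trans (wp-same σ* τ₁ sm₁ a b) wab)) z)))
          where
          sm₁ : Same 10 σ* τ₁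
          sm₁ = MatePhase.MInv.same I
          M : Matched τ₁ a b
          M = record { bla = trans (blue-same σ* τ₁ sm₁ a) bla ; blb = trans (blue-same σ* τ₁ sm₁ b) blb
                     ; na = λ z → na' (trans (sym (sm₁ a rPID refl)) z)
                     ; ma = trans (fa π ja ka C* τ₁ I) (sym (sm₁ b rPID refl)) ; mb = trans (fb π jb' kb' C* τ₁ I) (sym (sm₁ a rPID refl)) }
          found : Reached (K + 1 ∸ Mv τ₁ a b) τ' → Reaches c τ'
          found (v , l) = v , subst (λ z → K₁ + 1 ∸ z ≤ τ' v ! rSCORE) (trans (Mv-same σ* τ₁ sm₁ a b) (trans (Mv* a b na nb) (cong₂ tM (rep-self a xa) (rep-self b xb)))) l
        pick-a : ∀ x y → pick i x y (σ* a) ≡ x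
        pick-a x y = cong (λ z → if z then y else x) bla
        pick-b : ∀ x y → pick i x y (σ* b) ≡ y
        pick-b x y = cong (λ z → if z then y else x) blb
        choose : (Σ ℕ λ j → Σ ℕ λ k → (j < suc J) × (k < 4) × Finds a b j k) → (Σ ℕ λ j → Σ ℕ λ k → (j < suc J) × (k < 4) × Finds b a j k) →
          ∀ τ → Inner τ → Reaches c (Run (allPairs (suc L) H J i) τ)
        choose (jr , kr , jr< , kr< , fa) (jb , kb , jb< , kb< , fb) =
          hit-loop Inner (suc J) P₃ g₃ c jr jr< (hit-loop Inner 4 (P₂ jr) (g₂ jr) c kr kr< (hit-loop Inner (suc J) (P₁ jr kr) (g₁ jr kr) c jb jb<
            (hit-loop Inner 4 (λ kb → pairProg (suc L) H i (params jr kr jb kb)) (λ kb → good-pair (params jr kr jb kb)) c kb kb< λ τ In →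
              conclude (params jr kr jb kb) (pick-a jr jb) (pick-a kr kb) (pick-b jr jb) (pick-b kr kb) fa fb τ (Run (pairProg (suc L) H i (params jr kr jb kb)) τ) (pair-outcome (params jr kr jb kb) τ In))))

  Outer : State → Set
  Outer τ = F τ × Snd τ

  bodyProg : ℕ → ℕ → ℕ → Prog
  bodyProg i s s' = starProg H i s s' ⨾ allPairs (suc L) H J i

  module Body (i s s' : ℕ) where
    open PairPhase R loopless w ID ID-inj i using (Same; low)
    open AtStar lev ok i s s'

    body-run : ∀ (Q : State → Set) τ → Outer τ →
      (∀ σ* (o : StarOut τ σ*) (F* : F σ*) → Snd σ* → Q (Run (allPairs (suc L) H J i) σ*)) → Q (Run (bodyProg i s s') τ)
    body-run Q τ (f , sn) h = seq (StarOut τ) Q (starProg H i s s') (allPairs (suc L) H J i) τ (star-correct τ f)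
      λ σ* o → h σ* o (Facts-same lev ok τ σ* (λ v q l → StarOut.perm-ok o v q (∨-l l)) f)
                      (λ v → subst (λ z → (z ≡ 0) ⊎ Sound lev ok z) (sym (StarOut.perm-ok o v rSCORE refl)) (sn v))

    good-body : Good Outer (bodyProg i s s')
    good-body τ I = body-run (λ τ' → Outer τ' × (∀ v → τ v ! rSCORE ≤ τ' v ! rSCORE)) τ I λ σ* o F* sn* →
      let ((sm , sn) , gr) = Pairs.g₄ i s s' σ* F* (StarOut.ctx o) (StarOut.pid-ok o) (StarOut.pos-ok o) σ* ((λ _ _ _ → refl) , sn*)
      in (Facts-same lev ok σ* _ (λ v q l → sm v q (<ᵇ-true (≤-trans (<ᵇ-sound {toℕ q} {6} l) (m≤m+n 6 4)))) F* , sn)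
         , λ v → ≤-trans (≤-reflexive (sym (StarOut.perm-ok o v rSCORE refl))) (gr v)

    hit-body : ∀ a b → X a ≡ true → X b ≡ true → bit i (ID (branch a)) ≡ false → bit i (ID (branch b)) ≡ true →
        cutval (anc a) < W₂ lev ok a b + W₂ lev ok a b → cutval (anc b) < W₂ lev ok a b + W₂ lev ok a b →
        ∀ τ → Outer τ → Reaches (K₁ + 1 ∸ tM a b) (Run (bodyProg i s s') τ)
    hit-body a b xa xb ta tb ca cb τ I = body-run (Reaches (K₁ + 1 ∸ tM a b)) τ I λ σ* o F* sn* →
      Pairs.hit-pairs i s s' σ* F* (StarOut.ctx o) (StarOut.pid-ok o) (StarOut.pos-ok o) a b xa xb ta tb ca cb σ* ((λ _ _ _ → refl) , sn*)

  good₁ : ∀ i s → Good Outer (loop N (bodyProg i s))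
  good₁ i s = good-loop Outer N (bodyProg i s) (λ s' → Body.good-body i s s')

  good₂ : ∀ i → Good Outer (loop N λ s → loop N (bodyProg i s))
  good₂ i = good-loop Outer N _ (good₁ i)

  good-main : Good Outer (mainProg L N H J)
  good-main = good-loop Outer L _ good₂

  hit-ordered : ∀ i → i < L → ∀ a b → 2 ≤ d a → 2 ≤ d b → bit i (ID (branch a)) ≡ false → bit i (ID (branch b)) ≡ true →
    cutval (anc a) < W₂ lev ok a b + W₂ lev ok a b → cutval (anc b) < W₂ lev ok a b + W₂ lev ok a b →
    ∀ τ → Outer τ → Reaches (K₁ + 1 ∸ tM a b) (Run (mainProg L N H J) τ)
  hit-ordered i i<L a b da db ta tb ca cb = hit-loop Outer L _ good₂ _ i i<L (hit-loop Outer N _ (good₁ i) _ (lev a) (LevelsOK.lev< ok a)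
      (hit-loop Outer N (bodyProg i (lev a)) (λ s' → Body.good-body i (lev a) s') _ (lev b) (LevelsOK.lev< ok b)
        (Body.hit-body i (lev a) (lev b) a b
          (∧-i {2 ≤ᵇ d a} (≤ᵇ-true da) (==-true (sym (cong (λ z → if z then lev b else lev a) ta))))
          (∧-i {2 ≤ᵇ d b} (≤ᵇ-true db) (==-true (sym (cong (λ z → if z then lev b else lev a) tb)))) ta tb ca cb)))

  W₂-sym : ∀ a b → W₂ lev ok a b ≡ W₂ lev ok b a
  W₂-sym a b = trans (⟪⟫-sym _) (⟪⟫-cong λ u x → ∧-flip (anc a x) (anc b u))
    where
    ∧-flip : ∀ p q → p ∧ q ≡ q ∧ p
    ∧-flip true true = refl
    ∧-flip true false = refl
    ∧-flip false true = refl
    ∧-flip false false = refl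

  tM-sym : ∀ a b → tM a b ≡ tM b a
  tM-sym a b = cong₂ _∸_ (+-comm (cutval (anc a)) (cutval (anc b))) (cong₂ _+_ (W₂-sym a b) (W₂-sym a b))

  -- The colour is a bit in which the tops of the two branches differ; if it is set on the side of
  -- `a`, the roles are exchanged by symmetry.
  hit-main : ∀ a b → 2 ≤ d a → 2 ≤ d b → branch a ≢ branch b →
    cutval (anc a) < W₂ lev ok a b + W₂ lev ok a b → cutval (anc b) < W₂ lev ok a b + W₂ lev ok a b →
    ∀ τ → Outer τ → Reaches (K₁ + 1 ∸ tM a b) (Run (mainProg L N H J) τ)
  hit-main a b da db ne ca cb τ I = case differing L ≤-refl of λ
      { (inj₁ same) → ⊥-elim (ne (ID-inj _ _ (bits-ext L _ _ (ID< _) (ID< _) same)))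
      ; (inj₂ (i , i<L , neq)) → case bool-case (bit i (ID (branch a))) of λ
          { (inj₂ fa) → hit-ordered i i<L a b da db fa (other fa neq) ca cb τ I
          ; (inj₁ ta) → subst (λ z → Reaches (K₁ + 1 ∸ z) (Run (mainProg L N H J) τ)) (tM-sym b a)
              (hit-ordered i i<L b a db da (other' ta neq) ta (subst (cutval (anc b) <_) (cong₂ _+_ (W₂-sym a b) (W₂-sym a b)) cb) (subst (cutval (anc a) <_) (cong₂ _+_ (W₂-sym a b) (W₂-sym a b)) ca) τ I) } }
    where
    other : ∀ {p q} → p ≡ false → p ≢ q → q ≡ true
    other {q = true} _ _ = refl
    other {q = false} e n = ⊥-elim (n e)
    other' : ∀ {p q} → p ≡ true → p ≢ q → q ≡ false
    other' {q = false} _ _ = refl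
    other' {q = true} e n = ⊥-elim (n e)
    differing : ∀ k → k ≤ L → (∀ i → i < k → bit i (ID (branch a)) ≡ bit i (ID (branch b))) ⊎ (Σ ℕ λ i → (i < L) × (bit i (ID (branch a)) ≢ bit i (ID (branch b))))
    differing zero _ = inj₁ λ i ()
    differing (suc k) l = case differing k (<⇒≤ l) of λ
      { (inj₂ z) → inj₂ z
      ; (inj₁ h) → case bit k (ID (branch a)) ≟B bit k (ID (branch b)) of λ
          { (no n) → inj₂ (k , l , n)
          ; (yes e) → inj₁ λ i i<k → case m≤n⇒m<n∨m≡n (≤-pred i<k) of λ { (inj₁ lt) → h i lt ; (inj₂ refl) → e } } }

-- The whole program and its specification

finalProg : Prog
finalProg = mk add mx silent (λ _ _ → true)
  -- The root has no edge above it and contributes no cut of its own.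
  (ite (λ ε → Env.own ε ! rD ≡ᵇ 0) (own# rSCORE) (own# rSCORE ⊔# (own# rKK ⊞ con 1 ⊟ own# rCUT))) ((rSCORE , yy#) ∷ [])

fullTail₁ fullTail₂ fullTail₃ fullTail₄ fullTail₅ fullProg : ℕ → ℕ → ℕ → Prog
fullTail₁ L N J = mainProg L N (suc N) J ⨾ finalProg
fullTail₂ L N J = cutProg N (suc N) ⨾ fullTail₁ L N J
fullTail₃ L N J = totalProg ⨾ fullTail₂ L N J
fullTail₄ L N J = levelProg N ⨾ fullTail₃ L N J
fullTail₅ L N J = tauProg ⨾ fullTail₄ L N J
fullProg L N J = depthProg N L ⨾ fullTail₅ L N J

readOut : Mem → Maybe ℕ
readOut ρ = if ρ ! rSCORE ≡ᵇ 0 then nothing else just (ρ ! rKK + 1 ∸ ρ ! rSCORE)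

module FullRun {n m : ℕ} {ends : Fin m → Fin n × Fin n} {inT par : Fin m → Bool} {r : Fin n}
               (R : Rooted ends inT par r) (loopless : ∀ e → proj₁ (ends e) ≢ proj₂ (ends e)) (w : Fin m → ℕ)
               (ID : Fin n → ℕ) (ID-inj : ∀ u v → ID u ≡ ID v → u ≡ v)
               (L N J : ℕ) (ID< : ∀ v → ID v < 2 ^ L) (n< : n < 2 ^ N)
               (J-big : TreeRun.⟪_⟫ R loopless w (λ _ _ → true) < 2 ^ J) where
  open Rooted R
  open TreeFacts R
  open TreeRun R loopless w
  open LevelPhase R loopless w
  open CutPhase R loopless w ID ID-inj

  n≤ : n ≤ 2 ^ N
  n≤ = <⇒≤ n<

  K₁ : ℕ
  K₁ = ⟪ (λ _ _ → true) ⟫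

  pairW pairM : V → V → ℕ
  pairW a b = ⟪ (λ u x → anc a u ∧ anc b x) ⟫
  pairM a b = cutval (anc a) + cutval (anc b) ∸ (pairW a b + pairW a b)

  Pairable : V → V → Set
  Pairable a b = (2 ≤ d a) × (2 ≤ d b) × (branch a ≢ branch b)

  -- The score of a cut is K + 1 minus its value, so that 0 stands for the absence of cuts.
  record Correct (τ : State) : Set where
    field
      KK-val : ∀ v → τ v ! rKK ≡ K₁
      one-resp : ∀ v u → u ≢ r → K₁ + 1 ∸ cutval (anc u) ≤ τ v ! rSCORE
      two-resp : ∀ v a b → Pairable a b → cutval (anc a) < pairW a b + pairW a b → cutval (anc b) < pairW a b + pairW a b →
        K₁ + 1 ∸ pairM a b ≤ τ v ! rSCORE
      attained : ∀ v → τ v ! rSCORE ≢ 0 → (Σ V λ u → (u ≢ r) × (τ v ! rSCORE ≡ K₁ + 1 ∸ cutval (anc u)))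
        ⊎ (Σ V λ a → Σ V λ b → Pairable a b × (τ v ! rSCORE ≡ K₁ + 1 ∸ pairM a b))

  Start : State → Set
  Start σ = (∀ v → σ v ! rID ≡ ID v) × (∀ v q → not (toℕ q ≡ᵇ 0) ≡ true → σ v ! q ≡ 0)

  Sp₁ Sp₂ Sp₃ Sp₄ Sp₅ : State → Set
  Sp₁ τ = (∀ v → τ v ! rID ≡ ID v) × (∀ v → τ v ! rD ≡ d v) × (∀ v → τ v ! rT ≡ 0) × (∀ v → τ v ! rLEV ≡ 0) × (∀ v → τ v ! rSCORE ≡ 0)
  Sp₂ τ = Sp₁ τ × (∀ v → v ≢ r → τ v ! rTAU ≡ ID (branch v))
  Sp₃ τ = (∀ v → τ v ! rID ≡ ID v) × (∀ v → τ v ! rD ≡ d v) × (∀ v → τ v ! rSCORE ≡ 0) × (∀ v → v ≢ r → τ v ! rTAU ≡ ID (branch v)) × LevelsOK N (λ v → τ v ! rLEV)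
  Sp₄ τ = Sp₃ τ × (∀ v → τ v ! rKK ≡ K₁)
  Sp₅ τ = Sp₄ τ × (∀ v → v ≢ r → τ v ! rCUT ≡ cutval (anc v))

  step₁ : ∀ σ → Start σ → Sp₁ (Run (depthProg N L) σ)
  step₁ σ (hid , h0) = (λ v → trans (fr v rID refl) (hid v))
      , toRun (λ τ → ∀ v → τ v ! rD ≡ d v) (depthProg N L) σ (DepthPhase.depth-correct R loopless w ID ID-inj L ID< N σ n≤ hid (λ v → h0 v rD refl) (λ v → h0 v rMRG refl))
      , (λ v → trans (fr v rT refl) (h0 v rT refl)) , (λ v → trans (fr v rLEV refl) (h0 v rLEV refl)) , (λ v → trans (fr v rSCORE refl) (h0 v rSCORE refl))
    where
    keepD : Reg → Bool
    keepD q = not ((toℕ q ≡ᵇ 1) ∨ ((toℕ q ≡ᵇ 20) ∨ (toℕ q ≡ᵇ 21)))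
    fr : ∀ v q → keepD q ≡ true → Run (depthProg N L) σ v ! q ≡ σ v ! q
    fr v q h = frame-run keepD (depthProg N L) (tt , λ _ _ → (tt , tt) , (tt , tt)) σ v q h

  step₂ : ∀ τ → Sp₁ τ → Sp₂ (Run tauProg τ)
  step₂ τ s@(hid , hd , _) = toRun Sp₂ tauProg τ (s , tau-correct τ ID hid hd)

  step₃ : ∀ τ → Sp₂ τ → Sp₃ (Run (levelProg N) τ)
  step₃ τ ((hid , hd , hT , hL , hS) , hτ) = (λ v → trans (fr v rID refl) (hid v)) , (λ v → trans (fr v rD refl) (hd v)) , (λ v → trans (fr v rSCORE refl) (hS v))
      , (λ v q → trans (fr v rTAU refl) (hτ v q))
      , toRun (λ τ' → LevelsOK N (λ v → τ' v ! rLEV)) (levelProg N) τ (level-correct N τ n< hT hL)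
    where
    keepL : Reg → Bool
    keepL q = not ((toℕ q ≡ᵇ 3) ∨ ((toℕ q ≡ᵇ 19) ∨ (toℕ q ≡ᵇ 22)))
    fr : ∀ v q → keepL q ≡ true → Run (levelProg N) τ v ! q ≡ τ v ! q
    fr v q h = frame-run keepL (levelProg N) (λ _ → tt , tt) τ v q h

  step₄ : ∀ τ → Sp₃ τ → Sp₄ (Run totalProg τ)
  step₄ τ s = toRun Sp₄ totalProg τ (s , total-correct τ)

  LevelsOK-cong : ∀ {lev lev' : V → ℕ} → (∀ v → lev' v ≡ lev v) → LevelsOK N lev → LevelsOK N lev'
  LevelsOK-cong e ok = record
    { lev< = λ v → subst (_< N) (sym (e v)) (LevelsOK.lev< ok v)
    ; lev-mono = λ v q → subst₂ _≤_ (sym (e v)) (sym (e (p v))) (LevelsOK.lev-mono ok v q)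
    ; lev-chain = λ c c' q q' pq l l' → LevelsOK.lev-chain ok c c' q q' pq (trans (sym (e c)) (trans l (e (p c)))) (trans (sym (e c')) (trans l' (e (p c)))) }

  step₅ : ∀ τ → Sp₄ τ → Sp₅ (Run (cutProg N (suc N)) τ)
  step₅ τ ((hid , hd , hS , hτ , ok) , hK) =
      (((λ v → trans (fr v rID refl) (hid v)) , (λ v → trans (fr v rD refl) (hd v)) , (λ v → trans (fr v rSCORE refl) (hS v)) , (λ v q → trans (fr v rTAU refl) (hτ v q)) , LevelsOK-cong (λ v → fr v rLEV refl) ok)
      , (λ v → trans (fr v rKK refl) (hK v)))
      , cut-correct ok n≤ τ (record { D-ok = hd ; ID-ok = hid ; LEV-ok = λ _ → refl })
    where
    keepC : Reg → Bool
    keepC q = (toℕ q <ᵇ 5) ∨ (toℕ q ≡ᵇ 23)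
    fr : ∀ v q → keepC q ≡ true → Run (cutProg N (suc N)) τ v ! q ≡ τ v ! q
    fr v q h = frame-run keepC (cutProg N (suc N)) (λ _ → (tt , tt) , (tt , tt , λ _ → tt) , tt , (tt , tt , λ _ → tt) , tt) τ v q h

  record Sp₆ (τ : State) : Set where
    field
      hd : ∀ v → τ v ! rD ≡ d v
      hK : ∀ v → τ v ! rKK ≡ K₁
      hCut : ∀ v → v ≢ r → τ v ! rCUT ≡ cutval (anc v)
      snd' : ∀ v → (τ v ! rSCORE ≡ 0) ⊎ (Σ V λ a → Σ V λ b → Pairable a b × (τ v ! rSCORE ≡ K₁ + 1 ∸ pairM a b))
      hit : ∀ a b → Pairable a b → cutval (anc a) < pairW a b + pairW a b → cutval (anc b) < pairW a b + pairW a b →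
        Σ V λ v → K₁ + 1 ∸ pairM a b ≤ τ v ! rSCORE

  step₆ : ∀ τ → Sp₅ τ → Sp₆ (Run (mainProg L N (suc N) J) τ)
  step₆ τ (((hid , hd , hS , hτ , ok) , hK) , hCut) = record
      { hd = MainPhase.Facts.D-ok f ; hK = MainPhase.Facts.KK-ok f ; hCut = MainPhase.Facts.CUT-ok f
      ; snd' = λ v → conv (s v)
      ; hit = λ a b (da , db , ne) ca cb → MainLoop.hit-main R loopless w ID ID-inj L N J ID< n≤ lev ok J-big a b da db ne ca cb τ outer }
    where
    lev : V → ℕ
    lev v = τ v ! rLEV
    outer : MainLoop.Outer R loopless w ID ID-inj L N J ID< n≤ lev ok J-big τ
    outer = record { D-ok = hd ; ID-ok = hid ; LEV-ok = λ _ → refl ; TAU-ok = hτ ; KK-ok = hK ; CUT-ok = hCut } , λ v → inj₁ (hS v)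
    good = proj₁ (MainLoop.good-main R loopless w ID ID-inj L N J ID< n≤ lev ok J-big τ outer)
    f = proj₁ good
    s = proj₂ good
    conv : ∀ {c} → (c ≡ 0) ⊎ MainPhase.Sound R loopless w ID ID-inj L N J ID< n≤ lev ok c → (c ≡ 0) ⊎ (Σ V λ a → Σ V λ b → Pairable a b × (c ≡ K₁ + 1 ∸ pairM a b))
    conv (inj₁ z) = inj₁ z
    conv (inj₂ (a , b , da , db , ne , e)) = inj₂ (a , b , (da , db , ne) , e)

  step₇ : ∀ τ → Sp₆ τ → Correct (Run finalProg τ)
  step₇ τ S₆ = toRun Correct finalProg τ record
      { KK-val = hK
      ; one-resp = λ v u q → subst (K₁ + 1 ∸ cutval (anc u) ≤_) (sym (Y-eq v)) (≤-trans (≤-trans (≤-reflexive (cong₂ (λ k c → k + 1 ∸ c) (sym (hK u)) (sym (hCut u q)))) (m≤n⊔m (τ u ! rSCORE) _))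
          (≤-trans (≤-reflexive (sym (x-other u q))) (fold-≥ mx (Xv S τ) u)))
      ; two-resp = λ v a b pr ca cb → let (u , l) = hit a b pr ca cb in subst (_ ≤_) (sym (Y-eq v)) (≤-trans l (≤-trans (x-≥ u) (fold-≥ mx (Xv S τ) u)))
      ; attained = λ v nz → let (u , e) = ⨆-attained (Xv S τ) (λ z → nz (trans (Y-eq v) z)) in
          attain (Yv S τ v) nz u (trans (Y-eq v) e) (u ≟F r)
      }
    where
    open Sp₆ S₆
    S : Step
    S = mkStep add mx silent (λ _ _ → true)
      (ite (λ ε → Env.own ε ! rD ≡ᵇ 0) (own# rSCORE) (own# rSCORE ⊔# (own# rKK ⊞ con 1 ⊟ own# rCUT))) ((rSCORE , yy#) ∷ []) tt
    all-r : ∀ u → top (kOf S τ) u ≡ r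
    all-r u = case top-stop (kOf S τ) u of λ
      { (inj₁ e) → e
      ; (inj₂ f) → case top (kOf S τ) u ≟F r of λ { (yes e) → e ; (no ne) → ⊥-elim (true≢false (∧-i (not-t (≐-false ne)) refl) f) } }
    Y-eq : ∀ v → Yv S τ v ≡ ⨆ (Xv S τ)
    Y-eq v = trans (Y-top S τ v) (fold-cong mx λ u → cong (_▸ Xv S τ u) (≐-true (trans (all-r u) (sym (all-r v)))))
    x-root : ∀ u → u ≡ r → Xv S τ u ≡ τ u ! rSCORE
    x-root u e = cong (λ b → if b then τ u ! rSCORE else τ u ! rSCORE ⊔ (τ u ! rKK + 1 ∸ τ u ! rCUT)) (==-true (trans (hd u) (trans (cong d e) d-r)))
    x-other : ∀ u → u ≢ r → Xv S τ u ≡ τ u ! rSCORE ⊔ (τ u ! rKK + 1 ∸ τ u ! rCUT)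
    x-other u q = cong (λ b → if b then τ u ! rSCORE else τ u ! rSCORE ⊔ (τ u ! rKK + 1 ∸ τ u ! rCUT)) (==-false λ z → q (d≡0 u (trans (sym (hd u)) z)))
    x-≥ : ∀ u → τ u ! rSCORE ≤ Xv S τ u
    x-≥ u = case u ≟F r of λ { (yes e) → ≤-reflexive (sym (x-root u e)) ; (no q) → ≤-trans (m≤m⊔n _ _) (≤-reflexive (sym (x-other u q))) }
    from-score : ∀ c → c ≢ 0 → ∀ u → c ≡ τ u ! rSCORE → (Σ V λ u → (u ≢ r) × (c ≡ K₁ + 1 ∸ cutval (anc u))) ⊎ (Σ V λ a → Σ V λ b → Pairable a b × (c ≡ K₁ + 1 ∸ pairM a b))
    from-score c nz u e = case snd' u of λ { (inj₁ z) → ⊥-elim (nz (trans e z)) ; (inj₂ (a , b , pr , q)) → inj₂ (a , b , pr , trans e q) }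
    attain : ∀ c → c ≢ 0 → ∀ u → c ≡ Xv S τ u → Dec (u ≡ r) → (Σ V λ u → (u ≢ r) × (c ≡ K₁ + 1 ∸ cutval (anc u))) ⊎ (Σ V λ a → Σ V λ b → Pairable a b × (c ≡ K₁ + 1 ∸ pairM a b))
    attain c nz u e (yes q) = from-score c nz u (trans e (x-root u q))
    attain c nz u e (no q) = case ⊔-sel (τ u ! rSCORE) (τ u ! rKK + 1 ∸ τ u ! rCUT) of λ
      { (inj₁ z) → from-score c nz u (trans e (trans (x-other u q) z))
      ; (inj₂ z) → inj₁ (u , q , trans e (trans (x-other u q) (trans z (cong₂ (λ k c → k + 1 ∸ c) (hK u) (hCut u q))))) }

  full-correct : ∀ σ → Start σ → Correct (Run (fullProg L N J) σ)
  full-correct σ st =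
    seq Sp₁ Correct (depthProg N L) (fullTail₅ L N J) σ (step₁ σ st) λ τ₁ s₁ →
    seq Sp₂ Correct tauProg (fullTail₄ L N J) τ₁ (step₂ τ₁ s₁) λ τ₂ s₂ →
    seq Sp₃ Correct (levelProg N) (fullTail₃ L N J) τ₂ (step₃ τ₂ s₂) λ τ₃ s₃ →
    seq Sp₄ Correct totalProg (fullTail₂ L N J) τ₃ (step₄ τ₃ s₃) λ τ₄ s₄ →
    seq Sp₅ Correct (cutProg N (suc N)) (fullTail₁ L N J) τ₄ (step₅ τ₄ s₄) λ τ₅ s₅ →
    seq Sp₆ Correct (mainProg L N (suc N) J) finalProg τ₅ (step₆ τ₅ s₅) λ τ₆ s₆ → step₇ τ₆ s₆

-- The cuts of the problem

𝟙*▸ : ∀ a b x → 𝟙 a * x + 𝟙 b * x ≡ (a ▸ x) + (b ▸ x)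
𝟙*▸ a b x = cong₂ _+_ (𝟙-* a x) (𝟙-* b x)

xor-▸ : ∀ a b x → ((a ∧ not b) ▸ x) + ((b ∧ not a) ▸ x) ≡ ((a xor b) ▸ x)
xor-▸ true true x = refl
xor-▸ true false x = +-identityʳ x
xor-▸ false true x = refl
xor-▸ false false x = refl

-- An edge joining two disjoint sets is counted by both cuts, but not by the cut of their union.
disjoint-▸ : ∀ a a' b b' x → (a ∧ b) ≡ false → (a' ∧ b') ≡ false →
  ((a xor a') ▸ x) + ((b xor b') ▸ x) ≡ (((a xor a') xor (b xor b')) ▸ x) + ((((a ∧ b') ▸ x) + ((a' ∧ b) ▸ x)) + (((a ∧ b') ▸ x) + ((a' ∧ b) ▸ x)))
disjoint-▸ false false false false x h h' = refl
disjoint-▸ false false false true x h h' = sym (+-identityʳ x)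
disjoint-▸ false false true false x h h' = sym (+-identityʳ x)
disjoint-▸ false false true true x h h' = refl
disjoint-▸ false true false false x h h' = refl
disjoint-▸ false true true false x h h' = refl
disjoint-▸ true false false false x h h' = refl
disjoint-▸ true false false true x h h' = sym (cong₂ _+_ (+-identityʳ x) (+-identityʳ x))
disjoint-▸ true true false false x h h' = refl

xor-⊎ : ∀ {a b} → a xor b ≡ true → (a ≡ true × b ≡ false) ⊎ (a ≡ false × b ≡ true)
xor-⊎ {true} {false} h = inj₁ (refl , refl)
xor-⊎ {false} {true} h = inj₂ (refl , refl)

xor-true-false : ∀ {a b} → a ≡ true → b ≡ false → a xor b ≡ true
xor-true-false refl refl = refl

xor-false-true : ∀ {a b} → a ≡ false → b ≡ true → a xor b ≡ true
xor-false-true refl refl = refl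

module Answer {n m : ℕ} (ends : Fin m → Fin n × Fin n) (inT par : Fin m → Bool) (r : Fin n)
    (simple : SimpleGraph ends) (span : SpanningTree ends inT) (orient : RootOrientation ends inT r par)
    (w : Fin m → ℕ) (ID : Fin n → ℕ) (ID-inj : ∀ u v → ID u ≡ ID v → u ≡ v)
    (L N J : ℕ) (ID< : ∀ v → ID v < 2 ^ L) (n< : n < 2 ^ N)
    (J-big : TreeRun.⟪_⟫ (SpanningTreeFacts.rooted ends inT par r simple span orient) (proj₁ simple) w (λ _ _ → true) < 2 ^ J)
    (k : ℕ) (lab : Fin n → Maybe (Fin k)) (inst : SubtreeInstance ends inT r k lab) where

  private
    R = SpanningTreeFacts.rooted ends inT par r simple span orient
    loopless = proj₁ simple

  open Rooted R
  open TreeFacts R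
  open TreeRun R loopless w
  open LevelPhase R loopless w using (branch; branch-p; branch-anc; deep)
  open CutPhase R loopless w ID ID-inj using (cutval)
  open FullRun R loopless w ID ID-inj L N J ID< n< J-big
  open TreePaths ends inT par r simple span orient using (on-path; on-path⁻)

  sep : V → Fin m → Bool
  sep a e = anc a (fst e) xor anc a (snd e)

  weight : (Fin m → Bool) → ℕ
  weight ind = ∑ (λ e → ind e ▸ w e)

  weightOf-weight : ∀ {ind ind'} → (∀ e → ind e ≡ ind' e) → weightOf ends inT w ind ≡ weight ind'
  weightOf-weight {ind} h = trans (sum-∑ (λ e → ind e ▸ w e)) (fold-cong add λ e → cong (_▸ w e) (h e))

  weight-≤ : ∀ ind → weight ind ≤ K₁
  weight-≤ ind = ≤-trans (∑-mono λ e → ≤-trans (▸-≤ (ind e) (w e)) (≤-trans (≤-reflexive (sym (*-identityˡ (w e)))) (m≤m+n (1 * w e) (1 * w e)))) (≤-reflexive (sym (⟪⟫-def (λ _ _ → true))))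
    where
    ▸-≤ : ∀ b x → b ▸ x ≤ x
    ▸-≤ true x = ≤-refl
    ▸-≤ false x = z≤n

  ⟪⟫-weight : ∀ F → ⟪ F ⟫ ≡ ∑ (λ e → (F (fst e) (snd e) ▸ w e) + (F (snd e) (fst e) ▸ w e))
  ⟪⟫-weight F = trans (⟪⟫-def F) (fold-cong add λ e → 𝟙*▸ (F (fst e) (snd e)) (F (snd e) (fst e)) (w e))

  cutval-weight : ∀ a → cutval (anc a) ≡ weight (sep a)
  cutval-weight a = trans (⟪⟫-weight (λ u x → anc a u ∧ not (anc a x))) (fold-cong add λ e → xor-▸ (anc a (fst e)) (anc a (snd e)) (w e))

  -- The nodes below `a` and those below `b` lie in different branches, so the two sets are disjoint
  -- and the identity for a single edge can be summed up.
  pairM-weight : ∀ a b → Pairable a b → pairM a b ≡ weight (λ e → sep a e xor sep b e)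
  pairM-weight a b (da , db , ne) = trans (cong (_∸ (pairW a b + pairW a b)) total) (m+n∸n≡m _ (pairW a b + pairW a b))
    where
    root≢ : ∀ v → 2 ≤ d v → v ≢ r
    root≢ v l e = case subst (2 ≤_) (trans (cong d e) d-r) l of λ ()
    disjoint : ∀ v → (anc a v ∧ anc b v) ≡ false
    disjoint v = bool-false λ h → ne (trans (sym (branch-anc a v (root≢ a da) (∧-l h))) (branch-anc b v (root≢ b db) (∧-r {anc a v} h)))
    J₂ : Fin m → ℕ
    J₂ e = ((anc a (fst e) ∧ anc b (snd e)) ▸ w e) + ((anc a (snd e) ∧ anc b (fst e)) ▸ w e)
    total : cutval (anc a) + cutval (anc b) ≡ weight (λ e → sep a e xor sep b e) + (pairW a b + pairW a b)
    total = begin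
        cutval (anc a) + cutval (anc b)                            ≡⟨ cong₂ _+_ (cutval-weight a) (cutval-weight b) ⟩
        weight (sep a) + weight (sep b)                            ≡⟨ sym (∑-+ (λ e → sep a e ▸ w e) (λ e → sep b e ▸ w e)) ⟩
        ∑ (λ e → (sep a e ▸ w e) + (sep b e ▸ w e))
          ≡⟨ fold-cong add (λ e → disjoint-▸ (anc a (fst e)) (anc a (snd e)) (anc b (fst e)) (anc b (snd e)) (w e) (disjoint (fst e)) (disjoint (snd e))) ⟩
        ∑ (λ e → ((sep a e xor sep b e) ▸ w e) + (J₂ e + J₂ e))      ≡⟨ ∑-+ (λ e → (sep a e xor sep b e) ▸ w e) (λ e → J₂ e + J₂ e) ⟩
        weight (λ e → sep a e xor sep b e) + ∑ (λ e → J₂ e + J₂ e) ≡⟨ cong (weight (λ e → sep a e xor sep b e) +_) (trans (∑-+ J₂ J₂) (sym (cong₂ _+_ pw pw))) ⟩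
        weight (λ e → sep a e xor sep b e) + (pairW a b + pairW a b) ∎
      where
      open ≡-Reasoning
      pw : pairW a b ≡ ∑ J₂
      pw = ⟪⟫-weight (λ u x → anc a u ∧ anc b x)

  Cut₁ : Fin m → ℕ → Set
  Cut₁ = Cut1 ends inT w
  Cut₂ : Fin m → Fin m → ℕ → Set
  Cut₂ = Cut2 ends inT w

  c : Fin m → V
  c = chd ends par

  cut1-value : ∀ e x → inT e ≡ true → Cut₁ e x → x ≡ cutval (anc (c e))
  cut1-value e x te (ind , iff , eq) = trans eq (trans (weightOf-weight λ f → bool-ext
      (λ h → on-path e te f (Equivalence.to (iff f) h)) (λ h → Equivalence.from (iff f) (on-path⁻ e te f h))) (sym (cutval-weight (c e))))

  cut1-exists : ∀ e → inT e ≡ true → Cut₁ e (cutval (anc (c e)))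
  cut1-exists e te = sep (c e) , (λ f → mk⇔ (on-path⁻ e te f) (on-path e te f)) , trans (cutval-weight (c e)) (sym (weightOf-weight λ _ → refl))

  off-path : ∀ e f → inT e ≡ true → ¬ OnTreePath ends inT e f → sep (c e) f ≡ false
  off-path e f te h = bool-false λ q → h (on-path⁻ e te f q)

  off-path⁻ : ∀ e f → inT e ≡ true → sep (c e) f ≡ false → ¬ OnTreePath ends inT e f
  off-path⁻ e f te h o = true≢false (on-path e te f o) h

  exactly-one : ∀ e f g → inT e ≡ true → inT f ≡ true → (sep (c e) g xor sep (c f) g ≡ true) ⇔
    ((OnTreePath ends inT e g × ¬ OnTreePath ends inT f g) ⊎ (¬ OnTreePath ends inT e g × OnTreePath ends inT f g))
  exactly-one e f g te tf = mk⇔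
    (λ h → case xor-⊎ {sep (c e) g} h of λ
      { (inj₁ (x , y)) → inj₁ (on-path⁻ e te g x , off-path⁻ f g tf y)
      ; (inj₂ (x , y)) → inj₂ (off-path⁻ e g te x , on-path⁻ f tf g y) })
    (λ { (inj₁ (x , y)) → xor-true-false (on-path e te g x) (off-path f g tf y)
       ; (inj₂ (x , y)) → xor-false-true (off-path e g te x) (on-path f tf g y) })

  cut2-value : ∀ e f x → inT e ≡ true → inT f ≡ true → Pairable (c e) (c f) → Cut₂ e f x → x ≡ pairM (c e) (c f)
  cut2-value e f x te tf pr (ind , iff , eq) = trans eq (trans (weightOf-weight λ g → bool-ext
      (λ h → Equivalence.from (exactly-one e f g te tf) (Equivalence.to (iff g) h))
      (λ h → Equivalence.from (iff g) (Equivalence.to (exactly-one e f g te tf) h))) (sym (pairM-weight (c e) (c f) pr)))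

  cut2-exists : ∀ e f → inT e ≡ true → inT f ≡ true → Pairable (c e) (c f) → Cut₂ e f (pairM (c e) (c f))
  cut2-exists e f te tf pr = (λ g → sep (c e) g xor sep (c f) g) , (λ g → exactly-one e f g te tf)
    , trans (pairM-weight (c e) (c f) pr) (sym (weightOf-weight λ _ → refl))

  lab-r : lab r ≡ nothing
  lab-r = Equivalence.from (proj₁ inst r) refl

  labelled≢r : ∀ {v i} → lab v ≡ just i → v ≢ r
  labelled≢r h refl = case trans (sym h) lab-r of λ ()

  label : ∀ v → v ≢ r → Σ (Fin k) λ i → lab v ≡ just i
  label v q with lab v in eq
  ... | just i = i , refl
  ... | nothing = ⊥-elim (q (Equivalence.to (proj₁ inst v) eq))

  to-ends : ∀ (Q : V → Set) e → Q (c e) → Q (prt ends par e) → Q (fst e) × Q (snd e)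
  to-ends Q e x y with par e
  ... | true = y , x
  ... | false = x , y

  from-ends : ∀ (Q : V → Set) e → Q (fst e) → Q (snd e) → Q (c e) × Q (prt ends par e)
  from-ends Q e x y with par e
  ... | true = y , x
  ... | false = x , y

  lab-p : ∀ v → v ≢ r → p v ≢ r → lab v ≡ lab (p v)
  lab-p v q qp = go (pe v q)
    where
    go : Σ (Fin m) (λ e → (inT e ≡ true) × (c e ≡ v)) → lab v ≡ lab (p v)
    go (e , te , refl) = case proj₂ (proj₂ (proj₂ inst)) e te of λ
        { (inj₁ z) → ⊥-elim (proj₁ nr z) ; (inj₂ (inj₁ z)) → ⊥-elim (proj₂ nr z)
        ; (inj₂ (inj₂ z)) → trans (proj₁ (same z)) (sym (proj₂ (same z))) }
      where
      nr : (fst e ≢ r) × (snd e ≢ r)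
      nr = to-ends (_≢ r) e q (subst (_≢ r) (sym (prt-p e te)) qp)
      same : lab (fst e) ≡ lab (snd e) → (lab (c e) ≡ lab (snd e)) × (lab (p (c e)) ≡ lab (snd e))
      same z = let s = from-ends (λ x → lab x ≡ lab (snd e)) e z refl in proj₁ s , subst (λ x → lab x ≡ lab (snd e)) (prt-p e te) (proj₂ s)

  parent≢r : ∀ v → 2 ≤ d v → (v ≢ r) × (p v ≢ r)
  parent≢r v l = q , λ e → case subst (2 ≤_) (trans (d-p v q) (cong suc (trans (cong d e) d-r))) l of λ { (s≤s ()) }
    where
    q : v ≢ r
    q e = case subst (2 ≤_) (trans (cong d e) d-r) l of λ ()

  depth≥2 : ∀ v → v ≢ r → p v ≢ r → 2 ≤ d v
  depth≥2 v q qp = subst (2 ≤_) (sym (trans (d-p v q) (cong suc (d-p (p v) qp)))) (s≤s (s≤s z≤n))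

  lab-branch : ∀ v → lab (branch v) ≡ lab v
  lab-branch = top-preserves deep lab λ v q t → lab-p v q (proj₂ (parent≢r v (<ᵇ-sound {1} (∧-r {not (v ≐ r)} t))))

  In : Fin k → Fin m → Set
  In = InSubtree ends inT r k lab

  in-ends : ∀ i e → In i e → (lab (c e) ≡ just i) × (lab (p (c e)) ≡ just i)
  in-ends i e (te , x , y) = let s = from-ends (λ v → lab v ≡ just i) e x y in proj₁ s , subst (λ v → lab v ≡ just i) (prt-p e te) (proj₂ s)

  in-deep : ∀ i e → In i e → 2 ≤ d (c e)
  in-deep i e h = depth≥2 (c e) (labelled≢r (proj₁ (in-ends i e h))) (labelled≢r (proj₂ (in-ends i e h)))

  in-pairable : ∀ i j e f → i ≢ j → In i e → In j f → Pairable (c e) (c f)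
  in-pairable i j e f ne he hf = in-deep i e he , in-deep j f hf , λ q → ne (just-injective
    (trans (sym (proj₁ (in-ends i e he))) (trans (sym (lab-branch (c e))) (trans (cong lab q) (trans (lab-branch (c f)) (proj₁ (in-ends j f hf)))))))

  -- The converse of `lab-branch`: a walk inside one subtree avoids the root and stays in one
  -- branch. Together they identify the given subtrees with the branches computed by the algorithm.
  subtree-branch : ∀ i {u v es vs} → Walk ends (In i) u v es vs → branch u ≡ branch v
  subtree-branch i nil = refl
  subtree-branch i (cons {e = e} h j q) = trans (edge j) (subtree-branch i q)
    where
    base : branch (fst e) ≡ branch (snd e)
    base = let s = to-ends (λ v → branch v ≡ branch (c e)) e refl
                     (trans (cong branch (prt-p e (proj₁ h))) (sym (branch-p (c e) (labelled≢r (proj₁ (in-ends i e h))) (labelled≢r (proj₂ (in-ends i e h)))))) in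
      trans (proj₁ s) (sym (proj₂ s))
    edge : ∀ {a b} → Joins ends e a b → branch a ≡ branch b
    edge (inj₁ z) = subst₂ (λ a b → branch a ≡ branch b) (cong proj₁ z) (cong proj₂ z) base
    edge (inj₂ z) = sym (subst₂ (λ a b → branch a ≡ branch b) (cong proj₁ z) (cong proj₂ z) base)

  parent-edge : ∀ v i → 2 ≤ d v → lab v ≡ just i → Σ (Fin m) λ e → In i e × (c e ≡ v)
  parent-edge v i l h = go (pe v (proj₁ (parent≢r v l)))
    where
    go : Σ (Fin m) (λ e → (inT e ≡ true) × (c e ≡ v)) → Σ (Fin m) λ e → In i e × (c e ≡ v)
    go (e , te , refl) = e , (te , to-ends (λ x → lab x ≡ just i) e h
      (trans (cong lab (prt-p e te)) (trans (sym (lab-p v (proj₁ (parent≢r v l)) (proj₂ (parent≢r v l)))) h))) , refl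

  Cand : ℕ → Set
  Cand = Candidate ends inT r k lab w

  cand₁ : ∀ u → u ≢ r → Cand (cutval (anc u))
  cand₁ u q = go (pe u q)
    where
    go : Σ (Fin m) (λ e → (inT e ≡ true) × (c e ≡ u)) → Cand (cutval (anc u))
    go (e , te , refl) = inj₁ (e , te , cut1-exists e te)

  pairM-sym : ∀ a b → pairM a b ≡ pairM b a
  pairM-sym a b = cong₂ (λ x y → x ∸ (y + y)) (+-comm (cutval (anc a)) (cutval (anc b)))
    (trans (⟪⟫-sym (λ u x → anc a u ∧ anc b x)) (⟪⟫-cong λ u x → ∧-comm (anc a x) (anc b u)))

  cand₂ : ∀ a b → Pairable a b → Cand (pairM a b)
  cand₂ a b pr@(da , db , ne) = go (label a (proj₁ (parent≢r a da))) (label b (proj₁ (parent≢r b db)))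
    where
    go : Σ (Fin k) (λ i → lab a ≡ just i) → Σ (Fin k) (λ j → lab b ≡ just j) → Cand (pairM a b)
    go (i , la) (j , lb) = go₂ (parent-edge a i da la) (parent-edge b j db lb)
      where
      go₂ : Σ (Fin m) (λ e → In i e × (c e ≡ a)) → Σ (Fin m) (λ f → In j f × (c f ≡ b)) → Cand (pairM a b)
      go₂ (e , he , refl) (f , hf , refl) = case <F-cmp i j of λ
        { (tri< l _ _) → inj₂ (i , j , e , f , l , he , hf , cut2-exists e f (proj₁ he) (proj₁ hf) pr)
        ; (tri≈ _ refl _) → ⊥-elim (ne (subtree-branch i (proj₁ (proj₂ (proj₂ (proj₁ (proj₂ (proj₂ inst)) i a b la lb))))))
        ; (tri> _ _ l) → subst Cand (pairM-sym b a) (inj₂ (j , i , f , e , l , hf , he , cut2-exists f e (proj₁ hf) (proj₁ he) (db , da , λ z → ne (sym z)))) }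

  Value : ℕ → Set
  Value y = (Σ V λ u → (u ≢ r) × (y ≡ cutval (anc u))) ⊎ (Σ V λ a → Σ V λ b → Pairable a b × (y ≡ pairM a b))

  cand-value : ∀ y → Cand y → Value y
  cand-value y (inj₁ (e , te , h)) = inj₁ (c e , chd≢r e te , cut1-value e y te h)
  cand-value y (inj₂ (i , j , e , f , l , he , hf , h)) = inj₂ (c e , c f , pr , cut2-value e f y (proj₁ he) (proj₁ hf) pr h)
    where
    pr : Pairable (c e) (c f)
    pr = in-pairable i j e f (λ z → <-irrefl (cong toℕ z) l) he hf

  value-≤ : ∀ y → Value y → y ≤ K₁
  value-≤ y (inj₁ (u , _ , refl)) = ≤-trans (≤-reflexive (cutval-weight u)) (weight-≤ _)
  value-≤ y (inj₂ (a , b , pr , refl)) = ≤-trans (≤-reflexive (pairM-weight a b pr)) (weight-≤ _)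

  value-cand : ∀ y → Value y → Cand y
  value-cand y (inj₁ (u , q , refl)) = cand₁ u q
  value-cand y (inj₂ (a , b , pr , refl)) = cand₂ a b pr

  module _ (τ : State) (C : Correct τ) (v : V) where
    open Correct C

    s : ℕ
    s = τ v ! rSCORE

    from-score : ∀ y → y ≤ K₁ → K₁ + 1 ∸ y ≤ s → K₁ + 1 ∸ s ≤ y
    from-score y l h = ≤-trans (∸-monoʳ-≤ (K₁ + 1) h) (≤-reflexive (m∸[m∸n]≡n (≤-trans l (m≤m+n K₁ 1))))

    below₁ : ∀ u → u ≢ r → K₁ + 1 ∸ s ≤ cutval (anc u)
    below₁ u q = from-score _ (value-≤ _ (inj₁ (u , q , refl))) (one-resp v u q)

    -- A pair whose joint weight is at most half of one of its cuts does not beat the other cut.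
    light-pair : ∀ x y z → y ≤ x → z ≤ x + z ∸ y
    light-pair x y z l = ≤-trans (m≤n+m z (x ∸ y)) (≤-reflexive (sym (+-∸-comm z l)))

    -- The main loop guarantees only pairs that are heavy from both sides. In the light cases one of
    -- the two edges alone has a cut at most as large.
    below : ∀ y → Value y → K₁ + 1 ∸ s ≤ y
    below y (inj₁ (u , q , refl)) = below₁ u q
    below y (inj₂ (a , b , pr@(da , db , ne) , refl)) = go (cutval (anc a) <? pairW a b + pairW a b) (cutval (anc b) <? pairW a b + pairW a b)
      where
      go : Dec (cutval (anc a) < pairW a b + pairW a b) → Dec (cutval (anc b) < pairW a b + pairW a b) → K₁ + 1 ∸ s ≤ pairM a b
      go (yes x) (yes z) = from-score _ (value-≤ _ (inj₂ (a , b , pr , refl))) (two-resp v a b pr x z)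
      go (no x) _ = ≤-trans (below₁ b (proj₁ (parent≢r b db))) (light-pair (cutval (anc a)) (pairW a b + pairW a b) (cutval (anc b)) (≮⇒≥ x))
      go _ (no z) = ≤-trans (below₁ a (proj₁ (parent≢r a da))) (≤-trans (light-pair (cutval (anc b)) (pairW a b + pairW a b) (cutval (anc a)) (≮⇒≥ z))
        (≤-reflexive (cong (_∸ (pairW a b + pairW a b)) (+-comm (cutval (anc b)) (cutval (anc a))))))

    attained-value : s ≢ 0 → Value (K₁ + 1 ∸ s)
    attained-value nz = case attained v nz of λ
      { (inj₁ (u , q , e)) → inj₁ (u , q , back _ (value-≤ _ (inj₁ (u , q , refl))) e)
      ; (inj₂ (a , b , pr , e)) → inj₂ (a , b , pr , back _ (value-≤ _ (inj₂ (a , b , pr , refl))) e) }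
      where
      back : ∀ y → y ≤ K₁ → s ≡ K₁ + 1 ∸ y → K₁ + 1 ∸ s ≡ y
      back y l e = trans (cong (K₁ + 1 ∸_) e) (m∸[m∸n]≡n (≤-trans l (m≤m+n K₁ 1)))

    -- Every cut value is at most `K₁`, so a recorded score is positive; score 0 therefore certifies
    -- that there is no candidate.
    correct-output : IsMinCandidate ends inT r k lab w (readOut (τ v))
    correct-output = case s ≟ 0 of λ
      { (yes z) → inj₁ (cong (λ b → if b then nothing else just (τ v ! rKK + 1 ∸ s)) (==-true z)
          , λ y h → <⇒≱ (s≤s (value-≤ y (cand-value y h))) (≤-trans (≤-reflexive (trans (+-comm 1 K₁) (cong (K₁ + 1 ∸_) (sym z)))) (below y (cand-value y h))))
      ; (no nz) → inj₂ (K₁ + 1 ∸ s , trans (cong (λ b → if b then nothing else just (τ v ! rKK + 1 ∸ s)) (==-false nz)) (cong (λ x → just (x + 1 ∸ s)) (KK-val v))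
          , value-cand _ (attained-value nz) , λ y h → below y (cand-value y h)) }

-- Polylogarithmic bounds

data Poly (X : ℕ) : ℕ → Prog → Set where
  one : ∀ {S} → Poly X 1 (step S)
  both : ∀ {a b p q} → Poly X a p → Poly X b q → Poly X (a + b) (p ⨾ q)
  looped : ∀ {a k f} → k ≤ X → (∀ i → Poly X a (f i)) → Poly X (suc a) (loop k f)
  downed : ∀ {a k f} → k ≤ X → (∀ i → Poly X a (f i)) → Poly X (suc a) (down k f)

loopSteps-length : ∀ k f {c} → (∀ i → length (f i) ≤ c) → length (loopSteps k f) ≤ k * c
loopSteps-length zero f h = z≤n
loopSteps-length (suc k) f {c} h = ≤-trans (≤-reflexive (trans (length-++ (loopSteps k f)) (+-comm (length (loopSteps k f)) (length (f k)))))
  (+-mono-≤ (h k) (loopSteps-length k f h))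

downSteps-length : ∀ k f {c} → (∀ i → length (f i) ≤ c) → length (downSteps k f) ≤ k * c
downSteps-length zero f h = z≤n
downSteps-length (suc k) f {c} h = ≤-trans (≤-reflexive (length-++ (f k))) (+-mono-≤ (h k) (downSteps-length k f h))

module _ (X : ℕ) (X≥1 : 1 ≤ X) where

  power-mono : ∀ {a b} → a ≤ b → X ^ a ≤ X ^ b
  power-mono l = ^-monoʳ-≤ X {{>-nonZero X≥1}} l

  poly-sum : ∀ a b {x y} → x ≤ a * X ^ a → y ≤ b * X ^ b → x + y ≤ (a + b) * X ^ (a + b)
  poly-sum a b h h' = ≤-trans (+-mono-≤ (≤-trans h (*-monoʳ-≤ a (power-mono (m≤m+n a b)))) (≤-trans h' (*-monoʳ-≤ b (power-mono (m≤n+m b a)))))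
    (≤-reflexive (sym (*-distribʳ-+ (X ^ (a + b)) a b)))

  poly-loop : ∀ a k {x} → k ≤ X → x ≤ k * (a * X ^ a) → x ≤ suc a * X ^ suc a
  poly-loop a k l h = ≤-trans h (≤-trans (*-monoˡ-≤ (a * X ^ a) l) (≤-trans (≤-reflexive comm) (m≤n+m (a * (X * X ^ a)) (X * X ^ a))))
    where
    open +-*-Solver
    comm : X * (a * X ^ a) ≡ a * (X * X ^ a)
    comm = solve 3 (λ x a y → x :* (a :* y) := a :* (x :* y)) refl X a (X ^ a)

  -- Bounds of the form `a * X ^ a` are closed under adding degrees for a sequence and under raising
  -- the degree by one for a loop of at most `X` turns.
  steps-poly : ∀ {a p} → Poly X a p → length (steps p) ≤ a * X ^ a
  steps-poly one = ≤-trans X≥1 (≤-reflexive (sym (trans (+-identityʳ _) (*-identityʳ X))))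
  steps-poly (both {a} {b} {p} {q} x y) = ≤-trans (≤-reflexive (length-++ (steps p))) (poly-sum a b (steps-poly x) (steps-poly y))
  steps-poly (looped {a} {k} {f} l h) = poly-loop a k l (loopSteps-length k (λ i → steps (f i)) (λ i → steps-poly (h i)))
  steps-poly (downed {a} {k} {f} l h) = poly-loop a k l (downSteps-length k (λ i → steps (f i)) (λ i → steps-poly (h i)))

record Bounds (X L N J : ℕ) : Set where
  field
    L≤ : suc L ≤ X
    N≤ : suc N ≤ X
    J≤ : suc J ≤ X
    4≤ : 4 ≤ X

module _ {X L N J : ℕ} (B : Bounds X L N J) where
  open Bounds B

  private
    L≤' : L ≤ X
    L≤' = ≤-trans (n≤1+n L) L≤
    N≤' : N ≤ X
    N≤' = ≤-trans (n≤1+n N) N≤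

  depth-poly : Poly X _ (depthProg N L)
  depth-poly = both one (looped N≤' λ _ → looped L≤' λ _ → both (both one one) (both one one))

  level-poly : Poly X _ (levelProg N)
  level-poly = looped N≤' λ _ → both one one

  suffix-poly : Poly X _ (suffixProg (suc N))
  suffix-poly = both one (looped N≤ λ _ → one)

  cut-poly : Poly X _ (cutProg N (suc N))
  cut-poly = looped N≤' λ _ → both (both one one) (both (both one suffix-poly) (both one (both (both one suffix-poly) one)))

  stage-poly : ∀ i h → Poly X _ (stage (suc N) i h)
  stage-poly i h = both (both one suffix-poly) (both one (both one (both one (both one (both (both one suffix-poly) one)))))

  pair-poly : ∀ i π → Poly X _ (pairProg (suc L) (suc N) i π)
  pair-poly i π = both (both one (downed L≤ λ _ → one)) (both one (downed N≤ (stage-poly i)))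

  main-poly : Poly X _ (mainProg L N (suc N) J)
  main-poly = looped L≤' λ i → looped N≤' λ s → looped N≤' λ s' →
    both (both (both one one) (both one (both (both one suffix-poly) one)))
      (looped J≤ λ _ → looped 4≤ λ _ → looped J≤ λ _ → looped 4≤ λ _ → pair-poly i _)

  full-poly : Poly X _ (fullProg L N J)
  full-poly = both depth-poly (both one (both level-poly (both one (both cut-poly (both main-poly one)))))

abstract
  -- One for every step and one for every loop in the text of the program, as computed by
  -- `full-poly`.
  full-degree : ℕ
  full-degree = 59

  full-length : ∀ {X L N J} → Bounds X L N J → length (steps (fullProg L N J)) ≤ full-degree * X ^ full-degree
  full-length B = steps-poly _ (≤-trans (s≤s z≤n) (Bounds.4≤ B)) {59} (full-poly B)

PolyLog : (ℕ → ℕ) → Set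
PolyLog f = Σ ℕ λ c → ∀ n → f n ≤ polylog c n

logs : ℕ → ℕ
logs n = suc ⌊log₂ n ⌋

polylog-mono : ∀ {c c'} n → c ≤ c' → polylog c n ≤ polylog c' n
polylog-mono n l = *-mono-≤ l (^-monoʳ-≤ (logs n) l)

PL-const : ∀ k → PolyLog (λ _ → k)
PL-const k = k , λ n → ≤-trans (≤-reflexive (sym (*-identityʳ k))) (*-monoʳ-≤ k (m^n>0 (logs n) k))

PL-logs : PolyLog logs
PL-logs = 1 , λ n → ≤-reflexive (sym (trans (+-identityʳ _) (*-identityʳ (logs n))))

PL-+ : ∀ {f g} → PolyLog f → PolyLog g → PolyLog (λ n → f n + g n)
PL-+ (a , h) (b , h') = a + b , λ n → poly-sum (logs n) (s≤s z≤n) a b (h n) (h' n)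

PL-* : ∀ {f g} → PolyLog f → PolyLog g → PolyLog (λ n → f n * g n)
PL-* (a , h) (b , h') = c , λ n → ≤-trans (*-mono-≤ (h n) (h' n)) (≤-trans (≤-reflexive (solve 4 (λ a x b y → (a :* x) :* (b :* y) := (a :* b) :* (x :* y)) refl a (logs n ^ a) b (logs n ^ b)))
    (*-mono-≤ (m≤m+n (a * b) (a + b)) (≤-trans (≤-reflexive (sym (^-distribˡ-+-* (logs n) a b))) (power-mono (logs n) (s≤s z≤n) (m≤n+m (a + b) (a * b))))))
  where
  open +-*-Solver
  c : ℕ
  c = a * b + (a + b)

PL-^ : ∀ {f} k → PolyLog f → PolyLog (λ n → f n ^ k)
PL-^ zero h = PL-const 1
PL-^ (suc k) h = PL-* h (PL-^ k h)

PL-≤ : ∀ {f g} → (∀ n → f n ≤ g n) → PolyLog g → PolyLog f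
PL-≤ l (c , h) = c , λ n → ≤-trans (l n) (h n)

n<2^logs : ∀ n → n < 2 ^ logs n
n<2^logs n = ≰⇒> λ l → <-irrefl refl (≤-trans (≤-reflexive (sym (⌊log₂[2^n]⌋≡n (logs n)))) (⌊log₂⌋-mono-≤ l))

growthExp : ℕ → ℕ → ℕ
growthExp a b = a + (b + (a + ((b + b) + a)))

growth-bound : ∀ a b n → lim ≤ 2 ^ a → n ≤ 2 ^ b → lim * (n * (lim * (n * n * lim))) ≤ 2 ^ growthExp a b
growth-bound a b n la lb = ≤-trans (*-mono-≤ la (*-mono-≤ lb (*-mono-≤ la (*-mono-≤ (*-mono-≤ lb lb) la)))) (≤-reflexive (sym (begin
    2 ^ growthExp a b                                              ≡⟨ ^-distribˡ-+-* 2 a _ ⟩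
    2 ^ a * 2 ^ (b + (a + ((b + b) + a)))                          ≡⟨ cong (2 ^ a *_) (^-distribˡ-+-* 2 b _) ⟩
    2 ^ a * (2 ^ b * 2 ^ (a + ((b + b) + a)))                      ≡⟨ cong (λ z → 2 ^ a * (2 ^ b * z)) (^-distribˡ-+-* 2 a _) ⟩
    2 ^ a * (2 ^ b * (2 ^ a * 2 ^ ((b + b) + a)))                  ≡⟨ cong (λ z → 2 ^ a * (2 ^ b * (2 ^ a * z))) (trans (^-distribˡ-+-* 2 (b + b) a) (cong (_* 2 ^ a) (^-distribˡ-+-* 2 b b))) ⟩
    2 ^ a * (2 ^ b * (2 ^ a * (2 ^ b * 2 ^ b * 2 ^ a))) ∎)))
  where open ≡-Reasoning

-- In a simple graph an edge is determined by the ordered pair of its ends, of which there are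
-- `n * n`.
edges-≤ : ∀ {n m} (ends : Fin m → Fin n × Fin n) → SimpleGraph ends → m ≤ n * n
edges-≤ ends (_ , simple) = injective⇒≤ {f = λ e → combine (proj₁ (ends e)) (proj₂ (ends e))} λ {e} {f} q →
  let (x , y) = combine-injective (proj₁ (ends e)) (proj₂ (ends e)) (proj₁ (ends f)) (proj₂ (ends f)) q in
  simple e f (proj₁ (ends e)) (proj₂ (ends e)) (inj₁ refl) (inj₁ (cong₂ _,_ (sym x) (sym y)))

-- The parameters of the algorithm

module Parameters (d : ℕ) where

  levels idBits weightBits growthRate startBits : ℕ → ℕ
  levels n = logs n
  idBits n = polylog d n
  -- The total over both orientations is at most `2 * n * n` times the largest weight. One extra bit
  -- pays for the factor 2, the other makes the bound strict.
  weightBits n = 2 + (levels n + (levels n + levels n * d))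
  -- The size bound of a step, `lim`, is `2 ^ 6`.
  growthRate n = growthExp 6 (levels n)
  startBits n = idBits n + levels n * d

  program : ℕ → Prog
  program n = fullProg (idBits n) (levels n) (weightBits n)

  -- The bits of the initial values plus the growth over the whole program; the additional 1 gives
  -- the strict inequality required by `Growth.safe`.
  wordBits : ℕ → ℕ
  wordBits n = suc (startBits n + growthRate n * length (steps (program n)))

  algorithm : (n : ℕ) → Algorithm n
  algorithm n = Compile.alg n (steps (program n)) (wordBits n) readOut

  PL-idBits : PolyLog idBits
  PL-idBits = d , λ n → ≤-refl

  PL-levels*d : PolyLog (λ n → levels n * d)
  PL-levels*d = PL-* PL-logs (PL-const d)

  PL-weightBits : PolyLog weightBits
  PL-weightBits = PL-+ (PL-const 2) (PL-+ PL-logs (PL-+ PL-logs PL-levels*d))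

  loopBound : ℕ → ℕ
  loopBound n = suc (idBits n) + (suc (levels n) + (suc (weightBits n) + 4))

  PL-loopBound : PolyLog loopBound
  PL-loopBound = PL-+ (PL-+ (PL-const 1) PL-idBits) (PL-+ (PL-+ (PL-const 1) PL-logs) (PL-+ (PL-+ (PL-const 1) PL-weightBits) (PL-const 4)))

  bounds : ∀ n → Bounds (loopBound n) (idBits n) (levels n) (weightBits n)
  bounds n = record
    { L≤ = m≤m+n _ _
    ; N≤ = ≤-trans (m≤m+n _ _) (m≤n+m _ (suc (idBits n)))
    ; J≤ = ≤-trans (≤-trans (m≤m+n _ _) (m≤n+m _ (suc (levels n)))) (m≤n+m _ (suc (idBits n)))
    ; 4≤ = ≤-trans (≤-trans (m≤n+m _ (suc (weightBits n))) (m≤n+m _ (suc (levels n)))) (m≤n+m _ (suc (idBits n))) }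

  PL-length : PolyLog (λ n → length (steps (program n)))
  PL-length = PL-≤ (λ n → full-length (bounds n)) (PL-* (PL-const full-degree) (PL-^ full-degree PL-loopBound))

  PL-rounds : PolyLog (λ n → Algorithm.R (algorithm n))
  PL-rounds = PL-≤ (λ n → ≤-reflexive (double-+ (length (steps (program n))))) (PL-+ PL-length PL-length)

  PL-growthRate : PolyLog growthRate
  PL-growthRate = PL-+ (PL-const 6) (PL-+ PL-logs (PL-+ (PL-const 6) (PL-+ (PL-+ PL-logs PL-logs) (PL-const 6))))

  PL-wordBits : PolyLog wordBits
  PL-wordBits = PL-+ (PL-const 1) (PL-+ (PL-+ PL-idBits PL-levels*d) (PL-* PL-growthRate PL-length))

  PL-messages : PolyLog (λ n → Algorithm.B (algorithm n))
  PL-messages = PL-≤ (λ n → ≤-reflexive (width-≡ (wordBits n))) (PL-* (PL-const 24) PL-wordBits)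

  module _ {n m : ℕ} (ends : Fin m → Fin n × Fin n) (w : Fin m → ℕ) (inT par : Fin m → Bool) (r : Fin n) (ID : Fin n → ℕ)
           (k : ℕ) (lab : Fin n → Maybe (Fin k)) (simple : SimpleGraph ends) (span : SpanningTree ends inT)
           (orient : RootOrientation ends inT r par) (wb : WeightsBounded d n w) (ids : IDsValid d n ID)
           (inst : SubtreeInstance ends inT r k lab) where

    private
      R = SpanningTreeFacts.rooted ends inT par r simple span orient
      loopless = proj₁ simple
      init = Compile.initial n (steps (program n)) (wordBits n) readOut ends inT par w loopless ID

    open TreeRun R loopless w

    n≤2^ : n ≤ 2 ^ levels n
    n≤2^ = <⇒≤ (n<2^logs n)

    weights-≤ : ∀ e → w e ≤ 2 ^ (levels n * d)
    weights-≤ e = ≤-trans (proj₂ (wb e)) (≤-trans (^-monoˡ-≤ d n≤2^) (≤-reflexive (^-*-assoc 2 (levels n) d)))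

    total-< : ⟪ (λ _ _ → true) ⟫ < 2 ^ weightBits n
    total-< = ≤-<-trans (≤-reflexive (⟪⟫-def (λ _ _ → true))) (≤-<-trans (fold-bound add {B = 2 * 2 ^ D} edge)
      (≤-<-trans (*-monoˡ-≤ (2 * 2 ^ D) (≤-trans (edges-≤ ends simple) (*-mono-≤ n≤2^ n≤2^))) (≤-<-trans (≤-reflexive regroup) strict)))
      where
      open +-*-Solver
      l D E : ℕ
      l = levels n
      D = l * d
      E = l + (l + D)
      edge : ∀ e → 1 * w e + 1 * w e ≤ 2 * 2 ^ D
      edge e = ≤-trans (≤-reflexive (solve 1 (λ x → con 1 :* x :+ con 1 :* x := con 2 :* x) refl (w e))) (*-monoʳ-≤ 2 (weights-≤ e))
      regroup : 2 ^ l * 2 ^ l * (2 * 2 ^ D) ≡ 2 * 2 ^ E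
      regroup = trans (solve 2 (λ x y → x :* x :* (con 2 :* y) := con 2 :* (x :* (x :* y))) refl (2 ^ l) (2 ^ D))
        (cong (2 *_) (sym (trans (^-distribˡ-+-* 2 l (l + D)) (cong (2 ^ l *_) (^-distribˡ-+-* 2 l D)))))
      strict : 2 * 2 ^ E < 2 ^ (2 + E)
      strict = ^-monoʳ-< 2 (s≤s (s≤s z≤n)) {suc E} {suc (suc E)} ≤-refl

    init-≤ : ∀ v q → lookup (init v) q ≤ 2 ^ startBits n
    init-≤ v zero = ≤-trans (<⇒≤ (proj₂ ids v)) (^-monoʳ-≤ 2 (m≤m+n (idBits n) (levels n * d)))
    init-≤ v (suc q) = ≤-trans (≤-reflexive (lookup-replicate q 0)) z≤n

    module _ (v : Fin n) where

      safeRun : Compile.SafeRun n (steps (program n)) (wordBits n) readOut ends inT par w loopless (steps (program n)) init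
      -- The node `v` provides `1 ≤ n`.
      safeRun = Growth.safe ends inT par w loopless (steps (program n)) (wordBits n) readOut (≤-trans (s≤s z≤n) (toℕ<n v)) (edges-≤ ends simple)
        (growthRate n) (growth-bound 6 (levels n) n (≤-reflexive lim-≡) n≤2^) (steps (program n)) init (startBits n) init-≤
        (λ e → ≤-trans (weights-≤ e) (^-monoʳ-≤ 2 (m≤n+m (levels n * d) (idBits n)))) ≤-refl

      final-state : FullRun.Correct R loopless w ID (proj₁ ids) (idBits n) (levels n) (weightBits n) (proj₂ ids) (n<2^logs n) total-<
        (runL (steps (program n)) init)
      final-state = subst C (sym (runL-steps (program n) init)) (fromRun C (program n) init
          (FullRun.full-correct R loopless w ID (proj₁ ids) (idBits n) (levels n) (weightBits n) (proj₂ ids) (n<2^logs n) total-< init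
            ((λ _ → refl) , λ { _ (suc q) _ → lookup-replicate q 0 })))
        where
        C : State → Set
        C = FullRun.Correct R loopless w ID (proj₁ ids) (idBits n) (levels n) (weightBits n) (proj₂ ids) (n<2^logs n) total-<

      correct : IsMinCandidate ends inT r k lab w (Semantics.outputs ends (algorithm n) w inT par ID v)
      correct = subst (IsMinCandidate ends inT r k lab w)
        (sym (Compile.outputs-correct n (steps (program n)) (wordBits n) readOut ends inT par w loopless ID safeRun v))
        (Answer.correct-output ends inT par r simple span orient w ID (proj₁ ids) (idBits n) (levels n) (weightBits n) (proj₂ ids) (n<2^logs n) total-< k lab inst
          (runL (steps (program n)) init) final-state v)

theorem8p4 : (d : ℕ) →
    Σ ℕ λ c → Σ ((n : ℕ) → Algorithm n) λ A →
    (∀ n → (Algorithm.B (A n) ≤ polylog c n) × (Algorithm.R (A n) ≤ polylog c n))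
    × (∀ n m (ends : Fin m → Fin n × Fin n) (w : Fin m → ℕ) (inT par : Fin m → Bool)
    (r : Fin n) (ID : Fin n → ℕ) (k : ℕ) (lab : Fin n → Maybe (Fin k)) →
    SimpleGraph ends → SpanningTree ends inT → RootOrientation ends inT r par →
    WeightsBounded d n w → IDsValid d n ID → SubtreeInstance ends inT r k lab →
    ∀ v → IsMinCandidate ends inT r k lab w (Semantics.outputs ends (A n) w inT par ID v))
theorem8p4 d = a + b , algorithm
    , (λ n → ≤-trans (proj₂ PL-messages n) (polylog-mono n (m≤m+n a b)) , ≤-trans (proj₂ PL-rounds n) (polylog-mono n (m≤n+m b a)))
    , λ n m ends w inT par r ID k lab simple span orient wb ids inst v → correct ends w inT par r ID k lab simple span orient wb ids inst v
  where
  open Parameters d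
  a b : ℕ
  a = proj₁ PL-messages
  b = proj₁ PL-rounds
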